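{- As identities of $q$-series (for $|q|<1$): \begin{align*} \varphi^3 (q) \varphi (q^5)= & E_{\chi_0,\chi_1}(q) -2E_{\chi_0,\chi_1}(q^2) -4 E_{\chi_0,\chi_1}(q^4) + 5E_{\chi_1,\chi_0}(q) + 10E_{\chi_1,\chi_0}(q^2) -20E_{\chi_1,\chi_0}(q^4),\\ \varphi^2 (q)\varphi (q^2)\varphi (q^{10})= &-\tfrac{1}{2}E_{\chi_0,\chi_1}(q) +\tfrac{1}{2} E_{\chi_0,\chi_1}(q^2) - E_{\chi_0,\chi_1}(q^4) -4 E_{\chi_0,\chi_1}(q^8) +\tfrac{5}{2}E_{\chi_1,\chi_0}(q)+\tfrac{5}{2}E_{\chi_1,\chi_0}(q^2)\\& + 5E_{\chi_1,\chi_0}(q^4) -20E_{\chi_1,\chi_0}(q^8)+ 2B_2(q),\\ \varphi(q)\varphi ^2(q^2)\varphi (q^5)= & \tfrac{1}{2}E_{\chi_0,\chi_1}(q) -\tfrac{1}{2} E_{\chi_0,\chi_1}(q^2) - E_{\chi_0,\chi_1}(q^4) -4 E_{\chi_0,\chi_1}(q^8) +\tfrac{5}{2}E_{\chi_1,\chi_0}(q)+\tfrac{5}{2}E_{\chi_1,\chi_0}(q^2)\\& - 5E_{\chi_1,\chi_0}(q^4)+20E_{\chi_1,\chi_0}(q^8)+5 B_1(q) -B_2(q),\\ \varphi (q) \varphi^3 (q^5)=& E_{\chi_0,\chi_1}(q) -2 E_{\chi_0,\chi_1}(q^2) -4 E_{\chi_0,\chi_1}(q^4) + E_{\chi_1,\chi_0}(q)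 + 2E_{\chi_1,\chi_0}(q^2) -4E_{\chi_1,\chi_0}(q^4),\\ \varphi(q)\varphi (q^5)\varphi^2 (q^{10})=&\tfrac{1}{2}E_{\chi_0,\chi_1}(q) -\tfrac{1}{2} E_{\chi_0,\chi_1}(q^2) - E_{\chi_0,\chi_1}(q^4) -4E_{\chi_0,\chi_1}(q^8)+\tfrac{1}{2}E_{\chi_1,\chi_0}(q)+\tfrac{1}{2}E_{\chi_1,\chi_0}(q^2)\\& - E_{\chi_1,\chi_0}(q^4)+4E_{\chi_1,\chi_0}(q^8)- B_1(q) +B_2(q),\\ \varphi(q^2)\varphi^2 (q^5)\varphi (q^{10})=&-\tfrac{1}{2}E_{\chi_0,\chi_1}(q) +\tfrac{1}{2} E_{\chi_0,\chi_1}(q^2) - E_{\chi_0,\chi_1}(q^4) -4E_{\chi_0,\chi_1}(q^8) +\tfrac{1}{2}E_{\chi_1,\chi_0}(q)+\tfrac{1}{2}E_{\chi_1,\chi_0}(q^2)\\&+ E_{\chi_1,\chi_0}(q^4) -4E_{\chi_1,\chi_0}(q^8)-2 B_1(q). \end{align*}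
   Context: $\varphi(q)=\sum_{m=-\infty}^{\infty}q^{m^2}$. $\chi_0$ is the trivial character and $\chi_1(m)=\left(\frac{5}{m}\right)$ (Kronecker symbol). For $n\in\mathbb{N}$, $\sigma_{\chi,\psi}(n)=\sum_{m\mid n}\psi(m)\chi(n/m)m$. $E_{\chi_0,\chi_1}(q)=-\frac15+\sum_{n\ge1}\sigma_{\chi_0,\chi_1}(n)q^n$ and $E_{\chi_1,\chi_0}(q)=\sum_{n\ge1}\sigma_{\chi_1,\chi_0}(n)q^n$. With $q=e^{2\pi i z}$ and $\eta(z)=q^{1/24}\prod_{m\ge1}(1-q^m)$: $B_1(q)=\frac{\eta(2z)\eta^4(20z)}{\eta(10z)}$, $B_2(q)=\frac{\eta^4(4z)\eta(10z)}{\eta(2z)}$. -}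

module Defs where

open import Data.Nat as ℕ using (ℕ; zero; suc; NonZero)
open import Data.Nat.Divisibility using (_∣?_)
open import Data.Nat.DivMod using (_/_; _%_)
open import Data.Integer as ℤ using (ℤ; +_)
open import Data.Rational as ℚ using (ℚ; 0ℚ; 1ℚ; _+_; _*_; _-_; -_)
open import Data.List using (List; foldr; map; upTo; filter)
open import Relation.Nullary.Decidable using (does)
open import Data.Bool using (if_then_else_)

-- Formal q-series with rational coefficients: f n = coefficient of q^n.
PS : Set
PS = ℕ → ℚ

ℕ→ℚ : ℕ → ℚ
ℕ→ℚ n = (+ n) ℚ./ 1

sumℚ : List ℚ → ℚ
sumℚ = foldr _+_ 0ℚ

Σ≤ : ℕ → (ℕ → ℚ) → ℚ
Σ≤ n f = sumℚ (map f (upTo (suc n)))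

_⊛_ : PS → PS → PS
(f ⊛ g) n = Σ≤ n (λ k → f k * g (n ℕ.∸ k))

-- f ↦ f(q^k)   (k ≥ 1)
sub : (k : ℕ) → .{{NonZero k}} → PS → PS
sub k f n = if does (k ∣? n) then f (n / k) else 0ℚ

shift : ℕ → PS → PS
shift s f n = if does (s ℕ.≤? n) then f (n ℕ.∸ s) else 0ℚ

-- φ(q) = Σ_{m ∈ ℤ} q^{m²}: coefficient of q^n is #{m ∈ ℤ : m² = n},
-- counting m = 0 once and m = ±k (k ≥ 1) twice.
φ : PS
φ n = Σ≤ n (λ k → if does (k ℕ.* k ℕ.≟ n)
                     then (if does (k ℕ.≟ 0) then 1ℚ else ℕ→ℚ 2)
                     else 0ℚ)

χ₀ : ℕ → ℚ
χ₀ _ = 1ℚ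

-- Kronecker symbol (5/m) for m ≥ 1 (5 ≡ 1 mod 4, so it is the character mod 5
-- given by Legendre symbol (m/5))
χ₁ : ℕ → ℚ
χ₁ m with m % 5
... | 1 = 1ℚ
... | 4 = 1ℚ
... | 2 = - 1ℚ
... | 3 = - 1ℚ
... | _ = 0ℚ

σ : (χ ψ : ℕ → ℚ) → (n : ℕ) → ℚ
σ χ ψ n = sumℚ (map (λ k → ψ (suc k) * χ (n / suc k) * ℕ→ℚ (suc k))
                    (filter (λ k → suc k ∣? n) (upTo n)))

E₀₁ : PS
E₀₁ zero = - ((+ 1) ℚ./ 5)
E₀₁ n@(suc _) = σ χ₀ χ₁ n

E₁₀ : PS
E₁₀ zero = 0ℚ
E₁₀ n@(suc _) = σ χ₁ χ₀ n

_⊕_ : PS → PS → PS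
(f ⊕ g) n = f n + g n

infixl 6 _⊕_
infixl 7 _⊛_
infixr 8 _·_

_·_ : ℚ → PS → PS
(c · f) n = c * f n

infix 4 _⁄_
_⁄_ : ℤ → (b : ℕ) → .{{NonZero b}} → ℚ
a ⁄ b = a ℚ./ b

-- the series 1 and 1 - q^k, and 1/(1 - q^k) = Σ_j q^{kj}  (k ≥ 1)
one : PS
one zero = 1ℚ
one (suc _) = 0ℚ

oneMinus : (k : ℕ) → PS
oneMinus k n = if does (n ℕ.≟ 0) then 1ℚ else (if does (n ℕ.≟ k) then - 1ℚ else 0ℚ)

geom : (k : ℕ) → .{{NonZero k}} → PS
geom k n = if does (k ∣? n) then 1ℚ else 0ℚ

_^_ : PS → ℕ → PS
f ^ zero = one
f ^ suc e = f ⊛ (f ^ e)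

-- finite product Π_{m=1}^{N} F m   (F k is the factor with index m = k + 1)
ΠS : ℕ → (ℕ → PS) → PS
ΠS zero F = one
ΠS (suc N) F = F N ⊛ ΠS N F

-- infinite product Π_{m≥1} F(m-1), for factors ≡ 1 (mod q^m):
-- its q^n-coefficient equals that of the finite product over 1 ≤ m ≤ n.
Π∞ : (ℕ → PS) → PS
Π∞ F n = ΠS n F n

-- B₁(q) = η(2z)η⁴(20z)/η(10z) = q³ Π_{m≥1} (1-q^{2m})(1-q^{20m})⁴/(1-q^{10m})
B₁ : PS
B₁ = shift 3 (Π∞ (λ k → oneMinus (2 ℕ.* suc k) ⊛ (oneMinus (20 ℕ.* suc k) ^ 4)
                         ⊛ geom (10 ℕ.* suc k)))

-- B₂(q) = η⁴(4z)η(10z)/η(2z) = q Π_{m≥1} (1-q^{4m})⁴(1-q^{10m})/(1-q^{2m})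
B₂ : PS
B₂ = shift 1 (Π∞ (λ k → (oneMinus (4 ℕ.* suc k) ^ 4) ⊛ oneMinus (10 ℕ.* suc k)
                         ⊛ geom (2 ℕ.* suc k)))

{-# OPTIONS --safe #-}
-- Write fₖ = Π (1 - q^(km)), x = φ(q), y = φ(-q), X = φ(q⁵), Y = φ(-q⁵).
--
-- Eisenstein series.  Let g and h be the theta series Σ (-1)^m q^((5m²+m)/2) and Σ (-1)^m q^((5m²+3m)/2),
-- whose quotient is the Rogers–Ramanujan continued fraction.  By the triple product the logarithmic
-- derivative of h/g is -E₀₁ up to a constant, and gh = f₁f₅.  The Wronskian of g and h is f₁⁶: rotating
-- the lattice ℤ[i] by 2 - i turns the double series of f₁³ · f₁³ (Jacobi) into four copies of it.  Hence
-- 5 f₅ E₀₁ = -f₁⁵.  Let f₁ = α + β + γ be the 5-dissection.  Jacobi's f₁³ has no exponents ≡ 2 mod 5,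
-- so αγ = -β²; this determines the twist χ₁ E₀₁ from f₁⁵ = -5 f₅ E₀₁, and with
-- E₁₀ = χ₁ E₀₁ + 5 E₁₀(q⁵) yields f₁ E₁₀ = q f₅⁵.
--
-- Theta series.  Index-t sublattices of ℤ² give x² + y² = 2 φ(q²)², xy = φ(-q²)² (t = 2),
-- x² - X² as 4q times a product of two theta series (t = 5, norm of 2 + i), and xY - yX = 4q f₄ f₂₀
-- (t = 3 followed by t = 2, norm of 1 + √-5).  Everything else is polynomial algebra in these
-- relations, cancelling series with invertible leading coefficient and using that a series has at
-- most one square root with given leading term.  In particular y³Y and yY³ are combinations of
-- the eta quotients of E₀₁ and E₁₀, the substitution q → -q is the Hecke relation at 2, and
-- 16 B₁ = (XY - xy)(xY - yX), 16 B₂ = (5XY - xy)(xY - yX).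
module Submission where

open import Level using (0ℓ)
open import Algebra.Bundles using (CommutativeRing)
open import Algebra.Solver.Ring.AlmostCommutativeRing using (fromCommutativeRing; _-Raw-AlmostCommutative⟶_)
import Algebra.Solver.Ring
import Algebra.Properties.AbelianGroup
import Algebra.Properties.Group
import Algebra.Properties.Ring
import Algebra.Properties.Semiring.Exp
import Algebra.Properties.Semiring.Mult
import Relation.Binary.Reasoning.Setoid
open import Data.Nat as ℕ using (ℕ; zero; suc; z≤n; s≤s; NonZero)
import Data.Nat.Properties as ℕₚ
open import Data.Integer as ℤ using (ℤ; -[1+_]; _⊖_) renaming (+_ to pos)
import Data.Integer.Properties as ℤₚ
open import Data.List using (List; []; _∷_; _++_; foldl; map; filter; upTo; applyUpTo; cartesianProduct; deduplicate)
open import Data.Maybe using (Maybe; just; nothing)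
open import Data.Product as Prod using ()
open import Data.Vec as Vec using (Vec; []; _∷_)
open import Data.Vec.N-ary using (N-ary; _$ⁿ_; ∀ⁿ; curryⁿ)
open import Data.Vec.Relation.Binary.Pointwise.Inductive using (Pointwise; []; _∷_; lookup)
open import Relation.Nullary using (¬_; Dec; yes; no; does)
open import Relation.Binary.PropositionalEquality as ≡ using (_≡_)

-- The products x³X and xX³ are linear in the Eisenstein series by way of eta quotients. The other
-- four contain c = φ(q²) or d = φ(q¹⁰), which are only square roots in x, y, X, Y, since 2c² = x² +
-- y² and 2d² = X² + Y². Separating the parts even and odd under q → -q confines this difficulty. In
-- 2x²cd = (x² + y²)cd + (x² - y²)cd the first summand is 2c³d, the cubic case at q². In 2xXc² = (xX
-- + yY)c² + (xX - yY)c² the last summand is half of (xX - yY)(x² + y²), a polynomial whose mixed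
-- terms are a multiple of xY - yX and supply the cusp forms. There remain (x² - y²)cd and (xX +
-- yY)d², and each is recognised by comparing squares modulo the quartic relations between x, y, X,
-- Y. The versions with X² - Y² and with c² then follow by multiplication and cancellation, without
-- another root.

module IntegerCoefficients (R : CommutativeRing 0ℓ 0ℓ) where
  open CommutativeRing R
  open Algebra.Properties.Ring ring
  open Algebra.Properties.Semiring.Mult semiring using (_×_; ×-homo-+; ×1-homo-*)
  open Relation.Binary.Reasoning.Setoid setoid

  fromℤ : ℤ → Carrier
  fromℤ (pos n)    = n × 1#
  fromℤ -[1+ n ] = - (suc n × 1#)

  fromℤ-⊖ : ∀ m n → fromℤ (m ⊖ n) ≈ m × 1# - n × 1#
  fromℤ-⊖ m zero = sym (trans (+-congˡ -0#≈0#) (+-identityʳ _))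
  fromℤ-⊖ zero (suc n) = sym (+-identityˡ _)
  fromℤ-⊖ (suc m) (suc n) = begin
    fromℤ (suc m ⊖ suc n)             ≡⟨ ≡.cong fromℤ (ℤₚ.[1+m]⊖[1+n]≡m⊖n m n) ⟩
    fromℤ (m ⊖ n)                     ≈⟨ fromℤ-⊖ m n ⟩
    m × 1# - n × 1#                   ≈⟨ +-congʳ (+-identityʳ _) ⟨
    (m × 1# + 0#) - n × 1#            ≈⟨ +-congʳ (+-congˡ (-‿inverseʳ 1#)) ⟨
    (m × 1# + (1# - 1#)) - n × 1#     ≈⟨ +-congʳ (+-assoc _ _ _) ⟨
    ((m × 1# + 1#) - 1#) - n × 1#     ≈⟨ +-assoc _ _ _ ⟩
    (m × 1# + 1#) + (- 1# - n × 1#)   ≈⟨ +-cong (+-comm _ _) (-‿+-comm _ _) ⟩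
    (1# + m × 1#) - (1# + n × 1#)     ∎

  fromℤ-neg : ∀ i → fromℤ (ℤ.- i) ≈ - fromℤ i
  fromℤ-neg (pos zero)   = sym -0#≈0#
  fromℤ-neg (pos (suc n))  = refl
  fromℤ-neg -[1+ n ]   = sym (-‿involutive _)

  fromℤ-+ : ∀ i j → fromℤ (i ℤ.+ j) ≈ fromℤ i + fromℤ j
  fromℤ-+ (pos m) (pos n) = ×-homo-+ 1# m n
  fromℤ-+ (pos m) -[1+ n ] = fromℤ-⊖ m (suc n)
  fromℤ-+ -[1+ m ] (pos n) = trans (fromℤ-⊖ n (suc m)) (+-comm _ _)
  fromℤ-+ -[1+ m ] -[1+ n ] = begin
    - (suc (suc (m ℕ.+ n)) × 1#)       ≡⟨ ≡.cong (λ k → - (suc k × 1#)) (≡.sym (ℕₚ.+-suc m n)) ⟩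
    - ((suc m ℕ.+ suc n) × 1#)         ≈⟨ -‿cong (×-homo-+ 1# (suc m) (suc n)) ⟩
    - (suc m × 1# + suc n × 1#)        ≈⟨ -‿+-comm _ _ ⟨
    - (suc m × 1#) - suc n × 1#        ∎

  fromℤ-*⁺ : ∀ m n → fromℤ (pos m ℤ.* pos n) ≈ fromℤ (pos m) * fromℤ (pos n)
  fromℤ-*⁺ m n = trans (reflexive (≡.cong fromℤ (≡.sym (ℤₚ.pos-* m n)))) (×1-homo-* m n)

  fromℤ-*ʳ : ∀ m j → fromℤ (pos m ℤ.* j) ≈ fromℤ (pos m) * fromℤ j
  fromℤ-*ʳ m (pos n) = fromℤ-*⁺ m n
  fromℤ-*ʳ m -[1+ n ] = begin
    fromℤ (pos m ℤ.* ℤ.- (pos (suc n)))      ≡⟨ ≡.cong fromℤ (≡.sym (ℤₚ.neg-distribʳ-* (pos m) (pos (suc n)))) ⟩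
    fromℤ (ℤ.- (pos m ℤ.* pos (suc n)))      ≈⟨ fromℤ-neg (pos m ℤ.* pos (suc n)) ⟩
    - fromℤ (pos m ℤ.* pos (suc n))          ≈⟨ -‿cong (fromℤ-*⁺ m (suc n)) ⟩
    - (m × 1# * (suc n × 1#))          ≈⟨ -‿distribʳ-* _ _ ⟩
    m × 1# * - (suc n × 1#)            ∎

  fromℤ-* : ∀ i j → fromℤ (i ℤ.* j) ≈ fromℤ i * fromℤ j
  fromℤ-* (pos m) j = fromℤ-*ʳ m j
  fromℤ-* -[1+ m ] j = begin
    fromℤ (ℤ.- (pos (suc m)) ℤ.* j)        ≡⟨ ≡.cong fromℤ (≡.sym (ℤₚ.neg-distribˡ-* (pos (suc m)) j)) ⟩
    fromℤ (ℤ.- (pos (suc m) ℤ.* j))        ≈⟨ fromℤ-neg (pos (suc m) ℤ.* j) ⟩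
    - fromℤ (pos (suc m) ℤ.* j)            ≈⟨ -‿cong (fromℤ-*ʳ (suc m) j) ⟩
    - (suc m × 1# * fromℤ j)           ≈⟨ -‿distribˡ-* _ _ ⟩
    - (suc m × 1#) * fromℤ j           ∎

  fromℤ-morphism : CommutativeRing.rawRing ℤₚ.+-*-commutativeRing
                   -Raw-AlmostCommutative⟶ fromCommutativeRing R
  fromℤ-morphism = record
    { ⟦_⟧ = fromℤ ; +-homo = fromℤ-+ ; *-homo = fromℤ-* ; -‿homo = fromℤ-neg
    ; 0-homo = refl ; 1-homo = +-identityʳ 1# }

  -- One direction suffices: equal integers have equal images, while distinct integers may still
  -- coincide in `R`, so a negative answer carries no information.
  weak≟ : ∀ i j → Maybe (fromℤ i ≈ fromℤ j)
  weak≟ i j with i ℤ.≟ j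
  ... | yes i≡j = just (reflexive (≡.cong fromℤ i≡j))
  ... | no _    = nothing

  open Algebra.Solver.Ring _ _ fromℤ-morphism weak≟ public
    using (solve; prove; _:=_; _:+_; _:*_; _:-_; :-_; _:^_; con; var; op; [+]; [*]; Polynomial; ⟦_⟧; ⟦_⟧↓)
  open import Algebra.Properties.Semiring.Exp semiring using (_^_; ^-congˡ)

  -- Polynomial consequences of polynomial equations

  #_ : ∀ {n} → ℕ → Polynomial n
  # m = con (pos m)

  Equation : ℕ → Set
  Equation n = Polynomial n Prod.× Polynomial n

  private
    close : ∀ {A : Set} n → N-ary n (Polynomial n) A → A
    close n E = E $ⁿ Vec.map var (Vec.allFin n)

    curry-∀ⁿ : ∀ {A : Set} n {P : Vec A n → Set} → (∀ xs → P xs) → ∀ⁿ n (curryⁿ P)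
    curry-∀ⁿ zero    p = p Vec.[]
    curry-∀ⁿ (suc n) p = λ x → curry-∀ⁿ n (λ xs → p (x Vec.∷ xs))

    -- The hypotheses are pooled into one equation s = t; writing l - r = s - t without subtraction
    -- leaves a single cancellation.
    certify : ∀ {l r s t} → s ≈ t → l + t ≈ r + s → l ≈ r
    certify {l} {r} {s} {t} s≈t eq = ∙-cancelʳ t l r (trans eq (+-congˡ s≈t))
      where open Algebra.Properties.AbelianGroup +-abelianGroup

  infix 6 ⟨_⟩·_
  ⟨_⟩·_ : ∀ {n} → Equation n → Polynomial n → Equation n Prod.× Polynomial n
  ⟨ h ⟩· c = h Prod., c

  infix 3 _⊢_
  record Certificate (n : ℕ) : Set where
    constructor _⊢_
    field
      hypotheses : List (Equation n Prod.× Polynomial n)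
      conclusion : Equation n

  module _ {n} (ρ : Vec Carrier n) where
    Holds : Equation n → Set
    Holds (l Prod., r) = ⟦ l ⟧ ρ ≈ ⟦ r ⟧ ρ

    Claim : Certificate n → Set
    Claim ([] ⊢ g)               = Holds g
    Claim ((h Prod., _) ∷ hs ⊢ g) = Holds h → Claim (hs ⊢ g)

    combine : Equation n → Certificate n → Equation n
    combine (s Prod., t) ([] ⊢ (l Prod., r)) = l :+ t Prod., r :+ s
    combine (s Prod., t) (((a Prod., b) Prod., c) ∷ hs ⊢ g) = combine (s :+ c :* a Prod., t :+ c :* b) (hs ⊢ g)

    -- The accumulated equation grows by one hypothesis at a time, whereas `eq` stays the same:
    -- `combine` computes the final sum of all hypotheses from any stage.
    claim : ∀ e → Holds e → ∀ C → ⟦ Prod.proj₁ (combine e C) ⟧↓ ρ ≈ ⟦ Prod.proj₂ (combine e C) ⟧↓ ρ → Claim C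
    claim (s Prod., t) s≈t ([] ⊢ (l Prod., r)) eq = certify s≈t (prove ρ (l :+ t) (r :+ s) eq)
    claim (s Prod., t) s≈t (((a Prod., b) Prod., c) ∷ hs ⊢ g) eq h =
      claim (s :+ c :* a Prod., t :+ c :* b) (+-cong s≈t (*-congˡ h)) (hs ⊢ g) eq

  -- The premise says that the conclusion is, identically, the combination of the
  -- hypotheses with the given multipliers.
  certificate : ∀ n (E : N-ary n (Polynomial n) (Certificate n)) →
    (∀ {ρ} → ⟦ Prod.proj₁ (combine ρ (# 0 Prod., # 0) (close n E)) ⟧↓ ρ ≈ ⟦ Prod.proj₂ (combine ρ (# 0 Prod., # 0) (close n E)) ⟧↓ ρ) →
    ∀ⁿ n (curryⁿ (λ ρ → Claim ρ (close n E)))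
  certificate n E eq = curry-∀ⁿ n (λ ρ → claim ρ (# 0 Prod., # 0) refl (close n E) eq)

  -- The endomorphisms in view are q → q^k and q → -q. A relation is proved once and carried to
  -- every power of q and to its conjugate, as soon as the images of its variables are known.
  module Transport (h : Carrier → Carrier)
    (h-cong : ∀ {x y} → x ≈ y → h x ≈ h y)
    (h-+ : ∀ x y → h (x + y) ≈ h x + h y)
    (h-* : ∀ x y → h (x * y) ≈ h x * h y)
    (h-neg : ∀ x → h (- x) ≈ - h x)
    (h-0 : h 0# ≈ 0#)
    (h-1 : h 1# ≈ 1#) where

    h-× : ∀ n → h (n × 1#) ≈ n × 1#
    h-× zero    = h-0
    h-× (suc n) = trans (h-+ _ _) (+-cong h-1 (h-× n))

    h-fromℤ : ∀ i → h (fromℤ i) ≈ fromℤ i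
    h-fromℤ (pos n)    = h-× n
    h-fromℤ -[1+ n ] = trans (h-neg _) (-‿cong (h-× (suc n)))

    h-^ : ∀ x n → h (x ^ n) ≈ h x ^ n
    h-^ x zero    = h-1
    h-^ x (suc n) = trans (h-* _ _) (*-congˡ (h-^ x n))

    Image : ∀ {n} → Vec Carrier n → Vec Carrier n → Set
    Image = Pointwise (λ x y → h x ≈ y)

    h-⟦⟧ : ∀ {n} (p : Polynomial n) {ρ ρ′} → Image ρ ρ′ → h (⟦ p ⟧ ρ) ≈ ⟦ p ⟧ ρ′
    h-⟦⟧ (op [+] p p′) ρ~ = trans (h-+ _ _) (+-cong (h-⟦⟧ p ρ~) (h-⟦⟧ p′ ρ~))
    h-⟦⟧ (op [*] p p′) ρ~ = trans (h-* _ _) (*-cong (h-⟦⟧ p ρ~) (h-⟦⟧ p′ ρ~))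
    h-⟦⟧ (con i) ρ~       = h-fromℤ i
    h-⟦⟧ (var x) ρ~       = lookup ρ~ x
    h-⟦⟧ (p :^ n) ρ~      = trans (h-^ _ n) (^-congˡ n (h-⟦⟧ p ρ~))
    h-⟦⟧ (:- p) ρ~        = trans (h-neg _) (-‿cong (h-⟦⟧ p ρ~))

    transport : ∀ n (E : N-ary n (Polynomial n) (Equation n)) {ρ ρ′} → Image ρ ρ′ →
      ⟦ Prod.proj₁ (close n E) ⟧ ρ ≈ ⟦ Prod.proj₂ (close n E) ⟧ ρ →
      ⟦ Prod.proj₁ (close n E) ⟧ ρ′ ≈ ⟦ Prod.proj₂ (close n E) ⟧ ρ′
    transport n E ρ~ eq = trans (sym (h-⟦⟧ (Prod.proj₁ (close n E)) ρ~))
      (trans (h-cong eq) (h-⟦⟧ (Prod.proj₂ (close n E)) ρ~))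

    -- Descent instead of ascent: an eta relation that first appears in powers of q² only is brought
    -- back to q by injectivity.
    reflect : (∀ {x y} → h x ≈ h y → x ≈ y) →
      ∀ n (E : N-ary n (Polynomial n) (Equation n)) {ρ ρ′} → Image ρ ρ′ →
      ⟦ Prod.proj₁ (close n E) ⟧ ρ′ ≈ ⟦ Prod.proj₂ (close n E) ⟧ ρ′ →
      ⟦ Prod.proj₁ (close n E) ⟧ ρ ≈ ⟦ Prod.proj₂ (close n E) ⟧ ρ
    reflect h-inj n E ρ~ eq = h-inj (trans (h-⟦⟧ (Prod.proj₁ (close n E)) ρ~)
      (trans eq (sym (h-⟦⟧ (Prod.proj₂ (close n E)) ρ~))))

-- Here fk stands for Π (1 - q^(km)), x, y, X, Y for φ(q), φ(-q), φ(q⁵), φ(-q⁵), and ek, gk for E₀₁, E₁₀ at q^k.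
module EtaAlgebra (R : CommutativeRing 0ℓ 0ℓ) where
  open CommutativeRing R
  open IntegerCoefficients R

  -- Substituting y = f1²/f2 and Y = f5²/f10 into the index-5 relation and clearing denominators.
  R2-eta = certificate 7 (λ q f1 f2 f5 f10 y Y →
    ⟨ y :* f2 := f1 :^ 2 ⟩· ((y :* f2 :+ f1 :^ 2) :* f10 :^ 2 :* f5) ∷
    ⟨ Y :* f10 := f5 :^ 2 ⟩· (:- ((Y :* f10 :+ f5 :^ 2) :* f5 :* f2 :^ 2)) ∷
    ⟨ (Y :* Y :- y :* y) :* (f2 :* f5) := # 4 :* (q :* (f1 :* f10 :^ 3)) ⟩· (f2 :* f10 :^ 2) ∷
    [] ⊢ f5 :^ 5 :* f2 :^ 2 := f1 :^ 4 :* f10 :^ 2 :* f5 :+ # 4 :* q :* f1 :* f2 :* f10 :^ 5) refl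

  -- The square of the formula for f₁(-q), called `n1`; `w` is φ(-q²), and each theta function is
  -- replaced by its eta quotient.
  conjugate-square = certificate 7 (λ f1 n1 f2 f4 x y w →
    ⟨ y :* f2 := f1 :^ 2 ⟩· (:- (n1 :^ 2 :* f4 :^ 2)) ∷
    ⟨ x :* f2 := n1 :^ 2 ⟩· (:- (y :* f2 :* f4 :^ 2)) ∷
    ⟨ x :* y := w :* w ⟩· (f2 :^ 2 :* f4 :^ 2) ∷
    ⟨ w :* f4 := f2 :^ 2 ⟩· (f2 :^ 2 :* (w :* f4 :+ f2 :^ 2)) ∷
    [] ⊢ f1 :* n1 :* f4 :* (f1 :* n1 :* f4) := f2 :^ 3 :* f2 :^ 3) refl

  -- Here and below a common factor stays on both sides: an arbitrary ring has no cancellation, and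
  -- for series it is removed later by its nonzero leading coefficient.
  difference-product = certificate 13 (λ q f1 n1 f2 f4 f5 n5 f10 f20 x y X Y →
    ⟨ (Y :* Y :- y :* y) :* (f2 :* f5) := # 4 :* (q :* (f1 :* f10 :^ 3)) ⟩· ((x :* x :- X :* X) :* f2 :* n5 :* f4 :* f20) ∷
    ⟨ (x :* x :- X :* X) :* (f2 :* n5) := # 4 :* (q :* (n1 :* f10 :^ 3)) ⟩· (# 4 :* q :* f1 :* f10 :^ 3 :* f4 :* f20) ∷
    ⟨ f1 :* n1 :* f4 := f2 :^ 3 ⟩· (# 16 :* q :^ 2 :* f10 :^ 6 :* f20) ∷
    ⟨ f5 :* n5 :* f20 := f10 :^ 3 ⟩· (:- ((x :* x :- X :* X) :* (Y :* Y :- y :* y) :* f4 :* f2 :^ 2)) ∷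
    [] ⊢ f2 :^ 2 :* f10 :^ 3 :* ((x :* x :- X :* X) :* (Y :* Y :- y :* y) :* f4) := f2 :^ 2 :* f10 :^ 3 :* (# 16 :* q :^ 2 :* f2 :* f10 :^ 3 :* f20)) refl

  -- Rests on (XY - xy)² = (xY - yX)² - (x² - X²)(Y² - y²). All three terms are known eta quotients
  -- once XY - xy is read as d² - c² with c = φ(-q²), d = φ(-q¹⁰), so a relation between eta
  -- products alone is left.
  R1-eta = certificate 11 (λ q f2 f4 f10 f20 x y X Y c d →
    ⟨ x :* Y :- y :* X := # 4 :* (q :* (f4 :* f20)) ⟩· (:- ((x :* Y :- y :* X :+ # 4 :* (q :* (f4 :* f20))) :* f4 :^ 2 :* f10 :^ 2)) ∷
    ⟨ (x :* x :- X :* X) :* (Y :* Y :- y :* y) :* f4 := # 16 :* q :^ 2 :* f2 :* f10 :^ 3 :* f20 ⟩· (f4 :* f10 :^ 2) ∷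
    ⟨ (d :* d :- c :* c) :* (f4 :* f10) := # 4 :* (q :^ 2 :* (f2 :* f20 :^ 3)) ⟩· ((d :* d :- c :* c) :* f4 :* f10 :+ # 4 :* q :^ 2 :* f2 :* f20 :^ 3) ∷
    ⟨ x :* y := c :* c ⟩· (:- ((X :* Y :- x :* y :+ (d :* d :- c :* c)) :* f4 :^ 2 :* f10 :^ 2)) ∷
    ⟨ X :* Y := d :* d ⟩· ((X :* Y :- x :* y :+ (d :* d :- c :* c)) :* f4 :^ 2 :* f10 :^ 2) ∷
    [] ⊢ # 16 :* q :^ 2 :* f20 :* (f4 :^ 4 :* f10 :^ 2 :* f20) := # 16 :* q :^ 2 :* f20 :* (f2 :* f4 :* f10 :^ 5 :+ q :^ 2 :* f2 :^ 2 :* f20 :^ 5)) refl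

  -- The multipliers -4f2 and f1 eliminate the terms with q.
  R4-eta = certificate 5 (λ q f1 f2 f5 f10 →
    ⟨ f2 :^ 4 :* f5 :^ 2 :* f10 := f1 :* f2 :* f5 :^ 5 :+ q :* f1 :^ 2 :* f10 :^ 5 ⟩· (:- (# 4 :* f2)) ∷
    ⟨ f5 :^ 5 :* f2 :^ 2 := f1 :^ 4 :* f10 :^ 2 :* f5 :+ # 4 :* q :* f1 :* f2 :* f10 :^ 5 ⟩· f1 ∷
    [] ⊢ f5 :* (# 5 :* f1 :* f2 :^ 2 :* f5 :^ 4) := f5 :* (f1 :^ 5 :* f10 :^ 2 :+ # 4 :* f2 :^ 5 :* f5 :* f10)) refl

  -- By the eta quotients the product on the left is 4q f1³ f5 f10²/f2². Divided by f1 f2² and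
  -- multiplied by q, `R2-eta` says that this is 4(g - 4g2).
  E₁₀-product = certificate 9 (λ q f1 f2 f5 f10 y Y g g2 →
    ⟨ y :* f2 := f1 :^ 2 ⟩· (Y :* f10 :* ((Y :* Y :- y :* y) :* (f2 :* f5)) :* f1) ∷
    ⟨ Y :* f10 := f5 :^ 2 ⟩· (f1 :^ 2 :* ((Y :* Y :- y :* y) :* (f2 :* f5)) :* f1) ∷
    ⟨ (Y :* Y :- y :* y) :* (f2 :* f5) := # 4 :* (q :* (f1 :* f10 :^ 3)) ⟩· (f1 :^ 2 :* f5 :^ 2 :* f1) ∷
    ⟨ f1 :* g := q :* f5 :^ 5 ⟩· (:- (# 4 :* f2 :^ 2 :* f10 :* f5)) ∷
    ⟨ f2 :* g2 := q :^ 2 :* f10 :^ 5 ⟩· (# 16 :* f1 :* f2 :* f10 :* f5) ∷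
    ⟨ f5 :^ 5 :* f2 :^ 2 := f1 :^ 4 :* f10 :^ 2 :* f5 :+ # 4 :* q :* f1 :* f2 :* f10 :^ 5 ⟩· (:- (# 4 :* q :* f10 :* f5)) ∷
    [] ⊢ f1 :* f2 :^ 2 :* f10 :* f5 :* (y :* Y :* (Y :* Y :- y :* y)) := f1 :* f2 :^ 2 :* f10 :* f5 :* (# 4 :* g :- # 16 :* g2)) refl

  -- Division of `R4-eta` by f2² f10 turns its fourth powers into Y² and y²; this is the origin of
  -- the combination 5Y² - y².
  S-eta = certificate 6 (λ f1 f2 f5 f10 y Y →
    ⟨ y :* f2 := f1 :^ 2 ⟩· (:- (f1 :* f10 :^ 2 :* (y :* f2 :+ f1 :^ 2))) ∷
    ⟨ Y :* f10 := f5 :^ 2 ⟩· (# 5 :* f1 :* f2 :^ 2 :* (Y :* f10 :+ f5 :^ 2)) ∷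
    ⟨ # 5 :* f1 :* f2 :^ 2 :* f5 :^ 4 := f1 :^ 5 :* f10 :^ 2 :+ # 4 :* f2 :^ 5 :* f5 :* f10 ⟩· # 1 ∷
    [] ⊢ f2 :^ 2 :* f10 :* ((# 5 :* (Y :* Y) :- y :* y) :* (f1 :* f10)) := f2 :^ 2 :* f10 :* (# 4 :* (f2 :^ 3 :* f5))) refl

  E₀₁-product = certificate 8 (λ f1 f2 f5 f10 y Y e e2 →
    ⟨ y :* f2 := f1 :^ 2 ⟩· (Y :* f10 :* ((# 5 :* (Y :* Y) :- y :* y) :* (f1 :* f10)) :* (# 5 :* f5)) ∷
    ⟨ Y :* f10 := f5 :^ 2 ⟩· (f1 :^ 2 :* ((# 5 :* (Y :* Y) :- y :* y) :* (f1 :* f10)) :* (# 5 :* f5)) ∷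
    ⟨ (# 5 :* (Y :* Y) :- y :* y) :* (f1 :* f10) := # 4 :* (f2 :^ 3 :* f5) ⟩· (f1 :^ 2 :* f5 :^ 2 :* (# 5 :* f5)) ∷
    ⟨ # 5 :* (f5 :* e) := :- (f1 :^ 5) ⟩· (# 4 :* f1 :* f2 :* f10 :^ 2) ∷
    ⟨ # 5 :* (f10 :* e2) := :- (f2 :^ 5) ⟩· (# 16 :* f1 :* f2 :* f10 :* f5) ∷
    ⟨ # 5 :* f1 :* f2 :^ 2 :* f5 :^ 4 := f1 :^ 5 :* f10 :^ 2 :+ # 4 :* f2 :^ 5 :* f5 :* f10 ⟩· (# 4 :* f1 :* f2) ∷
    [] ⊢ # 5 :* f1 :* f2 :* f10 :^ 2 :* f5 :* (y :* Y :* (# 5 :* (Y :* Y) :- y :* y)) := # 5 :* f1 :* f2 :* f10 :^ 2 :* f5 :* ((:- (# 4 :* e)) :- # 16 :* e2)) refl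

  -- f1 and f5 drop out, so the product is q times a function of q². Conjugation therefore only
  -- changes its sign, on which `N₃-eta` and `even-square` rest.
  M-eta = certificate 7 (λ q f1 f2 f5 f10 y Y →
    ⟨ (Y :* Y :- y :* y) :* (f2 :* f5) := # 4 :* (q :* (f1 :* f10 :^ 3)) ⟩· ((# 5 :* (Y :* Y) :- y :* y) :* (f1 :* f10)) ∷
    ⟨ (# 5 :* (Y :* Y) :- y :* y) :* (f1 :* f10) := # 4 :* (f2 :^ 3 :* f5) ⟩· (# 4 :* q :* f1 :* f10 :^ 3) ∷
    [] ⊢ f1 :* f2 :* f5 :* f10 :* ((Y :* Y :- y :* y) :* (# 5 :* (Y :* Y) :- y :* y)) := f1 :* f2 :* f5 :* f10 :* (# 16 :* q :* f2 :^ 2 :* f10 :^ 2)) refl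

  -- (5Y² - y²) - 5(Y² - y²) = 4y²; the plain difference, 4Y², gives the companion.
  cubes₁ = certificate 6 (λ y Y e e2 g g2 →
    ⟨ y :* Y :* (# 5 :* (Y :* Y) :- y :* y) := (:- (# 4 :* e)) :- # 16 :* e2 ⟩· # 1 ∷
    ⟨ y :* Y :* (Y :* Y :- y :* y) := # 4 :* g :- # 16 :* g2 ⟩· (:- (# 5)) ∷
    [] ⊢ # 4 :* (y :^ 3 :* Y) := # 4 :* ((:- e) :- # 4 :* e2 :- # 5 :* g :+ # 20 :* g2)) refl

  cubes₂ = certificate 6 (λ y Y e e2 g g2 →
    ⟨ y :* Y :* (# 5 :* (Y :* Y) :- y :* y) := (:- (# 4 :* e)) :- # 16 :* e2 ⟩· # 1 ∷
    ⟨ y :* Y :* (Y :* Y :- y :* y) := # 4 :* g :- # 16 :* g2 ⟩· (:- (# 1)) ∷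
    [] ⊢ # 4 :* (y :* Y :^ 3) := # 4 :* ((:- e) :- # 4 :* e2 :- g :+ # 4 :* g2)) refl

  -- Both sides are 16q² f4² f20²: the left is the square of xY - yX, the right is the product of
  -- `M-eta` at q², where `c` and `d` are φ(-q²) and φ(-q¹⁰).
  N-eta = certificate 9 (λ q f4 f20 x y X Y c d →
    ⟨ x :* Y :- y :* X := # 4 :* (q :* (f4 :* f20)) ⟩· (x :* Y :- y :* X :+ # 4 :* (q :* (f4 :* f20))) ∷
    ⟨ (d :* d :- c :* c) :* (# 5 :* (d :* d) :- c :* c) := # 16 :* q :^ 2 :* f4 :^ 2 :* f20 :^ 2 ⟩· (:- (# 1)) ∷
    ⟨ x :* y := c :* c ⟩· (:- (x :* y :+ c :* c :- # 6 :* (d :* d))) ∷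
    ⟨ X :* Y := d :* d ⟩· (:- (# 5 :* (X :* Y :+ d :* d) :- # 6 :* (x :* y))) ∷
    [] ⊢ x :* x :* (Y :* Y) :+ y :* y :* (X :* X) :- # 2 :* (x :* y :* (X :* Y)) := (X :* Y :- x :* y) :* (# 5 :* (X :* Y) :- x :* y)) refl

  -- The product in `M-eta` is odd in q and cancels against its conjugate.
  N₃-eta = certificate 7 (λ q f2 f10 x y X Y →
    ⟨ (Y :* Y :- y :* y) :* (# 5 :* (Y :* Y) :- y :* y) := # 16 :* q :* f2 :^ 2 :* f10 :^ 2 ⟩· # 1 ∷
    ⟨ (X :* X :- x :* x) :* (# 5 :* (X :* X) :- x :* x) := :- (# 16 :* q :* f2 :^ 2 :* f10 :^ 2) ⟩· # 1 ∷
    [] ⊢ x :^ 4 :- # 6 :* (x :* x :* (X :* X)) :+ # 5 :* X :^ 4 :+ (y :^ 4 :- # 6 :* (y :* y :* (Y :* Y)) :+ # 5 :* Y :^ 4) := # 0) refl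

  -- XY - xy = d² - c² is 4q² f2 f20³/(f4 f10), and its denominator f4 cancels against xY - yX = 4q
  -- f4 f20.
  B₁-eta = certificate 12 (λ q f2 f4 f10 f20 x y X Y c d B →
    ⟨ f10 :* B := q :^ 3 :* f2 :* f20 :^ 4 ⟩· (# 16 :* f4) ∷
    ⟨ (d :* d :- c :* c) :* (f4 :* f10) := # 4 :* (q :^ 2 :* (f2 :* f20 :^ 3)) ⟩· (:- (# 4 :* q :* f4 :* f20)) ∷
    ⟨ x :* Y :- y :* X := # 4 :* (q :* (f4 :* f20)) ⟩· (:- ((d :* d :- c :* c) :* f4 :* f10)) ∷
    ⟨ x :* y := c :* c ⟩· (f4 :* f10 :* (x :* Y :- y :* X)) ∷
    ⟨ X :* Y := d :* d ⟩· (:- (f4 :* f10 :* (x :* Y :- y :* X))) ∷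
    [] ⊢ f4 :* f10 :* (# 16 :* B) := f4 :* f10 :* ((X :* Y :- x :* y) :* (x :* Y :- y :* X))) refl

  B₂-eta = certificate 12 (λ q f2 f4 f10 f20 x y X Y c d B →
    ⟨ f2 :* B := q :* f4 :^ 4 :* f10 ⟩· (# 16 :* f20) ∷
    ⟨ (# 5 :* (d :* d) :- c :* c) :* (f2 :* f20) := # 4 :* (f4 :^ 3 :* f10) ⟩· (:- (# 4 :* q :* f4 :* f20)) ∷
    ⟨ x :* Y :- y :* X := # 4 :* (q :* (f4 :* f20)) ⟩· (:- ((# 5 :* (d :* d) :- c :* c) :* f2 :* f20)) ∷
    ⟨ x :* y := c :* c ⟩· (f2 :* f20 :* (x :* Y :- y :* X)) ∷
    ⟨ X :* Y := d :* d ⟩· (:- (# 5 :* f2 :* f20 :* (x :* Y :- y :* X))) ∷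
    [] ⊢ f2 :* f20 :* (# 16 :* B) := f2 :* f20 :* ((# 5 :* (X :* Y) :- x :* y) :* (x :* Y :- y :* X))) refl

  -- Squaring removes the roots: c²d² becomes (x² + y²)(X² + Y²)/4, and what is left is an identity
  -- in x, y, X, Y modulo the quartic relations of `N-eta` and `N₃-eta`.
  U₂-square = certificate 6 (λ x y X Y c d →
    ⟨ x :* x :* (Y :* Y) :+ y :* y :* (X :* X) :- # 2 :* (x :* y :* (X :* Y)) := (X :* Y :- x :* y) :* (# 5 :* (X :* Y) :- x :* y) ⟩· (:- (# 20 :* x :* y :* X :* Y :+ # 20 :* X :^ 4 :+ # 20 :* Y :^ 4 :- # 14 :* x :^ 2 :* X :^ 2 :- # 14 :* y :^ 2 :* Y :^ 2)) ∷
    ⟨ x :^ 4 :- # 6 :* (x :* x :* (X :* X)) :+ # 5 :* X :^ 4 :+ (y :^ 4 :- # 6 :* (y :* y :* (Y :* Y)) :+ # 5 :* Y :^ 4) := # 0 ⟩· (:- (# 5 :* x :^ 2 :* X :^ 2 :- # 4 :* x :^ 2 :* Y :^ 2 :- # 6 :* x :* y :* X :* Y :- # 4 :* y :^ 2 :* X :^ 2 :+ # 5 :* y :^ 2 :* Y :^ 2 :+ # 20 :* X :^ 2 :* Y :^ 2)) ∷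
    ⟨ x :* x :+ y :* y := # 2 :* (c :* c) ⟩· (:- (# 4 :* (x :* x :- y :* y) :^ 2 :* (X :* X :+ Y :* Y))) ∷
    ⟨ X :* X :+ Y :* Y := # 2 :* (d :* d) ⟩· (:- (# 8 :* (x :* x :- y :* y) :^ 2 :* c :* c)) ∷
    [] ⊢ # 4 :* ((x :* x :- y :* y) :* (c :* d)) :* (# 4 :* ((x :* x :- y :* y) :* (c :* d))) := ((# 5 :* (X :* Y) :- x :* y) :* (x :* Y :- y :* X) :+ x :* X :* (# 3 :* (x :* x) :- # 5 :* (X :* X)) :- y :* Y :* (# 3 :* (y :* y) :- # 5 :* (Y :* Y))) :* ((# 5 :* (X :* Y) :- x :* y) :* (x :* Y :- y :* X) :+ x :* X :* (# 3 :* (x :* x) :- # 5 :* (X :* X)) :- y :* Y :* (# 3 :* (y :* y) :- # 5 :* (Y :* Y)))) refl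

  -- No second root is needed: X² - Y² times the formula for (x² - y²)cd is x² - y² times the one
  -- wanted.
  U₆ = certificate 6 (λ x y X Y c d →
    ⟨ # 4 :* ((x :* x :- y :* y) :* (c :* d)) := (# 5 :* (X :* Y) :- x :* y) :* (x :* Y :- y :* X) :+ x :* X :* (# 3 :* (x :* x) :- # 5 :* (X :* X)) :- y :* Y :* (# 3 :* (y :* y) :- # 5 :* (Y :* Y)) ⟩· (X :* X :- Y :* Y) ∷
    ⟨ x :* x :* (Y :* Y) :+ y :* y :* (X :* X) :- # 2 :* (x :* y :* (X :* Y)) := (X :* Y :- x :* y) :* (# 5 :* (X :* Y) :- x :* y) ⟩· (:- (# 2 :* (x :* X :+ y :* Y))) ∷
    ⟨ x :^ 4 :- # 6 :* (x :* x :* (X :* X)) :+ # 5 :* X :^ 4 :+ (y :^ 4 :- # 6 :* (y :* y :* (Y :* Y)) :+ # 5 :* Y :^ 4) := # 0 ⟩· (:- (x :* X :+ y :* Y)) ∷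
    [] ⊢ (x :* x :- y :* y) :* (# 4 :* ((X :* X :- Y :* Y) :* (c :* d))) := (x :* x :- y :* y) :* (x :* X :* (x :* x :- # 3 :* (X :* X)) :- y :* Y :* (y :* y :- # 3 :* (Y :* Y)) :- (X :* Y :- x :* y) :* (x :* Y :- y :* X))) refl

  -- (xX + yY)² + (xY - yX)² = (x² + y²)(X² + Y²) = 4c²d², and (xY - yX)² is expressed in c and d by
  -- the conjugate of `M-eta` at q².
  even-square = certificate 9 (λ q f4 f20 x y X Y c d →
    ⟨ x :* Y :- y :* X := # 4 :* (q :* (f4 :* f20)) ⟩· (:- (x :* Y :- y :* X :+ # 4 :* (q :* (f4 :* f20)))) ∷
    ⟨ (d :* d :- c :* c) :* (# 5 :* (d :* d) :- c :* c) := :- (# 16 :* q :^ 2 :* f4 :^ 2 :* f20 :^ 2) ⟩· (:- (# 1)) ∷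
    ⟨ x :* x :+ y :* y := # 2 :* (c :* c) ⟩· (X :* X :+ Y :* Y) ∷
    ⟨ X :* X :+ Y :* Y := # 2 :* (d :* d) ⟩· (# 2 :* c :* c) ∷
    [] ⊢ (x :* X :+ y :* Y) :* (x :* X :+ y :* Y) := # 4 :* (c :* c :* (d :* d)) :- (c :* c :- d :* d) :* (# 5 :* (d :* d) :- c :* c)) refl

  -- Both sides are 16q² f4² f20².
  CD-eta = certificate 11 (λ q f4 f8 f20 f40 c s d t C D →
    ⟨ c :* t :- s :* d := # 4 :* (q :^ 2 :* (f8 :* f40)) ⟩· (# 4 :* f4 :^ 2 :* f20 :^ 2) ∷
    ⟨ C :* f8 := f4 :^ 2 ⟩· (# 4 :* (c :* t :- s :* d) :* D :* f40) ∷
    ⟨ D :* f40 := f20 :^ 2 ⟩· (# 4 :* (c :* t :- s :* d) :* f4 :^ 2) ∷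
    ⟨ (d :* d :- c :* c) :* (# 5 :* (d :* d) :- c :* c) := :- (# 16 :* q :^ 2 :* f4 :^ 2 :* f20 :^ 2) ⟩· (f8 :* f40) ∷
    [] ⊢ f8 :* f40 :* (# 4 :* (C :* D :* (c :* t :- s :* d))) := f8 :* f40 :* ((c :* c :- d :* d) :* (# 5 :* (d :* d) :- c :* c))) refl

  -- The relation available for CD involves its product with ct - sd, so both sides are first
  -- multiplied by (ct - sd)²; then CD disappears in favour of c and d.
  even-d-square = certificate 7 (λ e c s d t C D →
    ⟨ e :* e := # 4 :* (c :* c :* (d :* d)) :- (c :* c :- d :* d) :* (# 5 :* (d :* d) :- c :* c) ⟩· ((c :* t :- s :* d) :^ 2 :* d :^ 4) ∷
    ⟨ c :* c :* (t :* t) :+ s :* s :* (d :* d) :- # 2 :* (c :* s :* (d :* t)) := (d :* t :- c :* s) :* (# 5 :* (d :* t) :- c :* s) ⟩· (c :^ 4 :* d :^ 4 :+ # 5 :* d :^ 8 :- # 6 :* c :^ 2 :* d :^ 6) ∷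
    ⟨ # 4 :* (C :* D :* (c :* t :- s :* d)) := (c :* c :- d :* d) :* (# 5 :* (d :* d) :- c :* c) ⟩· (:- (((c :* t :- s :* d) :* (c :* d :* (c :* c :- # 3 :* (d :* d)) :+ # 4 :* (C :* D :* (D :* D))) :+ (c :* d :* (c :* c :- # 3 :* (d :* d)) :* (c :* t :- s :* d) :+ (c :* c :- d :* d) :* (# 5 :* (d :* d) :- c :* c) :* (d :* t))) :* D :^ 2)) ∷
    ⟨ D :* D := d :* t ⟩· (:- (((c :* t :- s :* d) :* (c :* d :* (c :* c :- # 3 :* (d :* d)) :+ # 4 :* (C :* D :* (D :* D))) :+ (c :* d :* (c :* c :- # 3 :* (d :* d)) :* (c :* t :- s :* d) :+ (c :* c :- d :* d) :* (# 5 :* (d :* d) :- c :* c) :* (d :* t))) :* ((c :* c :- d :* d) :* (# 5 :* (d :* d) :- c :* c)))) ∷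
    [] ⊢ (c :* t :- s :* d) :* (c :* t :- s :* d) :* (e :* (d :* d) :* (e :* (d :* d))) := (c :* t :- s :* d) :* (c :* t :- s :* d) :* ((c :* d :* (c :* c :- # 3 :* (d :* d)) :+ # 4 :* (C :* D :* (D :* D))) :* (c :* d :* (c :* c :- # 3 :* (d :* d)) :+ # 4 :* (C :* D :* (D :* D))))) refl

  -- With C² = cs and D² = dt, the terms in CD of c² times the known formula and d² times the new
  -- one differ by 4cd·CD(ct - sd), which is again known.
  even-c = certificate 7 (λ e c s d t C D →
    ⟨ e :* (d :* d) := c :* d :* (c :* c :- # 3 :* (d :* d)) :+ # 4 :* (C :* D :* (D :* D)) ⟩· (c :* c) ∷
    ⟨ # 4 :* (C :* D :* (c :* t :- s :* d)) := (c :* c :- d :* d) :* (# 5 :* (d :* d) :- c :* c) ⟩· (c :* d) ∷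
    ⟨ D :* D := d :* t ⟩· (# 4 :* c :^ 2 :* C :* D) ∷
    ⟨ C :* C := c :* s ⟩· (:- (# 4 :* d :^ 2 :* C :* D)) ∷
    [] ⊢ d :* d :* (e :* (c :* c)) := d :* d :* (c :* d :* (# 3 :* (c :* c) :- # 5 :* (d :* d)) :+ # 4 :* (C :* D :* (C :* C)))) refl

  -- `m` and `n` are E₀₁ and E₁₀ at -q, eliminated by the Hecke relations at 2.
  conjugate₁ = certificate 10 (λ x X e1 e2 e4 g1 g2 g4 m n →
    ⟨ x :^ 3 :* X := (:- m) :- # 4 :* e2 :- # 5 :* n :+ # 20 :* g2 ⟩· # 1 ∷
    ⟨ m := (:- e1) :- # 2 :* e2 :+ # 4 :* e4 ⟩· (:- (# 1)) ∷
    ⟨ n := (:- g1) :+ # 2 :* g2 :+ # 4 :* g4 ⟩· (:- (# 5)) ∷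
    [] ⊢ x :^ 3 :* X := e1 :- # 2 :* e2 :- # 4 :* e4 :+ # 5 :* g1 :+ # 10 :* g2 :- # 20 :* g4) refl

  conjugate₂ = certificate 10 (λ x X e1 e2 e4 g1 g2 g4 m n →
    ⟨ x :* X :^ 3 := (:- m) :- # 4 :* e2 :- n :+ # 4 :* g2 ⟩· # 1 ∷
    ⟨ m := (:- e1) :- # 2 :* e2 :+ # 4 :* e4 ⟩· (:- (# 1)) ∷
    ⟨ n := (:- g1) :+ # 2 :* g2 :+ # 4 :* g4 ⟩· (:- (# 1)) ∷
    [] ⊢ x :* X :^ 3 := e1 :- # 2 :* e2 :- # 4 :* e4 :+ g1 :+ # 2 :* g2 :- # 4 :* g4) refl

  identity₁ = certificate 8 (λ x X e1 e2 e4 g1 g2 g4 →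
    ⟨ x :^ 3 :* X := e1 :- # 2 :* e2 :- # 4 :* e4 :+ # 5 :* g1 :+ # 10 :* g2 :- # 20 :* g4 ⟩· # 1 ∷
    [] ⊢ # 1 :* (x :^ 3 :* X) := # 1 :* e1 :+ con -[1+ 1 ] :* e2 :+ con -[1+ 3 ] :* e4 :+ # 5 :* g1 :+ # 10 :* g2 :+ con -[1+ 19 ] :* g4) refl

  identity₄ = certificate 8 (λ x X e1 e2 e4 g1 g2 g4 →
    ⟨ x :* X :^ 3 := e1 :- # 2 :* e2 :- # 4 :* e4 :+ g1 :+ # 2 :* g2 :- # 4 :* g4 ⟩· # 1 ∷
    [] ⊢ # 1 :* (x :* X :^ 3) := # 1 :* e1 :+ con -[1+ 1 ] :* e2 :+ con -[1+ 3 ] :* e4 :+ # 1 :* g1 :+ # 2 :* g2 :+ con -[1+ 3 ] :* g4) refl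

  -- 8x²cd = 4(x² + y²)cd + 4(x² - y²)cd. The first summand is 8c³d, the second is 16B₂ plus cubic
  -- products.
  identity₂ = certificate 15 (λ x y X Y c d B2 e1 e2 e4 e8 g1 g2 g4 g8 →
    ⟨ x :* x :+ y :* y := # 2 :* (c :* c) ⟩· (# 4 :* c :* d) ∷
    ⟨ # 4 :* ((x :* x :- y :* y) :* (c :* d)) := (# 5 :* (X :* Y) :- x :* y) :* (x :* Y :- y :* X) :+ x :* X :* (# 3 :* (x :* x) :- # 5 :* (X :* X)) :- y :* Y :* (# 3 :* (y :* y) :- # 5 :* (Y :* Y)) ⟩· # 1 ∷
    ⟨ # 16 :* B2 := (# 5 :* (X :* Y) :- x :* y) :* (x :* Y :- y :* X) ⟩· (:- (# 1)) ∷
    ⟨ x :^ 3 :* X := e1 :- # 2 :* e2 :- # 4 :* e4 :+ # 5 :* g1 :+ # 10 :* g2 :- # 20 :* g4 ⟩· # 3 ∷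
    ⟨ x :* X :^ 3 := e1 :- # 2 :* e2 :- # 4 :* e4 :+ g1 :+ # 2 :* g2 :- # 4 :* g4 ⟩· (:- (# 5)) ∷
    ⟨ y :^ 3 :* Y := (:- e1) :- # 4 :* e2 :- # 5 :* g1 :+ # 20 :* g2 ⟩· (:- (# 3)) ∷
    ⟨ y :* Y :^ 3 := (:- e1) :- # 4 :* e2 :- g1 :+ # 4 :* g2 ⟩· # 5 ∷
    ⟨ c :^ 3 :* d := e2 :- # 2 :* e4 :- # 4 :* e8 :+ # 5 :* g2 :+ # 10 :* g4 :- # 20 :* g8 ⟩· # 8 ∷
    [] ⊢ # 8 :* (x :^ 2 :* c :* d) := con -[1+ 3 ] :* e1 :+ # 4 :* e2 :+ con -[1+ 7 ] :* e4 :+ con -[1+ 31 ] :* e8 :+ # 20 :* g1 :+ # 20 :* g2 :+ # 40 :* g4 :+ con -[1+ 159 ] :* g8 :+ # 16 :* B2) refl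

  -- 8cX²d = 8cd³ + 4(X² - Y²)cd, the last term being -16B₁ plus cubic products.
  identity₆ = certificate 15 (λ x y X Y c d B1 e1 e2 e4 e8 g1 g2 g4 g8 →
    ⟨ X :* X :+ Y :* Y := # 2 :* (d :* d) ⟩· (# 4 :* c :* d) ∷
    ⟨ # 4 :* ((X :* X :- Y :* Y) :* (c :* d)) := x :* X :* (x :* x :- # 3 :* (X :* X)) :- y :* Y :* (y :* y :- # 3 :* (Y :* Y)) :- (X :* Y :- x :* y) :* (x :* Y :- y :* X) ⟩· # 1 ∷
    ⟨ # 16 :* B1 := (X :* Y :- x :* y) :* (x :* Y :- y :* X) ⟩· # 1 ∷
    ⟨ x :^ 3 :* X := e1 :- # 2 :* e2 :- # 4 :* e4 :+ # 5 :* g1 :+ # 10 :* g2 :- # 20 :* g4 ⟩· # 1 ∷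
    ⟨ x :* X :^ 3 := e1 :- # 2 :* e2 :- # 4 :* e4 :+ g1 :+ # 2 :* g2 :- # 4 :* g4 ⟩· (:- (# 3)) ∷
    ⟨ y :^ 3 :* Y := (:- e1) :- # 4 :* e2 :- # 5 :* g1 :+ # 20 :* g2 ⟩· (:- (# 1)) ∷
    ⟨ y :* Y :^ 3 := (:- e1) :- # 4 :* e2 :- g1 :+ # 4 :* g2 ⟩· # 3 ∷
    ⟨ c :* d :^ 3 := e2 :- # 2 :* e4 :- # 4 :* e8 :+ g2 :+ # 2 :* g4 :- # 4 :* g8 ⟩· # 8 ∷
    [] ⊢ # 8 :* (c :* X :^ 2 :* d) := con -[1+ 3 ] :* e1 :+ # 4 :* e2 :+ con -[1+ 7 ] :* e4 :+ con -[1+ 31 ] :* e8 :+ # 4 :* g1 :+ # 4 :* g2 :+ # 8 :* g4 :+ con -[1+ 31 ] :* g8 :+ con -[1+ 15 ] :* B1) refl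

  -- 16xc²X = 8(xX + yY)c² + 4(xX - yY)(x² + y²). The mixed terms of the last product are -4xy(xY -
  -- yX), which is 80B₁ - 16B₂.
  identity₃ = certificate 18 (λ x y X Y c d C D B1 B2 e1 e2 e4 e8 g1 g2 g4 g8 →
    ⟨ x :* x :+ y :* y := # 2 :* (c :* c) ⟩· (:- (# 4 :* (x :* X :- y :* Y))) ∷
    ⟨ (x :* X :+ y :* Y) :* (c :* c) := c :* d :* (# 3 :* (c :* c) :- # 5 :* (d :* d)) :+ # 4 :* (C :* D :* (C :* C)) ⟩· # 8 ∷
    ⟨ x :^ 3 :* X := e1 :- # 2 :* e2 :- # 4 :* e4 :+ # 5 :* g1 :+ # 10 :* g2 :- # 20 :* g4 ⟩· # 4 ∷
    ⟨ y :^ 3 :* Y := (:- e1) :- # 4 :* e2 :- # 5 :* g1 :+ # 20 :* g2 ⟩· (:- (# 4)) ∷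
    ⟨ # 16 :* B1 := (X :* Y :- x :* y) :* (x :* Y :- y :* X) ⟩· (:- (# 5)) ∷
    ⟨ # 16 :* B2 := (# 5 :* (X :* Y) :- x :* y) :* (x :* Y :- y :* X) ⟩· # 1 ∷
    ⟨ c :^ 3 :* d := e2 :- # 2 :* e4 :- # 4 :* e8 :+ # 5 :* g2 :+ # 10 :* g4 :- # 20 :* g8 ⟩· # 24 ∷
    ⟨ c :* d :^ 3 := e2 :- # 2 :* e4 :- # 4 :* e8 :+ g2 :+ # 2 :* g4 :- # 4 :* g8 ⟩· (:- (# 40)) ∷
    ⟨ C :^ 3 :* D := (:- e4) :- # 4 :* e8 :- # 5 :* g4 :+ # 20 :* g8 ⟩· # 32 ∷
    [] ⊢ # 16 :* (x :* c :^ 2 :* X) := # 8 :* e1 :+ con -[1+ 7 ] :* e2 :+ con -[1+ 15 ] :* e4 :+ con -[1+ 63 ] :* e8 :+ # 40 :* g1 :+ # 40 :* g2 :+ con -[1+ 79 ] :* g4 :+ # 320 :* g8 :+ # 80 :* B1 :+ con -[1+ 15 ] :* B2) refl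

  -- As for xc²X, with X² + Y² in place of x² + y²: the mixed terms are 4XY(xY - yX) = 16B₂ - 16B₁.
  identity₅ = certificate 18 (λ x y X Y c d C D B1 B2 e1 e2 e4 e8 g1 g2 g4 g8 →
    ⟨ X :* X :+ Y :* Y := # 2 :* (d :* d) ⟩· (:- (# 4 :* (x :* X :- y :* Y))) ∷
    ⟨ (x :* X :+ y :* Y) :* (d :* d) := c :* d :* (c :* c :- # 3 :* (d :* d)) :+ # 4 :* (C :* D :* (D :* D)) ⟩· # 8 ∷
    ⟨ x :* X :^ 3 := e1 :- # 2 :* e2 :- # 4 :* e4 :+ g1 :+ # 2 :* g2 :- # 4 :* g4 ⟩· # 4 ∷
    ⟨ y :* Y :^ 3 := (:- e1) :- # 4 :* e2 :- g1 :+ # 4 :* g2 ⟩· (:- (# 4)) ∷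
    ⟨ # 16 :* B1 := (X :* Y :- x :* y) :* (x :* Y :- y :* X) ⟩· # 1 ∷
    ⟨ # 16 :* B2 := (# 5 :* (X :* Y) :- x :* y) :* (x :* Y :- y :* X) ⟩· (:- (# 1)) ∷
    ⟨ c :^ 3 :* d := e2 :- # 2 :* e4 :- # 4 :* e8 :+ # 5 :* g2 :+ # 10 :* g4 :- # 20 :* g8 ⟩· # 8 ∷
    ⟨ c :* d :^ 3 := e2 :- # 2 :* e4 :- # 4 :* e8 :+ g2 :+ # 2 :* g4 :- # 4 :* g8 ⟩· (:- (# 24)) ∷
    ⟨ C :* D :^ 3 := (:- e4) :- # 4 :* e8 :- g4 :+ # 4 :* g8 ⟩· # 32 ∷
    [] ⊢ # 16 :* (x :* X :* d :^ 2) := # 8 :* e1 :+ con -[1+ 7 ] :* e2 :+ con -[1+ 15 ] :* e4 :+ con -[1+ 63 ] :* e8 :+ # 8 :* g1 :+ # 8 :* g2 :+ con -[1+ 15 ] :* g4 :+ # 64 :* g8 :+ con -[1+ 15 ] :* B1 :+ # 16 :* B2) refl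

open import Function using (_∘_; id)
open import Relation.Binary.PropositionalEquality using (_≢_; refl; sym; trans; cong; cong₂; subst; module ≡-Reasoning)

-- Finite sums in a commutative ring

module FiniteSum (R : CommutativeRing 0ℓ 0ℓ) where
  private module R = CommutativeRing R
  open R using (Carrier; _≈_; 0#)
  open IntegerCoefficients R
  open import Relation.Binary.Reasoning.Setoid R.setoid

  S : ℕ → (ℕ → Carrier) → Carrier
  S zero    F = 0#
  S (suc n) F = F 0 R.+ S n (F ∘ suc)

  S-cong : ∀ n F G → (∀ i → i ℕ.< n → F i ≈ G i) → S n F ≈ S n G
  S-cong zero    F G F≈G = R.refl
  S-cong (suc n) F G F≈G = R.+-cong (F≈G 0 (s≤s z≤n)) (S-cong n _ _ (λ i i<n → F≈G (suc i) (s≤s i<n)))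

  S-zero : ∀ n F → (∀ i → i ℕ.< n → F i ≈ 0#) → S n F ≈ 0#
  S-zero zero    F F≈0 = R.refl
  S-zero (suc n) F F≈0 = R.trans
    (R.+-cong (F≈0 0 (s≤s z≤n)) (S-zero n _ (λ i i<n → F≈0 (suc i) (s≤s i<n)))) (R.+-identityˡ _)

  S-+ : ∀ n F G → S n (λ i → F i R.+ G i) ≈ S n F R.+ S n G
  S-+ zero    F G = R.sym (R.+-identityˡ _)
  S-+ (suc n) F G = R.trans (R.+-congˡ (S-+ n (F ∘ suc) (G ∘ suc)))
    (solve 4 (λ a b c d → (a :+ b) :+ (c :+ d) := (a :+ c) :+ (b :+ d)) R.refl _ _ _ _)

  S-*ˡ : ∀ n c F → S n (λ i → c R.* F i) ≈ c R.* S n F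
  S-*ˡ zero    c F = R.sym (R.zeroʳ c)
  S-*ˡ (suc n) c F = R.trans (R.+-congˡ (S-*ˡ n c (F ∘ suc))) (R.sym (R.distribˡ _ _ _))

  S-split : ∀ m n F → S (m ℕ.+ n) F ≈ S m F R.+ S n (λ i → F (m ℕ.+ i))
  S-split zero    n F = R.sym (R.+-identityˡ _)
  S-split (suc m) n F = R.trans (R.+-congˡ (S-split m n (F ∘ suc))) (R.sym (R.+-assoc _ _ _))

  S-last : ∀ n F → S (suc n) F ≈ S n F R.+ F n
  S-last zero    F = R.+-comm _ _
  S-last (suc n) F = R.trans (R.+-congˡ (S-last n (F ∘ suc))) (R.sym (R.+-assoc _ _ _))

  S-reverse : ∀ n F → S n F ≈ S n (λ i → F (n ℕ.∸ suc i))
  S-reverse zero    F = R.refl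
  S-reverse (suc n) F = R.trans (S-last n F) (R.trans (R.+-congʳ (S-reverse n F)) (R.+-comm _ _))

  S-extend : ∀ m n F → (∀ i → m ℕ.≤ i → F i ≈ 0#) → m ℕ.≤ n → S n F ≈ S m F
  S-extend m n F F≈0 m≤n = begin
    S n F                                     ≡⟨ cong (λ k → S k F) (sym (ℕₚ.m+[n∸m]≡n m≤n)) ⟩
    S (m ℕ.+ (n ℕ.∸ m)) F                     ≈⟨ S-split m (n ℕ.∸ m) F ⟩
    S m F R.+ S (n ℕ.∸ m) (λ i → F (m ℕ.+ i)) ≈⟨ R.+-congˡ (S-zero (n ℕ.∸ m) _ (λ i _ → F≈0 _ (ℕₚ.m≤m+n m i))) ⟩
    S m F R.+ 0#                              ≈⟨ R.+-identityʳ _ ⟩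
    S m F                                     ∎

  S-block : ∀ k m F → S (m ℕ.* k) F ≈ S m (λ j → S k (λ r → F (r ℕ.+ j ℕ.* k)))
  S-block k zero    F = R.refl
  S-block k (suc m) F = begin
    S (k ℕ.+ m ℕ.* k) F                                     ≈⟨ S-split k (m ℕ.* k) F ⟩
    S k F R.+ S (m ℕ.* k) (λ i → F (k ℕ.+ i))               ≈⟨ R.+-cong
      (S-cong k _ _ (λ r _ → R.reflexive (cong F (sym (ℕₚ.+-identityʳ r)))))
      (R.trans (S-block k m _) (S-cong m _ _ (λ j _ → S-cong k _ _ (λ r _ → R.reflexive (cong F (comm₃ k r (j ℕ.* k))))))) ⟩
    S (suc m) (λ j → S k (λ r → F (r ℕ.+ j ℕ.* k)))         ∎
    where
    comm₃ : ∀ a b c → a ℕ.+ (b ℕ.+ c) ≡ b ℕ.+ (a ℕ.+ c)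
    comm₃ a b c = trans (sym (ℕₚ.+-assoc a b c)) (trans (cong (ℕ._+ c) (ℕₚ.+-comm a b)) (ℕₚ.+-assoc b a c))

-- Gaussian binomials and the finite triple product

module QBinomial (R : CommutativeRing 0ℓ 0ℓ) (Q : CommutativeRing.Carrier R) where
  open CommutativeRing R using (Carrier; _≈_; 0#; 1#; setoid)
  private module R = CommutativeRing R
  open FiniteSum R
  open IntegerCoefficients R
  open import Relation.Binary.Reasoning.Setoid setoid

  Qp : ℕ → Carrier
  Qp zero    = 1#
  Qp (suc n) = Q R.* Qp n

  Qp-+ : ∀ m n → Qp (m ℕ.+ n) ≈ Qp m R.* Qp n
  Qp-+ zero    n = R.sym (R.*-identityˡ _)
  Qp-+ (suc m) n = R.trans (R.*-congˡ (Qp-+ m n)) (R.sym (R.*-assoc _ _ _))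

  -- The Gaussian binomial coefficient, generated by Pascal's rule so that nothing has to be
  -- divided.
  Gb : ℕ → ℕ → Carrier
  Gb N       zero    = 1#
  Gb zero    (suc j) = 0#
  Gb (suc N) (suc j) = Gb N j R.+ Qp (suc j) R.* Gb N (suc j)

  Gb-> : ∀ N j → N ℕ.< j → Gb N j ≈ 0#
  Gb-> zero    (suc j) _         = R.refl
  Gb-> (suc N) (suc j) (s≤s N<j) = R.trans (R.+-cong (Gb-> N j N<j)
    (R.trans (R.*-congˡ (Gb-> N (suc j) (ℕₚ.m<n⇒m<1+n N<j))) (R.zeroʳ _))) (R.+-identityˡ _)

  poch : Carrier → ℕ → Carrier
  poch x zero    = 1#
  poch x (suc n) = (1# R.- x R.* Qp n) R.* poch x n

  poch-front : ∀ x n → poch x (suc n) ≈ (1# R.- x) R.* poch (x R.* Q) n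
  poch-front x zero    = R.*-congʳ (R.+-congˡ (R.-‿cong (R.*-identityʳ x)))
  poch-front x (suc n) = begin
    (1# R.- x R.* (Q R.* Qp n)) R.* poch x (suc n)                          ≈⟨ R.*-congˡ (poch-front x n) ⟩
    (1# R.- x R.* (Q R.* Qp n)) R.* ((1# R.- x) R.* poch (x R.* Q) n)       ≈⟨ solve 5 (λ o x q p r →
      (o :- x :* (q :* p)) :* ((o :- x) :* r) := (o :- x) :* ((o :- x :* q :* p) :* r)) R.refl 1# x Q (Qp n) (poch (x R.* Q) n) ⟩
    (1# R.- x) R.* ((1# R.- x R.* Q R.* Qp n) R.* poch (x R.* Q) n)         ∎

  -- Pascal's rule moved onto the other factor: raising N by one replaces v(j) by Q^j v(j) + v(j +
  -- 1). The binomial theorem and the triple product are both inductions on this step.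
  Pascal-sum : ∀ N (v : ℕ → Carrier) →
    S (suc (suc N)) (λ j → Gb (suc N) j R.* v j) ≈ S (suc N) (λ j → Gb N j R.* (Qp j R.* v j R.+ v (suc j)))
  Pascal-sum N v = begin
    1# R.* v 0 R.+ S (suc N) (λ j → (Gb N j R.+ Qp (suc j) R.* Gb N (suc j)) R.* v (suc j))
      ≈⟨ R.+-congˡ (R.trans (S-cong (suc N) (λ j → (Gb N j R.+ Qp (suc j) R.* Gb N (suc j)) R.* v (suc j)) (λ j → g j R.+ h (suc j))
           (λ j _ → solve 4 (λ a b c d → (a :+ b :* c) :* d := a :* d :+ c :* (b :* d))
             R.refl (Gb N j) (Qp (suc j)) (Gb N (suc j)) (v (suc j)))) (S-+ (suc N) g (λ j → h (suc j)))) ⟩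
    1# R.* v 0 R.+ (S (suc N) g R.+ S (suc N) (λ j → h (suc j)))
      ≈⟨ solve 3 (λ a b c → a :+ (b :+ c) := (a :+ c) :+ b) R.refl (1# R.* v 0) (S (suc N) g) (S (suc N) (λ j → h (suc j))) ⟩
    (1# R.* v 0 R.+ S (suc N) (λ j → h (suc j))) R.+ S (suc N) g
      ≈⟨ R.+-congʳ (R.+-congʳ (R.*-congˡ (R.sym (R.*-identityˡ (v 0))))) ⟩
    S (suc (suc N)) h R.+ S (suc N) g
      ≈⟨ R.+-congʳ (R.trans (S-last (suc N) h) (R.trans (R.+-congˡ (R.trans (R.*-congʳ (Gb-> N (suc N) ℕₚ.≤-refl)) (R.zeroˡ _))) (R.+-identityʳ _))) ⟩
    S (suc N) h R.+ S (suc N) g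
      ≈⟨ S-+ (suc N) h g ⟨
    S (suc N) (λ j → h j R.+ g j)
      ≈⟨ S-cong (suc N) (λ j → h j R.+ g j) (λ j → Gb N j R.* (Qp j R.* v j R.+ v (suc j))) (λ j _ → R.sym (R.distribˡ _ _ _)) ⟩
    S (suc N) (λ j → Gb N j R.* (Qp j R.* v j R.+ v (suc j))) ∎
    where
    g h : ℕ → Carrier
    g j = Gb N j R.* v (suc j)
    h j = Gb N j R.* (Qp j R.* v j)

  -- (-x)^j Q^(j(j-1)/2).
  u : Carrier → ℕ → Carrier
  u x zero    = 1#
  u x (suc j) = R.- (x R.* Qp j) R.* u x j

  u-shift : ∀ x j → u (x R.* Q) j ≈ Qp j R.* u x j
  u-shift x zero    = R.sym (R.*-identityˡ _)
  u-shift x (suc j) = R.trans (R.*-congˡ (u-shift x j))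
    (solve 4 (λ x q p w → :- (x :* q :* p) :* (p :* w) := q :* p :* (:- (x :* p) :* w)) R.refl x Q (Qp j) (u x j))

  q-binomial : ∀ a x → poch x a ≈ S (suc a) (λ j → Gb a j R.* u x j)
  q-binomial zero    x = R.sym (R.trans (R.+-identityʳ _) (R.*-identityˡ _))
  q-binomial (suc a) x = begin
    poch x (suc a)                                                     ≈⟨ poch-front x a ⟩
    (1# R.- x) R.* poch (x R.* Q) a                                    ≈⟨ R.*-congˡ (q-binomial a (x R.* Q)) ⟩
    (1# R.- x) R.* S (suc a) (λ j → Gb a j R.* u (x R.* Q) j)          ≈⟨ S-*ˡ (suc a) (1# R.- x) (λ j → Gb a j R.* u (x R.* Q) j) ⟨
    S (suc a) (λ j → (1# R.- x) R.* (Gb a j R.* u (x R.* Q) j))        ≈⟨ S-cong (suc a) (λ j → (1# R.- x) R.* (Gb a j R.* u (x R.* Q) j)) (λ j → Gb a j R.* (Qp j R.* u x j R.+ u x (suc j))) (λ j _ → R.trans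
      (R.*-congˡ (R.*-congˡ (u-shift x j)))
      (R.trans (solve 5 (λ o x g p w → (o :- x) :* (g :* (p :* w)) := g :* (o :* (p :* w) :+ :- (x :* p) :* w)) R.refl 1# x (Gb a j) (Qp j) (u x j))
               (R.*-congˡ (R.+-congʳ (R.*-identityˡ _))))) ⟩
    S (suc a) (λ j → Gb a j R.* (Qp j R.* u x j R.+ u x (suc j)))      ≈⟨ Pascal-sum a (u x) ⟨
    S (suc (suc a)) (λ j → Gb (suc a) j R.* u x j)                     ∎

  -- The quotient formula cleared of denominators; the inductive step is 1 - Q^m + Q^m (1 - Q^n) = 1
  -- - Q^(m+n).
  Gb-poch : ∀ j i → Gb (j ℕ.+ i) j R.* (poch Q j R.* poch Q i) ≈ poch Q (j ℕ.+ i)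
  Gb-poch zero    i = R.trans (R.*-identityˡ _) (R.*-identityˡ _)
  Gb-poch (suc j) zero = R.trans
    (R.*-congʳ (R.trans (R.+-congˡ (R.trans (R.*-congˡ (Gb-> (j ℕ.+ 0) (suc j) (s≤s (ℕₚ.≤-reflexive (ℕₚ.+-identityʳ j))))) (R.zeroʳ _))) (R.+-identityʳ _)))
    (R.trans (solve 4 (λ g a b c → g :* ((a :* b) :* c) := a :* (g :* (b :* c))) R.refl (Gb (j ℕ.+ 0) j) (1# R.- Q R.* Qp j) (poch Q j) 1#)
    (R.trans (R.*-congˡ (Gb-poch j 0)) (R.reflexive (cong (λ k → (1# R.- Q R.* Qp k) R.* poch Q (j ℕ.+ 0)) (sym (ℕₚ.+-identityʳ j))))))
  Gb-poch (suc j) (suc i) = begin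
    (G₁ R.+ Qp (suc j) R.* G₂) R.* ((a R.* poch Q j) R.* (b R.* poch Q i))
      ≈⟨ solve 7 (λ g₁ p g₂ a c b d → (g₁ :+ p :* g₂) :* ((a :* c) :* (b :* d)) :=
           a :* (g₁ :* (c :* (b :* d))) :+ p :* (b :* (g₂ :* ((a :* c) :* d)))) R.refl G₁ (Qp (suc j)) G₂ a (poch Q j) b (poch Q i) ⟩
    a R.* (G₁ R.* (poch Q j R.* poch Q (suc i))) R.+ Qp (suc j) R.* (b R.* (G₂ R.* (poch Q (suc j) R.* poch Q i)))
      ≈⟨ R.+-cong (R.*-congˡ (Gb-poch j (suc i))) (R.*-congˡ (R.*-congˡ (R.trans
           (R.*-congʳ (R.reflexive (cong (λ k → Gb k (suc j)) (ℕₚ.+-suc j i))))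
           (R.trans (Gb-poch (suc j) i) (R.reflexive (cong (poch Q) (sym (ℕₚ.+-suc j i)))))))) ⟩
    a R.* poch Q (j ℕ.+ suc i) R.+ Qp (suc j) R.* (b R.* poch Q (j ℕ.+ suc i))
      ≈⟨ solve 4 (λ o x y p → (o :- x) :* p :+ x :* ((o :- y) :* p) := (o :- x :+ x :* o :- x :* y) :* p) R.refl 1# (Qp (suc j)) (Qp (suc i)) _ ⟩
    (1# R.- Qp (suc j) R.+ Qp (suc j) R.* 1# R.- Qp (suc j) R.* Qp (suc i)) R.* poch Q (j ℕ.+ suc i)
      ≈⟨ R.*-congʳ (R.+-cong (R.trans (R.+-congˡ (R.*-identityʳ _)) (solve 2 (λ o x → o :- x :+ x := o) R.refl 1# (Qp (suc j))))
                             (R.-‿cong (R.sym (Qp-+ (suc j) (suc i))))) ⟩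
    (1# R.- Qp (suc j ℕ.+ suc i)) R.* poch Q (j ℕ.+ suc i) ∎
    where
    G₁ = Gb (j ℕ.+ suc i) j
    G₂ = Gb (j ℕ.+ suc i) (suc j)
    a = 1# R.- Q R.* Qp j
    b = 1# R.- Q R.* Qp i

  module _ (X Y : Carrier) (XY≈Q : X R.* Y ≈ Q) where

    -- The term of index j - b in the bilateral sum, a power of X or of Y according to sign. Two
    -- elements with XY = Q replace z and Q/z, so monomials in q, which are not invertible, may be
    -- inserted.
    v : ℕ → ℕ → Carrier
    v zero    j       = u X j
    v (suc b) zero    = u Y (suc b)
    v (suc b) (suc j) = v b j

    v-0 : ∀ b → v b 0 ≈ u Y b
    v-0 zero    = R.refl
    v-0 (suc b) = R.refl

    -- Lowering the bilateral index by one means dividing by X. At positive indices multiplication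
    -- by Y does this, because XY = Q; elsewhere one more power of Y appears.
    v-step : ∀ b j → R.- (Y R.* Qp b) R.* v b j ≈ Qp j R.* v (suc b) j
    v-step b zero = R.trans (R.*-congˡ (v-0 b)) (R.sym (R.*-identityˡ _))
    v-step zero (suc j) = begin
      R.- (Y R.* 1#) R.* (R.- (X R.* Qp j) R.* u X j)   ≈⟨ solve 5 (λ y o x p w → :- (y :* o) :* (:- (x :* p) :* w) := ((x :* y) :* (o :* p)) :* w) R.refl Y 1# X (Qp j) (u X j) ⟩
      ((X R.* Y) R.* (1# R.* Qp j)) R.* u X j           ≈⟨ R.*-congʳ (R.*-cong XY≈Q (R.*-identityˡ _)) ⟩
      (Q R.* Qp j) R.* u X j                            ∎
    v-step (suc b) (suc j) = begin
      R.- (Y R.* (Q R.* Qp b)) R.* v b j     ≈⟨ solve 4 (λ y q p w → :- (y :* (q :* p)) :* w := q :* (:- (y :* p) :* w)) R.refl Y Q (Qp b) (v b j) ⟩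
      Q R.* (R.- (Y R.* Qp b) R.* v b j)     ≈⟨ R.*-congˡ (v-step b j) ⟩
      Q R.* (Qp j R.* v (suc b) j)           ≈⟨ R.*-assoc _ _ _ ⟨
      Q R.* Qp j R.* v (suc b) j             ∎

    -- Induction on b from the q-binomial theorem: by `v-step` the new factor 1 - Y Q^b brings the
    -- terms into the shape that `Pascal-sum` expects.
    finite-JTP : ∀ b a → poch Y b R.* poch X a ≈ S (suc (b ℕ.+ a)) (λ j → Gb (b ℕ.+ a) j R.* v b j)
    finite-JTP zero    a = R.trans (R.*-identityˡ _) (q-binomial a X)
    finite-JTP (suc b) a = begin
      ((1# R.- Y R.* Qp b) R.* poch Y b) R.* poch X a             ≈⟨ R.*-assoc _ _ _ ⟩
      (1# R.- Y R.* Qp b) R.* (poch Y b R.* poch X a)             ≈⟨ R.*-congˡ (finite-JTP b a) ⟩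
      (1# R.- Y R.* Qp b) R.* S (suc (b ℕ.+ a)) (λ j → Gb (b ℕ.+ a) j R.* v b j) ≈⟨ S-*ˡ (suc (b ℕ.+ a)) (1# R.- Y R.* Qp b) (λ j → Gb (b ℕ.+ a) j R.* v b j) ⟨
      S (suc (b ℕ.+ a)) (λ j → (1# R.- Y R.* Qp b) R.* (Gb (b ℕ.+ a) j R.* v b j)) ≈⟨ S-cong (suc (b ℕ.+ a)) (λ j → (1# R.- Y R.* Qp b) R.* (Gb (b ℕ.+ a) j R.* v b j)) (λ j → Gb (b ℕ.+ a) j R.* (Qp j R.* v (suc b) j R.+ v (suc b) (suc j))) (λ j _ → R.trans
        (solve 4 (λ o z g w → (o :- z) :* (g :* w) := g :* (:- z :* w :+ o :* w)) R.refl 1# (Y R.* Qp b) (Gb (b ℕ.+ a) j) (v b j))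
        (R.*-congˡ (R.+-cong (v-step b j) (R.*-identityˡ _)))) ⟩
      S (suc (b ℕ.+ a)) (λ j → Gb (b ℕ.+ a) j R.* (Qp j R.* v (suc b) j R.+ v (suc b) (suc j))) ≈⟨ Pascal-sum (b ℕ.+ a) (v (suc b)) ⟨
      S (suc (suc b ℕ.+ a)) (λ j → Gb (suc b ℕ.+ a) j R.* v (suc b) j) ∎

    v-pos : ∀ n k → v n (n ℕ.+ k) ≡ u X k
    v-pos zero    k = refl
    v-pos (suc n) k = v-pos n k

    v-low : ∀ j l → v (j ℕ.+ suc l) j ≡ u Y (suc l)
    v-low zero    l = refl
    v-low (suc j) l = v-low j l

    v-neg : ∀ n l → l ℕ.< n → v n (n ℕ.∸ suc l) ≡ u Y (suc l)
    v-neg n l l<n = trans (cong (λ k → v k (n ℕ.∸ suc l)) (sym (ℕₚ.m∸n+n≡m l<n))) (v-low (n ℕ.∸ suc l) l)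

    finite-JTP′ : ∀ n → poch Y n R.* poch X n ≈
      S n (λ l → Gb (n ℕ.+ n) (n ℕ.∸ suc l) R.* u Y (suc l)) R.+ S (suc n) (λ k → Gb (n ℕ.+ n) (n ℕ.+ k) R.* u X k)
    finite-JTP′ n = begin
      poch Y n R.* poch X n ≈⟨ finite-JTP n n ⟩
      S (suc (n ℕ.+ n)) F   ≡⟨ cong (λ k → S k F) (sym (ℕₚ.+-suc n n)) ⟩
      S (n ℕ.+ suc n) F     ≈⟨ S-split n (suc n) F ⟩
      S n F R.+ S (suc n) (λ k → F (n ℕ.+ k)) ≈⟨ R.+-cong
        (R.trans (S-reverse n F) (S-cong n (λ l → F (n ℕ.∸ suc l)) (λ l → Gb (n ℕ.+ n) (n ℕ.∸ suc l) R.* u Y (suc l))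
          (λ l l<n → R.*-congˡ (R.reflexive (v-neg n l l<n)))))
        (S-cong (suc n) (λ k → F (n ℕ.+ k)) (λ k → Gb (n ℕ.+ n) (n ℕ.+ k) R.* u X k)
          (λ k _ → R.*-congˡ (R.reflexive (v-pos n k)))) ⟩
      S n (λ l → Gb (n ℕ.+ n) (n ℕ.∸ suc l) R.* u Y (suc l)) R.+ S (suc n) (λ k → Gb (n ℕ.+ n) (n ℕ.+ k) R.* u X k) ∎
      where
      F : ℕ → Carrier
      F j = Gb (n ℕ.+ n) j R.* v n j

open import Defs
open import Data.Bool using (true; false; if_then_else_)
open import Data.Empty using (⊥-elim)
open import Data.Fin as Fin using (Fin; toℕ; fromℕ<)
open import Data.Fin.Patterns using (0F; 1F; 2F; 3F; 4F)
import Data.Fin.Properties as Finₚ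
open import Data.Integer.DivMod using (_/ℕ_; _%ℕ_; n%ℕd<d; a≡a%ℕn+[a/ℕn]*n)
import Data.Integer.Solver
import Data.Integer.Tactic.RingSolver as ℤ-Solver
import Data.Nat.Tactic.RingSolver as ℕ-Solver
open import Data.List.Membership.Propositional using (_∈_)
open import Data.List.Membership.Propositional.Properties using (∈-map⁺; ∈-map⁻; ∈-++⁺ˡ; ∈-++⁺ʳ; ∈-++⁻; ∈-cartesianProduct⁺; ∈-upTo⁺; ∈-deduplicate⁺)
open import Data.List.Properties using (map-applyUpTo; ∷-injective)
open import Data.List.Relation.Unary.All using (All; []; _∷_)
open import Data.List.Relation.Unary.AllPairs using ([]; _∷_)
open import Data.List.Relation.Unary.Any using (here; there)
open import Data.List.Relation.Unary.Unique.Propositional using (Unique)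
import Data.List.Relation.Unary.Unique.DecPropositional.Properties as DecUniqueₚ
import Data.List.Relation.Unary.Unique.Propositional.Properties as Uniqueₚ
open import Data.Nat.Coprimality using (Coprime; 1-coprimeTo) renaming (sym to coprime-sym)
open import Data.Nat.Divisibility as ∣ using (_∣_; divides; _∣?_)
open import Data.Nat.DivMod using (_%_; m*n/n≡m; m/n≤m; m%n<n; [m+kn]%n≡m%n; %-distribˡ-+; %-distribˡ-*)
open import Data.Nat.Induction using (<-rec)
open import Data.Nat.Primality using (Prime; prime?; prime⇒nonZero; euclidsLemma)
open import Data.Product using (Σ; _×_; _,_; proj₁; proj₂; ∃)
open import Data.Product.Properties using (≡-dec)
open import Data.Rational as ℚ using (ℚ; 0ℚ; 1ℚ; _+_; _*_; -_; mkℚ)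
import Data.Rational.Properties as ℚₚ
open import Data.Rational.Solver using (module +-*-Solver)
open import Data.Sum using (_⊎_; inj₁; inj₂)
open import Relation.Binary.Definitions using (DecidableEquality)
open import Relation.Nullary.Decidable using (dec-true; dec-false; from-yes)
open import Relation.Unary using (Decidable)
open Algebra.Properties.AbelianGroup ℤₚ.+-0-abelianGroup using () renaming (∙-cancelˡ to ℤ-cancelˡ)
open Algebra.Properties.Group ℚₚ.+-0-group using (⁻¹-involutive)

-- Formal power series

open FiniteSum ℚₚ.+-*-commutativeRing public

sumℚ-applyUpTo : ∀ n F → sumℚ (applyUpTo F n) ≡ S n F
sumℚ-applyUpTo zero    F = refl
sumℚ-applyUpTo (suc n) F = cong (F 0 +_) (sumℚ-applyUpTo n (F ∘ suc))

sumℚ-upTo : ∀ n F → sumℚ (map F (upTo n)) ≡ S n F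
sumℚ-upTo n F = trans (cong sumℚ (map-applyUpTo id F n)) (sumℚ-applyUpTo n F)

infix 4 _≋_
_≋_ : PS → PS → Set
f ≋ g = ∀ n → f n ≡ g n

𝟘 : PS
𝟘 _ = 0ℚ

infix 8 ⊝_
⊝_ : PS → PS
(⊝ f) n = - f n

conv : ∀ f g n → (f ⊛ g) n ≡ S (suc n) (λ k → f k * g (n ℕ.∸ k))
conv f g n = sumℚ-upTo (suc n) (λ k → f k * g (n ℕ.∸ k))

conv-zero : ∀ f g → (f ⊛ g) 0 ≡ f 0 * g 0
conv-zero f g = ℚₚ.+-identityʳ (f 0 * g 0)

conv-suc : ∀ f g n → (f ⊛ g) (suc n) ≡ f 0 * g (suc n) + ((f ∘ suc) ⊛ g) n
conv-suc f g n = trans (conv f g (suc n)) (cong (f 0 * g (suc n) +_) (sym (conv (f ∘ suc) g n)))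

module _ where
  open +-*-Solver using (solve; _:=_; _:+_; _:*_; :-_)

  ⊛-cong : ∀ {f f′ g g′} → f ≋ f′ → g ≋ g′ → (f ⊛ g) ≋ (f′ ⊛ g′)
  ⊛-cong {f} {f′} {g} {g′} p q n = trans (conv f g n) (trans
    (S-cong (suc n) _ _ (λ k _ → cong₂ _*_ (p k) (q (n ℕ.∸ k)))) (sym (conv f′ g′ n)))

  ⊛-distribʳ : ∀ h f g → ((f ⊕ g) ⊛ h) ≋ ((f ⊛ h) ⊕ (g ⊛ h))
  ⊛-distribʳ h f g n = begin
    ((f ⊕ g) ⊛ h) n                         ≡⟨ conv (f ⊕ g) h n ⟩
    S (suc n) (λ k → (f k + g k) * h (n ℕ.∸ k)) ≡⟨ S-cong (suc n) _ _ (λ k _ → ℚₚ.*-distribʳ-+ (h (n ℕ.∸ k)) (f k) (g k)) ⟩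
    S (suc n) (λ k → f k * h (n ℕ.∸ k) + g k * h (n ℕ.∸ k)) ≡⟨ S-+ (suc n) (λ k → f k * h (n ℕ.∸ k)) (λ k → g k * h (n ℕ.∸ k)) ⟩
    S (suc n) (λ k → f k * h (n ℕ.∸ k)) + S (suc n) (λ k → g k * h (n ℕ.∸ k)) ≡⟨ cong₂ _+_ (conv f h n) (conv g h n) ⟨
    ((f ⊛ h) ⊕ (g ⊛ h)) n                   ∎
    where open ≡-Reasoning

  ·-⊛ : ∀ c f g → ((c · f) ⊛ g) ≋ (c · (f ⊛ g))
  ·-⊛ c f g n = trans (conv (c · f) g n) (trans
    (trans (S-cong (suc n) _ _ (λ k _ → ℚₚ.*-assoc c (f k) (g (n ℕ.∸ k)))) (S-*ˡ (suc n) c (λ k → f k * g (n ℕ.∸ k))))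
    (cong (c *_) (sym (conv f g n))))

  -- Peeling the first coefficient off both factors leaves a product two degrees lower, whence the
  -- two base cases.
  ⊛-comm : ∀ f g → (f ⊛ g) ≋ (g ⊛ f)
  ⊛-comm f g zero = trans (conv-zero f g) (trans (ℚₚ.*-comm (f 0) (g 0)) (sym (conv-zero g f)))
  ⊛-comm f g (suc zero) = begin
    (f ⊛ g) 1                                  ≡⟨ conv-suc f g 0 ⟩
    f 0 * g 1 + ((f ∘ suc) ⊛ g) 0              ≡⟨ cong (f 0 * g 1 +_) (conv-zero (f ∘ suc) g) ⟩
    f 0 * g 1 + f 1 * g 0                      ≡⟨ solve 4 (λ a b c d → a :* b :+ c :* d := d :* c :+ b :* a) refl (f 0) (g 1) (f 1) (g 0) ⟩
    g 0 * f 1 + g 1 * f 0                      ≡⟨ cong (g 0 * f 1 +_) (conv-zero (g ∘ suc) f) ⟨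
    g 0 * f 1 + ((g ∘ suc) ⊛ f) 0              ≡⟨ conv-suc g f 0 ⟨
    (g ⊛ f) 1                                  ∎
    where open ≡-Reasoning
  ⊛-comm f g (suc (suc n)) = begin
    (f ⊛ g) (2 ℕ.+ n)                                                   ≡⟨ conv-suc f g (suc n) ⟩
    f 0 * g (2 ℕ.+ n) + ((f ∘ suc) ⊛ g) (suc n)                         ≡⟨ cong (f 0 * g (2 ℕ.+ n) +_) (trans (⊛-comm (f ∘ suc) g (suc n)) (conv-suc g (f ∘ suc) n)) ⟩
    f 0 * g (2 ℕ.+ n) + (g 0 * f (2 ℕ.+ n) + ((g ∘ suc) ⊛ (f ∘ suc)) n) ≡⟨ cong (λ z → f 0 * g (2 ℕ.+ n) + (g 0 * f (2 ℕ.+ n) + z)) (⊛-comm (g ∘ suc) (f ∘ suc) n) ⟩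
    f 0 * g (2 ℕ.+ n) + (g 0 * f (2 ℕ.+ n) + ((f ∘ suc) ⊛ (g ∘ suc)) n) ≡⟨ solve 3 (λ a b c → a :+ (b :+ c) := b :+ (a :+ c)) refl (f 0 * g (2 ℕ.+ n)) (g 0 * f (2 ℕ.+ n)) (((f ∘ suc) ⊛ (g ∘ suc)) n) ⟩
    g 0 * f (2 ℕ.+ n) + (f 0 * g (2 ℕ.+ n) + ((f ∘ suc) ⊛ (g ∘ suc)) n) ≡⟨ cong (g 0 * f (2 ℕ.+ n) +_) (trans (⊛-comm (g ∘ suc) f (suc n)) (conv-suc f (g ∘ suc) n)) ⟨
    g 0 * f (2 ℕ.+ n) + ((g ∘ suc) ⊛ f) (suc n)                         ≡⟨ conv-suc g f (suc n) ⟨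
    (g ⊛ f) (2 ℕ.+ n)                                                   ∎
    where open ≡-Reasoning

  ⊛-assoc : ∀ f g h → ((f ⊛ g) ⊛ h) ≋ (f ⊛ (g ⊛ h))
  ⊛-assoc f g h zero = begin
    ((f ⊛ g) ⊛ h) 0          ≡⟨ trans (conv-zero (f ⊛ g) h) (cong (_* h 0) (conv-zero f g)) ⟩
    f 0 * g 0 * h 0          ≡⟨ ℚₚ.*-assoc (f 0) (g 0) (h 0) ⟩
    f 0 * (g 0 * h 0)        ≡⟨ trans (conv-zero f (g ⊛ h)) (cong (f 0 *_) (conv-zero g h)) ⟨
    (f ⊛ (g ⊛ h)) 0          ∎
    where open ≡-Reasoning
  ⊛-assoc f g h (suc n) = begin
    ((f ⊛ g) ⊛ h) (suc n)                                                       ≡⟨ conv-suc (f ⊛ g) h n ⟩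
    (f ⊛ g) 0 * h (suc n) + (((f ⊛ g) ∘ suc) ⊛ h) n                             ≡⟨ cong₂ _+_ (cong (_* h (suc n)) (conv-zero f g)) (⊛-cong {g = h} (conv-suc f g) (λ _ → refl) n) ⟩
    f 0 * g 0 * h (suc n) + (((f 0 · (g ∘ suc)) ⊕ ((f ∘ suc) ⊛ g)) ⊛ h) n       ≡⟨ cong (f 0 * g 0 * h (suc n) +_) (⊛-distribʳ h (f 0 · (g ∘ suc)) ((f ∘ suc) ⊛ g) n) ⟩
    f 0 * g 0 * h (suc n) + (((f 0 · (g ∘ suc)) ⊛ h) n + (((f ∘ suc) ⊛ g) ⊛ h) n) ≡⟨ cong (f 0 * g 0 * h (suc n) +_) (cong₂ _+_ (·-⊛ (f 0) (g ∘ suc) h n) (⊛-assoc (f ∘ suc) g h n)) ⟩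
    f 0 * g 0 * h (suc n) + (f 0 * ((g ∘ suc) ⊛ h) n + ((f ∘ suc) ⊛ (g ⊛ h)) n) ≡⟨ solve 5 (λ a b c d e → a :* b :* c :+ (a :* d :+ e) := a :* (b :* c :+ d) :+ e) refl (f 0) (g 0) (h (suc n)) (((g ∘ suc) ⊛ h) n) (((f ∘ suc) ⊛ (g ⊛ h)) n) ⟩
    f 0 * (g 0 * h (suc n) + ((g ∘ suc) ⊛ h) n) + ((f ∘ suc) ⊛ (g ⊛ h)) n       ≡⟨ cong (λ z → f 0 * z + ((f ∘ suc) ⊛ (g ⊛ h)) n) (conv-suc g h n) ⟨
    f 0 * (g ⊛ h) (suc n) + ((f ∘ suc) ⊛ (g ⊛ h)) n                             ≡⟨ conv-suc f (g ⊛ h) n ⟨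
    (f ⊛ (g ⊛ h)) (suc n)                                                       ∎
    where open ≡-Reasoning

  ⊛-zeroˡ : ∀ f → (𝟘 ⊛ f) ≋ 𝟘
  ⊛-zeroˡ f n = trans (conv 𝟘 f n) (S-zero (suc n) _ (λ k _ → ℚₚ.*-zeroˡ (f (n ℕ.∸ k))))

  ⊛-identityˡ : ∀ f → (one ⊛ f) ≋ f
  ⊛-identityˡ f zero = trans (conv-zero one f) (ℚₚ.*-identityˡ (f 0))
  ⊛-identityˡ f (suc n) = trans (conv-suc one f n)
    (trans (cong₂ _+_ (ℚₚ.*-identityˡ (f (suc n))) (⊛-zeroˡ f n)) (ℚₚ.+-identityʳ (f (suc n))))

PS-ring : CommutativeRing 0ℓ 0ℓ
PS-ring = record
  { Carrier = PS ; _≈_ = _≋_ ; _+_ = _⊕_ ; _*_ = _⊛_ ; -_ = ⊝_ ; 0# = 𝟘 ; 1# = one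
  ; isCommutativeRing = record
    { isRing = record
      { +-isAbelianGroup = record
        { isGroup = record
          { isMonoid = record
            { isSemigroup = record
              { isMagma = record
                { isEquivalence = record
                  { refl = λ _ → refl ; sym = λ p n → sym (p n) ; trans = λ p q n → trans (p n) (q n) }
                ; ∙-cong = λ p q n → cong₂ _+_ (p n) (q n) }
              ; assoc = λ f g h n → ℚₚ.+-assoc (f n) (g n) (h n) }
            ; identity = (λ f n → ℚₚ.+-identityˡ (f n)) , (λ f n → ℚₚ.+-identityʳ (f n)) }
          ; inverse = (λ f n → ℚₚ.+-inverseˡ (f n)) , (λ f n → ℚₚ.+-inverseʳ (f n))
          ; ⁻¹-cong = λ p n → cong -_ (p n) }
        ; comm = λ f g n → ℚₚ.+-comm (f n) (g n) }
      ; *-cong = ⊛-cong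
      ; *-assoc = ⊛-assoc
      ; *-identity = ⊛-identityˡ , (λ f n → trans (⊛-comm f one n) (⊛-identityˡ f n))
      ; distrib = (λ h f g n → trans (⊛-comm h (f ⊕ g) n) (trans (⊛-distribʳ h f g n)
                     (cong₂ _+_ (⊛-comm f h n) (⊛-comm g h n))))
                , ⊛-distribʳ }
    ; *-comm = ⊛-comm } }

module PSR = CommutativeRing PS-ring
module PSI = IntegerCoefficients PS-ring
module ΣPS = FiniteSum PS-ring

open +-*-Solver public using () renaming (solve to solveℚ; _:+_ to _:⊞:_; _:*_ to _:×:_; _:=_ to _:≡:_; :-_ to :∸_; con to conℚ)

κ : ℕ → PS
κ n = PSI.fromℤ (pos n)

≋-refl : ∀ {f : PS} → f ≋ f
≋-refl _ = refl

≋-sym : ∀ {f g : PS} → f ≋ g → g ≋ f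
≋-sym p n = sym (p n)

infixr 4 _⨾_
_⨾_ : ∀ {f g h : PS} → f ≋ g → g ≋ h → f ≋ h
(p ⨾ q) n = trans (p n) (q n)

⊛-congˡ : ∀ f {g g′} → g ≋ g′ → f ⊛ g ≋ f ⊛ g′
⊛-congˡ f {g} {g′} q = ⊛-cong {f} {f} {g} {g′} ≋-refl q

⊛-congʳ : ∀ g {f f′} → f ≋ f′ → f ⊛ g ≋ f′ ⊛ g
⊛-congʳ g {f} {f′} p = ⊛-cong {f} {f′} {g} {g} p ≋-refl

⊕-cong : ∀ {f f′ g g′ : PS} → f ≋ f′ → g ≋ g′ → f ⊕ g ≋ f′ ⊕ g′
⊕-cong p q n = cong₂ _+_ (p n) (q n)

-- mono m n is also the Kronecker delta of m and n.
mono : ℕ → PS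
mono zero    = one
mono (suc e) zero    = 0ℚ
mono (suc e) (suc n) = mono e n

mono-refl : ∀ e → mono e e ≡ 1ℚ
mono-refl zero    = refl
mono-refl (suc e) = mono-refl e

mono-≢ : ∀ e n → e ≢ n → mono e n ≡ 0ℚ
mono-≢ zero    zero    e≢n = ⊥-elim (e≢n refl)
mono-≢ zero    (suc n) e≢n = refl
mono-≢ (suc e) zero    e≢n = refl
mono-≢ (suc e) (suc n) e≢n = mono-≢ e n (e≢n ∘ cong suc)

mono-⊛-suc : ∀ s f n → (mono (suc s) ⊛ f) (suc n) ≡ (mono s ⊛ f) n
mono-⊛-suc s f n = trans (conv-suc (mono (suc s)) f n)
  (trans (cong (_+ (mono s ⊛ f) n) (ℚₚ.*-zeroˡ (f (suc n)))) (ℚₚ.+-identityˡ ((mono s ⊛ f) n)))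

mono-⊛-+ : ∀ s f n → (mono s ⊛ f) (s ℕ.+ n) ≡ f n
mono-⊛-+ zero    f n = PSR.*-identityˡ f n
mono-⊛-+ (suc s) f n = trans (mono-⊛-suc s f (s ℕ.+ n)) (mono-⊛-+ s f n)

mono-⊛-< : ∀ s f n → n ℕ.< s → (mono s ⊛ f) n ≡ 0ℚ
mono-⊛-< (suc s) f zero    _         = trans (conv-zero (mono (suc s)) f) (ℚₚ.*-zeroˡ (f 0))
mono-⊛-< (suc s) f (suc n) (s≤s n<s) = trans (mono-⊛-suc s f n) (mono-⊛-< s f n n<s)

mono-+ : ∀ a b → mono a ⊛ mono b ≋ mono (a ℕ.+ b)
mono-+ zero    b = PSR.*-identityˡ (mono b)
mono-+ (suc a) b zero    = mono-⊛-< (suc a) (mono b) 0 (s≤s z≤n)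
mono-+ (suc a) b (suc n) = trans (mono-⊛-suc a (mono b) n) (mono-+ a b n)

≤ᵇ-suc : ∀ s n → (suc s ℕ.≤ᵇ suc n) ≡ (s ℕ.≤ᵇ n)
≤ᵇ-suc zero    n = refl
≤ᵇ-suc (suc s) n = refl

shift≋mono : ∀ s f → shift s f ≋ mono s ⊛ f
shift≋mono zero    f n       = sym (PSR.*-identityˡ f n)
shift≋mono (suc s) f zero    = sym (mono-⊛-< (suc s) f 0 (s≤s z≤n))
shift≋mono (suc s) f (suc n) = trans
  (cong (λ b → if b then f (n ℕ.∸ s) else 0ℚ) (≤ᵇ-suc s n))
  (trans (shift≋mono s f n) (sym (mono-⊛-suc s f n)))

K : ℚ → PS
K c = c · one

K-⊛ : ∀ c f → K c ⊛ f ≋ c · f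
K-⊛ c f n = trans (·-⊛ c one f n) (cong (c *_) (PSR.*-identityˡ f n))

·-cong : ∀ c {f g} → f ≋ g → c · f ≋ c · g
·-cong c p n = cong (c *_) (p n)

-- Congruence modulo q^(N+1).
Agree : ℕ → PS → PS → Set
Agree N f g = ∀ n → n ℕ.≤ N → f n ≡ g n

Agree-⊛ : ∀ N f f′ g g′ → Agree N f f′ → Agree N g g′ → Agree N (f ⊛ g) (f′ ⊛ g′)
Agree-⊛ N f f′ g g′ p q n n≤N = trans (conv f g n) (trans
  (S-cong (suc n) _ _ (λ k k<1+n → cong₂ _*_ (p k (ℕₚ.≤-trans (ℕₚ.≤-pred k<1+n) n≤N))
                                            (q (n ℕ.∸ k) (ℕₚ.≤-trans (ℕₚ.m∸n≤m n k) n≤N))))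
  (sym (conv f′ g′ n)))

Agree-trans : ∀ {N f g h} → Agree N f g → Agree N g h → Agree N f h
Agree-trans p q n n≤N = trans (p n n≤N) (q n n≤N)

Agree-sym : ∀ {N f g} → Agree N f g → Agree N g f
Agree-sym p n n≤N = sym (p n n≤N)

≋⇒Agree : ∀ N {f g} → f ≋ g → Agree N f g
≋⇒Agree N p n _ = p n

ℚ-cancelˡ : ∀ a b → a ≢ 0ℚ → a * b ≡ 0ℚ → b ≡ 0ℚ
ℚ-cancelˡ a b a≢0 ab≡0 = begin
  b                 ≡⟨ ℚₚ.*-identityˡ b ⟨
  1ℚ * b            ≡⟨ cong (_* b) (ℚₚ.*-inverseˡ a) ⟨
  (ℚ.1/ a) * a * b  ≡⟨ ℚₚ.*-assoc (ℚ.1/ a) a b ⟩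
  (ℚ.1/ a) * (a * b) ≡⟨ cong ((ℚ.1/ a) *_) ab≡0 ⟩
  (ℚ.1/ a) * 0ℚ     ≡⟨ ℚₚ.*-zeroʳ (ℚ.1/ a) ⟩
  0ℚ                ∎
  where
  open ≡-Reasoning
  instance nz : ℚ.NonZero a
           nz = ℚ.≢-nonZero a≢0

Agree-cancel : ∀ N f g → f 0 ≢ 0ℚ → Agree N (f ⊛ g) 𝟘 → Agree N g 𝟘
Agree-cancel N f g f₀≢0 fg≡0 = <-rec (λ n → n ℕ.≤ N → g n ≡ 0ℚ) step
  where
  step : ∀ n → (∀ {m} → m ℕ.< n → m ℕ.≤ N → g m ≡ 0ℚ) → n ℕ.≤ N → g n ≡ 0ℚ
  step n IH n≤N = ℚ-cancelˡ (f 0) (g n) f₀≢0 (begin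
    f 0 * g n                                     ≡⟨ ℚₚ.+-identityʳ (f 0 * g n) ⟨
    f 0 * g n + 0ℚ                                ≡⟨ cong (f 0 * g n +_) (S-zero n (λ k → f (suc k) * g (n ℕ.∸ suc k)) (λ k k<n →
      trans (cong (f (suc k) *_) (IH (ℕₚ.∸-monoʳ-< {o = 0} (s≤s z≤n) k<n) (ℕₚ.≤-trans (ℕₚ.m∸n≤m n (suc k)) n≤N)))
            (ℚₚ.*-zeroʳ (f (suc k))))) ⟨
    f 0 * g n + S n (λ k → f (suc k) * g (n ℕ.∸ suc k)) ≡⟨ conv f g n ⟨
    (f ⊛ g) n                                     ≡⟨ fg≡0 n n≤N ⟩
    0ℚ                                            ∎)
    where open ≡-Reasoning

x-y≡0⇒x≡y : ∀ x y → x + - y ≡ 0ℚ → x ≡ y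
x-y≡0⇒x≡y x y p = trans (solve 2 (λ x y → x := (x :+ :- y) :+ y) refl x y)
  (trans (cong (_+ y) p) (ℚₚ.+-identityˡ y))
  where open +-*-Solver

x≡y⇒x-y≡0 : ∀ x y → x ≡ y → x + - y ≡ 0ℚ
x≡y⇒x-y≡0 x y refl = ℚₚ.+-inverseʳ x

Agree-cancelˡ : ∀ N f g h → f 0 ≢ 0ℚ → Agree N (f ⊛ g) (f ⊛ h) → Agree N g h
Agree-cancelˡ N f g h f₀≢0 p n n≤N = x-y≡0⇒x≡y (g n) (h n)
  (Agree-cancel N f (g ⊕ ⊝ h) f₀≢0 (λ m m≤N → trans
     (PSI.solve 3 (λ f g h → f :* (g :+ :- h) := f :* g :+ :- (f :* h)) (λ _ → refl) f g h m)
     (x≡y⇒x-y≡0 ((f ⊛ g) m) ((f ⊛ h) m) (p m m≤N))) n n≤N)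
  where open PSI using (_:=_; _:+_; _:*_; :-_)

⊛-cancelˡ : ∀ f g h → f 0 ≢ 0ℚ → f ⊛ g ≋ f ⊛ h → g ≋ h
⊛-cancelˡ f g h f₀≢0 p n = Agree-cancelˡ n f g h f₀≢0 (≋⇒Agree n p) n ℕₚ.≤-refl

mono-cancelˡ : ∀ s g h → mono s ⊛ g ≋ mono s ⊛ h → g ≋ h
mono-cancelˡ s g h p n = trans (sym (mono-⊛-+ s g n)) (trans (p (s ℕ.+ n)) (mono-⊛-+ s h n))

⊛-cancel₁ : ∀ f g h → f 0 ≡ 0ℚ → f 1 ≢ 0ℚ → f ⊛ g ≋ f ⊛ h → g ≋ h
⊛-cancel₁ f g h f₀≡0 f₁≢0 p = ⊛-cancelˡ (f ∘ suc) g h f₁≢0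
  (λ n → trans (sym (drop g n)) (trans (p (suc n)) (drop h n)))
  where
  drop : ∀ g n → (f ⊛ g) (suc n) ≡ ((f ∘ suc) ⊛ g) n
  drop g n = trans (conv-suc f g n) (trans
    (cong (_+ ((f ∘ suc) ⊛ g) n) (trans (cong (_* g (suc n)) f₀≡0) (ℚₚ.*-zeroˡ (g (suc n)))))
    (ℚₚ.+-identityˡ (((f ∘ suc) ⊛ g) n)))

private
  square-diff : ∀ a b → a ⊛ a ≋ b ⊛ b → (a ⊕ b) ⊛ a ≋ (a ⊕ b) ⊛ b
  square-diff a b p = PSI.solve 2 (λ a b → (a :+ b) :* a := a :* a :+ a :* b) ≋-refl a b
    ⨾ ⊕-cong p (≋-refl {a ⊛ b})
    ⨾ PSI.solve 2 (λ a b → b :* b :+ a :* b := (a :+ b) :* b) ≋-refl a b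
    where open PSI using (_:=_; _:+_; _:*_)

-- Equal squares give (a + b)a = (a + b)b, and the leading coefficient of a + b excludes a = -b.
sqrt-unique : ∀ a b → (a ⊕ b) 0 ≢ 0ℚ → a ⊛ a ≋ b ⊛ b → a ≋ b
sqrt-unique a b nz p = ⊛-cancelˡ (a ⊕ b) a b nz (square-diff a b p)

-- The same for series without constant term, where a + b starts at q.
sqrt-unique₁ : ∀ a b → (a ⊕ b) 0 ≡ 0ℚ → (a ⊕ b) 1 ≢ 0ℚ → a ⊛ a ≋ b ⊛ b → a ≋ b
sqrt-unique₁ a b z nz p = ⊛-cancel₁ (a ⊕ b) a b z nz (square-diff a b p)

-- The substitution q → q^k

module _ (k : ℕ) .{{_ : NonZero k}} where

  sub-mult : ∀ f m → sub k f (m ℕ.* k) ≡ f m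
  sub-mult f m rewrite dec-true (k ∣? (m ℕ.* k)) (∣.n∣m*n m) = cong f (m*n/n≡m m k)

  sub-∤ : ∀ f n → ¬ k ∣ n → sub k f n ≡ 0ℚ
  sub-∤ f n k∤n rewrite dec-false (k ∣? n) k∤n = refl

  ≋-sub : ∀ f g → (∀ m → g (m ℕ.* k) ≡ f m) → (∀ n → ¬ k ∣ n → g n ≡ 0ℚ) → g ≋ sub k f
  ≋-sub f g p q n with k ∣? n in eq
  ... | yes (divides m refl) = trans (p m) (cong f (sym (m*n/n≡m m k)))
  ... | no k∤n = q n k∤n

  sub-cong : ∀ {f g} → f ≋ g → sub k f ≋ sub k g
  sub-cong {f} {g} p = ≋-sub g (sub k f) (λ m → trans (sub-mult f m) (p m)) (sub-∤ f)

  sub-inj : ∀ {f g} → sub k f ≋ sub k g → f ≋ g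
  sub-inj {f} {g} p m = trans (sym (sub-mult f m)) (trans (p (m ℕ.* k)) (sub-mult g m))

  sub-⊕ : ∀ f g → sub k (f ⊕ g) ≋ sub k f ⊕ sub k g
  sub-⊕ f g = ≋-sym (≋-sub (f ⊕ g) (sub k f ⊕ sub k g)
    (λ m → cong₂ _+_ (sub-mult f m) (sub-mult g m))
    (λ n p → trans (cong₂ _+_ (sub-∤ f n p) (sub-∤ g n p)) (ℚₚ.+-identityˡ 0ℚ)))

  sub-⊝ : ∀ f → sub k (⊝ f) ≋ ⊝ sub k f
  sub-⊝ f = ≋-sym (≋-sub (⊝ f) (⊝ sub k f) (λ m → cong -_ (sub-mult f m)) (λ n p → cong -_ (sub-∤ f n p)))

  sub-𝟘 : sub k 𝟘 ≋ 𝟘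
  sub-𝟘 = ≋-sym (≋-sub 𝟘 𝟘 (λ _ → refl) (λ _ _ → refl))

  sub-one : sub k one ≋ one
  sub-one = ≋-sym (≋-sub one one at-mult at-other)
    where
    at-mult : ∀ m → one (m ℕ.* k) ≡ one m
    at-mult zero    = refl
    at-mult (suc m) = mono-≢ 0 (suc m ℕ.* k)
      (λ p → ℕ.≢-nonZero⁻¹ (suc m ℕ.* k) {{ℕₚ.m*n≢0 (suc m) k}} (sym p))
    at-other : ∀ n → ¬ k ∣ n → one n ≡ 0ℚ
    at-other zero    k∤0 = ⊥-elim (k∤0 (k ∣.∣0))
    at-other (suc n) _   = refl

  ∤-between : ∀ r j → 0 ℕ.< r → r ℕ.< k → ¬ k ∣ r ℕ.+ j ℕ.* k
  ∤-between r@(suc _) j _ r<k k∣ = ∣.>⇒∤ r<k (∣.∣m+n∣m⇒∣n (subst (k ∣_) (ℕₚ.+-comm r (j ℕ.* k)) k∣) (∣.n∣m*n j))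

  S-multiples : ∀ m F → (∀ i → ¬ k ∣ i → F i ≡ 0ℚ) → S (m ℕ.* k) F ≡ S m (λ j → F (j ℕ.* k))
  S-multiples m F F≡0 = trans (S-block k m F) (S-cong m _ _ (λ j _ → inner k refl j))
    where
    inner : ∀ l → l ≡ k → ∀ j → S l (λ r → F (r ℕ.+ j ℕ.* k)) ≡ F (j ℕ.* k)
    inner zero    refl j = ⊥-elim (ℕ.≢-nonZero⁻¹ k refl)
    inner (suc l) refl j = trans (cong (F (j ℕ.* k) +_) (S-zero l _ (λ r r<l →
      F≡0 (suc r ℕ.+ j ℕ.* k) (∤-between (suc r) j (s≤s z≤n) (s≤s r<l))))) (ℚₚ.+-identityʳ (F (j ℕ.* k)))

  sub-⊛ : ∀ f g → sub k (f ⊛ g) ≋ sub k f ⊛ sub k g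
  sub-⊛ f g = ≋-sym (≋-sub (f ⊛ g) (sub k f ⊛ sub k g) at-mult at-other)
    where
    at-mult : ∀ m → (sub k f ⊛ sub k g) (m ℕ.* k) ≡ (f ⊛ g) m
    at-mult m = begin
      (sub k f ⊛ sub k g) (m ℕ.* k)       ≡⟨ conv (sub k f) (sub k g) (m ℕ.* k) ⟩
      S (suc (m ℕ.* k)) F                 ≡⟨ S-last (m ℕ.* k) F ⟩
      S (m ℕ.* k) F + F (m ℕ.* k)         ≡⟨ cong (_+ F (m ℕ.* k)) (S-multiples m F (λ i k∤i →
        trans (cong (_* sub k g (m ℕ.* k ℕ.∸ i)) (sub-∤ f i k∤i)) (ℚₚ.*-zeroˡ (sub k g (m ℕ.* k ℕ.∸ i))))) ⟩
      S m (λ j → F (j ℕ.* k)) + F (m ℕ.* k) ≡⟨ S-last m (λ j → F (j ℕ.* k)) ⟨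
      S (suc m) (λ j → F (j ℕ.* k))       ≡⟨ S-cong (suc m) _ _ (λ j _ → cong₂ _*_ (sub-mult f j)
        (trans (cong (sub k g) (sym (ℕₚ.*-distribʳ-∸ k m j))) (sub-mult g (m ℕ.∸ j)))) ⟩
      S (suc m) (λ j → f j * g (m ℕ.∸ j)) ≡⟨ conv f g m ⟨
      (f ⊛ g) m                           ∎
      where
      open ≡-Reasoning
      F : ℕ → ℚ
      F i = sub k f i * sub k g (m ℕ.* k ℕ.∸ i)
    at-other : ∀ n → ¬ k ∣ n → (sub k f ⊛ sub k g) n ≡ 0ℚ
    at-other n k∤n = trans (conv (sub k f) (sub k g) n) (S-zero (suc n) _ term)
      where
      term : ∀ i → i ℕ.< suc n → sub k f i * sub k g (n ℕ.∸ i) ≡ 0ℚ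
      term i (s≤s i≤n) with k ∣? i
      ... | no k∤i = ℚₚ.*-zeroˡ (sub k g (n ℕ.∸ i))
      ... | yes k∣i = trans (cong (f (i ℕ./ k) *_) (sub-∤ g (n ℕ.∸ i) (λ k∣n-i → k∤n
                 (subst (k ∣_) (ℕₚ.m∸n+n≡m i≤n) (∣.∣m∣n⇒∣m+n k∣n-i k∣i))))) (ℚₚ.*-zeroʳ (f (i ℕ./ k)))

  sub-mono : ∀ e → sub k (mono e) ≋ mono (e ℕ.* k)
  sub-mono e = ≋-sym (≋-sub (mono e) (mono (e ℕ.* k)) at-mult
    (λ n k∤n → mono-≢ (e ℕ.* k) n (λ p → k∤n (divides e (sym p)))))
    where
    at-mult : ∀ m → mono (e ℕ.* k) (m ℕ.* k) ≡ mono e m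
    at-mult m with e ℕ.≟ m
    ... | yes refl = trans (mono-refl (e ℕ.* k)) (sym (mono-refl e))
    ... | no e≢m   = trans (mono-≢ (e ℕ.* k) (m ℕ.* k) (λ p → e≢m (ℕₚ.*-cancelʳ-≡ e m k p))) (sym (mono-≢ e m e≢m))

  open PSI.Transport (sub k) (λ {f} {g} → sub-cong {f} {g}) sub-⊕ sub-⊛ sub-⊝ sub-𝟘 sub-one public
    using () renaming (transport to sub-transport; reflect to sub-reflect)

sub-sub : ∀ a b .{{_ : NonZero a}} .{{_ : NonZero b}} .{{_ : NonZero (a ℕ.* b)}} f →
          sub a (sub b f) ≋ sub (a ℕ.* b) f
sub-sub a b f = ≋-sub (a ℕ.* b) f (sub a (sub b f)) at-mult at-other
  where
  at-mult : ∀ m → sub a (sub b f) (m ℕ.* (a ℕ.* b)) ≡ f m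
  at-mult m = trans (cong (sub a (sub b f)) (trans (cong (m ℕ.*_) (ℕₚ.*-comm a b)) (sym (ℕₚ.*-assoc m b a))))
    (trans (sub-mult a (sub b f) (m ℕ.* b)) (sub-mult b f m))
  at-other : ∀ n → ¬ (a ℕ.* b) ∣ n → sub a (sub b f) n ≡ 0ℚ
  at-other n ab∤n with a ∣? n
  ... | no _ = refl
  ... | yes (divides m refl) = trans (cong (sub b f) (m*n/n≡m m a))
    (sub-∤ b f m (λ b∣m → ab∤n (subst ((a ℕ.* b) ∣_) (ℕₚ.*-comm a m) (∣.*-monoʳ-∣ a b∣m))))

-- Twists of coefficients and the substitution q → -q

twist : (ℕ → ℚ) → PS → PS
twist c f n = c n * f n

twist-⊛ : ∀ c → (∀ m n → c (m ℕ.+ n) ≡ c m * c n) → ∀ f g → twist c (f ⊛ g) ≋ twist c f ⊛ twist c g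
twist-⊛ c c-+ f g n = begin
  c n * (f ⊛ g) n                                    ≡⟨ cong (c n *_) (conv f g n) ⟩
  c n * S (suc n) (λ k → f k * g (n ℕ.∸ k))          ≡⟨ S-*ˡ (suc n) (c n) (λ k → f k * g (n ℕ.∸ k)) ⟨
  S (suc n) (λ k → c n * (f k * g (n ℕ.∸ k)))        ≡⟨ S-cong (suc n) _ _ (λ k k<1+n → trans
    (cong (_* (f k * g (n ℕ.∸ k))) (trans (cong c (sym (ℕₚ.m+[n∸m]≡n (ℕₚ.≤-pred k<1+n)))) (c-+ k (n ℕ.∸ k))))
    (solve 4 (λ a b c d → (a :* b) :* (c :* d) := (a :* c) :* (b :* d)) refl (c k) (c (n ℕ.∸ k)) (f k) (g (n ℕ.∸ k)))) ⟩
  S (suc n) (λ k → twist c f k * twist c g (n ℕ.∸ k)) ≡⟨ conv (twist c f) (twist c g) n ⟨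
  (twist c f ⊛ twist c g) n                          ∎
  where
  open ≡-Reasoning
  open +-*-Solver

alt : ℕ → ℚ
alt zero    = 1ℚ
alt (suc n) = - alt n

alt-+ : ∀ m n → alt (m ℕ.+ n) ≡ alt m * alt n
alt-+ zero    n = sym (ℚₚ.*-identityˡ (alt n))
alt-+ (suc m) n = trans (cong -_ (alt-+ m n)) (ℚₚ.neg-distribˡ-* (alt m) (alt n))

neg : PS → PS
neg = twist alt

neg-cong : ∀ {f g} → f ≋ g → neg f ≋ neg g
neg-cong p n = cong (alt n *_) (p n)

neg-⊛ : ∀ f g → neg (f ⊛ g) ≋ neg f ⊛ neg g
neg-⊛ = twist-⊛ alt alt-+

neg-⊕ : ∀ f g → neg (f ⊕ g) ≋ neg f ⊕ neg g
neg-⊕ f g n = ℚₚ.*-distribˡ-+ (alt n) (f n) (g n)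

neg-⊝ : ∀ f → neg (⊝ f) ≋ ⊝ neg f
neg-⊝ f n = sym (ℚₚ.neg-distribʳ-* (alt n) (f n))

neg-𝟘 : neg 𝟘 ≋ 𝟘
neg-𝟘 n = ℚₚ.*-zeroʳ (alt n)

neg-one : neg one ≋ one
neg-one zero    = refl
neg-one (suc n) = ℚₚ.*-zeroʳ (alt (suc n))

alt-double : ∀ m → alt (m ℕ.* 2) ≡ 1ℚ
alt-double zero    = refl
alt-double (suc m) = trans (⁻¹-involutive (alt (m ℕ.* 2))) (alt-double m)

neg-sub2 : ∀ f → neg (sub 2 f) ≋ sub 2 f
neg-sub2 f = ≋-sub 2 f (neg (sub 2 f))
  (λ m → trans (cong₂ _*_ (alt-double m) (sub-mult 2 f m)) (ℚₚ.*-identityˡ (f m)))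
  (λ n p → trans (cong (alt n *_) (sub-∤ 2 f n p)) (ℚₚ.*-zeroʳ (alt n)))

neg-mono : ∀ e → neg (mono e) ≋ alt e · mono e
neg-mono e n with e ℕ.≟ n
... | yes refl = refl
... | no e≢n = trans (cong (alt n *_) (mono-≢ e n e≢n)) (trans (ℚₚ.*-zeroʳ (alt n))
  (sym (trans (cong (alt e *_) (mono-≢ e n e≢n)) (ℚₚ.*-zeroʳ (alt e)))))

open PSI.Transport neg (λ {f} {g} → neg-cong {f} {g}) neg-⊕ neg-⊛ neg-⊝ neg-𝟘 neg-one public
  using () renaming (transport to neg-transport)

-- Theta series over an index set

record Discrete (I : Set) : Set where
  field _≟_ : DecidableEquality I

open Discrete {{...}} public

instance
  ℤ-discrete : Discrete ℤ
  ℤ-discrete = record { _≟_ = ℤ._≟_ }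

  ×-discrete : ∀ {I J} {{_ : Discrete I}} {{_ : Discrete J}} → Discrete (I × J)
  ×-discrete = record { _≟_ = ≡-dec _≟_ _≟_ }

private variable
  I J : Set

sumOver : List I → (I → ℚ) → ℚ
sumOver []       F = 0ℚ
sumOver (x ∷ xs) F = F x + sumOver xs F

sumOver-cong : ∀ (xs : List I) {F G} → (∀ i → F i ≡ G i) → sumOver xs F ≡ sumOver xs G
sumOver-cong []       p = refl
sumOver-cong (x ∷ xs) p = cong₂ _+_ (p x) (sumOver-cong xs p)

sumOver-zero : ∀ (xs : List I) {F} → (∀ i → F i ≡ 0ℚ) → sumOver xs F ≡ 0ℚ
sumOver-zero []       p = refl
sumOver-zero (x ∷ xs) p = trans (cong₂ _+_ (p x) (sumOver-zero xs p)) (ℚₚ.+-identityˡ 0ℚ)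

sumOver-+ : ∀ (xs : List I) F G → sumOver xs (λ i → F i + G i) ≡ sumOver xs F + sumOver xs G
sumOver-+ []       F G = refl
sumOver-+ (x ∷ xs) F G = trans (cong ((F x + G x) +_) (sumOver-+ xs F G))
  (solve 4 (λ a b c d → (a :+ b) :+ (c :+ d) := (a :+ c) :+ (b :+ d)) refl (F x) (G x) (sumOver xs F) (sumOver xs G))
  where open +-*-Solver

sumOver-*ˡ : ∀ (xs : List I) c F → sumOver xs (λ i → c * F i) ≡ c * sumOver xs F
sumOver-*ˡ []       c F = sym (ℚₚ.*-zeroʳ c)
sumOver-*ˡ (x ∷ xs) c F = trans (cong (c * F x +_) (sumOver-*ˡ xs c F)) (sym (ℚₚ.*-distribˡ-+ c (F x) (sumOver xs F)))

sumOver-++ : ∀ (xs ys : List I) F → sumOver (xs ++ ys) F ≡ sumOver xs F + sumOver ys F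
sumOver-++ []       ys F = sym (ℚₚ.+-identityˡ (sumOver ys F))
sumOver-++ (x ∷ xs) ys F = trans (cong (F x +_) (sumOver-++ xs ys F)) (sym (ℚₚ.+-assoc (F x) (sumOver xs F) (sumOver ys F)))

sumOver-map : ∀ (φ : J → I) xs F → sumOver (map φ xs) F ≡ sumOver xs (F ∘ φ)
sumOver-map φ []       F = refl
sumOver-map φ (x ∷ xs) F = cong (F (φ x) +_) (sumOver-map φ xs F)

sumOver-swap : ∀ (xs : List I) (ys : List J) (F : I → J → ℚ) →
  sumOver xs (λ i → sumOver ys (F i)) ≡ sumOver ys (λ j → sumOver xs (λ i → F i j))
sumOver-swap []       ys F = sym (sumOver-zero ys (λ _ → refl))
sumOver-swap (x ∷ xs) ys F = trans (cong (sumOver ys (F x) +_) (sumOver-swap xs ys F))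
  (sym (sumOver-+ ys (F x) (λ j → sumOver xs (λ i → F i j))))

sumOver-S : ∀ n (xs : List I) (F : ℕ → I → ℚ) → S n (λ k → sumOver xs (F k)) ≡ sumOver xs (λ i → S n (λ k → F k i))
sumOver-S zero    xs F = sym (sumOver-zero xs (λ _ → refl))
sumOver-S (suc n) xs F = trans (cong (sumOver xs (F 0) +_) (sumOver-S n xs (F ∘ suc)))
  (sym (sumOver-+ xs (F 0) (λ i → S n (λ k → F (suc k) i))))

sumOver-upTo : ∀ n F → sumOver (upTo n) F ≡ S n F
sumOver-upTo n F = trans (sumOver-foldr (upTo n)) (sumℚ-upTo n F)
  where
  sumOver-foldr : ∀ xs → sumOver xs F ≡ sumℚ (map F xs)
  sumOver-foldr []       = refl
  sumOver-foldr (x ∷ xs) = cong (F x +_) (sumOver-foldr xs)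

sumOver-cartesianProduct : ∀ (xs : List I) (ys : List J) F →
  sumOver (cartesianProduct xs ys) F ≡ sumOver xs (λ i → sumOver ys (λ j → F (i , j)))
sumOver-cartesianProduct []       ys F = refl
sumOver-cartesianProduct (x ∷ xs) ys F = trans (sumOver-++ (map (x ,_) ys) (cartesianProduct xs ys) F)
  (cong₂ _+_ (sumOver-map (x ,_) ys F) (sumOver-cartesianProduct xs ys F))

sumOver-*-sumOver : ∀ (xs : List I) (ys : List J) F G →
  sumOver xs F * sumOver ys G ≡ sumOver xs (λ i → sumOver ys (λ j → F i * G j))
sumOver-*-sumOver []       ys F G = ℚₚ.*-zeroˡ (sumOver ys G)
sumOver-*-sumOver (x ∷ xs) ys F G = trans (ℚₚ.*-distribʳ-+ (sumOver ys G) (F x) (sumOver xs F))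
  (cong₂ _+_ (sym (sumOver-*ˡ ys (F x) G)) (sumOver-*-sumOver xs ys F G))

ind : {{_ : Discrete I}} → I → I → ℚ
ind x y = if does (x ≟ y) then 1ℚ else 0ℚ

sumOver-ind-∉ : {{_ : Discrete I}} → ∀ (x : I) ys c → All (x ≢_) ys → sumOver ys (λ y → ind x y * c) ≡ 0ℚ
sumOver-ind-∉ x []       c []        = refl
sumOver-ind-∉ x (y ∷ ys) c (x≢y ∷ p) with x ≟ y
... | yes x≡y = ⊥-elim (x≢y x≡y)
... | no  _   = trans (cong₂ _+_ (ℚₚ.*-zeroˡ c) (sumOver-ind-∉ x ys c p)) (ℚₚ.+-identityˡ 0ℚ)

sumOver-ind-∈ : {{_ : Discrete I}} → ∀ (x : I) ys c → Unique ys → x ∈ ys → sumOver ys (λ y → ind x y * c) ≡ c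
sumOver-ind-∈ x (y ∷ ys) c (y∉ys ∷ u) x∈ with x ≟ y
... | yes refl = trans (cong₂ _+_ (ℚₚ.*-identityˡ c) (sumOver-ind-∉ x ys c y∉ys)) (ℚₚ.+-identityʳ c)
sumOver-ind-∈ x (y ∷ ys) c (y∉ys ∷ u) (here x≡y)  | no x≢y = ⊥-elim (x≢y x≡y)
sumOver-ind-∈ x (y ∷ ys) c (y∉ys ∷ u) (there x∈)  | no x≢y =
  trans (cong₂ _+_ (ℚₚ.*-zeroˡ c) (sumOver-ind-∈ x ys c u x∈)) (ℚₚ.+-identityˡ c)

term : (I → ℚ) → (I → ℕ) → ℕ → I → ℚ
term c e N i = mono (e i) N * c i

term-≢ : ∀ (c : I → ℚ) e N i → e i ≢ N → term c e N i ≡ 0ℚ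
term-≢ c e N i p = trans (cong (_* c i) (mono-≢ (e i) N p)) (ℚₚ.*-zeroˡ (c i))

Covers : (I → ℕ) → ℕ → List I → Set
Covers e N xs = Unique xs × (∀ i → e i ≡ N → i ∈ xs)

private
  term-expand : {{_ : Discrete I}} → ∀ (c : I → ℚ) e N ys → Covers e N ys → ∀ x →
    sumOver ys (λ y → ind x y * term c e N x) ≡ term c e N x
  term-expand c e N ys (u , cov) x with e x ℕ.≟ N
  ... | yes p = sumOver-ind-∈ x ys (term c e N x) u (cov x p)
  ... | no p = trans (sumOver-zero ys (λ y → trans (cong (ind x y *_) (term-≢ c e N x p)) (ℚₚ.*-zeroʳ (ind x y))))
                     (sym (term-≢ c e N x p))

  ind-sym : {{_ : Discrete I}} → ∀ (F : I → ℚ) x y → ind x y * F x ≡ ind y x * F y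
  ind-sym F x y with x ≟ y | y ≟ x
  ... | yes refl | yes _ = refl
  ... | yes refl | no p = ⊥-elim (p refl)
  ... | no p | yes refl = ⊥-elim (p refl)
  ... | no _ | no _ = trans (ℚₚ.*-zeroˡ (F x)) (sym (ℚₚ.*-zeroˡ (F y)))

-- Both lists hold every index that contributes, besides arbitrary others. Expanding each term over
-- the other list by indicators and exchanging the sums compares them without matching elements.
sumOver-indep : {{_ : Discrete I}} → ∀ (c : I → ℚ) e N xs ys → Covers e N xs → Covers e N ys →
  sumOver xs (term c e N) ≡ sumOver ys (term c e N)
sumOver-indep c e N xs ys cx cy = begin
  sumOver xs F                                      ≡⟨ sumOver-cong xs (term-expand c e N ys cy) ⟨
  sumOver xs (λ x → sumOver ys (λ y → ind x y * F x)) ≡⟨ sumOver-swap xs ys (λ x y → ind x y * F x) ⟩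
  sumOver ys (λ y → sumOver xs (λ x → ind x y * F x)) ≡⟨ sumOver-cong ys (λ y → sumOver-cong xs (λ x → ind-sym F x y)) ⟩
  sumOver ys (λ y → sumOver xs (λ x → ind y x * F y)) ≡⟨ sumOver-cong ys (term-expand c e N xs cx) ⟩
  sumOver ys F                                      ∎
  where
  open ≡-Reasoning
  F = term c e N

Proper : (I → ℕ) → Set
Proper {I} e = ∀ N → Σ (List I) (λ xs → Unique xs × (∀ i → e i ℕ.≤ N → i ∈ xs))

-- th c e p is the series Σ_i c(i) q^(e i).
th : (c : I → ℚ) (e : I → ℕ) → Proper e → PS
th c e p N = sumOver (proj₁ (p N)) (term c e N)

proper-covers : ∀ {e : I → ℕ} (p : Proper e) M {N} → N ℕ.≤ M → Covers e N (proj₁ (p M))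
proper-covers p M N≤M = proj₁ (proj₂ (p M)) , λ i ei≡N → proj₂ (proj₂ (p M)) i (ℕₚ.≤-trans (ℕₚ.≤-reflexive ei≡N) N≤M)

th-cover : {{_ : Discrete I}} → ∀ (c : I → ℚ) e (p : Proper e) N xs → Covers e N xs →
  th c e p N ≡ sumOver xs (term c e N)
th-cover c e p N xs cx = sumOver-indep c e N _ xs (proper-covers p N ℕₚ.≤-refl) cx

th-cong : {{_ : Discrete I}} → ∀ {c c′ : I → ℚ} {e e′} (p : Proper e) (p′ : Proper e′) →
  (∀ i → c i ≡ c′ i) → (∀ i → e i ≡ e′ i) → th c e p ≋ th c′ e′ p′
th-cong {c = c} {c′} {e} {e′} p p′ c≡ e≡ N = trans
  (th-cover c e p N (proj₁ (p′ N)) (proj₁ cov , λ i ei≡N → proj₂ cov i (trans (sym (e≡ i)) ei≡N)))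
  (sumOver-cong (proj₁ (p′ N)) (λ i → cong₂ _*_ (cong (λ k → mono k N) (e≡ i)) (c≡ i)))
  where cov = proper-covers p′ N ℕₚ.≤-refl

th-reindex : {{_ : Discrete I}} → ∀ (c : I → ℚ) e (p : Proper e) (φ : J → I) (p′ : Proper (e ∘ φ)) →
  (∀ {i j} → φ i ≡ φ j → i ≡ j) → (∀ i → ∃ λ j → φ j ≡ i) →
  th c e p ≋ th (c ∘ φ) (e ∘ φ) p′
th-reindex c e p φ p′ inj surj N = trans
  (th-cover c e p N (map φ ys) (Uniqueₚ.map⁺ inj (proj₁ cov) , mem))
  (sumOver-map φ ys (term c e N))
  where
  ys = proj₁ (p′ N)
  cov = proper-covers p′ N ℕₚ.≤-refl
  mem : ∀ i → e i ≡ N → i ∈ map φ ys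
  mem i ei≡N with surj i
  ... | j , refl = ∈-map⁺ φ (proj₂ cov j ei≡N)

proper-pull : {{_ : Discrete J}} → ∀ {e : I → ℕ} (φ : J → I) (ψ : I → J) → (∀ j → ψ (φ j) ≡ j) →
  Proper e → Proper (e ∘ φ)
proper-pull φ ψ ψφ p N = deduplicate _≟_ (map ψ xs) , DecUniqueₚ.deduplicate-! _≟_ (map ψ xs)
  , λ j le → ∈-deduplicate⁺ _≟_ (subst (_∈ map ψ xs) (ψφ j) (∈-map⁺ ψ (proj₂ (proj₂ (p N)) (φ j) le)))
  where xs = proj₁ (p N)

proper-× : ∀ {e : I → ℕ} {e′ : J → ℕ} → Proper e → Proper e′ → Proper (λ (ij : I × J) → e (proj₁ ij) ℕ.+ e′ (proj₂ ij))
proper-× p p′ N = cartesianProduct (proj₁ (p N)) (proj₁ (p′ N))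
  , Uniqueₚ.cartesianProduct⁺ (proj₁ (proj₂ (p N))) (proj₁ (proj₂ (p′ N)))
  , λ (i , j) le → ∈-cartesianProduct⁺ (proj₂ (proj₂ (p N)) i (ℕₚ.≤-trans (ℕₚ.m≤m+n _ _) le))
                                       (proj₂ (proj₂ (p′ N)) j (ℕₚ.≤-trans (ℕₚ.m≤n+m _ _) le))

th-⊛ : {{_ : Discrete I}} {{_ : Discrete J}} →
  ∀ (c : I → ℚ) e (p : Proper e) (c′ : J → ℚ) e′ (p′ : Proper e′) →
  th c e p ⊛ th c′ e′ p′ ≋
  th (λ ij → c (proj₁ ij) * c′ (proj₂ ij)) (λ ij → e (proj₁ ij) ℕ.+ e′ (proj₂ ij)) (proper-× p p′)
th-⊛ c e p c′ e′ p′ N = begin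
  (th c e p ⊛ th c′ e′ p′) N
    ≡⟨ conv (th c e p) (th c′ e′ p′) N ⟩
  S (suc N) (λ k → th c e p k * th c′ e′ p′ (N ℕ.∸ k))
    ≡⟨ S-cong (suc N) _ _ (λ k k<1+N → trans
         (cong₂ _*_ (th-cover c e p k xs (proper-covers p N (ℕₚ.≤-pred k<1+N)))
                    (th-cover c′ e′ p′ (N ℕ.∸ k) ys (proper-covers p′ N (ℕₚ.m∸n≤m N k))))
         (sumOver-*-sumOver xs ys (term c e k) (term c′ e′ (N ℕ.∸ k)))) ⟩
  S (suc N) (λ k → sumOver xs (λ i → sumOver ys (λ j → term c e k i * term c′ e′ (N ℕ.∸ k) j)))
    ≡⟨ sumOver-S (suc N) xs (λ k i → sumOver ys (λ j → term c e k i * term c′ e′ (N ℕ.∸ k) j)) ⟩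
  sumOver xs (λ i → S (suc N) (λ k → sumOver ys (λ j → term c e k i * term c′ e′ (N ℕ.∸ k) j)))
    ≡⟨ sumOver-cong xs (λ i → sumOver-S (suc N) ys (λ k j → term c e k i * term c′ e′ (N ℕ.∸ k) j)) ⟩
  sumOver xs (λ i → sumOver ys (λ j → S (suc N) (λ k → term c e k i * term c′ e′ (N ℕ.∸ k) j)))
    ≡⟨ sumOver-cong xs (λ i → sumOver-cong ys (λ j → pointwise i j)) ⟩
  sumOver xs (λ i → sumOver ys (λ j → mono (e i ℕ.+ e′ j) N * (c i * c′ j)))
    ≡⟨ sumOver-cartesianProduct xs ys _ ⟨
  th _ _ (proper-× p p′) N ∎
  where
  open ≡-Reasoning
  open +-*-Solver
  xs = proj₁ (p N)
  ys = proj₁ (p′ N)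
  pointwise : ∀ i j → S (suc N) (λ k → term c e k i * term c′ e′ (N ℕ.∸ k) j) ≡ mono (e i ℕ.+ e′ j) N * (c i * c′ j)
  pointwise i j = trans (S-cong (suc N) _ _ (λ k _ →
      solve 4 (λ a b c d → (a :* b) :* (c :* d) := (b :* d) :* (a :* c)) refl (mono (e i) k) (c i) (mono (e′ j) (N ℕ.∸ k)) (c′ j)))
    (trans (S-*ˡ (suc N) (c i * c′ j) (λ k → mono (e i) k * mono (e′ j) (N ℕ.∸ k)))
    (trans (cong ((c i * c′ j) *_) (trans (sym (conv (mono (e i)) (mono (e′ j)) N)) (mono-+ (e i) (e′ j) N)))
           (ℚₚ.*-comm (c i * c′ j) (mono (e i ℕ.+ e′ j) N))))

sumFin : ∀ t → (Fin t → PS) → PS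
sumFin zero    F = 𝟘
sumFin (suc t) F = F Fin.zero ⊕ sumFin t (F ∘ Fin.suc)

-- The maps `φ r` parametrise disjoint pieces that exhaust `I`; in the applications they are residue
-- classes or cosets of a sublattice.
th-split : {{_ : Discrete I}} → ∀ (c : I → ℚ) e (p : Proper e) t (φ : Fin t → J → I) (p′ : ∀ r → Proper (e ∘ φ r)) →
  (∀ {r s i j} → φ r i ≡ φ s j → r ≡ s × i ≡ j) → (∀ i → ∃ λ r → ∃ λ j → φ r j ≡ i) →
  th c e p ≋ sumFin t (λ r → th (c ∘ φ r) (e ∘ φ r) (p′ r))
th-split {I = I} {J = J} c e p t φ p′ inj surj N = trans
  (th-cover c e p N (all t φ p′) (all-unique t φ p′ inj , λ i ei≡N → covered i ei≡N (surj i)))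
  (all-sum t φ p′)
  where
  all : ∀ t (φ : Fin t → J → I) (p′ : ∀ r → Proper (e ∘ φ r)) → List I
  all zero    φ p′ = []
  all (suc t) φ p′ = map (φ Fin.zero) (proj₁ (p′ Fin.zero N)) ++ all t (φ ∘ Fin.suc) (p′ ∘ Fin.suc)

  all-sum : ∀ t φ p′ → sumOver (all t φ p′) (term c e N) ≡ sumFin t (λ r → th (c ∘ φ r) (e ∘ φ r) (p′ r)) N
  all-sum zero    φ p′ = refl
  all-sum (suc t) φ p′ = trans (sumOver-++ (map (φ Fin.zero) (proj₁ (p′ Fin.zero N))) _ (term c e N))
    (cong₂ _+_ (sumOver-map (φ Fin.zero) (proj₁ (p′ Fin.zero N)) (term c e N)) (all-sum t (φ ∘ Fin.suc) (p′ ∘ Fin.suc)))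

  all-mem : ∀ t φ p′ {i} → i ∈ all t φ p′ → ∃ λ r → ∃ λ j → i ≡ φ r j
  all-mem (suc t) φ p′ i∈ with ∈-++⁻ (map (φ Fin.zero) (proj₁ (p′ Fin.zero N))) i∈
  ... | inj₁ q with ∈-map⁻ (φ Fin.zero) q
  ...   | j , _ , eq = Fin.zero , j , eq
  all-mem (suc t) φ p′ i∈ | inj₂ q with all-mem t (φ ∘ Fin.suc) (p′ ∘ Fin.suc) q
  ...   | r , j , eq = Fin.suc r , j , eq

  all-unique : ∀ t φ p′ → (∀ {r s i j} → φ r i ≡ φ s j → r ≡ s × i ≡ j) → Unique (all t φ p′)
  all-unique zero    φ p′ inj = []
  all-unique (suc t) φ p′ inj = Uniqueₚ.++⁺
    (Uniqueₚ.map⁺ (λ eq → proj₂ (inj eq)) (proj₁ (proj₂ (p′ Fin.zero N))))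
    (all-unique t (φ ∘ Fin.suc) (p′ ∘ Fin.suc) (λ eq → Finₚ.suc-injective (proj₁ (inj eq)) , proj₂ (inj eq)))
    disjoint
    where
    disjoint : ∀ {v} → v ∈ map (φ Fin.zero) (proj₁ (p′ Fin.zero N)) × v ∈ all t (φ ∘ Fin.suc) (p′ ∘ Fin.suc) → _
    disjoint (a , b) with ∈-map⁻ (φ Fin.zero) a | all-mem t (φ ∘ Fin.suc) (p′ ∘ Fin.suc) b
    ... | j , _ , refl | r , j′ , eq with proj₁ (inj eq)
    ... | ()

  all-cover : ∀ t φ p′ r j → e (φ r j) ≡ N → φ r j ∈ all t φ p′
  all-cover (suc t) φ p′ Fin.zero    j eq = ∈-++⁺ˡ (∈-map⁺ (φ Fin.zero) (proj₂ (proj₂ (p′ Fin.zero N)) j (ℕₚ.≤-reflexive eq)))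
  all-cover (suc t) φ p′ (Fin.suc r) j eq = ∈-++⁺ʳ (map (φ Fin.zero) (proj₁ (p′ Fin.zero N))) (all-cover t (φ ∘ Fin.suc) (p′ ∘ Fin.suc) r j eq)

  covered : ∀ i → e i ≡ N → (∃ λ r → ∃ λ j → φ r j ≡ i) → i ∈ all t φ p′
  covered i ei≡N (r , j , refl) = all-cover t φ p′ r j ei≡N

th-⊕ : ∀ (c c′ : I → ℚ) e (p : Proper e) → th (λ i → c i + c′ i) e p ≋ th c e p ⊕ th c′ e p
th-⊕ c c′ e p N = trans (sumOver-cong xs (λ i → ℚₚ.*-distribˡ-+ (mono (e i) N) (c i) (c′ i)))
  (sumOver-+ xs (term c e N) (term c′ e N))
  where xs = proj₁ (p N)

th-· : ∀ a (c : I → ℚ) e (p : Proper e) → th (λ i → a * c i) e p ≋ a · th c e p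
th-· a c e p N = trans (sumOver-cong xs (λ i → solve 3 (λ m a c → m :* (a :* c) := a :* (m :* c)) refl (mono (e i) N) a (c i)))
  (sumOver-*ˡ xs a (term c e N))
  where
  open +-*-Solver
  xs = proj₁ (p N)

th-zero : ∀ (c : I → ℚ) e (p : Proper e) → (∀ i → c i ≡ 0ℚ) → th c e p ≋ 𝟘
th-zero c e p c≡0 N = sumOver-zero (proj₁ (p N)) (λ i → trans (cong (mono (e i) N *_) (c≡0 i)) (ℚₚ.*-zeroʳ (mono (e i) N)))

x≡-x⇒x≡0 : ∀ x → x ≡ - x → x ≡ 0ℚ
x≡-x⇒x≡0 x p = ℚ-cancelˡ (1ℚ + 1ℚ) x (λ ()) (begin
  (1ℚ + 1ℚ) * x  ≡⟨ solve 1 (λ x → (con 1ℚ :+ con 1ℚ) :* x := x :+ x) refl x ⟩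
  x + x          ≡⟨ cong (x +_) p ⟩
  x + - x        ≡⟨ ℚₚ.+-inverseʳ x ⟩
  0ℚ             ∎)
  where
  open ≡-Reasoning
  open +-*-Solver

-- The series equals its own negative. Fixed points of `φ` do no harm, as the weight vanishes there.
th-antisym : {{_ : Discrete I}} → ∀ (c : I → ℚ) e (p : Proper e) (φ : I → I) →
  (∀ i → φ (φ i) ≡ i) → (∀ i → e (φ i) ≡ e i) → (∀ i → c (φ i) ≡ - c i) → th c e p ≋ 𝟘
th-antisym c e p φ invol eφ cφ N = x≡-x⇒x≡0 (th c e p N) (begin
  th c e p N                      ≡⟨ th-reindex c e p φ pφ (λ {i} {j} q → trans (sym (invol i)) (trans (cong φ q) (invol j))) (λ i → φ i , invol i) N ⟩
  th (c ∘ φ) (e ∘ φ) pφ N         ≡⟨ th-cong pφ p (λ i → trans (cφ i) (solve 1 (λ x → :- x := (:- con 1ℚ) :* x) refl (c i))) eφ N ⟩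
  th (λ i → (- 1ℚ) * c i) e p N   ≡⟨ th-· (- 1ℚ) c e p N ⟩
  - 1ℚ * th c e p N               ≡⟨ solve 1 (λ x → (:- con 1ℚ) :* x := :- x) refl (th c e p N) ⟩
  - th c e p N                    ∎)
  where
  open ≡-Reasoning
  open +-*-Solver
  pφ : Proper (e ∘ φ)
  pφ = proper-pull φ φ invol p

mono-shift : ∀ s e n → mono (s ℕ.+ e) (s ℕ.+ n) ≡ mono e n
mono-shift zero    e n = refl
mono-shift (suc s) e n = mono-shift s e n

th-mono : {{_ : Discrete I}} → ∀ s (c : I → ℚ) e (p : Proper e) (p′ : Proper (λ i → s ℕ.+ e i)) →
  mono s ⊛ th c e p ≋ th c (λ i → s ℕ.+ e i) p′
th-mono s c e p p′ N with s ℕ.≤? N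
... | no s≰N = trans (mono-⊛-< s (th c e p) N (ℕₚ.≰⇒> s≰N)) (sym (sumOver-zero (proj₁ (p′ N))
  (λ i → term-≢ c (λ i → s ℕ.+ e i) N i (λ q → s≰N (ℕₚ.≤-trans (ℕₚ.m≤m+n s (e i)) (ℕₚ.≤-reflexive q))))))
... | yes s≤N with ℕₚ.m≤n⇒∃[o]m+o≡n s≤N
... | k , refl = begin
  (mono s ⊛ th c e p) (s ℕ.+ k)       ≡⟨ mono-⊛-+ s (th c e p) k ⟩
  th c e p k                          ≡⟨ sumOver-cong xs (λ i → cong (_* c i) (sym (mono-shift s (e i) k))) ⟩
  sumOver xs (term c (λ i → s ℕ.+ e i) (s ℕ.+ k)) ≡⟨ th-cover c (λ i → s ℕ.+ e i) p′ (s ℕ.+ k) xs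
     (proj₁ cov , λ i q → proj₂ cov i (ℕₚ.+-cancelˡ-≡ s (e i) k q)) ⟨
  th c (λ i → s ℕ.+ e i) p′ (s ℕ.+ k) ∎
  where
  open ≡-Reasoning
  xs = proj₁ (p k)
  cov = proper-covers p k ℕₚ.≤-refl

th-sub : {{_ : Discrete I}} → ∀ k .{{_ : NonZero k}} (c : I → ℚ) e (p : Proper e) (p′ : Proper (λ i → e i ℕ.* k)) →
  sub k (th c e p) ≋ th c (λ i → e i ℕ.* k) p′
th-sub k c e p p′ = ≋-sym (≋-sub k (th c e p) (th c (λ i → e i ℕ.* k) p′)
  (λ m → trans
    (th-cover c (λ i → e i ℕ.* k) p′ (m ℕ.* k) (proj₁ (p m))
      (proj₁ (cov m) , λ i q → proj₂ (cov m) i (ℕₚ.*-cancelʳ-≡ (e i) m k q)))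
    (sumOver-cong (proj₁ (p m)) (λ i → cong (_* c i)
      (trans (sym (sub-mono k (e i) (m ℕ.* k))) (sub-mult k (mono (e i)) m)))))
  (λ n k∤n → sumOver-zero (proj₁ (p′ n)) (λ i → term-≢ c (λ i → e i ℕ.* k) n i (λ q → k∤n (divides (e i) (sym q))))))
  where
  cov : ∀ m → _
  cov m = proper-covers p m ℕₚ.≤-refl

th-twist : ∀ a (c : I → ℚ) e (p : Proper e) → twist a (th c e p) ≋ th (λ i → a (e i) * c i) e p
th-twist a c e p N = trans (sym (sumOver-*ˡ (proj₁ (p N)) (a N) (term c e N))) (sumOver-cong (proj₁ (p N)) pointwise)
  where
  open +-*-Solver
  pointwise : ∀ i → a N * term c e N i ≡ term (λ i → a (e i) * c i) e N i
  pointwise i with e i ℕ.≟ N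
  ... | yes refl = solve 3 (λ a m c → a :* (m :* c) := m :* (a :* c)) refl (a (e i)) (mono (e i) (e i)) (c i)
  ... | no q = trans (cong (a N *_) (term-≢ c e N i q)) (trans (ℚₚ.*-zeroʳ (a N)) (sym (term-≢ (λ i → a (e i) * c i) e N i q)))

ints : ℕ → List ℤ
ints M = map pos (upTo (suc M)) ++ map -[1+_] (upTo M)

ints-unique : ∀ M → Unique (ints M)
ints-unique M = Uniqueₚ.++⁺ (Uniqueₚ.map⁺ ℤₚ.+-injective (Uniqueₚ.upTo⁺ (suc M)))
  (Uniqueₚ.map⁺ ℤₚ.-[1+-injective (Uniqueₚ.upTo⁺ M)) disjoint
  where
  disjoint : ∀ {v} → v ∈ map pos (upTo (suc M)) × v ∈ map -[1+_] (upTo M) → _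
  disjoint (a , b) with ∈-map⁻ pos a | ∈-map⁻ -[1+_] b
  ... | _ , _ , refl | _ , _ , ()

ints-∈ : ∀ M i → ℤ.∣ i ∣ ℕ.≤ M → i ∈ ints M
ints-∈ M (pos n)  le = ∈-++⁺ˡ (∈-map⁺ pos (∈-upTo⁺ (s≤s le)))
ints-∈ M -[1+ n ] le = ∈-++⁺ʳ (map pos (upTo (suc M))) (∈-map⁺ -[1+_] (∈-upTo⁺ le))

ints-sum : ∀ M F → sumOver (ints M) F ≡ S (suc M) (F ∘ pos) + S M (F ∘ -[1+_])
ints-sum M F = trans (sumOver-++ (map pos (upTo (suc M))) (map -[1+_] (upTo M)) F)
  (cong₂ _+_ (trans (sumOver-map pos (upTo (suc M)) F) (sumOver-upTo (suc M) (F ∘ pos)))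
             (trans (sumOver-map -[1+_] (upTo M) F) (sumOver-upTo M (F ∘ -[1+_]))))

-- The slack `suc` admits exponents that vanish away from index 0, as k(k-1)/2 does at k = 1.
proper-bound : ∀ (e : ℤ → ℕ) → (∀ i → ℤ.∣ i ∣ ℕ.≤ suc (e i)) → Proper e
proper-bound e bound N = ints (suc N) , ints-unique (suc N) , λ i le → ints-∈ (suc N) i (ℕₚ.≤-trans (bound i) (s≤s le))

module _ (t o : ℕ) .{{_ : NonZero t}} where

  -- The offset allows representatives centred at 0: with t = 5 and o = 2 they run from -2 to 2.
  residue : Fin t → ℤ → ℤ
  residue r j = pos t ℤ.* j ℤ.+ (pos (toℕ r) ℤ.- pos o)

  quot : ℤ → ℤ
  quot n = (n ℤ.+ pos o) /ℕ t

  private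
    no-wrap : ∀ r s d → r ℕ.< t → pos r ≢ pos s ℤ.+ pos t ℤ.* pos (suc d)
    no-wrap r s d r<t eq = ℕₚ.<⇒≱ r<t (ℕₚ.≤-trans (ℕₚ.m≤m*n t (suc d)) (ℕₚ.≤-trans (ℕₚ.m≤n+m _ s)
      (ℕₚ.≤-reflexive (sym (ℤₚ.+-injective (trans eq (cong (λ z → pos s ℤ.+ z) (sym (ℤₚ.pos-* t (suc d))))))))))

    unique : ∀ r s i j → r ℕ.< t → s ℕ.< t → pos t ℤ.* i ℤ.+ pos r ≡ pos t ℤ.* j ℤ.+ pos s → i ≡ j
    unique r s i j r<t s<t eq with i ℤ.- j in d
    ... | pos zero    = ℤₚ.i-j≡0⇒i≡j i j d
    ... | pos (suc k) = ⊥-elim (no-wrap s r k s<t (trans (solve₁ (pos t) (pos r) (pos s) i j eq) (cong (λ z → pos r ℤ.+ pos t ℤ.* z) d)))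
      where
      solve₁ : ∀ t r s i j → t ℤ.* i ℤ.+ r ≡ t ℤ.* j ℤ.+ s → s ≡ r ℤ.+ t ℤ.* (i ℤ.- j)
      solve₁ t r s i j eq = trans (lhs t s j) (trans (cong (ℤ._- t ℤ.* j) (sym eq)) (rhs t r i j))
        where
        lhs : ∀ t s j → s ≡ (t ℤ.* j ℤ.+ s) ℤ.- t ℤ.* j
        lhs = ℤ-Solver.solve-∀
        rhs : ∀ t r i j → (t ℤ.* i ℤ.+ r) ℤ.- t ℤ.* j ≡ r ℤ.+ t ℤ.* (i ℤ.- j)
        rhs = ℤ-Solver.solve-∀
    ... | -[1+ k ] = ⊥-elim (no-wrap r s k r<t (trans (solve₂ (pos t) (pos r) (pos s) i j eq) (cong (λ z → pos s ℤ.+ pos t ℤ.* ℤ.- z) d)))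
      where
      solve₂ : ∀ t r s i j → t ℤ.* i ℤ.+ r ≡ t ℤ.* j ℤ.+ s → r ≡ s ℤ.+ t ℤ.* ℤ.- (i ℤ.- j)
      solve₂ t r s i j eq = trans (lhs t r i) (trans (cong (ℤ._- t ℤ.* i) eq) (rhs t s i j))
        where
        lhs : ∀ t r i → r ≡ (t ℤ.* i ℤ.+ r) ℤ.- t ℤ.* i
        lhs = ℤ-Solver.solve-∀
        rhs : ∀ t s i j → (t ℤ.* j ℤ.+ s) ℤ.- t ℤ.* i ≡ s ℤ.+ t ℤ.* ℤ.- (i ℤ.- j)
        rhs = ℤ-Solver.solve-∀

    add-o : ∀ t i r o → t ℤ.* i ℤ.+ (r ℤ.- o) ℤ.+ o ≡ t ℤ.* i ℤ.+ r
    add-o = ℤ-Solver.solve-∀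

  residue-inj : ∀ {r s i j} → residue r i ≡ residue s j → r ≡ s × i ≡ j
  residue-inj {r} {s} {i} {j} eq = Finₚ.toℕ-injective (ℤₚ.+-injective (ℤ-cancelˡ (pos t ℤ.* i) (pos (toℕ r)) (pos (toℕ s))
      (trans eq′ (cong (λ k → pos t ℤ.* k ℤ.+ pos (toℕ s)) (sym i≡j))))) , i≡j
    where
    eq′ : pos t ℤ.* i ℤ.+ pos (toℕ r) ≡ pos t ℤ.* j ℤ.+ pos (toℕ s)
    eq′ = trans (sym (add-o (pos t) i (pos (toℕ r)) (pos o))) (trans (cong (ℤ._+ pos o) eq) (add-o (pos t) j (pos (toℕ s)) (pos o)))
    i≡j = unique (toℕ r) (toℕ s) i j (Finₚ.toℕ<n r) (Finₚ.toℕ<n s) eq′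

  residue-surj : ∀ n → ∃ λ r → residue r (quot n) ≡ n
  residue-surj n = fromℕ< (n%ℕd<d (n ℤ.+ pos o) t) , (begin
    pos t ℤ.* k ℤ.+ (pos (toℕ (fromℕ< r<t)) ℤ.- pos o)  ≡⟨ cong (λ z → pos t ℤ.* k ℤ.+ (pos z ℤ.- pos o)) (Finₚ.toℕ-fromℕ< r<t) ⟩
    pos t ℤ.* k ℤ.+ (pos r ℤ.- pos o)                   ≡⟨ rearrange (pos t) k (pos r) (pos o) ⟩
    (pos r ℤ.+ k ℤ.* pos t) ℤ.- pos o                   ≡⟨ cong (ℤ._- pos o) (a≡a%ℕn+[a/ℕn]*n (n ℤ.+ pos o) t) ⟨
    (n ℤ.+ pos o) ℤ.- pos o                             ≡⟨ cancel n (pos o) ⟩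
    n                                                   ∎)
    where
    open ≡-Reasoning
    k = quot n
    r = (n ℤ.+ pos o) %ℕ t
    r<t = n%ℕd<d (n ℤ.+ pos o) t
    rearrange : ∀ t k r o → t ℤ.* k ℤ.+ (r ℤ.- o) ≡ (r ℤ.+ k ℤ.* t) ℤ.- o
    rearrange = ℤ-Solver.solve-∀
    cancel : ∀ n o → (n ℤ.+ o) ℤ.- o ≡ n
    cancel = ℤ-Solver.solve-∀

  quot-residue : ∀ r j → quot (residue r j) ≡ j
  quot-residue r j = proj₂ (residue-inj {proj₁ (residue-surj (residue r j))} {r} (proj₂ (residue-surj (residue r j))))

  th-residues : ∀ c e (p : Proper e) (p′ : ∀ r → Proper (λ j → e (residue r j))) →
    th c e p ≋ sumFin t (λ r → th (λ j → c (residue r j)) (λ j → e (residue r j)) (p′ r))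
  th-residues c e p p′ = th-split c e p t residue p′ residue-inj
    (λ n → proj₁ (residue-surj n) , quot n , proj₂ (residue-surj n))

  residue₂ : Fin t → ℤ × ℤ → ℤ × ℤ
  residue₂ r (j , n) = residue r j , n

  th-residues₂ : ∀ c e (p : Proper e) (p′ : ∀ r → Proper (λ jn → e (residue₂ r jn))) →
    th c e p ≋ sumFin t (λ r → th (λ jn → c (residue₂ r jn)) (λ jn → e (residue₂ r jn)) (p′ r))
  th-residues₂ c e p p′ = th-split c e p t residue₂ p′
    (λ eq → proj₁ (residue-inj (cong proj₁ eq)) , cong₂ _,_ (proj₂ (residue-inj (cong proj₁ eq))) (cong proj₂ eq))
    (λ (m , n) → proj₁ (residue-surj m) , (quot m , n) , cong (_, n) (proj₂ (residue-surj m)))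

  proper-residue : ∀ {e : ℤ → ℕ} → Proper e → ∀ r → Proper (λ j → e (residue r j))
  proper-residue p r = proper-pull (residue r) quot (quot-residue r) p

  proper-residue₂ : ∀ {e : ℤ × ℤ → ℕ} → Proper e → ∀ r → Proper (λ jn → e (residue₂ r jn))
  proper-residue₂ p r = proper-pull (residue₂ r) (λ (m , n) → quot m , n) (λ (j , n) → cong (_, n) (quot-residue r j)) p

-- Infinite products

om : ℕ → PS
om e = one ⊕ ⊝ mono e

om-Agree : ∀ i e → i ℕ.< e → Agree i (om e) one
om-Agree i e i<e n n≤i = trans (cong (λ z → one n + - z) (mono-≢ e n (λ e≡n → ℕₚ.<⇒≱ i<e (ℕₚ.≤-trans (ℕₚ.≤-reflexive e≡n) n≤i))))
  (ℚₚ.+-identityʳ (one n))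

oneMinus≋om : ∀ k .{{_ : NonZero k}} → oneMinus k ≋ om k
oneMinus≋om (suc k) zero    = refl
oneMinus≋om (suc k) (suc n) = delta k n
  where
  delta : ∀ k n → (if n ℕ.≡ᵇ k then - 1ℚ else 0ℚ) ≡ 0ℚ + - mono k n
  delta zero    zero    = refl
  delta zero    (suc n) = refl
  delta (suc k) zero    = refl
  delta (suc k) (suc n) = delta k n

-- F i is 1 modulo q^(i+1), so n factors determine the product up to q^n; this is exactly the
-- truncation by which `Π∞` is defined.
Unital : (ℕ → PS) → Set
Unital F = ∀ i → Agree i (F i) one

ΠS-cong : ∀ n {F G} → (∀ i → F i ≋ G i) → ΠS n F ≋ ΠS n G
ΠS-cong zero    p = ≋-refl
ΠS-cong (suc n) {F} {G} p = ⊛-cong (p n) (ΠS-cong n p)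

ΠS-⊛ : ∀ n F G → ΠS n (λ i → F i ⊛ G i) ≋ ΠS n F ⊛ ΠS n G
ΠS-⊛ zero    F G = ≋-sym (PSR.*-identityˡ one)
ΠS-⊛ (suc n) F G = ⊛-congˡ (F n ⊛ G n) (ΠS-⊛ n F G)
  ⨾ PSI.solve 4 (λ a b c d → (a :* b) :* (c :* d) := (a :* c) :* (b :* d)) ≋-refl (F n) (G n) (ΠS n F) (ΠS n G)
  where open PSI using (_:=_; _:*_)

ΠS-one : ∀ n → ΠS n (λ _ → one) ≋ one
ΠS-one zero    = ≋-refl
ΠS-one (suc n) = PSR.*-identityˡ (ΠS n (λ _ → one)) ⨾ ΠS-one n

ΠS-split : ∀ m n F → ΠS (m ℕ.+ n) F ≋ ΠS m (λ i → F (i ℕ.+ n)) ⊛ ΠS n F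
ΠS-split zero    n F = ≋-sym (PSR.*-identityˡ (ΠS n F))
ΠS-split (suc m) n F = ⊛-congˡ (F (m ℕ.+ n)) (ΠS-split m n F)
  ⨾ ≋-sym (PSR.*-assoc (F (m ℕ.+ n)) (ΠS m (λ i → F (i ℕ.+ n))) (ΠS n F))

ΠS-block : ∀ t n F → ΠS (n ℕ.* t) F ≋ ΠS t (λ r → ΠS n (λ i → F (r ℕ.+ i ℕ.* t)))
ΠS-block t zero    F = ≋-sym (ΠS-one t)
ΠS-block t (suc n) F = ΠS-split t (n ℕ.* t) F
  ⨾ ⊛-congˡ (ΠS t (λ r → F (r ℕ.+ n ℕ.* t))) (ΠS-block t n F)
  ⨾ ≋-sym (ΠS-⊛ t (λ r → F (r ℕ.+ n ℕ.* t)) (λ r → ΠS n (λ i → F (r ℕ.+ i ℕ.* t))))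

ΠS-Agree : ∀ N n {F G} → (∀ i → Agree N (F i) (G i)) → Agree N (ΠS n F) (ΠS n G)
ΠS-Agree N zero    p = ≋⇒Agree N ≋-refl
ΠS-Agree N (suc n) {F} {G} p = Agree-⊛ N (F n) (G n) (ΠS n F) (ΠS n G) (p n) (ΠS-Agree N n p)

ΠS-stable : ∀ F → Unital F → ∀ N k → Agree N (ΠS (k ℕ.+ N) F) (ΠS N F)
ΠS-stable F u N zero    = ≋⇒Agree N ≋-refl
ΠS-stable F u N (suc k) = Agree-trans
  (Agree-⊛ N (F (k ℕ.+ N)) one (ΠS (k ℕ.+ N) F) (ΠS N F)
    (λ n n≤N → u (k ℕ.+ N) n (ℕₚ.≤-trans n≤N (ℕₚ.m≤n+m N k))) (ΠS-stable F u N k))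
  (≋⇒Agree N (PSR.*-identityˡ (ΠS N F)))

Π∞-Agree : ∀ F → Unital F → ∀ N M → N ℕ.≤ M → Agree N (Π∞ F) (ΠS M F)
Π∞-Agree F u N M N≤M n n≤N = sym (trans (cong (λ k → ΠS k F n) (sym (ℕₚ.m∸n+n≡m (ℕₚ.≤-trans n≤N N≤M))))
  (ΠS-stable F u n (M ℕ.∸ n) n ℕₚ.≤-refl))

Π∞-cong : ∀ {F G} → (∀ i → F i ≋ G i) → Π∞ F ≋ Π∞ G
Π∞-cong p n = ΠS-cong n p n

Π∞-⊛ : ∀ F G → Unital F → Unital G → Π∞ (λ i → F i ⊛ G i) ≋ Π∞ F ⊛ Π∞ G
Π∞-⊛ F G u v n = trans (ΠS-⊛ n F G n) (sym (Agree-⊛ n (Π∞ F) (ΠS n F) (Π∞ G) (ΠS n G)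
  (Π∞-Agree F u n n ℕₚ.≤-refl) (Π∞-Agree G v n n ℕₚ.≤-refl) n ℕₚ.≤-refl))

Π∞-block : ∀ t .{{_ : NonZero t}} F → Unital F → Π∞ F ≋ ΠS t (λ r → Π∞ (λ i → F (r ℕ.+ i ℕ.* t)))
Π∞-block t F u n = begin
  -- Enough factors are taken for each of the t residue classes to receive exactly n.
  Π∞ F n                                              ≡⟨ Π∞-Agree F u n (n ℕ.* t) (ℕₚ.m≤m*n n t) n ℕₚ.≤-refl ⟩
  ΠS (n ℕ.* t) F n                                    ≡⟨ ΠS-block t n F n ⟩
  ΠS t (λ r → ΠS n (λ i → F (r ℕ.+ i ℕ.* t))) n       ≡⟨ ΠS-Agree n t (λ r → Agree-sym (Π∞-Agree (λ i → F (r ℕ.+ i ℕ.* t)) (unital r) n n ℕₚ.≤-refl)) n ℕₚ.≤-refl ⟩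
  ΠS t (λ r → Π∞ (λ i → F (r ℕ.+ i ℕ.* t))) n         ∎
  where
  open ≡-Reasoning
  unital : ∀ r → Unital (λ i → F (r ℕ.+ i ℕ.* t))
  unital r i k k≤i = u (r ℕ.+ i ℕ.* t) k (ℕₚ.≤-trans k≤i (ℕₚ.≤-trans (ℕₚ.m≤m*n i t) (ℕₚ.m≤n+m _ r)))

ΠS-sub : ∀ k .{{_ : NonZero k}} n F → sub k (ΠS n F) ≋ ΠS n (λ i → sub k (F i))
ΠS-sub k zero    F = sub-one k
ΠS-sub k (suc n) F = sub-⊛ k (F n) (ΠS n F) ⨾ ⊛-congˡ (sub k (F n)) (ΠS-sub k n F)

sub-Agree : ∀ k .{{_ : NonZero k}} N f g → Agree N f g → Agree N (sub k f) (sub k g)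
sub-Agree k N f g p n n≤N with k ∣? n
... | yes _ = p (n ℕ./ k) (ℕₚ.≤-trans (m/n≤m n k) n≤N)
... | no _  = refl

Π∞-sub : ∀ k .{{_ : NonZero k}} F → Unital F → sub k (Π∞ F) ≋ Π∞ (λ i → sub k (F i))
Π∞-sub k F u n = trans (sub-Agree k n (Π∞ F) (ΠS n F) (Π∞-Agree F u n n ℕₚ.≤-refl) n ℕₚ.≤-refl) (ΠS-sub k n F n)

sub-om : ∀ k .{{_ : NonZero k}} e → sub k (om e) ≋ om (e ℕ.* k)
sub-om k e = sub-⊕ k one (⊝ mono e) ⨾ ⊕-cong (sub-one k) (sub-⊝ k (mono e) ⨾ λ n → cong -_ (sub-mono k e n))

-- Pr r t = Π_{i≥0} (1 - q^(r+1+ti)).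
Pr : ℕ → ℕ → PS
Pr r t = Π∞ (λ i → om (suc (r ℕ.+ i ℕ.* t)))

Pr-unital : ∀ r t .{{_ : NonZero t}} → Unital (λ i → om (suc (r ℕ.+ i ℕ.* t)))
Pr-unital r t i = om-Agree i (suc (r ℕ.+ i ℕ.* t)) (s≤s (ℕₚ.≤-trans (ℕₚ.m≤m*n i t) (ℕₚ.m≤n+m _ r)))

f₁ : PS
f₁ = Π∞ (λ i → om (suc i))

f₁-block : ∀ t .{{_ : NonZero t}} → f₁ ≋ ΠS t (λ r → Pr r t)
f₁-block t = Π∞-block t (λ i → om (suc i)) (λ i → om-Agree i (suc i) ℕₚ.≤-refl)

sub-Pr : ∀ k r t .{{_ : NonZero t}} → sub (suc k) (Pr r t) ≋ Pr (r ℕ.* suc k ℕ.+ k) (t ℕ.* suc k)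
sub-Pr k r t = Π∞-sub (suc k) (λ i → om (suc (r ℕ.+ i ℕ.* t))) (Pr-unital r t)
  ⨾ Π∞-cong (λ i → sub-om (suc k) (suc (r ℕ.+ i ℕ.* t)) ⨾ λ n → cong (λ e → om e n) (arith r i t k))
  where
  arith : ∀ r i t k → suc (r ℕ.+ i ℕ.* t) ℕ.* suc k ≡ suc ((r ℕ.* suc k ℕ.+ k) ℕ.+ i ℕ.* (t ℕ.* suc k))
  arith = ℕ-Solver.solve-∀

f₁-Pr : f₁ ≋ Pr 0 1
f₁-Pr = Π∞-cong (λ i n → cong (λ e → om (suc e) n) (sym (ℕₚ.*-identityʳ i)))

sub-f₁ : ∀ k → sub (suc k) f₁ ≋ Pr k (suc k)
sub-f₁ k = sub-cong (suc k) f₁-Pr ⨾ sub-Pr k 0 1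
  ⨾ λ n → cong (λ e → Pr k e n) (ℕₚ.*-identityˡ (suc k))

-- n(n-1)/2, so that `T (suc n)` is n(n+1)/2.
T : ℕ → ℕ
T zero    = 0
T (suc n) = n ℕ.+ T n

-- Jacobi's triple product

module ℚI = IntegerCoefficients ℚₚ.+-*-commutativeRing

ι : ℤ → ℚ
ι = ℚI.fromℤ

K-fromℤ : ∀ n → K (ι (pos n)) ≋ κ n
K-fromℤ zero    n = ℚₚ.*-zeroˡ (one n)
K-fromℤ (suc m) n = trans (ℚₚ.*-distribʳ-+ (one n) 1ℚ (ι (pos m))) (cong₂ _+_ (ℚₚ.*-identityˡ (one n)) (K-fromℤ m n))

ι-· : ∀ n f → ι (pos n) · f ≋ κ n ⊛ f
ι-· n f = ≋-sym (K-⊛ (ι (pos n)) f) ⨾ ⊛-congʳ f (K-fromℤ n)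

ℕ→ℚ-suc : ∀ n → ℕ→ℚ (suc n) ≡ 1ℚ + ℕ→ℚ n
ℕ→ℚ-suc n = sym (begin
  1ℚ + ℕ→ℚ n                                        ≡⟨ cong (1ℚ +_) (ℚₚ.↥p/↧p≡p (mkℚ (pos n) 0 c)) ⟩
  1ℚ + mkℚ (pos n) 0 c                              ≡⟨⟩
  (pos 1 ℤ.* pos 1 ℤ.+ pos n ℤ.* pos 1) ℚ./ 1       ≡⟨ cong (λ z → (pos 1 ℤ.+ z) ℚ./ 1) (ℤₚ.*-identityʳ (pos n)) ⟩
  ℕ→ℚ (suc n)                                       ∎)
  where
  open ≡-Reasoning
  c : Coprime n 1
  c = coprime-sym (1-coprimeTo n)

ℕ→ℚ≡ι : ∀ n → ℕ→ℚ n ≡ ι (pos n)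
ℕ→ℚ≡ι zero    = refl
ℕ→ℚ≡ι (suc n) = trans (ℕ→ℚ-suc n) (cong (1ℚ +_) (ℕ→ℚ≡ι n))

sgn : ℤ → ℚ
sgn (pos n)  = alt n
sgn -[1+ n ] = alt (suc n)

-- E a b k = a k(k+1)/2 + b k(k-1)/2.
E : ℕ → ℕ → ℤ → ℕ
E a b (pos n)  = a ℕ.* T (suc n) ℕ.+ b ℕ.* T n
E a b -[1+ n ] = a ℕ.* T (suc n) ℕ.+ b ℕ.* T (suc (suc n))

S-coeff : ∀ n F N → ΣPS.S n F N ≡ S n (λ i → F i N)
S-coeff zero    F N = refl
S-coeff (suc n) F N = cong (F 0 N +_) (S-coeff n (F ∘ suc) N)

module Limit (m′ : ℕ) where
  m : ℕ
  m = suc m′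

  open QBinomial PS-ring (mono m) public

  Q∞ : PS
  Q∞ = Pr m′ m

  Qp-mono : ∀ n → Qp n ≋ mono (n ℕ.* m)
  Qp-mono zero    = ≋-refl
  Qp-mono (suc n) = ⊛-congˡ (mono m) (Qp-mono n) ⨾ mono-+ m (n ℕ.* m)

  poch-ΠS : ∀ a n → poch (mono a) n ≋ ΠS n (λ i → om (a ℕ.+ i ℕ.* m))
  poch-ΠS a zero    = ≋-refl
  poch-ΠS a (suc n) = ⊛-cong
    (⊕-cong (≋-refl {one}) (λ k → cong -_ ((⊛-congˡ (mono a) (Qp-mono n) ⨾ mono-+ a (n ℕ.* m)) k)))
    (poch-ΠS a n)

  poch-Agree : ∀ r N n → N ℕ.≤ n → Agree N (poch (mono (suc r)) n) (Pr r m)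
  poch-Agree r N n N≤n = Agree-trans (≋⇒Agree N (poch-ΠS (suc r) n)) (Agree-sym (Π∞-Agree _ (Pr-unital r m) N n N≤n))

  u-mono : ∀ a k → u (mono a) k ≋ alt k · mono (a ℕ.* k ℕ.+ m ℕ.* T k)
  u-mono a zero    = λ n → trans (cong (λ z → mono z n) (sym (zero-exp a m′))) (sym (ℚₚ.*-identityˡ (mono (a ℕ.* 0 ℕ.+ m ℕ.* 0) n)))
    where
    zero-exp : ∀ a b → a ℕ.* 0 ℕ.+ suc b ℕ.* 0 ≡ 0
    zero-exp = ℕ-Solver.solve-∀
  u-mono a (suc k) = ⊛-cong
      (λ n → cong -_ ((⊛-congˡ (mono a) (Qp-mono k) ⨾ mono-+ a (k ℕ.* m)) n)) (u-mono a k ⨾ ≋-sym (K-⊛ (alt k) (mono e)))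
    ⨾ PSI.solve 3 (λ s k e → (:- s) :* (k :* e) := :- (k :* (s :* e))) ≋-refl (mono s) (K (alt k)) (mono e)
    ⨾ (λ n → cong -_ ((⊛-congˡ (K (alt k)) (mono-+ s e) ⨾ K-⊛ (alt k) (mono (s ℕ.+ e))) n))
    ⨾ (λ n → trans (ℚₚ.neg-distribˡ-* (alt k) (mono (s ℕ.+ e) n)) (cong (λ z → - alt k * mono z n) (arith a m′ k (T k))))
    where
    open PSI using (_:=_; _:*_; :-_)
    s = a ℕ.+ k ℕ.* m
    e = a ℕ.* k ℕ.+ m ℕ.* T k
    arith : ∀ a b k t → (a ℕ.+ k ℕ.* suc b) ℕ.+ (a ℕ.* k ℕ.+ suc b ℕ.* t) ≡ a ℕ.* suc k ℕ.+ suc b ℕ.* (k ℕ.+ t)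
    arith = ℕ-Solver.solve-∀

  -- All three Q-factorials agree with `Q∞` up to q^N, so `Gb-poch` reads Q∞² Gb ≡ Q∞, and one
  -- factor `Q∞` is cancelled.
  Gb-limit : ∀ N j i → N ℕ.≤ j → N ℕ.≤ i → Agree N (Q∞ ⊛ Gb (j ℕ.+ i) j) one
  Gb-limit N j i N≤j N≤i = Agree-cancelˡ N Q∞ (Q∞ ⊛ G) one (λ ())
    (Agree-trans (≋⇒Agree N (PSI.solve 2 (λ a g → a :* (a :* g) := g :* (a :* a)) ≋-refl Q∞ G))
    (Agree-trans (Agree-⊛ N G G (Q∞ ⊛ Q∞) (poch (mono m) j ⊛ poch (mono m) i) (≋⇒Agree N ≋-refl)
                   (Agree-⊛ N Q∞ _ Q∞ _ (Agree-sym (poch-Agree m′ N j N≤j)) (Agree-sym (poch-Agree m′ N i N≤i))))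
    (Agree-trans (≋⇒Agree N (Gb-poch j i))
    (Agree-trans (poch-Agree m′ N (j ℕ.+ i) (ℕₚ.≤-trans N≤j (ℕₚ.m≤m+n j i)))
                 (≋⇒Agree N (≋-sym (PSR.*-identityʳ Q∞)))))))
    where
    open PSI using (_:=_; _:*_)
    G = Gb (j ℕ.+ i) j

  -- Either the monomial lies beyond q^N, or the Gaussian coefficient has already reached its limit
  -- there.
  term-limit : ∀ N j i c e → (N ℕ.< e) ⊎ (N ℕ.≤ j × N ℕ.≤ i) →
    (Q∞ ⊛ (Gb (j ℕ.+ i) j ⊛ (c · mono e))) N ≡ mono e N * c
  term-limit N j i c e (inj₁ N<e) = begin
    (Q∞ ⊛ (G ⊛ (c · mono e))) N            ≡⟨ ⊛-congˡ Q∞ (⊛-congˡ G (≋-sym (K-⊛ c (mono e)))) N ⟩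
    (Q∞ ⊛ (G ⊛ (K c ⊛ mono e))) N          ≡⟨ PSI.solve 4 (λ a g k x → a :* (g :* (k :* x)) := x :* (a :* (g :* k))) ≋-refl Q∞ G (K c) (mono e) N ⟩
    (mono e ⊛ (Q∞ ⊛ (G ⊛ K c))) N          ≡⟨ mono-⊛-< e (Q∞ ⊛ (G ⊛ K c)) N N<e ⟩
    0ℚ                                     ≡⟨ trans (cong (_* c) (mono-≢ e N (λ e≡N → ℕₚ.<⇒≢ N<e (sym e≡N)))) (ℚₚ.*-zeroˡ c) ⟨
    mono e N * c                           ∎
    where
    open ≡-Reasoning
    open PSI using (_:=_; _:*_)
    G = Gb (j ℕ.+ i) j
  term-limit N j i c e (inj₂ (N≤j , N≤i)) = begin
    (Q∞ ⊛ (G ⊛ (c · mono e))) N            ≡⟨ PSR.*-assoc Q∞ G (c · mono e) N ⟨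
    ((Q∞ ⊛ G) ⊛ (c · mono e)) N            ≡⟨ Agree-⊛ N (Q∞ ⊛ G) one (c · mono e) (c · mono e) (Gb-limit N j i N≤j N≤i) (≋⇒Agree N ≋-refl) N ℕₚ.≤-refl ⟩
    (one ⊛ (c · mono e)) N                 ≡⟨ PSR.*-identityˡ (c · mono e) N ⟩
    c * mono e N                           ≡⟨ ℚₚ.*-comm c (mono e N) ⟩
    mono e N * c                           ∎
    where
    open ≡-Reasoning
    G = Gb (j ℕ.+ i) j

  module _ (c : ℤ → ℚ) (e : ℤ → ℕ) (bound : ∀ i → ℤ.∣ i ∣ ℕ.≤ suc (e i)) where

    partial : ℕ → PS
    partial n = ΣPS.S n (λ l → Gb (n ℕ.+ n) (n ℕ.∸ suc l) ⊛ (c -[1+ l ] · mono (e -[1+ l ])))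
              ⊕ ΣPS.S (suc n) (λ k → Gb (n ℕ.+ n) (n ℕ.+ k) ⊛ (c (pos k) · mono (e (pos k))))

    -- With n = 2(N + 1), an index of size at most N + 1 stays at distance at least N from the ends
    -- of the sum; by `bound`, a larger index has an exponent beyond N.
    partial-limit : ∀ N → let n = suc N ℕ.+ suc N in (Q∞ ⊛ partial n) N ≡ th c e (proper-bound e bound) N
    partial-limit N = begin
      (Q∞ ⊛ partial n) N                                        ≡⟨ PSR.distribˡ Q∞ (ΣPS.S n A) (ΣPS.S (suc n) B) N ⟩
      (Q∞ ⊛ ΣPS.S n A) N + (Q∞ ⊛ ΣPS.S (suc n) B) N             ≡⟨ cong₂ _+_ (coeff n A) (coeff (suc n) B) ⟩
      S n (λ l → (Q∞ ⊛ A l) N) + S (suc n) (λ k → (Q∞ ⊛ B k) N) ≡⟨ cong₂ _+_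
         (S-cong n _ _ negative)
         (S-cong (suc n) _ _ positive) ⟩
      S n (λ l → term c e N -[1+ l ]) + S (suc n) (λ k → term c e N (pos k)) ≡⟨ ℚₚ.+-comm (S n (λ l → term c e N -[1+ l ])) (S (suc n) (λ k → term c e N (pos k))) ⟩
      S (suc n) (λ k → term c e N (pos k)) + S n (λ l → term c e N -[1+ l ]) ≡⟨ ints-sum n (term c e N) ⟨
      sumOver (ints n) (term c e N)                             ≡⟨ th-cover c e (proper-bound e bound) N (ints n)
         (ints-unique n , λ i ei≡N → ints-∈ n i (ℕₚ.≤-trans (bound i) (ℕₚ.≤-trans (s≤s (ℕₚ.≤-reflexive ei≡N)) (ℕₚ.m≤m+n (suc N) (suc N))))) ⟨
      th c e (proper-bound e bound) N                           ∎
      where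
      open ≡-Reasoning
      n = suc N ℕ.+ suc N
      A B : ℕ → PS
      A l = Gb (n ℕ.+ n) (n ℕ.∸ suc l) ⊛ (c -[1+ l ] · mono (e -[1+ l ]))
      B k = Gb (n ℕ.+ n) (n ℕ.+ k) ⊛ (c (pos k) · mono (e (pos k)))
      coeff : ∀ k F → (Q∞ ⊛ ΣPS.S k F) N ≡ S k (λ i → (Q∞ ⊛ F i) N)
      coeff k F = trans (sym (ΣPS.S-*ˡ k Q∞ F N)) (S-coeff k (λ i → Q∞ ⊛ F i) N)
      half : ∀ l → l ℕ.≤ suc N → N ℕ.≤ n ℕ.∸ l
      half l l≤ = ℕₚ.≤-trans (ℕₚ.n≤1+n N) (ℕₚ.≤-trans (ℕₚ.≤-reflexive (sym (ℕₚ.m+n∸n≡m (suc N) (suc N)))) (ℕₚ.∸-monoʳ-≤ n l≤))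
      N≤n : N ℕ.≤ n
      N≤n = ℕₚ.≤-trans (ℕₚ.n≤1+n N) (ℕₚ.m≤m+n (suc N) (suc N))
      negative : ∀ l → l ℕ.< n → (Q∞ ⊛ A l) N ≡ term c e N -[1+ l ]
      negative l l<n = trans (cong (λ k → (Q∞ ⊛ (Gb k (n ℕ.∸ suc l) ⊛ (c -[1+ l ] · mono (e -[1+ l ])))) N) (sym idx))
        (term-limit N (n ℕ.∸ suc l) (suc l ℕ.+ n) (c -[1+ l ]) (e -[1+ l ]) cases)
        where
        idx : (n ℕ.∸ suc l) ℕ.+ (suc l ℕ.+ n) ≡ n ℕ.+ n
        idx = trans (sym (ℕₚ.+-assoc (n ℕ.∸ suc l) (suc l) n)) (cong (ℕ._+ n) (ℕₚ.m∸n+n≡m l<n))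
        cases : (N ℕ.< e -[1+ l ]) ⊎ (N ℕ.≤ n ℕ.∸ suc l × N ℕ.≤ suc l ℕ.+ n)
        cases with l ℕ.≤? N
        ... | yes l≤N = inj₂ (half (suc l) (s≤s l≤N) , ℕₚ.≤-trans N≤n (ℕₚ.m≤n+m n (suc l)))
        ... | no  l≰N = inj₁ (ℕₚ.<-≤-trans (ℕₚ.≰⇒> l≰N) (ℕₚ.≤-pred (bound -[1+ l ])))
      positive : ∀ k → k ℕ.< suc n → (Q∞ ⊛ B k) N ≡ term c e N (pos k)
      positive k (s≤s k≤n) = trans (cong (λ z → (Q∞ ⊛ (Gb z (n ℕ.+ k) ⊛ (c (pos k) · mono (e (pos k))))) N) (sym idx))
        (term-limit N (n ℕ.+ k) (n ℕ.∸ k) (c (pos k)) (e (pos k)) cases)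
        where
        idx : (n ℕ.+ k) ℕ.+ (n ℕ.∸ k) ≡ n ℕ.+ n
        idx = trans (ℕₚ.+-assoc n k (n ℕ.∸ k)) (cong (n ℕ.+_) (ℕₚ.m+[n∸m]≡n k≤n))
        cases : (N ℕ.< e (pos k)) ⊎ (N ℕ.≤ n ℕ.+ k × N ℕ.≤ n ℕ.∸ k)
        cases with k ℕ.≤? suc N
        ... | yes k≤ = inj₂ (ℕₚ.≤-trans N≤n (ℕₚ.m≤m+n n k) , half k k≤)
        ... | no  k≰ = inj₁ (ℕₚ.≤-pred (ℕₚ.≤-trans (ℕₚ.≰⇒> k≰) (bound (pos k))))

n≤T[1+n] : ∀ n → n ℕ.≤ T (suc n)
n≤T[1+n] n = ℕₚ.m≤m+n n (T n)

E-bound : ∀ a b .{{_ : NonZero b}} i → ℤ.∣ i ∣ ℕ.≤ suc (E a b i)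
E-bound a b (pos zero)    = z≤n
E-bound a b (pos (suc n)) = s≤s (ℕₚ.≤-trans (n≤T[1+n] n) (ℕₚ.≤-trans (ℕₚ.m≤n*m (T (suc n)) b) (ℕₚ.m≤n+m _ _)))
E-bound a b -[1+ n ]      = ℕₚ.≤-trans (n≤T[1+n] (suc n)) (ℕₚ.≤-trans (ℕₚ.m≤n*m _ b) (ℕₚ.≤-trans (ℕₚ.m≤n+m _ _) (ℕₚ.n≤1+n _)))

E-proper : ∀ a b .{{_ : NonZero b}} → Proper (E a b)
E-proper a b = proper-bound (E a b) (E-bound a b)

JT : (a b : ℕ) .{{_ : NonZero b}} → PS
JT a b = th sgn (E a b) (E-proper a b)

-- The finite product at X = q^a, Y = q^b, Q = q^(a+b), multiplied by `Q∞` and compared coefficient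
-- by coefficient.
jacobi-triple : ∀ α β → let a = suc α ; b = suc β ; m = a ℕ.+ b in
  JT a b ≋ Pr (α ℕ.+ b) m ⊛ (Pr β m ⊛ Pr α m)
jacobi-triple α β N = sym (begin
  (Q∞ ⊛ (Pr β m ⊛ Pr α m)) N                           ≡⟨ Agree-⊛ N Q∞ Q∞ _ _ (≋⇒Agree N ≋-refl)
    (Agree-⊛ N (Pr β m) (poch (mono b) n) (Pr α m) (poch (mono a) n)
      (Agree-sym (poch-Agree β N n N≤n)) (Agree-sym (poch-Agree α N n N≤n))) N ℕₚ.≤-refl ⟩
  (Q∞ ⊛ (poch (mono b) n ⊛ poch (mono a) n)) N         ≡⟨ ⊛-congˡ Q∞ (finite-JTP′ (mono a) (mono b) (mono-+ a b) n ⨾ terms) N ⟩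
  (Q∞ ⊛ partial sgn (E a b) (E-bound a b) n) N         ≡⟨ partial-limit sgn (E a b) (E-bound a b) N ⟩
  JT a b N                                             ∎)
  where
  open ≡-Reasoning
  a = suc α
  b = suc β
  open Limit (α ℕ.+ b)
  n = suc N ℕ.+ suc N
  N≤n : N ℕ.≤ n
  N≤n = ℕₚ.≤-trans (ℕₚ.n≤1+n N) (ℕₚ.m≤m+n (suc N) (suc N))
  exp-neg : ∀ a b l t → b ℕ.* suc l ℕ.+ (a ℕ.+ b) ℕ.* (l ℕ.+ t) ≡ a ℕ.* (l ℕ.+ t) ℕ.+ b ℕ.* (suc l ℕ.+ (l ℕ.+ t))
  exp-neg = ℕ-Solver.solve-∀
  exp-pos : ∀ a b k t → a ℕ.* k ℕ.+ (a ℕ.+ b) ℕ.* t ≡ a ℕ.* (k ℕ.+ t) ℕ.+ b ℕ.* t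
  exp-pos = ℕ-Solver.solve-∀
  terms : ΣPS.S n (λ l → Gb (n ℕ.+ n) (n ℕ.∸ suc l) ⊛ u (mono b) (suc l)) ⊕ ΣPS.S (suc n) (λ k → Gb (n ℕ.+ n) (n ℕ.+ k) ⊛ u (mono a) k)
          ≋ partial sgn (E a b) (E-bound a b) n
  terms = ⊕-cong
    (ΣPS.S-cong n (λ l → Gb (n ℕ.+ n) (n ℕ.∸ suc l) ⊛ u (mono b) (suc l))
      (λ l → Gb (n ℕ.+ n) (n ℕ.∸ suc l) ⊛ (alt (suc l) · mono (E a b -[1+ l ])))
      (λ l _ → ⊛-congˡ (Gb (n ℕ.+ n) (n ℕ.∸ suc l)) (u-mono b (suc l) ⨾ λ k → cong (λ z → alt (suc l) * mono z k) (exp-neg a b l (T l)))))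
    (ΣPS.S-cong (suc n) (λ k → Gb (n ℕ.+ n) (n ℕ.+ k) ⊛ u (mono a) k)
      (λ k → Gb (n ℕ.+ n) (n ℕ.+ k) ⊛ (alt k · mono (E a b (pos k))))
      (λ k _ → ⊛-congˡ (Gb (n ℕ.+ n) (n ℕ.+ k)) (u-mono a k ⨾ λ i → cong (λ z → alt k * mono z i) (exp-pos a b k (T k)))))

-- Dual numbers and Jacobi's formula for the cube

module _ (R : CommutativeRing 0ℓ 0ℓ) where
  private module R = CommutativeRing R
  open R using (Carrier; _≈_; 0#; 1#)
  open IntegerCoefficients R

  -- R[ε] with ε² = 0, the pair (a , b) being a + bε. It replaces differentiation of the triple
  -- product in its variable.
  Dual : CommutativeRing 0ℓ 0ℓ
  Dual = record
    { Carrier = Carrier × Carrier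
    ; _≈_ = λ (a , b) (c , d) → a ≈ c × b ≈ d
    ; _+_ = λ (a , b) (c , d) → a R.+ c , b R.+ d
    ; _*_ = λ (a , b) (c , d) → a R.* c , a R.* d R.+ b R.* c
    ; -_ = λ (a , b) → R.- a , R.- b
    ; 0# = 0# , 0#
    ; 1# = 1# , 0#
    ; isCommutativeRing = record
      { isRing = record
        { +-isAbelianGroup = record
          { isGroup = record
            { isMonoid = record
              { isSemigroup = record
                { isMagma = record
                  { isEquivalence = record
                    { refl = R.refl , R.refl
                    ; sym = λ (p , q) → R.sym p , R.sym q
                    ; trans = λ (p , q) (p′ , q′) → R.trans p p′ , R.trans q q′ }
                  ; ∙-cong = λ (p , q) (p′ , q′) → R.+-cong p p′ , R.+-cong q q′ }
                ; assoc = λ (a , b) (c , d) (e , f) → R.+-assoc a c e , R.+-assoc b d f }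
              ; identity = (λ (a , b) → R.+-identityˡ a , R.+-identityˡ b) , (λ (a , b) → R.+-identityʳ a , R.+-identityʳ b) }
            ; inverse = (λ (a , b) → R.-‿inverseˡ a , R.-‿inverseˡ b) , (λ (a , b) → R.-‿inverseʳ a , R.-‿inverseʳ b)
            ; ⁻¹-cong = λ (p , q) → R.-‿cong p , R.-‿cong q }
          ; comm = λ (a , b) (c , d) → R.+-comm a c , R.+-comm b d }
        ; *-cong = λ (p , q) (p′ , q′) → R.*-cong p p′ , R.+-cong (R.*-cong p q′) (R.*-cong q p′)
        ; *-assoc = λ (a , b) (c , d) (e , f) → R.*-assoc a c e
            , solve 6 (λ a b c d e f → a :* c :* f :+ (a :* d :+ b :* c) :* e := a :* (c :* f :+ d :* e) :+ b :* (c :* e)) R.refl a b c d e f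
        ; *-identity = (λ (a , b) → R.*-identityˡ a , R.trans (R.+-cong (R.*-identityˡ b) (R.zeroˡ a)) (R.+-identityʳ b))
                     , (λ (a , b) → R.*-identityʳ a , R.trans (R.+-cong (R.zeroʳ a) (R.*-identityʳ b)) (R.+-identityˡ b))
        ; distrib = (λ (a , b) (c , d) (e , f) → R.distribˡ a c e
                       , solve 6 (λ a b c d e f → a :* (d :+ f) :+ b :* (c :+ e) := (a :* d :+ b :* c) :+ (a :* f :+ b :* e)) R.refl a b c d e f)
                  , (λ (a , b) (c , d) (e , f) → R.distribʳ a c e
                       , solve 6 (λ a b c d e f → (c :+ e) :* b :+ (d :+ f) :* a := (c :* b :+ d :* a) :+ (e :* b :+ f :* a)) R.refl a b c d e f) }
      ; *-comm = λ (a , b) (c , d) → R.*-comm a c , solve 4 (λ a b c d → a :* d :+ b :* c := c :* b :+ d :* a) R.refl a b c d } }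

-- Jacobi's identity for f₁³ is the coefficient of ε in the triple product with
-- X = 1 + ε, Y = q(1 - ε), ε² = 0, whose factor 1 - X = -ε is the vanishing one.
module Cube where
  private
    D = Dual PS-ring
    module D = CommutativeRing D
    module ΣD = FiniteSum D
    module L = Limit 0
    module QD = QBinomial D (mono 1 , 𝟘)
    open PSI using (solve; _:=_; _:*_; _:+_; _:-_; :-_; #_)

  Qp-dual : ∀ n → QD.Qp n D.≈ (L.Qp n , 𝟘)
  Qp-dual zero    = ≋-refl , ≋-refl
  Qp-dual (suc n) = ⊛-congˡ (mono 1) (proj₁ (Qp-dual n))
    , (⊕-cong (⊛-congˡ (mono 1) (proj₂ (Qp-dual n))) (≋-refl {𝟘 ⊛ proj₁ (QD.Qp n)})
      ⨾ ⊕-cong (PSR.zeroʳ (mono 1)) (PSR.zeroˡ (proj₁ (QD.Qp n))) ⨾ PSR.+-identityˡ 𝟘)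

  mult-dual : ∀ {x y : PS × PS} {a b : PS} → x D.≈ (a , 𝟘) → y D.≈ (b , 𝟘) → (x D.* y) D.≈ (a ⊛ b , 𝟘)
  mult-dual {x} {y} {a} {b} p q = D.trans {x D.* y} {(a , 𝟘) D.* (b , 𝟘)} {a ⊛ b , 𝟘}
    (D.*-cong {x} {a , 𝟘} {y} {b , 𝟘} p q)
    (≋-refl , (⊕-cong (PSR.zeroʳ a) (PSR.zeroˡ b) ⨾ PSR.+-identityˡ 𝟘))

  Gb-dual : ∀ N j → QD.Gb N j D.≈ (L.Gb N j , 𝟘)
  Gb-dual N       zero    = ≋-refl , ≋-refl
  Gb-dual zero    (suc j) = ≋-refl , ≋-refl
  Gb-dual (suc N) (suc j) = let (p , q) = Gb-dual N j
                                (p′ , q′) = mult-dual {QD.Qp (suc j)} {QD.Gb N (suc j)} (Qp-dual (suc j)) (Gb-dual N (suc j))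
                            in ⊕-cong p p′ , (⊕-cong q q′ ⨾ PSR.+-identityˡ 𝟘)

  poch-fst : ∀ x n → proj₁ (QD.poch x n) ≋ L.poch (proj₁ x) n
  poch-fst x zero    = ≋-refl
  poch-fst x (suc n) = ⊛-cong
    (⊕-cong (≋-refl {one}) (λ k → cong -_ (⊛-congˡ (proj₁ x) (proj₁ (Qp-dual n)) k))) (poch-fst x n)

  poch-cong : ∀ {x y} n → x ≋ y → L.poch x n ≋ L.poch y n
  poch-cong zero    p = ≋-refl
  poch-cong {x} {y} (suc n) p = ⊛-cong
    (⊕-cong (≋-refl {one}) (λ k → cong -_ (⊛-congʳ (L.Qp n) p k))) (poch-cong n p)

  X Y : PS × PS
  X = one , one ⊛ one
  Y = mono 1 , ⊝ one ⊛ mono 1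

  XY≈Q : (X D.* Y) D.≈ (mono 1 , 𝟘)
  XY≈Q = PSR.*-identityˡ (mono 1) , solve 2 (λ o q → o :* (:- o :* q) :+ o :* o :* q := # 0) ≋-refl one (mono 1)

  -- The factor 1 - X = -ε annihilates the ε-parts of the remaining factors, which thus enter at X =
  -- 1.
  poch-X : ∀ n → QD.poch X (suc n) D.≈ (𝟘 , ⊝ L.poch (mono 1) n)
  poch-X n = D.trans {QD.poch X (suc n)} {(D.1# D.- X) D.* P} {𝟘 , ⊝ L.poch (mono 1) n} (QD.poch-front X n)
    ( (⊛-congʳ (proj₁ P) (PSR.-‿inverseʳ one) ⨾ PSR.zeroˡ (proj₁ P))
    , (⊕-cong (⊛-congʳ (proj₂ P) (PSR.-‿inverseʳ one) ⨾ PSR.zeroˡ (proj₂ P))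
              (⊛-cong
                (PSR.+-identityˡ (⊝ (one ⊛ one)) ⨾ λ k → cong -_ (PSR.*-identityˡ one k))
                (poch-fst (X D.* (mono 1 , 𝟘)) n ⨾ poch-cong n (PSR.*-identityˡ (mono 1))))
      ⨾ PSR.+-identityˡ (⊝ one ⊛ L.poch (mono 1) n)
      ⨾ solve 2 (λ o p → :- o :* p := :- (o :* p)) ≋-refl one (L.poch (mono 1) n)
      ⨾ λ k → cong -_ (PSR.*-identityˡ (L.poch (mono 1) n) k)) )
    where P = QD.poch (X D.* (mono 1 , 𝟘)) n

  times : ℕ → PS → PS
  times zero    s = 𝟘
  times (suc k) s = s ⊕ times k s

  -- `u` is homogeneous of degree k in its argument, so x(1 + sε) yields the factor 1 + ksε. The
  -- values used are s = 1 for X and s = -1 for Y.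
  u-dual : ∀ x s k → QD.u (x , s ⊛ x) k D.≈ (L.u x k , times k s ⊛ L.u x k)
  u-dual x s zero    = ≋-refl , ≋-sym (PSR.zeroˡ one)
  u-dual x s (suc k) = D.trans {QD.u (x , s ⊛ x) (suc k)} {(D.- (x , s ⊛ x) D.* (L.Qp k , 𝟘)) D.* (L.u x k , times k s ⊛ L.u x k)}
      {L.u x (suc k) , times (suc k) s ⊛ L.u x (suc k)}
    (D.*-cong {D.- ((x , s ⊛ x) D.* QD.Qp k)} {D.- (x , s ⊛ x) D.* (L.Qp k , 𝟘)} {QD.u (x , s ⊛ x) k} {L.u x k , times k s ⊛ L.u x k}
      (D.trans {D.- ((x , s ⊛ x) D.* QD.Qp k)} {D.- ((x , s ⊛ x) D.* (L.Qp k , 𝟘))} {D.- (x , s ⊛ x) D.* (L.Qp k , 𝟘)}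
        (D.-‿cong {(x , s ⊛ x) D.* QD.Qp k} {(x , s ⊛ x) D.* (L.Qp k , 𝟘)} (D.*-cong {x , s ⊛ x} {x , s ⊛ x} {QD.Qp k} {L.Qp k , 𝟘} (≋-refl , ≋-refl) (Qp-dual k)))
        ( solve 2 (λ x p → :- (x :* p) := :- x :* p) ≋-refl x (L.Qp k)
        , solve 4 (λ x s p z → :- (x :* z :+ s :* x :* p) := :- x :* z :+ :- (s :* x) :* p) ≋-refl x s (L.Qp k) 𝟘))
      (u-dual x s k))
    ( solve 3 (λ x p w → (:- x :* p) :* w := :- (x :* p) :* w) ≋-refl x (L.Qp k) (L.u x k)
    , solve 5 (λ x s p w t → (:- x :* p) :* (t :* w) :+ (:- x :* # 0 :+ :- (s :* x) :* p) :* w := (s :+ t) :* (:- (x :* p) :* w))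
        ≋-refl x s (L.Qp k) (L.u x k) (times k s))

  S-snd : ∀ n F → proj₂ (ΣD.S n F) ≋ ΣPS.S n (proj₂ ∘ F)
  S-snd zero    F = ≋-refl
  S-snd (suc n) F = ⊕-cong (≋-refl {proj₂ (F 0)}) (S-snd n (F ∘ suc))

  times-one : ∀ k → times k one ≋ K (ι (pos k))
  times-one zero    n = sym (ℚₚ.*-zeroˡ (one n))
  times-one (suc k) n = trans (cong (one n +_) (times-one k n))
    (trans (cong (_+ K (ι (pos k)) n) (sym (ℚₚ.*-identityˡ (one n)))) (sym (ℚₚ.*-distribʳ-+ (one n) 1ℚ (ι (pos k)))))

  times-minus : ∀ k → times k (⊝ one) ≋ ⊝ times k one
  times-minus zero    n = refl
  times-minus (suc k) n = trans (cong (- one n +_) (times-minus k n)) (sym (ℚₚ.neg-distrib-+ (one n) (times k one n)))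

  weight : ℤ → ℚ
  weight k = sgn k * ι k

  private
    K-·-mono : ∀ a b e → K a ⊛ (b · mono e) ≋ (b * a) · mono e
    K-·-mono a b e n = trans (K-⊛ a (b · mono e) n)
      (solveQ 3 (λ a b m → a :×: (b :×: m) :≡: (b :×: a) :×: m) refl a b (mono e n))
      where open +-*-Solver using () renaming (solve to solveQ; _:*_ to _:×:_; _:=_ to _:≡:_)

  bound : ∀ i → ℤ.∣ i ∣ ℕ.≤ suc (E 0 1 i)
  bound = E-bound 0 1

  finite : ∀ n → ⊝ (L.poch (mono 1) (suc n) ⊛ L.poch (mono 1) n) ≋ L.partial weight (E 0 1) bound (suc n)
  finite n′ =
      ≋-sym (⊕-cong (⊛-cong (poch-fst Y n) (proj₂ (poch-X n′)))
                    (⊛-congˡ (proj₂ PY) (proj₁ (poch-X n′)))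
             ⨾ solve 3 (λ a b c → a :* (:- b) :+ c :* # 0 := :- (a :* b)) ≋-refl (L.poch (mono 1) n) (L.poch (mono 1) n′) (proj₂ PY))
    ⨾ proj₂ (QD.finite-JTP′ X Y XY≈Q n)
    ⨾ ⊕-cong (S-snd n A ⨾ ΣPS.S-cong n _ _ (λ l _ → neg-term l))
             (S-snd (suc n) B ⨾ ΣPS.S-cong (suc n) _ _ (λ k _ → pos-term k))
    where
    n = suc n′
    PY = QD.poch Y n
    A B : ℕ → PS × PS
    A l = QD.Gb (n ℕ.+ n) (n ℕ.∸ suc l) D.* QD.u Y (suc l)
    B k = QD.Gb (n ℕ.+ n) (n ℕ.+ k) D.* QD.u X k
    A′ B′ : ℕ → PS
    A′ l = L.Gb (n ℕ.+ n) (n ℕ.∸ suc l) ⊛ (weight -[1+ l ] · mono (E 0 1 -[1+ l ]))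
    B′ k = L.Gb (n ℕ.+ n) (n ℕ.+ k) ⊛ (weight (pos k) · mono (E 0 1 (pos k)))
    snd-mult : ∀ (x y : PS × PS) {a b c} → x D.≈ (a , 𝟘) → y D.≈ (b , c) → proj₂ (x D.* y) ≋ a ⊛ c
    snd-mult x y {a} {b} {c} p q = proj₂ (D.*-cong {x} {a , 𝟘} {y} {b , c} p q)
      ⨾ solve 3 (λ a b c → a :* c :+ # 0 :* b := a :* c) ≋-refl a b c
    neg-term : ∀ l → proj₂ (A l) ≋ A′ l
    neg-term l = snd-mult (QD.Gb (n ℕ.+ n) (n ℕ.∸ suc l)) (QD.u Y (suc l)) (Gb-dual (n ℕ.+ n) (n ℕ.∸ suc l)) (u-dual (mono 1) (⊝ one) (suc l))
      ⨾ ⊛-congˡ (L.Gb (n ℕ.+ n) (n ℕ.∸ suc l))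
          (⊛-cong
             (times-minus (suc l) ⨾ (λ i → trans (cong -_ (times-one (suc l) i)) (ℚₚ.neg-distribˡ-* (ι (pos (suc l))) (one i))))
             (L.u-mono 1 (suc l))
           ⨾ K-·-mono (- ι (pos (suc l))) (alt (suc l)) e
           ⨾ λ i → cong (λ z → (alt (suc l) * ι -[1+ l ]) * mono z i) (arith l (T l)))
      where
      e = 1 ℕ.* suc l ℕ.+ 1 ℕ.* T (suc l)
      arith : ∀ l t → 1 ℕ.* suc l ℕ.+ 1 ℕ.* (l ℕ.+ t) ≡ 0 ℕ.* (l ℕ.+ t) ℕ.+ 1 ℕ.* (suc l ℕ.+ (l ℕ.+ t))
      arith = ℕ-Solver.solve-∀
    pos-term : ∀ k → proj₂ (B k) ≋ B′ k
    pos-term k = snd-mult (QD.Gb (n ℕ.+ n) (n ℕ.+ k)) (QD.u X k) (Gb-dual (n ℕ.+ n) (n ℕ.+ k)) (u-dual one one k)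
      ⨾ ⊛-congˡ (L.Gb (n ℕ.+ n) (n ℕ.+ k))
          (⊛-cong (times-one k) (L.u-mono 0 k)
           ⨾ K-·-mono (ι (pos k)) (alt k) (0 ℕ.* k ℕ.+ 1 ℕ.* T k))

  -- The sum runs over all integers, k and 1 - k sharing an exponent; adding up such pairs gives the
  -- usual weights (-1)^n (2n + 1), with the overall sign on the right.
  cube : th weight (E 0 1) (E-proper 0 1) ≋ ⊝ (f₁ ⊛ (f₁ ⊛ f₁))
  cube N = sym (begin
    (⊝ (f₁ ⊛ (f₁ ⊛ f₁))) N                                          ≡⟨ cong -_ (⊛-cong f₁-Pr (⊛-cong f₁-Pr f₁-Pr) N) ⟩
    (⊝ (P ⊛ (P ⊛ P))) N                                             ≡⟨ cong -_ (Agree-⊛ N P P (P ⊛ P) (L.poch (mono 1) n ⊛ L.poch (mono 1) n′) (≋⇒Agree N ≋-refl)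
                                                                         (Agree-⊛ N P _ P _ (Agree-sym (L.poch-Agree 0 N n N≤n)) (Agree-sym (L.poch-Agree 0 N n′ N≤n′))) N ℕₚ.≤-refl) ⟩
    (⊝ (P ⊛ (L.poch (mono 1) n ⊛ L.poch (mono 1) n′))) N            ≡⟨ solve 2 (λ p x → :- (p :* x) := p :* (:- x)) ≋-refl P (L.poch (mono 1) n ⊛ L.poch (mono 1) n′) N ⟩
    (P ⊛ (⊝ (L.poch (mono 1) n ⊛ L.poch (mono 1) n′))) N            ≡⟨ ⊛-congˡ P (finite n′) N ⟩
    (P ⊛ L.partial weight (E 0 1) bound n) N                        ≡⟨ L.partial-limit weight (E 0 1) bound N ⟩
    th weight (E 0 1) (E-proper 0 1) N                              ∎)
    where
    open ≡-Reasoning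
    P = Pr 0 1
    -- Thus n = n′ + 1 is 2(N + 1), the length in `partial-limit`, displayed as a successor for
    -- `poch-X`.
    n′ = N ℕ.+ suc N
    n = suc n′
    N≤n′ : N ℕ.≤ n′
    N≤n′ = ℕₚ.m≤m+n N (suc N)
    N≤n : N ℕ.≤ n
    N≤n = ℕₚ.≤-trans N≤n′ (ℕₚ.n≤1+n n′)

-- Changes of variables in theta series

alt-sq : ∀ n → alt n * alt n ≡ 1ℚ
alt-sq zero    = refl
alt-sq (suc n) = trans (solve 1 (λ a → :- a :* :- a := a :* a) refl (alt n)) (alt-sq n)
  where open +-*-Solver

sgn-suc : ∀ i → sgn (pos 1 ℤ.+ i) ≡ - sgn i
sgn-suc (pos n)          = refl
sgn-suc -[1+ zero ]      = refl
sgn-suc -[1+ (suc n) ]   = sym (⁻¹-involutive (alt (suc n)))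

sgn-pred : ∀ i → sgn (-[1+ 0 ] ℤ.+ i) ≡ - sgn i
sgn-pred i = trans (sym (⁻¹-involutive (sgn (-[1+ 0 ] ℤ.+ i)))) (cong -_ (trans (sym (sgn-suc (-[1+ 0 ] ℤ.+ i)))
  (cong sgn (trans (sym (ℤₚ.+-assoc (pos 1) -[1+ 0 ] i)) (ℤₚ.+-identityˡ i)))))

sgn-+ : ∀ i j → sgn (i ℤ.+ j) ≡ sgn i * sgn j
sgn-+ (pos zero) j = trans (cong sgn (ℤₚ.+-identityˡ j)) (sym (ℚₚ.*-identityˡ (sgn j)))
sgn-+ (pos (suc n)) j = trans (cong sgn (ℤₚ.+-assoc (pos 1) (pos n) j)) (trans (sgn-suc (pos n ℤ.+ j))
  (trans (cong -_ (sgn-+ (pos n) j)) (ℚₚ.neg-distribˡ-* (alt n) (sgn j))))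
sgn-+ -[1+ zero ] j = trans (sgn-pred j) (solve 1 (λ x → :- x := (:- con 1ℚ) :* x) refl (sgn j))
  where open +-*-Solver
sgn-+ -[1+ (suc n) ] j = trans (cong sgn (ℤₚ.+-assoc -[1+ 0 ] -[1+ n ] j)) (trans (sgn-pred (-[1+ n ] ℤ.+ j))
  (trans (cong -_ (sgn-+ -[1+ n ] j)) (ℚₚ.neg-distribˡ-* (alt (suc n)) (sgn j))))

sgn-sq : ∀ i → sgn i * sgn i ≡ 1ℚ
sgn-sq (pos n)  = alt-sq n
sgn-sq -[1+ n ] = alt-sq (suc n)

sgn-even : ∀ i j k → i ≡ j ℤ.+ (k ℤ.+ k) → sgn i ≡ sgn j
sgn-even i j k refl = trans (sgn-+ j (k ℤ.+ k)) (trans (cong (sgn j *_) (trans (sgn-+ k k) (sgn-sq k))) (ℚₚ.*-identityʳ (sgn j)))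

sgn-odd : ∀ i j k → i ≡ pos 1 ℤ.+ j ℤ.+ (k ℤ.+ k) → sgn i ≡ - sgn j
sgn-odd i j k p = trans (sgn-even i (pos 1 ℤ.+ j) k p) (sgn-suc j)

infix 4 _IsHalf_
-- Exponents are compared through integer polynomials equal to their doubles.
record _IsHalf_ (e : ℕ) (D : ℤ) : Set where
  constructor half
  field double : pos 2 ℤ.* pos e ≡ D

open _IsHalf_

half-≡ : ∀ {e e′ D D′} → e IsHalf D → e′ IsHalf D′ → D ≡ D′ → e ≡ e′
half-≡ {e} {e′} p q r = ℤₚ.+-injective (ℤₚ.*-cancelˡ-≡ (pos 2) (pos e) (pos e′) (trans (double p) (trans r (sym (double q)))))

half-+ : ∀ {e e′ D D′} → e IsHalf D → e′ IsHalf D′ → e ℕ.+ e′ IsHalf D ℤ.+ D′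
half-+ {e} {e′} (half refl) (half refl) = half (ℤₚ.*-distribˡ-+ (pos 2) (pos e) (pos e′))

half-* : ∀ {e D} k → e IsHalf D → e ℕ.* k IsHalf D ℤ.* pos k
half-* {e} k (half refl) = half (trans (cong (pos 2 ℤ.*_) (ℤₚ.pos-* e k)) (sym (ℤₚ.*-assoc (pos 2) (pos e) (pos k))))

half-*ˡ : ∀ {e D} k → e IsHalf D → k ℕ.* e IsHalf pos k ℤ.* D
half-*ˡ {e} {D} k p = half (trans (cong (λ z → pos 2 ℤ.* pos z) (ℕₚ.*-comm k e)) (trans (double (half-* k p)) (ℤₚ.*-comm D (pos k))))

half-const : ∀ s → s IsHalf pos 2 ℤ.* pos s
half-const s = half refl

T-half : ∀ n → T n IsHalf pos n ℤ.* pos n ℤ.- pos n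
T-half zero    = half refl
T-half (suc n) = half (trans (double (half-+ (half-const n) (T-half n))) (ring (pos n)))
  where
  ring : ∀ n → pos 2 ℤ.* n ℤ.+ (n ℤ.* n ℤ.- n) ≡ (pos 1 ℤ.+ n) ℤ.* (pos 1 ℤ.+ n) ℤ.- (pos 1 ℤ.+ n)
  ring = ℤ-Solver.solve-∀

E-half : ∀ a b k → E a b k IsHalf (pos a ℤ.+ pos b) ℤ.* k ℤ.* k ℤ.+ (pos a ℤ.- pos b) ℤ.* k
E-half a b (pos n) = half (trans (double (half-+ (half-*ˡ a (T-half (suc n))) (half-*ˡ b (T-half n)))) (ring (pos a) (pos b) (pos n)))
  where
  ring : ∀ a b n → a ℤ.* ((pos 1 ℤ.+ n) ℤ.* (pos 1 ℤ.+ n) ℤ.- (pos 1 ℤ.+ n)) ℤ.+ b ℤ.* (n ℤ.* n ℤ.- n) ≡ (a ℤ.+ b) ℤ.* n ℤ.* n ℤ.+ (a ℤ.- b) ℤ.* n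
  ring = ℤ-Solver.solve-∀
E-half a b -[1+ n ] = half (trans (double (half-+ (half-*ˡ a (T-half (suc n))) (half-*ˡ b (T-half (suc (suc n)))))) (ring (pos a) (pos b) (pos n)))
  where
  ring : ∀ a b n → a ℤ.* ((pos 1 ℤ.+ n) ℤ.* (pos 1 ℤ.+ n) ℤ.- (pos 1 ℤ.+ n)) ℤ.+ b ℤ.* ((pos 2 ℤ.+ n) ℤ.* (pos 2 ℤ.+ n) ℤ.- (pos 2 ℤ.+ n))
    ≡ (a ℤ.+ b) ℤ.* (ℤ.- (pos 1 ℤ.+ n)) ℤ.* (ℤ.- (pos 1 ℤ.+ n)) ℤ.+ (a ℤ.- b) ℤ.* (ℤ.- (pos 1 ℤ.+ n))
  ring = ℤ-Solver.solve-∀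

th-bij : {I J : Set} {{_ : Discrete I}} {{_ : Discrete J}} → ∀ {c : I → ℚ} {e} (p : Proper e) {c′ : J → ℚ} {e′} (p′ : Proper e′)
  (φ : J → I) (ψ : I → J) → (∀ j → ψ (φ j) ≡ j) → (∀ i → φ (ψ i) ≡ i) →
  (∀ j → e (φ j) ≡ e′ j) → (∀ j → c (φ j) ≡ c′ j) → th c e p ≋ th c′ e′ p′
th-bij {c = c} {e} p p′ φ ψ ψφ φψ e≡ c≡ =
  th-reindex c e p φ pφ (λ {i} {j} q → trans (sym (ψφ i)) (trans (cong ψ q) (ψφ j))) (λ i → ψ i , φψ i)
  ⨾ th-cong pφ p′ c≡ e≡
  where pφ = proper-pull φ ψ ψφ p

module _ (l : ℤ) where
  -- After the shear, the cosets of the sublattice m ≡ ln mod t are residue classes of the first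
  -- coordinate alone.
  shear unshear : ℤ × ℤ → ℤ × ℤ
  shear   (t , n) = t ℤ.+ l ℤ.* n , n
  unshear (t , n) = t ℤ.- l ℤ.* n , n

  private
    cancel₁ : ∀ t n → t ℤ.+ n ℤ.- n ≡ t
    cancel₁ = ℤ-Solver.solve-∀
    cancel₂ : ∀ t n → t ℤ.- n ℤ.+ n ≡ t
    cancel₂ = ℤ-Solver.solve-∀
    unshear-shear : ∀ tn → unshear (shear tn) ≡ tn
    unshear-shear (t , n) = cong (_, n) (cancel₁ t (l ℤ.* n))
    shear-unshear : ∀ tn → shear (unshear tn) ≡ tn
    shear-unshear (t , n) = cong (_, n) (cancel₂ t (l ℤ.* n))

  module _ (t o : ℕ) .{{_ : NonZero t}} where
    proper-shear : ∀ {e : ℤ × ℤ → ℕ} → Proper e → ∀ r → Proper (λ jn → e (shear (residue₂ t o r jn)))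
    proper-shear {e} p r = proper-residue₂ t o {e ∘ shear} (proper-pull shear unshear unshear-shear p) r

    shear-split : ∀ c e (p : Proper e) →
      th c e p ≋ sumFin t (λ r → th (λ jn → c (shear (residue₂ t o r jn))) (λ jn → e (shear (residue₂ t o r jn))) (proper-shear p r))
    shear-split c e p = th-bij p {c ∘ shear} {e ∘ shear} pull shear unshear unshear-shear shear-unshear (λ _ → refl) (λ _ → refl)
      ⨾ th-residues₂ t o (c ∘ shear) (e ∘ shear) pull (proper-shear p)
      where pull = proper-pull shear unshear unshear-shear p

1ᶻ : ℤ → ℚ
1ᶻ _ = 1ℚ

Th : (a b : ℕ) .{{_ : NonZero b}} → PS
Th a b = th 1ᶻ (E a b) (E-proper a b)

alt-odd : ∀ c t → alt ((1 ℕ.+ 2 ℕ.* c) ℕ.* t) ≡ alt t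
alt-odd c t = trans (cong alt (arith c t)) (trans (alt-+ t (c ℕ.* t ℕ.* 2)) (trans (cong (alt t *_) (alt-double (c ℕ.* t))) (ℚₚ.*-identityʳ (alt t))))
  where
  arith : ∀ c t → (1 ℕ.+ 2 ℕ.* c) ℕ.* t ≡ t ℕ.+ c ℕ.* t ℕ.* 2
  arith = ℕ-Solver.solve-∀

-- For odd coefficients the exponent has the parity of k(k+1)/2 + k(k-1)/2 = k².
alt-E : ∀ a b k → alt (E (1 ℕ.+ 2 ℕ.* a) (1 ℕ.+ 2 ℕ.* b) k) ≡ sgn k
alt-E a b (pos n) = trans (alt-+ ((1 ℕ.+ 2 ℕ.* a) ℕ.* T (suc n)) ((1 ℕ.+ 2 ℕ.* b) ℕ.* T n))
  (trans (cong₂ _*_ (trans (alt-odd a (T (suc n))) (alt-+ n (T n))) (alt-odd b (T n)))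
  (trans (ℚₚ.*-assoc (alt n) (alt (T n)) (alt (T n))) (trans (cong (alt n *_) (alt-sq (T n))) (ℚₚ.*-identityʳ (alt n)))))
alt-E a b -[1+ n ] = trans (alt-+ ((1 ℕ.+ 2 ℕ.* a) ℕ.* T (suc n)) ((1 ℕ.+ 2 ℕ.* b) ℕ.* T (suc (suc n))))
  (trans (cong₂ _*_ (alt-odd a (T (suc n))) (trans (alt-odd b (T (suc (suc n)))) (alt-+ (suc n) (T (suc n)))))
  (trans (solve 2 (λ x y → x :* (y :* x) := y :* (x :* x)) refl (alt (T (suc n))) (alt (suc n)))
  (trans (cong (alt (suc n) *_) (alt-sq (T (suc n)))) (ℚₚ.*-identityʳ (alt (suc n))))))
  where open +-*-Solver

neg-Th : ∀ a b → neg (Th (1 ℕ.+ 2 ℕ.* a) (1 ℕ.+ 2 ℕ.* b)) ≋ JT (1 ℕ.+ 2 ℕ.* a) (1 ℕ.+ 2 ℕ.* b)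
neg-Th a b = th-twist alt 1ᶻ (E (1 ℕ.+ 2 ℕ.* a) (1 ℕ.+ 2 ℕ.* b)) p
  ⨾ th-cong p p (λ k → trans (ℚₚ.*-identityʳ (alt (E (1 ℕ.+ 2 ℕ.* a) (1 ℕ.+ 2 ℕ.* b) k))) (alt-E a b k)) (λ _ → refl)
  where p = E-proper (1 ℕ.+ 2 ℕ.* a) (1 ℕ.+ 2 ℕ.* b)

φ≋Th : φ ≋ Th 1 1
φ≋Th n = sym (begin
  Th 1 1 n                                            ≡⟨ th-cover 1ᶻ (E 1 1) (E-proper 1 1) n (ints n) (ints-unique n , λ i ei≡n → ints-∈ n i (ℕₚ.≤-trans (bound i) (ℕₚ.≤-reflexive ei≡n))) ⟩
  sumOver (ints n) (term 1ᶻ (E 1 1) n)                ≡⟨ ints-sum n (term 1ᶻ (E 1 1) n) ⟩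
  (mono 0 n * 1ℚ + S n (λ k → term 1ᶻ (E 1 1) n (pos (suc k)))) + S n (λ k → term 1ᶻ (E 1 1) n -[1+ k ])
    ≡⟨ ℚₚ.+-assoc (mono 0 n * 1ℚ) (S n (λ k → term 1ᶻ (E 1 1) n (pos (suc k)))) (S n (λ k → term 1ᶻ (E 1 1) n -[1+ k ])) ⟩
  mono 0 n * 1ℚ + (S n (λ k → term 1ᶻ (E 1 1) n (pos (suc k))) + S n (λ k → term 1ᶻ (E 1 1) n -[1+ k ]))
    ≡⟨ cong₂ _+_ (first n) (trans (sym (S-+ n (λ k → term 1ᶻ (E 1 1) n (pos (suc k))) (λ k → term 1ᶻ (E 1 1) n -[1+ k ]))) (S-cong n _ (λ k → F n (suc k)) (λ k _ → later k))) ⟩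
  F n 0 + S n (λ k → F n (suc k))                     ≡⟨ sumℚ-upTo (suc n) (F n) ⟨
  φ n                                                 ∎)
  where
  open ≡-Reasoning
  F : ℕ → ℕ → ℚ
  F n k = if does (k ℕ.* k ℕ.≟ n) then (if does (k ℕ.≟ 0) then 1ℚ else ℕ→ℚ 2) else 0ℚ
  square-pos : ∀ k → E 1 1 (pos k) ≡ k ℕ.* k
  square-pos k = half-≡ (E-half 1 1 (pos k)) (half (cong (pos 2 ℤ.*_) (ℤₚ.pos-* k k))) (ring (pos k))
    where
    ring : ∀ k → pos 2 ℤ.* k ℤ.* k ℤ.+ pos 0 ℤ.* k ≡ pos 2 ℤ.* (k ℤ.* k)
    ring = ℤ-Solver.solve-∀
  square-neg : ∀ k → E 1 1 -[1+ k ] ≡ suc k ℕ.* suc k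
  square-neg k = half-≡ (E-half 1 1 -[1+ k ]) (half (cong (pos 2 ℤ.*_) (ℤₚ.pos-* (suc k) (suc k)))) (ring (pos (suc k)))
    where
    ring : ∀ k → pos 2 ℤ.* (ℤ.- k) ℤ.* (ℤ.- k) ℤ.+ pos 0 ℤ.* (ℤ.- k) ≡ pos 2 ℤ.* (k ℤ.* k)
    ring = ℤ-Solver.solve-∀
  bound : ∀ i → ℤ.∣ i ∣ ℕ.≤ E 1 1 i
  bound (pos zero)    = z≤n
  bound (pos (suc k)) = ℕₚ.≤-trans (ℕₚ.m≤m*n (suc k) (suc k)) (ℕₚ.≤-reflexive (sym (square-pos (suc k))))
  bound -[1+ k ]      = ℕₚ.≤-trans (ℕₚ.m≤m*n (suc k) (suc k)) (ℕₚ.≤-reflexive (sym (square-neg k)))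
  first : ∀ n → mono 0 n * 1ℚ ≡ F n 0
  first zero    = refl
  first (suc n) = refl
  later : ∀ k → term 1ᶻ (E 1 1) n (pos (suc k)) + term 1ᶻ (E 1 1) n -[1+ k ] ≡ F n (suc k)
  later k = trans (cong₂ (λ a b → mono a n * 1ℚ + mono b n * 1ℚ) (square-pos (suc k)) (square-neg k)) (both (suc k ℕ.* suc k))
    where
    both : ∀ s → mono s n * 1ℚ + mono s n * 1ℚ ≡ (if does (s ℕ.≟ n) then ℕ→ℚ 2 else 0ℚ)
    both s with s ℕ.≟ n
    ... | yes p = trans (cong (λ z → z * 1ℚ + z * 1ℚ) (trans (cong (mono s) (sym p)) (mono-refl s)))
                        (cong (λ b → if b then ℕ→ℚ 2 else 0ℚ) (sym (dec-true (s ℕ.≟ n) p)))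
    ... | no p  = trans (cong (λ z → z * 1ℚ + z * 1ℚ) (mono-≢ s n p))
                        (cong (λ b → if b then ℕ→ℚ 2 else 0ℚ) (sym (dec-false (s ℕ.≟ n) p)))

-- Polynomial functions on ℤ², presented so that identities between them are checked by normalisation.
module Plane where
  open Data.Integer.Solver.+-*-Solver public
    using (Polynomial; _:+_; _:*_; _:-_; :-_; _:^_; con; var; op; [+]; [*]; ⟦_⟧; ⟦_⟧↓; prove)

  Poly Map : Set
  Poly = Polynomial 2
  Map = Poly × Poly

  x y : Poly
  x = var 0F
  y = var 1F

  #_ : ℕ → Poly
  # n = con (pos n)

  idᴹ : Map
  idᴹ = x , y

  ⟪_⟫ : Poly → ℤ × ℤ → ℤ
  ⟪ p ⟫ (i , j) = ⟦ p ⟧ (i ∷ j ∷ [])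

  act : Map → ℤ × ℤ → ℤ × ℤ
  act (f , g) v = ⟪ f ⟫ v , ⟪ g ⟫ v

  infixl 10 _∘ₚ_ _∘ᴹ_
  _∘ₚ_ : Poly → Map → Poly
  op o p q ∘ₚ M = op o (p ∘ₚ M) (q ∘ₚ M)
  con i    ∘ₚ M = con i
  var 0F   ∘ₚ M = proj₁ M
  var 1F   ∘ₚ M = proj₂ M
  (p :^ n) ∘ₚ M = (p ∘ₚ M) :^ n
  (:- p)   ∘ₚ M = :- (p ∘ₚ M)

  _∘ᴹ_ : Map → Map → Map
  (f , g) ∘ᴹ M = f ∘ₚ M , g ∘ₚ M

  ∘ₚ-correct : ∀ p M v → ⟪ p ∘ₚ M ⟫ v ≡ ⟪ p ⟫ (act M v)
  ∘ₚ-correct (op [+] p q) M v = cong₂ ℤ._+_ (∘ₚ-correct p M v) (∘ₚ-correct q M v)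
  ∘ₚ-correct (op [*] p q) M v = cong₂ ℤ._*_ (∘ₚ-correct p M v) (∘ₚ-correct q M v)
  ∘ₚ-correct (con i) M v      = refl
  ∘ₚ-correct (var 0F) M v     = refl
  ∘ₚ-correct (var 1F) M v     = refl
  ∘ₚ-correct (p :^ n) M v     = cong (_^ᶻ n) (∘ₚ-correct p M v)
    where open import Algebra.Properties.Semiring.Exp ℤₚ.+-*-semiring renaming (_^_ to _^ᶻ_)
  ∘ₚ-correct (:- p) M v       = cong ℤ.-_ (∘ₚ-correct p M v)

  infix 4 _≐_ _≐ᴹ_
  _≐_ : Poly → Poly → Set
  p ≐ q = ∀ {ρ} → ⟦ p ⟧↓ ρ ≡ ⟦ q ⟧↓ ρ

  _≐ᴹ_ : Map → Map → Set
  M ≐ᴹ N = ∀ {ρ} → (⟦ proj₁ M ⟧↓ ρ , ⟦ proj₂ M ⟧↓ ρ) ≡ (⟦ proj₁ N ⟧↓ ρ , ⟦ proj₂ N ⟧↓ ρ)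

  ≐-eval : ∀ p q → p ≐ q → ∀ v → ⟪ p ⟫ v ≡ ⟪ q ⟫ v
  ≐-eval p q eq v = prove _ p q eq

  ≐ᴹ-eval : ∀ M N → M ≐ᴹ N → ∀ v → act M v ≡ act N v
  ≐ᴹ-eval (f , g) (f′ , g′) eq v = cong₂ _,_ (prove _ f f′ (cong proj₁ eq)) (prove _ g g′ (cong proj₂ eq))

  inverse-eval : ∀ φ ψ → ψ ∘ᴹ φ ≐ᴹ idᴹ → ∀ v → act ψ (act φ v) ≡ v
  inverse-eval φ ψ eq v = trans (sym (cong₂ _,_ (∘ₚ-correct (proj₁ ψ) φ v) (∘ₚ-correct (proj₂ ψ) φ v))) (≐ᴹ-eval (ψ ∘ᴹ φ) idᴹ eq v)

  -- The parametrisation shear l ∘ residue₂ t o r of a coset of a sublattice of index t.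
  coset : ℤ → ℕ → ℕ → ℕ → Map
  coset l t o r = (# t :* x :+ (# r :- # o)) :+ con l :* y , y

  -- Twice the exponent `E a b`, as a polynomial in p.
  E² : ℕ → ℕ → Poly → Poly
  E² a b p = (# a :+ # b) :* p :* p :+ (# a :- # b) :* p

  record Half (e : ℤ × ℤ → ℕ) (Q : Poly) : Set where
    constructor halves
    field at : ∀ v → e v IsHalf ⟪ Q ⟫ v

  half-pull : ∀ {e Q} M → Half e Q → Half (e ∘ act M) (Q ∘ₚ M)
  half-pull {e} {Q} M (halves H) = halves (λ v → subst (e (act M v) IsHalf_) (sym (∘ₚ-correct Q M v)) (H (act M v)))

  half-eval : ∀ {e Q e′ Q′} φ → Half e Q → Half e′ Q′ → Q ∘ₚ φ ≐ Q′ → ∀ v → e (act φ v) ≡ e′ v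
  half-eval {Q = Q} {Q′ = Q′} φ H H′ eq v = half-≡ (Half.at (half-pull φ H) v) (Half.at H′ v) (≐-eval (Q ∘ₚ φ) Q′ eq v)

  th-affine : ∀ {c e Q c′ e′ Q′} (p : Proper e) (p′ : Proper e′) → Half e Q → Half e′ Q′ → ∀ φ ψ →
    ψ ∘ᴹ φ ≐ᴹ idᴹ → φ ∘ᴹ ψ ≐ᴹ idᴹ → Q ∘ₚ φ ≐ Q′ → (∀ v → c (act φ v) ≡ c′ v) → th c e p ≋ th c′ e′ p′
  th-affine p p′ H H′ φ ψ ψφ φψ eq w = th-bij p p′ (act φ) (act ψ) (inverse-eval φ ψ ψφ) (inverse-eval ψ φ φψ) (half-eval φ H H′ eq) w

  th-affine-antisym : ∀ {c e Q} (p : Proper e) → Half e Q → ∀ φ →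
    φ ∘ᴹ φ ≐ᴹ idᴹ → Q ∘ₚ φ ≐ Q → (∀ v → c (act φ v) ≡ - c v) → th c e p ≋ 𝟘
  th-affine-antisym {c} {e} p H φ φφ eq w = th-antisym c e p (act φ) (inverse-eval φ φ φφ) (half-eval φ H H eq) w

  sgn-≐ : ∀ p q k → p ≐ q :+ (k :+ k) → ∀ v → sgn (⟪ p ⟫ v) ≡ sgn (⟪ q ⟫ v)
  sgn-≐ p q k eq v = sgn-even (⟪ p ⟫ v) (⟪ q ⟫ v) (⟪ k ⟫ v) (≐-eval p (q :+ (k :+ k)) eq v)

  sgn-≐-odd : ∀ p q k → p ≐ # 1 :+ q :+ (k :+ k) → ∀ v → sgn (⟪ p ⟫ v) ≡ - sgn (⟪ q ⟫ v)
  sgn-≐-odd p q k eq v = sgn-odd (⟪ p ⟫ v) (⟪ q ⟫ v) (⟪ k ⟫ v) (≐-eval p (# 1 :+ q :+ (k :+ k)) eq v)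

  signed : Poly → ℤ × ℤ → ℚ
  signed W v = (sgn (proj₁ v) * sgn (proj₂ v)) * ι (⟪ W ⟫ v)

  module _ (W : Poly) (N : Map) (W′ : Poly) (N′ : Map) where
    private
      P  = proj₁ N :+ proj₂ N
      P′ = proj₁ N′ :+ proj₂ N′

      value : W ∘ₚ N ≐ W′ ∘ₚ N′ → ∀ v → ι (⟪ W ⟫ (act N v)) ≡ ι (⟪ W′ ⟫ (act N′ v))
      value eq v = cong ι (trans (sym (∘ₚ-correct W N v)) (trans (≐-eval (W ∘ₚ N) (W′ ∘ₚ N′) eq v) (∘ₚ-correct W′ N′ v)))

      value-neg : W ∘ₚ N ≐ :- (W′ ∘ₚ N′) → ∀ v → ι (⟪ W ⟫ (act N v)) ≡ - ι (⟪ W′ ⟫ (act N′ v))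
      value-neg eq v = trans (cong ι (trans (sym (∘ₚ-correct W N v)) (trans (≐-eval (W ∘ₚ N) (:- (W′ ∘ₚ N′)) eq v) (cong ℤ.-_ (∘ₚ-correct W′ N′ v)))))
        (ℚI.fromℤ-neg (⟪ W′ ⟫ (act N′ v)))

      sign : ∀ k → P ≐ P′ :+ (k :+ k) → ∀ v →
        sgn (⟪ proj₁ N ⟫ v) * sgn (⟪ proj₂ N ⟫ v) ≡ sgn (⟪ proj₁ N′ ⟫ v) * sgn (⟪ proj₂ N′ ⟫ v)
      sign k eq v = trans (sym (sgn-+ (⟪ proj₁ N ⟫ v) (⟪ proj₂ N ⟫ v))) (trans (sgn-≐ P P′ k eq v) (sgn-+ (⟪ proj₁ N′ ⟫ v) (⟪ proj₂ N′ ⟫ v)))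

    signed-even : ∀ k → P ≐ P′ :+ (k :+ k) → W ∘ₚ N ≐ W′ ∘ₚ N′ → ∀ v → signed W (act N v) ≡ signed W′ (act N′ v)
    signed-even k eq eqW v = cong₂ _*_ (sign k eq v) (value eqW v)

    signed-neg : ∀ k → P ≐ P′ :+ (k :+ k) → W ∘ₚ N ≐ :- (W′ ∘ₚ N′) → ∀ v → signed W (act N v) ≡ - signed W′ (act N′ v)
    signed-neg k eq eqW v = trans (cong₂ _*_ (sign k eq v) (value-neg eqW v)) (sym (ℚₚ.neg-distribʳ-* (sgn (⟪ proj₁ N′ ⟫ v) * sgn (⟪ proj₂ N′ ⟫ v)) (ι (⟪ W′ ⟫ (act N′ v)))))

    -- The change of parity and the change of the weight cancel.
    signed-odd : ∀ k → P ≐ # 1 :+ P′ :+ (k :+ k) → W ∘ₚ N ≐ :- (W′ ∘ₚ N′) → ∀ v → signed W (act N v) ≡ signed W′ (act N′ v)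
    signed-odd k eq eqW v = trans (cong₂ _*_ (trans (sym (sgn-+ (⟪ proj₁ N ⟫ v) (⟪ proj₂ N ⟫ v))) (trans (sgn-≐-odd P P′ k eq v) (cong -_ (sgn-+ (⟪ proj₁ N′ ⟫ v) (⟪ proj₂ N′ ⟫ v))))) (value-neg eqW v))
      (solveℚ 3 (λ s t z → :∸ (s :×: t) :×: :∸ z :≡: (s :×: t) :×: z) refl (sgn (⟪ proj₁ N′ ⟫ v)) (sgn (⟪ proj₂ N′ ⟫ v)) (ι (⟪ W′ ⟫ (act N′ v))))

-- Theta relations from sublattices

proper-≤ : ∀ {I : Set} {e e′ : I → ℕ} → (∀ i → e i ℕ.≤ e′ i) → Proper e → Proper e′
proper-≤ le p N = proj₁ (p N) , proj₁ (proj₂ (p N)) , λ i e′i≤N → proj₂ (proj₂ (p N)) i (ℕₚ.≤-trans (le i) e′i≤N)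

proper-* : ∀ {I : Set} {e : I → ℕ} k .{{_ : NonZero k}} → Proper e → Proper (λ i → e i ℕ.* k)
proper-* {e = e} k = proper-≤ (λ i → ℕₚ.m≤m*n (e i) k)

proper-shift : ∀ {I : Set} {e : I → ℕ} s → Proper e → Proper (λ i → s ℕ.+ e i)
proper-shift {e = e} s = proper-≤ (λ i → ℕₚ.m≤n+m (e i) s)

th-sub-⊛ : ∀ k l .{{_ : NonZero k}} .{{_ : NonZero l}} c e (p : Proper e) c′ e′ (p′ : Proper e′) →
  sub k (th c e p) ⊛ sub l (th c′ e′ p′) ≋
  th (λ ij → c (proj₁ ij) * c′ (proj₂ ij)) (λ (ij : ℤ × ℤ) → e (proj₁ ij) ℕ.* k ℕ.+ e′ (proj₂ ij) ℕ.* l) (proper-× (proper-* k p) (proper-* l p′))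
th-sub-⊛ k l c e p c′ e′ p′ = ⊛-cong
    (th-sub k c e p (proper-* k p)) (th-sub l c′ e′ p′ (proper-* l p′))
  ⨾ th-⊛ c (λ i → e i ℕ.* k) (proper-* k p) c′ (λ i → e′ i ℕ.* l) (proper-* l p′)

-- The sublattice m ≡ n mod 2 is (1 + i)ℤ[i]; there m = a + b, n = a - b turns m² + n² into 2(a² +
-- b²).
module NormOfOnePlusI where
  open Plane

  e : ℤ × ℤ → ℕ
  e mn = E 1 1 (proj₁ mn) ℕ.+ E 1 1 (proj₂ mn)

  p : Proper e
  p = proper-× (E-proper 1 1) (E-proper 1 1)

  Q : Half e (E² 1 1 x :+ E² 1 1 y)
  Q = halves (λ (m , n) → half-+ (E-half 1 1 m) (E-half 1 1 n))

  e′ : ℤ × ℤ → ℕ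
  e′ ab = E 1 1 (proj₁ ab) ℕ.* 2 ℕ.+ E 1 1 (proj₂ ab) ℕ.* 2

  p′ : Proper e′
  p′ = proper-× (proper-* 2 (E-proper 1 1)) (proper-* 2 (E-proper 1 1))

  Q′ : Half e′ (E² 1 1 x :* # 2 :+ E² 1 1 y :* # 2)
  Q′ = halves (λ (a , b) → half-+ (half-* 2 (E-half 1 1 a)) (half-* 2 (E-half 1 1 b)))

  piece : (ℤ × ℤ → ℚ) → Fin 2 → PS
  piece c r = th (λ jn → c (shear (pos 1) (residue₂ 2 0 r jn))) (λ jn → e (shear (pos 1) (residue₂ 2 0 r jn))) (proper-shear (pos 1) 2 0 {e} p r)

  M₀ M₁ : Map
  M₀ = coset (pos 1) 2 0 0
  M₁ = coset (pos 1) 2 0 1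

  even-piece : ∀ (c : ℤ × ℤ → ℚ) c′ → (∀ v → c (act (x :+ y , x :- y) v) ≡ c′ v) → piece c 0F ≋ th c′ e′ p′
  even-piece c c′ w = th-affine (proper-shear (pos 1) 2 0 {e} p 0F) p′ (half-pull M₀ Q) Q′ N (y :+ x , x) refl refl refl
    (λ v → trans (cong c (≐ᴹ-eval (M₀ ∘ᴹ N) (x :+ y , x :- y) refl v)) (w v))
    where
    N : Map
    N = y , x :- y

-- The weight 1 + (-1)^(m+n) is 2 on the sublattice and 0 off it.
φ²+φ[-]² : Th 1 1 ⊛ Th 1 1 ⊕ JT 1 1 ⊛ JT 1 1 ≋ (1ℚ + 1ℚ) · (sub 2 (Th 1 1) ⊛ sub 2 (Th 1 1))
φ²+φ[-]² = ⊕-cong (th-⊛ 1ᶻ (E 1 1) (E-proper 1 1) 1ᶻ (E 1 1) (E-proper 1 1)) (th-⊛ sgn (E 1 1) (E-proper 1 1) sgn (E 1 1) (E-proper 1 1))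
  ⨾ ≋-sym (th-⊕ c₁ c₂ e p)
  ⨾ shear-split (pos 1) 2 0 c e p
  ⨾ ⊕-cong (even-piece c c′ weight₀) (⊕-cong (th-zero (λ jn → c (shear (pos 1) (residue₂ 2 0 1F jn))) _ (proper-shear (pos 1) 2 0 {e} p 1F) weight₁) (≋-refl {𝟘}))
  ⨾ (λ n → trans (cong (th c′ e′ p′ n +_) (ℚₚ.+-identityˡ 0ℚ)) (ℚₚ.+-identityʳ (th c′ e′ p′ n)))
  ⨾ th-· (1ℚ + 1ℚ) (λ _ → 1ℚ * 1ℚ) e′ p′
  ⨾ ·-cong (1ℚ + 1ℚ) (≋-sym (th-sub-⊛ 2 2 1ᶻ (E 1 1) (E-proper 1 1) 1ᶻ (E 1 1) (E-proper 1 1)))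
  where
  open NormOfOnePlusI
  open Plane
  c₁ c₂ c c′ : ℤ × ℤ → ℚ
  c₁ _ = 1ℚ * 1ℚ
  c₂ mn = sgn (proj₁ mn) * sgn (proj₂ mn)
  c mn = c₁ mn + c₂ mn
  c′ _ = (1ℚ + 1ℚ) * (1ℚ * 1ℚ)
  weight₀ : ∀ v → c (act (x :+ y , x :- y) v) ≡ c′ v
  weight₀ v = cong ((1ℚ * 1ℚ) +_) (trans (cong (_* sgn (⟪ x :- y ⟫ v)) (sgn-≐ (x :+ y) (x :- y) y refl v)) (sgn-sq (⟪ x :- y ⟫ v)))
  weight₁ : ∀ v → c (act M₁ v) ≡ 0ℚ
  weight₁ v = trans (cong (λ z → (1ℚ * 1ℚ) + z * sgn (⟪ y ⟫ v)) (sgn-≐-odd (proj₁ M₁) y x refl v))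
    (cong ((1ℚ * 1ℚ) +_) (trans (sym (ℚₚ.neg-distribˡ-* (sgn (⟪ y ⟫ v)) (sgn (⟪ y ⟫ v)))) (cong -_ (sgn-sq (⟪ y ⟫ v)))))

φφ[-] : Th 1 1 ⊛ JT 1 1 ≋ sub 2 (JT 1 1) ⊛ sub 2 (JT 1 1)
φφ[-] = th-⊛ 1ᶻ (E 1 1) (E-proper 1 1) sgn (E 1 1) (E-proper 1 1)
  ⨾ shear-split (pos 1) 2 0 c e p
  ⨾ ⊕-cong (even-piece c c′ weight₀) (⊕-cong odd-piece (≋-refl {𝟘}))
  ⨾ (λ n → trans (cong (th c′ e′ p′ n +_) (ℚₚ.+-identityˡ 0ℚ)) (ℚₚ.+-identityʳ (th c′ e′ p′ n)))
  ⨾ ≋-sym (th-sub-⊛ 2 2 sgn (E 1 1) (E-proper 1 1) sgn (E 1 1) (E-proper 1 1))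
  where
  open NormOfOnePlusI
  open Plane
  c c′ : ℤ × ℤ → ℚ
  c mn = 1ℚ * sgn (proj₂ mn)
  c′ ab = sgn (proj₁ ab) * sgn (proj₂ ab)
  weight₀ : ∀ v → c (act (x :+ y , x :- y) v) ≡ c′ v
  weight₀ v = trans (ℚₚ.*-identityˡ (sgn (⟪ x :- y ⟫ v))) (trans (sgn-≐ (x :- y) (x :+ y) (:- y) refl v) (sgn-+ (⟪ x ⟫ v) (⟪ y ⟫ v)))
  odd-piece : piece c 1F ≋ 𝟘
  -- The involution exchanges m = 2x + 1 + y with n = y, which have opposite parity.
  odd-piece = th-affine-antisym (proper-shear (pos 1) 2 0 {e} p 1F) (half-pull M₁ Q) (:- x :- # 1 , y :+ (# 2 :* x :+ # 1)) refl refl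
    (λ v → trans (cong (1ℚ *_) (sgn-≐-odd (y :+ (# 2 :* x :+ # 1)) y x refl v)) (sym (ℚₚ.neg-distribʳ-* 1ℚ (sgn (⟪ y ⟫ v)))))

module NormOfTwoPlusI where
  open Plane
  open NormOfOnePlusI public using (e; p; Q)

  c : ℤ × ℤ → ℚ
  c _ = 1ℚ * 1ℚ

  piece : Fin 5 → PS
  piece r = th (λ jn → c (shear (pos 2) (residue₂ 5 0 r jn))) (λ jn → e (shear (pos 2) (residue₂ 5 0 r jn))) (proper-shear (pos 2) 5 0 {e} p r)

  -- `e₁` is the norm on a nonzero coset of the index-5 sublattice: five times it is (5m + 2)² + (5n
  -- - 1)².
  e₀ e₁ : ℤ × ℤ → ℕ
  e₀ mn = E 1 1 (proj₁ mn) ℕ.* 5 ℕ.+ E 1 1 (proj₂ mn) ℕ.* 5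
  e₁ mn = 1 ℕ.+ (E 9 1 (proj₁ mn) ℕ.+ E 3 7 (proj₂ mn))

  p₀ : Proper e₀
  p₀ = proper-× (proper-* 5 (E-proper 1 1)) (proper-* 5 (E-proper 1 1))

  p₁ : Proper e₁
  p₁ = proper-shift 1 (proper-× (E-proper 9 1) (E-proper 3 7))

  Q₁ : Half e₁ (# 2 :* # 1 :+ (E² 9 1 x :+ E² 3 7 y))
  Q₁ = halves (λ (m , n) → half-+ (half-const 1) (half-+ (E-half 9 1 m) (E-half 3 7 n)))

  piece₀ : piece 0F ≋ th c e₀ p₀
  piece₀ = th-affine (proper-shear (pos 2) 5 0 {e} p 0F) p₀ (half-pull (coset (pos 2) 5 0 0) Q)
    (halves {Q = E² 1 1 x :* # 5 :+ E² 1 1 y :* # 5} (λ (m , n) → half-+ (half-* 5 (E-half 1 1 m)) (half-* 5 (E-half 1 1 n))))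
    (y , x :- # 2 :* y) (y :+ # 2 :* x , x) refl refl refl (λ _ → refl)

  -- Multiplication by i sends the coset m ≡ 2n + r mod 5 to the one with -2r, hence permutes the
  -- four nonzero cosets; this is why all four give the same series.
  piece₁ : piece 1F ≋ th c e₁ p₁
  piece₁ = th-affine (proper-shear (pos 2) 5 0 {e} p 1F) p₁ (half-pull (coset (pos 2) 5 0 1) Q) Q₁
    (:- y , x :+ # 2 :* y) (y :+ # 2 :* x , :- x) refl refl refl (λ _ → refl)

  piece₂ : piece 2F ≋ th c e₁ p₁
  piece₂ = th-affine (proper-shear (pos 2) 5 0 {e} p 2F) p₁ (half-pull (coset (pos 2) 5 0 2) Q) Q₁
    (x , y :- # 2 :* x :- # 1) (x , y :+ # 2 :* x :+ # 1) refl refl refl (λ _ → refl)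

  piece₃ : piece 3F ≋ th c e₁ p₁
  piece₃ = th-affine (proper-shear (pos 2) 5 0 {e} p 3F) p₁ (half-pull (coset (pos 2) 5 0 3) Q) Q₁
    (:- x :- # 1 , # 2 :* x :- y :+ # 1) (:- x :- # 1 , :- y :- # 2 :* x :- # 1) refl refl refl (λ _ → refl)

  piece₄ : piece 4F ≋ th c e₁ p₁
  piece₄ = th-affine (proper-shear (pos 2) 5 0 {e} p 4F) p₁ (half-pull (coset (pos 2) 5 0 4) Q) Q₁
    (y :- # 1 , :- x :- # 2 :* y) (:- y :- # 2 :* (x :+ # 1) , x :+ # 1) refl refl refl (λ _ → refl)

φ²-φ[5]² : Th 1 1 ⊛ Th 1 1 ≋ sub 5 (Th 1 1) ⊛ sub 5 (Th 1 1) ⊕ κ 4 ⊛ (mono 1 ⊛ (Th 9 1 ⊛ Th 3 7))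
φ²-φ[5]² = th-⊛ 1ᶻ (E 1 1) (E-proper 1 1) 1ᶻ (E 1 1) (E-proper 1 1)
  ⨾ shear-split (pos 2) 5 0 c e p
  ⨾ ⊕-cong (piece₀ ⨾ ≋-sym (th-sub-⊛ 5 5 1ᶻ (E 1 1) (E-proper 1 1) 1ᶻ (E 1 1) (E-proper 1 1)))
      (⊕-cong (piece₁ ⨾ target) (⊕-cong (piece₂ ⨾ target) (⊕-cong (piece₃ ⨾ target) (⊕-cong (piece₄ ⨾ target) (≋-refl {𝟘})))))
  ⨾ PSI.solve 2 (λ a b → a :+ (b :+ (b :+ (b :+ (b :+ # 0)))) := a :+ # 4 :* b) ≋-refl (sub 5 (Th 1 1) ⊛ sub 5 (Th 1 1)) (mono 1 ⊛ (Th 9 1 ⊛ Th 3 7))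
  where
  open NormOfTwoPlusI
  open PSI using (_:=_; _:+_; _:*_; #_)
  target : th c e₁ p₁ ≋ mono 1 ⊛ (Th 9 1 ⊛ Th 3 7)
  target = ≋-sym (⊛-congˡ (mono 1) (th-⊛ 1ᶻ (E 9 1) (E-proper 9 1) 1ᶻ (E 3 7) (E-proper 3 7))
    ⨾ th-mono 1 c (λ mn → E 9 1 (proj₁ mn) ℕ.+ E 3 7 (proj₂ mn)) (proper-× (E-proper 9 1) (E-proper 3 7)) p₁)

-- xY - yX is the theta series of m² + 5n² with weight (-1)^n - (-1)^m, which is 0 unless m and n
-- have opposite parity.
module NormOfOnePlusRootMinusFive where
  open Plane

  e : ℤ × ℤ → ℕ
  e mn = E 1 1 (proj₁ mn) ℕ.+ E 1 1 (proj₂ mn) ℕ.* 5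

  c : ℤ × ℤ → ℚ
  c mn = sgn (proj₂ mn) + - sgn (proj₁ mn)

  p : Proper e
  p = proper-× (E-proper 1 1) (proper-* 5 (E-proper 1 1))

  Q : Half e (E² 1 1 x :+ E² 1 1 y :* # 5)
  Q = halves (λ (m , n) → half-+ (E-half 1 1 m) (half-* 5 (E-half 1 1 n)))

  M : Fin 3 → Map
  M r = coset (pos 1) 3 1 (toℕ r)

  pr : ∀ r → Proper (e ∘ act (M r))
  pr r = proper-shear (pos 1) 3 1 {e} p r

  piece : Fin 3 → PS
  piece r = th (c ∘ act (M r)) (e ∘ act (M r)) (pr r)

  -- On m ≡ n mod 3 the form has an extra symmetry, sending m = 3x + y, n = y to 2x - y, -x - y. It
  -- exchanges the parities of m and n and so negates the weight.
  piece₁ : piece 1F ≋ 𝟘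
  piece₁ = th-affine-antisym (pr 1F) (half-pull (M 1F) Q) (x , :- y :- x) refl refl
    (λ v → trans (cong₂ (λ a b → a + - b) (sgn-≐ (:- y :- x) (proj₁ (M 1F)) (:- y :- # 2 :* x) refl v) (sgn-≐ (proj₁ (M 1F) ∘ₚ (x , :- y :- x)) y (x :- y) refl v))
      (solveℚ 2 (λ a b → a :⊞: :∸ b :≡: :∸ (b :⊞: :∸ a)) refl (sgn (⟪ proj₁ (M 1F) ⟫ v)) (sgn (⟪ y ⟫ v))))

  piece₀ : piece 0F ≋ piece 2F
  piece₀ = th-affine (pr 0F) (pr 2F) (half-pull (M 0F) Q) (half-pull (M 2F) Q) (:- x , :- y) (:- x , :- y) refl refl refl
    (λ v → cong₂ (λ a b → a + - b) (sgn-≐ (:- y) y (:- y) refl v) (sgn-≐ (proj₁ (M 0F) ∘ₚ (:- x , :- y)) (proj₁ (M 2F)) (:- proj₁ (M 2F)) refl v))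

  R : Fin 2 → Map
  R s = # 2 :* x :+ (# (toℕ s) :- # 0) , y

  pr₂ : ∀ s → Proper (e ∘ act (M 2F) ∘ act (R s))
  pr₂ s = proper-residue₂ 2 0 {e ∘ act (M 2F)} (pr 2F) s

  subpiece : Fin 2 → PS
  subpiece s = th (c ∘ act (M 2F) ∘ act (R s)) (e ∘ act (M 2F) ∘ act (R s)) (pr₂ s)

  e′ : ℤ × ℤ → ℕ
  e′ ab = 1 ℕ.+ (E 2 1 (proj₁ ab) ℕ.* 4 ℕ.+ E 2 1 (proj₂ ab) ℕ.* 20)

  p′ : Proper e′
  p′ = proper-shift 1 (proper-× (proper-* 4 (E-proper 2 1)) (proper-* 20 (E-proper 2 1)))

  Q′ : Half e′ (# 2 :* # 1 :+ (E² 2 1 x :* # 4 :+ E² 2 1 y :* # 20))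
  Q′ = halves (λ (a , b) → half-+ (half-const 1) (half-+ (half-* 4 (E-half 2 1 a)) (half-* 20 (E-half 2 1 b))))

  -- Here m = a + 5b + 1 and n = a - b: the mixed terms of m² + 5n² cancel and leave 1 + 4p(a) +
  -- 20p(b) with the pentagonal p(k) = k(3k + 1)/2.
  subpiece₀ : subpiece 0F ≋ th (λ ab → (1ℚ + 1ℚ) * (sgn (proj₁ ab) * sgn (proj₂ ab))) e′ p′
  subpiece₀ = th-affine (pr₂ 0F) p′ (half-pull (R 0F) (half-pull (M 2F) Q)) Q′ N (y :+ x , x) refl refl refl
    (λ v → trans (cong (λ z → sgn (⟪ x :- y ⟫ v) + - z) (sgn-≐-odd (proj₁ (M 2F ∘ᴹ R 0F ∘ᴹ N)) (x :- y) (# 3 :* y) refl v))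
      (trans (solveℚ 1 (λ a → a :⊞: :∸ (:∸ a) :≡: (conℚ 1ℚ :⊞: conℚ 1ℚ) :×: a) refl (sgn (⟪ x :- y ⟫ v)))
        (cong ((1ℚ + 1ℚ) *_) (trans (sgn-≐ (x :- y) (x :+ y) (:- y) refl v) (sgn-+ (⟪ x ⟫ v) (⟪ y ⟫ v))))))
    where
    N : Map
    N = y , x :- y

  subpiece₁ : subpiece 1F ≋ 𝟘
  subpiece₁ = th-zero _ _ (pr₂ 1F) (λ v → trans (cong (λ z → sgn (⟪ y ⟫ v) + - z) (sgn-≐ (proj₁ (M 2F ∘ᴹ R 1F)) y (# 3 :* x :+ # 2) refl v)) (ℚₚ.+-inverseʳ (sgn (⟪ y ⟫ v))))

φφ[-5]-φ[-]φ[5] : Th 1 1 ⊛ sub 5 (JT 1 1) ⊕ ⊝ (JT 1 1 ⊛ sub 5 (Th 1 1)) ≋ κ 4 ⊛ (mono 1 ⊛ (sub 4 (JT 2 1) ⊛ sub 20 (JT 2 1)))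
φφ[-5]-φ[-]φ[5] = ⊕-cong (half-sub 1ᶻ sgn) ((λ n → cong -_ (half-sub sgn 1ᶻ n)) ⨾ (λ n → minus-one (th (λ mn → sgn (proj₁ mn) * 1ℚ) e p n)) ⨾ ≋-sym (th-· (- 1ℚ) (λ mn → sgn (proj₁ mn) * 1ℚ) e p))
  ⨾ ≋-sym (th-⊕ (λ mn → 1ℚ * sgn (proj₂ mn)) (λ mn → - 1ℚ * (sgn (proj₁ mn) * 1ℚ)) e p)
  ⨾ th-cong p p (λ mn → solveℚ 2 (λ x y → conℚ 1ℚ :×: y :⊞: (:∸ conℚ 1ℚ) :×: (x :×: conℚ 1ℚ) :≡: y :⊞: :∸ x) refl (sgn (proj₁ mn)) (sgn (proj₂ mn))) (λ _ → refl)
  ⨾ shear-split (pos 1) 3 1 c e p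
  ⨾ ⊕-cong (piece₀ ⨾ piece₂) (⊕-cong piece₁ (⊕-cong piece₂ (≋-refl {𝟘})))
  ⨾ PSI.solve 1 (λ a → # 2 :* a :+ (# 0 :+ (# 2 :* a :+ # 0)) := # 4 :* a) ≋-refl (mono 1 ⊛ (sub 4 (JT 2 1) ⊛ sub 20 (JT 2 1)))
  where
  open NormOfOnePlusRootMinusFive
  open PSI using (_:=_; _:+_; _:*_; #_)
  minus-one : ∀ x → - x ≡ - 1ℚ * x
  minus-one x = solveℚ 1 (λ x → :∸ x :≡: (:∸ conℚ 1ℚ) :×: x) refl x
  half-sub : ∀ c c′ → th c (E 1 1) (E-proper 1 1) ⊛ sub 5 (th c′ (E 1 1) (E-proper 1 1)) ≋ th (λ mn → c (proj₁ mn) * c′ (proj₂ mn)) e p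
  half-sub c c′ = ⊛-congˡ (th c (E 1 1) (E-proper 1 1)) (th-sub 5 c′ (E 1 1) (E-proper 1 1) (proper-* 5 (E-proper 1 1)))
    ⨾ th-⊛ c (E 1 1) (E-proper 1 1) c′ (λ i → E 1 1 i ℕ.* 5) (proper-* 5 (E-proper 1 1))
  piece₂ : piece 2F ≋ κ 2 ⊛ (mono 1 ⊛ (sub 4 (JT 2 1) ⊛ sub 20 (JT 2 1)))
  piece₂ = th-residues₂ 2 0 (c ∘ Plane.act (M 2F)) (e ∘ Plane.act (M 2F)) (pr 2F) pr₂
    ⨾ ⊕-cong (subpiece₀ ⨾ th-· (1ℚ + 1ℚ) (λ ab → sgn (proj₁ ab) * sgn (proj₂ ab)) e′ p′ ⨾ ι-· 2 (th (λ ab → sgn (proj₁ ab) * sgn (proj₂ ab)) e′ p′)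
               ⨾ ⊛-congˡ (κ 2) (≋-sym target))
             (⊕-cong subpiece₁ (≋-refl {𝟘}))
    ⨾ PSI.solve 1 (λ a → a :+ (# 0 :+ # 0) := a) ≋-refl (κ 2 ⊛ (mono 1 ⊛ (sub 4 (JT 2 1) ⊛ sub 20 (JT 2 1))))
    where
    target : mono 1 ⊛ (sub 4 (JT 2 1) ⊛ sub 20 (JT 2 1)) ≋ th (λ ab → sgn (proj₁ ab) * sgn (proj₂ ab)) e′ p′
    target = ⊛-congˡ (mono 1) (th-sub-⊛ 4 20 sgn (E 2 1) (E-proper 2 1) sgn (E 2 1) (E-proper 2 1))
      ⨾ th-mono 1 (λ ab → sgn (proj₁ ab) * sgn (proj₂ ab)) (λ ab → E 2 1 (proj₁ ab) ℕ.* 4 ℕ.+ E 2 1 (proj₂ ab) ℕ.* 20)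
          (proper-× (proper-* 4 (E-proper 2 1)) (proper-* 20 (E-proper 2 1))) p′

module Wronskian where
  open Plane using (signed; ⟪_⟫)

  module Pieces where
    open Plane

    e : ℤ × ℤ → ℕ
    e lk = E 0 1 (proj₁ lk) ℕ.+ E 0 1 (proj₂ lk)

    p : Proper e
    p = proper-× (E-proper 0 1) (E-proper 0 1)

    Q : Half e (E² 0 1 x :+ E² 0 1 y)
    Q = halves (λ (l , k) → half-+ (E-half 0 1 l) (E-half 0 1 k))

    -- W = (X + 2Y)² - (2X - Y)², from the two coordinates of (2 + i)(X + iY). Up to `D`, which is
    -- antisymmetric in x and y and sums to 0, it is 8XY, the weight of a product of two cubes.
    X Y D W : Poly
    X = # 2 :* x :- # 1
    Y = # 2 :* y :- # 1
    D = # 3 :* Y :* Y :- # 3 :* X :* X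
    W = D :+ # 8 :* Y :* X

    M : Fin 5 → Map
    M r = coset (ℤ.- pos 2) 5 2 (toℕ r)

    pr : ∀ r → Proper (e ∘ act (M r))
    pr r = proper-shear (ℤ.- pos 2) 5 2 {e} p r

    piece : Fin 5 → PS
    piece r = th (signed W ∘ act (M r)) (e ∘ act (M r)) (pr r)

    -- (10y + 3)² - (10x + 1)², the value of `W` in rotated coordinates. It is also 8 plus 40 times
    -- the difference of the exponents of `JT 4 1` and `JT 3 2`, hence the weight of a Wronskian.
    W′ : Poly
    W′ = # 8 :+ # 20 :* (# 5 :* y :* y :+ # 3 :* y) :- # 20 :* (# 5 :* x :* x :+ # 1 :* x)

    e′ : ℤ × ℤ → ℕ
    e′ mn = E 3 2 (proj₁ mn) ℕ.+ E 4 1 (proj₂ mn)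

    p′ : Proper e′
    p′ = proper-× (E-proper 3 2) (E-proper 4 1)

    Q′ : Half e′ (E² 3 2 x :+ E² 4 1 y)
    Q′ = halves (λ (m , n) → half-+ (E-half 3 2 m) (E-half 4 1 n))

    -- The quarter turn (x , y) → (1 - y , x) negates both `W` and (-1)^(x+y), and it permutes the
    -- four cosets where X + 2Y is nonzero modulo 5. So their series agree.
    piece₀ : piece 0F ≋ th (signed W′) e′ p′
    piece₀ = th-affine (pr 0F) p′ (half-pull (M 0F) Q) Q′ N (# 2 :* x :- # 1 :- y , x :- # 1) refl refl refl
      (signed-even W (M 0F ∘ᴹ N) W′ idᴹ (# 1 :+ y) refl refl)
      where
      N : Map
      N = y :+ # 1 , # 1 :- x :+ # 2 :* y

    -- On this coset 5 divides both X + 2Y and 2X - Y. The involution exchanges the two up to sign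
    -- and negates `W`, the difference of their squares.
    piece₁ : piece 1F ≋ 𝟘
    piece₁ = th-affine-antisym (pr 1F) (half-pull (M 1F) Q) N refl refl
      (signed-neg W (M 1F ∘ᴹ N) W (M 1F) (# 2 :* y :- # 6 :* x :+ # 2) refl refl)
      where
      N : Map
      N = y :- # 2 :* x :+ # 1 , # 2 :* y :- # 3 :* x :+ # 1

    piece₂ : piece 2F ≋ th (signed W′) e′ p′
    piece₂ = th-affine (pr 2F) p′ (half-pull (M 2F) Q) Q′ N (y :- # 2 :* x , :- x) refl refl refl
      (signed-even W (M 2F ∘ᴹ N) W′ idᴹ (:- x :- # 2 :* y) refl refl)
      where
      N : Map
      N = :- y , x :- # 2 :* y

    piece₃ : piece 3F ≋ th (signed W′) e′ p′
    piece₃ = th-affine (pr 3F) p′ (half-pull (M 3F) Q) Q′ N (:- x , # 2 :* x :- y) refl refl refl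
      (signed-odd W (M 3F ∘ᴹ N) W′ idᴹ (:- # 2 :* x) refl refl)
      where
      N : Map
      N = :- x , :- # 2 :* x :- y

    piece₄ : piece 4F ≋ th (signed W′) e′ p′
    piece₄ = th-affine (pr 4F) p′ (half-pull (M 4F) Q) Q′ N (x , y :- # 2 :* x :- # 1) refl refl refl
      (signed-odd W (M 4F ∘ᴹ N) W′ idᴹ (x :- y) refl refl)
      where
      N : Map
      N = x , # 2 :* x :+ y :+ # 1

    W-split : ∀ v → ⟪ W ⟫ v ≡ ⟪ D ⟫ v ℤ.+ pos 8 ℤ.* (⟪ X ⟫ v ℤ.* ⟪ Y ⟫ v)
    W-split = ≐-eval W (D :+ # 8 :* (X :* Y)) refl

    D-vanishes : th (signed D) e p ≋ 𝟘
    D-vanishes = th-affine-antisym p Q (y , x) refl refl (signed-neg D (y , x) D idᴹ (# 0) refl refl)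

  open Pieces public

  four-pieces : th (signed W) e p ≋ κ 4 ⊛ th (signed W′) e′ p′
  four-pieces = shear-split (ℤ.- pos 2) 5 2 (signed W) e p
    ⨾ ⊕-cong piece₀ (⊕-cong piece₁ (⊕-cong piece₂ (⊕-cong piece₃ (⊕-cong piece₄ (≋-refl {𝟘})))))
    ⨾ PSI.solve 1 (λ a → a :+ (# 0 :+ (a :+ (a :+ (a :+ # 0)))) := # 4 :* a) ≋-refl (th (signed W′) e′ p′)
    where open PSI using (_:=_; _:+_; _:*_; #_)

  odd-weight : ℤ → ℚ
  odd-weight k = sgn k * ι (pos 2 ℤ.* k ℤ.- pos 1)

  -- The weight 2k - 1 is centred at the symmetry k → 1 - k of the exponent. The shift from 2k costs
  -- nothing, since Σ (-1)^k q^(k(k-1)/2) is negated by that symmetry.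
  cube-odd : th odd-weight (E 0 1) (E-proper 0 1) ≋ ⊝ (κ 2 ⊛ (f₁ ⊛ (f₁ ⊛ f₁)))
  cube-odd = th-cong (E-proper 0 1) (E-proper 0 1) (λ k → trans (cong (sgn k *_) (trans (ℚI.fromℤ-+ (pos 2 ℤ.* k) (ℤ.- pos 1)) (cong (_+ - 1ℚ) (ℚI.fromℤ-* (pos 2) k))))
          (solveℚ 2 (λ s k → s :×: (conℚ (1ℚ + 1ℚ) :×: k :⊞: (:∸ conℚ 1ℚ)) :≡: conℚ (1ℚ + 1ℚ) :×: (s :×: k) :⊞: (:∸ conℚ 1ℚ) :×: s) refl (sgn k) (ι k))) (λ _ → refl)
    ⨾ th-⊕ (λ k → (1ℚ + 1ℚ) * Cube.weight k) (λ k → - 1ℚ * sgn k) (E 0 1) (E-proper 0 1)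
    ⨾ ⊕-cong (th-· (1ℚ + 1ℚ) Cube.weight (E 0 1) (E-proper 0 1) ⨾ ·-cong (1ℚ + 1ℚ) Cube.cube)
             (th-· (- 1ℚ) sgn (E 0 1) (E-proper 0 1) ⨾ ·-cong (- 1ℚ) alternating)
    ⨾ (λ n → solveℚ 1 (λ x → conℚ (1ℚ + 1ℚ) :×: (:∸ x) :⊞: (:∸ conℚ 1ℚ) :×: conℚ 0ℚ :≡: :∸ (x :⊞: x)) refl ((f₁ ⊛ (f₁ ⊛ f₁)) n))
    ⨾ PSI.solve 1 (λ a → :- (a :+ a) := :- (# 2 :* a)) ≋-refl (f₁ ⊛ (f₁ ⊛ f₁))
    where
    open PSI using (_:=_; _:+_; _:*_; :-_; #_)
    alternating : th sgn (E 0 1) (E-proper 0 1) ≋ 𝟘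
    alternating = th-antisym sgn (E 0 1) (E-proper 0 1) (λ k → pos 1 ℤ.- k) inv (λ k → half-≡ (E-half 0 1 (pos 1 ℤ.- k)) (E-half 0 1 k) (exponent k))
      (λ k → sgn-odd (pos 1 ℤ.- k) k (ℤ.- k) (parity k))
      where
      inv : ∀ k → pos 1 ℤ.- (pos 1 ℤ.- k) ≡ k
      inv = ℤ-Solver.solve-∀
      exponent : ∀ k → (pos 1 ℤ.* (pos 1 ℤ.- k) ℤ.* (pos 1 ℤ.- k) ℤ.+ (ℤ.- pos 1) ℤ.* (pos 1 ℤ.- k)) ≡ (pos 1 ℤ.* k ℤ.* k ℤ.+ (ℤ.- pos 1) ℤ.* k)
      exponent = ℤ-Solver.solve-∀
      parity : ∀ k → pos 1 ℤ.- k ≡ pos 1 ℤ.+ k ℤ.+ (ℤ.- k ℤ.+ ℤ.- k)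
      parity = ℤ-Solver.solve-∀

  total : th (signed W) e p ≋ κ 32 ⊛ ((f₁ ⊛ (f₁ ⊛ f₁)) ⊛ (f₁ ⊛ (f₁ ⊛ f₁)))
  total = th-cong p p weights (λ _ → refl)
    ⨾ th-⊕ (signed D) (λ lk → ι (pos 8) * (odd-weight (proj₁ lk) * odd-weight (proj₂ lk))) e p
    ⨾ ⊕-cong D-vanishes (th-· (ι (pos 8)) (λ lk → odd-weight (proj₁ lk) * odd-weight (proj₂ lk)) e p
        ⨾ ·-cong (ι (pos 8)) (≋-sym (th-⊛ odd-weight (E 0 1) (E-proper 0 1) odd-weight (E 0 1) (E-proper 0 1))
            ⨾ ⊛-cong cube-odd cube-odd)
        ⨾ ι-· 8 (⊝ (κ 2 ⊛ F) ⊛ ⊝ (κ 2 ⊛ F)))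
    ⨾ PSI.solve 1 (λ a → # 0 :+ # 8 :* (:- (# 2 :* a) :* :- (# 2 :* a)) := # 32 :* (a :* a)) ≋-refl F
    where
    open PSI using (_:=_; _:+_; _:*_; :-_; #_)
    F = f₁ ⊛ (f₁ ⊛ f₁)
    weights : ∀ lk → signed W lk ≡ signed D lk + ι (pos 8) * (odd-weight (proj₁ lk) * odd-weight (proj₂ lk))
    weights (l , k) = trans (cong (λ z → (sgn l * sgn k) * ι z) (W-split (l , k)))
      (trans (cong ((sgn l * sgn k) *_) (trans (ℚI.fromℤ-+ (⟪ D ⟫ (l , k)) (pos 8 ℤ.* (⟪ X ⟫ (l , k) ℤ.* ⟪ Y ⟫ (l , k))))
        (cong (ι (⟪ D ⟫ (l , k)) +_) (trans (ℚI.fromℤ-* (pos 8) (⟪ X ⟫ (l , k) ℤ.* ⟪ Y ⟫ (l , k))) (cong (ι (pos 8) *_) (ℚI.fromℤ-* (⟪ X ⟫ (l , k)) (⟪ Y ⟫ (l , k))))))))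
      (solveℚ 6 (λ s t d n x y → (s :×: t) :×: (d :⊞: n :×: (x :×: y)) :≡: (s :×: t) :×: d :⊞: n :×: ((s :×: x) :×: (t :×: y))) refl
        (sgn l) (sgn k) (ι (⟪ D ⟫ (l , k))) (ι (pos 8)) (ι (⟪ X ⟫ (l , k))) (ι (⟪ Y ⟫ (l , k)))))

-- Logarithmic derivatives and E₀₁

Θ : PS → PS
Θ = twist ℕ→ℚ

ℕ→ℚ-+ : ∀ m n → ℕ→ℚ (m ℕ.+ n) ≡ ℕ→ℚ m + ℕ→ℚ n
ℕ→ℚ-+ m n = trans (ℕ→ℚ≡ι (m ℕ.+ n)) (trans (ℚI.fromℤ-+ (pos m) (pos n)) (cong₂ _+_ (sym (ℕ→ℚ≡ι m)) (sym (ℕ→ℚ≡ι n))))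

ℕ→ℚ-* : ∀ m n → ℕ→ℚ (m ℕ.* n) ≡ ℕ→ℚ m * ℕ→ℚ n
ℕ→ℚ-* m n = trans (ℕ→ℚ≡ι (m ℕ.* n)) (trans (cong ι (ℤₚ.pos-* m n)) (trans (ℚI.fromℤ-* (pos m) (pos n)) (cong₂ _*_ (sym (ℕ→ℚ≡ι m)) (sym (ℕ→ℚ≡ι n)))))

Θ-cong : ∀ {f g} → f ≋ g → Θ f ≋ Θ g
Θ-cong p n = cong (ℕ→ℚ n *_) (p n)

Θ-⊛ : ∀ f g → Θ (f ⊛ g) ≋ Θ f ⊛ g ⊕ f ⊛ Θ g
Θ-⊛ f g n = begin
  ℕ→ℚ n * (f ⊛ g) n                                              ≡⟨ cong (ℕ→ℚ n *_) (conv f g n) ⟩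
  ℕ→ℚ n * S (suc n) (λ k → f k * g (n ℕ.∸ k))                    ≡⟨ S-*ˡ (suc n) (ℕ→ℚ n) (λ k → f k * g (n ℕ.∸ k)) ⟨
  S (suc n) (λ k → ℕ→ℚ n * (f k * g (n ℕ.∸ k)))                  ≡⟨ S-cong (suc n) _ _ (λ k k<1+n → trans
    (cong (_* (f k * g (n ℕ.∸ k))) (trans (cong ℕ→ℚ (sym (ℕₚ.m+[n∸m]≡n (ℕₚ.≤-pred k<1+n)))) (ℕ→ℚ-+ k (n ℕ.∸ k))))
    (solve 4 (λ a b c d → (a :+ b) :* (c :* d) := (a :* c) :* d :+ c :* (b :* d)) refl (ℕ→ℚ k) (ℕ→ℚ (n ℕ.∸ k)) (f k) (g (n ℕ.∸ k)))) ⟩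
  S (suc n) (λ k → Θ f k * g (n ℕ.∸ k) + f k * Θ g (n ℕ.∸ k))    ≡⟨ S-+ (suc n) (λ k → Θ f k * g (n ℕ.∸ k)) (λ k → f k * Θ g (n ℕ.∸ k)) ⟩
  S (suc n) (λ k → Θ f k * g (n ℕ.∸ k)) + S (suc n) (λ k → f k * Θ g (n ℕ.∸ k)) ≡⟨ cong₂ _+_ (conv (Θ f) g n) (conv f (Θ g) n) ⟨
  (Θ f ⊛ g ⊕ f ⊛ Θ g) n                                          ∎
  where
  open ≡-Reasoning
  open +-*-Solver

-- `ℓ` is Θf/f, stated without division.
LogDeriv : PS → PS → Set
LogDeriv f ℓ = Θ f ≋ f ⊛ ℓ

LogDeriv-cong : ∀ {f g} ℓ → f ≋ g → LogDeriv f ℓ → LogDeriv g ℓ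
LogDeriv-cong ℓ p d = Θ-cong (≋-sym p) ⨾ d ⨾ ⊛-congʳ ℓ p

LogDeriv-⊛ : ∀ f g ℓ ℓ′ → LogDeriv f ℓ → LogDeriv g ℓ′ → LogDeriv (f ⊛ g) (ℓ ⊕ ℓ′)
LogDeriv-⊛ f g ℓ ℓ′ p q = Θ-⊛ f g ⨾ ⊕-cong (⊛-congʳ g p) (⊛-congˡ f q)
  ⨾ PSI.solve 4 (λ f g l m → (f :* l) :* g :+ f :* (g :* m) := (f :* g) :* (l :+ m)) ≋-refl f g ℓ ℓ′
  where open PSI using (_:=_; _:+_; _:*_)

LogDeriv-ΠS : ∀ F ℓ → (∀ i → LogDeriv (F i) (ℓ i)) → ∀ n → LogDeriv (ΠS n F) (ΣPS.S n ℓ)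
LogDeriv-ΠS F ℓ d zero = (λ { zero → ℚₚ.*-zeroˡ 1ℚ ; (suc n) → ℚₚ.*-zeroʳ (ℕ→ℚ (suc n)) }) ⨾ ≋-sym (PSR.*-identityˡ 𝟘)
LogDeriv-ΠS F ℓ d (suc n) = LogDeriv-⊛ (F n) (ΠS n F) (ℓ n) (ΣPS.S n ℓ) (d n) (LogDeriv-ΠS F ℓ d n)
  ⨾ ⊛-congˡ (F n ⊛ ΠS n F) (PSR.+-comm (ℓ n) (ΣPS.S n ℓ) ⨾ ≋-sym (ΣPS.S-last n ℓ))

LogDeriv-Π∞ : ∀ F ℓ → Unital F → (∀ i → LogDeriv (F i) (ℓ i)) → (∀ i n → n ℕ.≤ i → ℓ i n ≡ 0ℚ) →
  LogDeriv (Π∞ F) (λ N → S N (λ i → ℓ i N))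
LogDeriv-Π∞ F ℓ u d v N = trans (LogDeriv-ΠS F ℓ d N N)
  (Agree-⊛ N (ΠS N F) (Π∞ F) (ΣPS.S N ℓ) (λ n → S n (λ i → ℓ i n)) (Agree-sym (Π∞-Agree F u N N ℕₚ.≤-refl))
    (λ n n≤N → trans (S-coeff N ℓ n) (S-extend n N (λ i → ℓ i n) (λ i n≤i → v i n n≤i) n≤N)) N ℕₚ.≤-refl)

ones : PS
ones _ = 1ℚ

om-ones : om 1 ⊛ ones ≋ one
om-ones = PSI.solve 3 (λ o q x → (o :+ :- q) :* x := o :* x :+ :- (q :* x)) ≋-refl one (mono 1) ones
  ⨾ ⊕-cong (PSR.*-identityˡ ones) ≋-refl ⨾ values
  where
  open PSI using (_:=_; _:+_; _:*_; :-_)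
  values : ones ⊕ ⊝ (mono 1 ⊛ ones) ≋ one
  values zero    = cong (λ z → 1ℚ + - z) (mono-⊛-< 1 ones 0 (s≤s z≤n))
  values (suc n) = cong (λ z → 1ℚ + - z) (trans (mono-⊛-suc 0 ones n) (PSR.*-identityˡ ones n))

om-geom : ∀ k .{{_ : NonZero k}} → om k ⊛ geom k ≋ one
om-geom k = ⊛-congʳ (geom k) (λ n → cong (λ e → om e n) (sym (ℕₚ.*-identityˡ k)))
  ⨾ ⊛-congʳ (geom k) (≋-sym (sub-om k 1)) ⨾ ≋-sym (sub-⊛ k (om 1) ones) ⨾ sub-cong k om-ones ⨾ sub-one k

-- Θ(1 - q^e)/(1 - q^e) = -e q^e/(1 - q^e) for e = d + 1.
lam : ℕ → PS
lam d = (- ℕ→ℚ (suc d)) · (geom (suc d) ⊕ ⊝ one)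

LogDeriv-om : ∀ d → LogDeriv (om (suc d)) (lam d)
LogDeriv-om d = left ⨾ ≋-sym (⊛-congˡ (om (suc d)) (≋-sym (K-⊛ c (geom (suc d) ⊕ ⊝ one)))
  ⨾ PSI.solve 4 (λ m k g o → m :* (k :* (g :+ :- o)) := k :* (m :* g :+ :- (m :* o))) ≋-refl (om (suc d)) (K c) (geom (suc d)) one
  ⨾ ⊛-congˡ (K c) (⊕-cong (om-geom (suc d)) (λ n → cong -_ (PSR.*-identityʳ (om (suc d)) n)))
  ⨾ ⊛-congˡ (K c) (PSI.solve 2 (λ o q → o :+ :- (o :+ :- q) := q) ≋-refl one (mono (suc d)))
  ⨾ K-⊛ c (mono (suc d)))
  where
  open PSI using (_:=_; _:+_; _:*_; :-_)
  c = - ℕ→ℚ (suc d)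
  left : Θ (om (suc d)) ≋ c · mono (suc d)
  left zero    = trans (ℚₚ.*-zeroˡ (1ℚ + - 0ℚ)) (sym (ℚₚ.*-zeroʳ c))
  left (suc n) with d ℕ.≟ n
  ... | yes refl = trans (cong (λ z → ℕ→ℚ (suc d) * (0ℚ + - z)) (mono-refl d)) (trans (sym (ℚₚ.neg-distribʳ-* (ℕ→ℚ (suc d)) 1ℚ)) (trans (ℚₚ.neg-distribˡ-* (ℕ→ℚ (suc d)) 1ℚ) (cong (c *_) (sym (mono-refl d)))))
  ... | no d≢n = trans (cong (λ z → ℕ→ℚ (suc n) * (0ℚ + - z)) (mono-≢ d n d≢n)) (trans (ℚₚ.*-zeroʳ (ℕ→ℚ (suc n))) (sym (trans (cong (c *_) (mono-≢ d n d≢n)) (ℚₚ.*-zeroʳ c))))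

lam-0 : ∀ d → lam d 0 ≡ 0ℚ
lam-0 d = trans (cong (λ b → (- ℕ→ℚ (suc d)) * ((if b then 1ℚ else 0ℚ) + - 1ℚ)) (dec-true (suc d ∣? 0) (suc d ∣.∣0))) (ℚₚ.*-zeroʳ (- ℕ→ℚ (suc d)))

lam-suc : ∀ d n → lam d (suc n) ≡ (if does (suc d ∣? suc n) then - ℕ→ℚ (suc d) else 0ℚ)
lam-suc d n with does (suc d ∣? suc n)
... | true  = ℚₚ.*-identityʳ (- ℕ→ℚ (suc d))
... | false = ℚₚ.*-zeroʳ (- ℕ→ℚ (suc d))

lam-vanish : ∀ d n → n ℕ.≤ d → lam d n ≡ 0ℚ
lam-vanish d zero    _   = lam-0 d
lam-vanish d (suc n) n<d = trans (lam-suc d n) (cong (λ b → if b then - ℕ→ℚ (suc d) else 0ℚ) (dec-false (suc d ∣? suc n) (∣.>⇒∤ (s≤s n<d))))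

lam5 : ℕ → PS
lam5 r N = S N (λ i → lam (r ℕ.+ i ℕ.* 5) N)

LogDeriv-Pr : ∀ r → LogDeriv (Pr r 5) (lam5 r)
LogDeriv-Pr r = LogDeriv-Π∞ (λ i → om (suc (r ℕ.+ i ℕ.* 5))) (λ i → lam (r ℕ.+ i ℕ.* 5)) (Pr-unital r 5)
  (λ i → LogDeriv-om (r ℕ.+ i ℕ.* 5)) (λ i n n≤i → lam-vanish (r ℕ.+ i ℕ.* 5) n (ℕₚ.≤-trans n≤i (ℕₚ.≤-trans (ℕₚ.m≤m*n i 5) (ℕₚ.m≤n+m _ r))))

sumℚ-filter : ∀ {P : ℕ → Set} (P? : Decidable P) F xs →
  sumℚ (map F (filter P? xs)) ≡ sumℚ (map (λ k → if does (P? k) then F k else 0ℚ) xs)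
sumℚ-filter P? F []       = refl
sumℚ-filter P? F (x ∷ xs) with does (P? x)
... | true  = cong (F x +_) (sumℚ-filter P? F xs)
... | false = trans (sumℚ-filter P? F xs) (sym (ℚₚ.+-identityˡ _))

-- Defined for every d, with 0 off the divisors and at d = 0, so divisor sums become sums over any
-- sufficiently long interval and can be split into residue classes.
divisorTerm : (χ ψ : ℕ → ℚ) → ℕ → ℕ → ℚ
divisorTerm χ ψ n zero    = 0ℚ
divisorTerm χ ψ n (suc k) = if does (suc k ∣? n) then ψ (suc k) * χ (n ℕ./ suc k) * ℕ→ℚ (suc k) else 0ℚ

divisorTerm-∤ : ∀ χ ψ n d → ¬ d ∣ n → divisorTerm χ ψ n d ≡ 0ℚ
divisorTerm-∤ χ ψ n zero    _   = refl
divisorTerm-∤ χ ψ n (suc k) d∤n = cong (λ b → if b then ψ (suc k) * χ (n ℕ./ suc k) * ℕ→ℚ (suc k) else 0ℚ) (dec-false (suc k ∣? n) d∤n)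

divisorTerm-∣ : ∀ χ ψ m d .{{_ : NonZero d}} → divisorTerm χ ψ (m ℕ.* d) d ≡ ψ d * χ m * ℕ→ℚ d
divisorTerm-∣ χ ψ m (suc k) = trans (cong (λ b → if b then ψ (suc k) * χ (m ℕ.* suc k ℕ./ suc k) * ℕ→ℚ (suc k) else 0ℚ) (dec-true (suc k ∣? (m ℕ.* suc k)) (∣.n∣m*n m)))
  (cong (λ z → ψ (suc k) * χ z * ℕ→ℚ (suc k)) (m*n/n≡m m (suc k)))

σ-sum : ∀ χ ψ n M .{{_ : NonZero n}} → n ℕ.< M → σ χ ψ n ≡ S M (divisorTerm χ ψ n)
σ-sum χ ψ n M n<M = trans (sumℚ-filter (λ k → suc k ∣? n) _ (upTo n))
  (trans (sumℚ-upTo n (λ k → divisorTerm χ ψ n (suc k)))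
  (trans (sym (ℚₚ.+-identityˡ (S n (λ k → divisorTerm χ ψ n (suc k)))))
         (sym (S-extend (suc n) M (divisorTerm χ ψ n) (λ d n<d → divisorTerm-∤ χ ψ n d (∣.>⇒∤ n<d)) n<M))))

χ-table : ℕ → ℚ
χ-table 1 = 1ℚ
χ-table 4 = 1ℚ
χ-table 2 = - 1ℚ
χ-table 3 = - 1ℚ
χ-table _ = 0ℚ

χ₁-table : ∀ m → χ₁ m ≡ χ-table (m % 5)
χ₁-table m with m % 5
... | 0 = refl
... | 1 = refl
... | 2 = refl
... | 3 = refl
... | 4 = refl
... | suc (suc (suc (suc (suc _)))) = refl

χ₁-periodic : ∀ r i → χ₁ (r ℕ.+ i ℕ.* 5) ≡ χ-table (r % 5)
χ₁-periodic r i = trans (χ₁-table (r ℕ.+ i ℕ.* 5)) (cong χ-table ([m+kn]%n≡m%n r i 5))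

-- `lam5 r` collects the divisors congruent to r + 1 modulo 5, so the signs are those of -χ₁ up to
-- the sign inside `lam`. The constant offsets the value -1/5 of E₀₁ at q = 0.
E₀₁-lam : lam5 0 ⊕ lam5 3 ⊕ ⊝ lam5 1 ⊕ ⊝ lam5 2 ≋ ⊝ E₀₁ ⊕ K (- (pos 1 ℚ./ 5))
E₀₁-lam zero = refl
E₀₁-lam N@(suc n) = sym (begin
  - σ χ₀ χ₁ N + c * 0ℚ                                   ≡⟨ trans (cong (- σ χ₀ χ₁ N +_) (ℚₚ.*-zeroʳ c)) (ℚₚ.+-identityʳ (- σ χ₀ χ₁ N)) ⟩
  -- Divisors are sought up to 5N, which makes the range consist of N full blocks of residues modulo
  -- 5.
  - σ χ₀ χ₁ N                                            ≡⟨ cong -_ (trans (σ-sum χ₀ χ₁ N (suc (N ℕ.* 5)) (s≤s (ℕₚ.m≤m*n N 5))) (ℚₚ.+-identityˡ (S (N ℕ.* 5) G))) ⟩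
  - S (N ℕ.* 5) G                                        ≡⟨ cong -_ (trans (S-block 5 N G) (S-cong N _ H (λ j _ → inner j))) ⟩
  - S N H                                                ≡⟨ cong -_ linear ⟩
  - (((- a 0 + - a 3) + a 1) + a 2)                      ≡⟨ solve 4 (λ a b c d → :- (((:- a :+ :- d) :+ b) :+ c) := ((a :+ d) :+ :- b) :+ :- c) refl (a 0) (a 1) (a 2) (a 3) ⟩
  ((a 0 + a 3) + - a 1) + - a 2                          ∎)
  where
  open ≡-Reasoning
  open +-*-Solver
  c = - (pos 1 ℚ./ 5)
  G : ℕ → ℚ
  G k = divisorTerm χ₀ χ₁ N (suc k)
  a : ℕ → ℚ
  a r = lam5 r N
  L : ℕ → ℕ → ℚ
  L r j = lam (r ℕ.+ j ℕ.* 5) N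
  H : ℕ → ℚ
  H j = ((- L 0 j + - L 3 j) + L 1 j) + L 2 j
  G-value : ∀ r j → G (r ℕ.+ j ℕ.* 5) ≡ - (χ-table (suc r % 5)) * L r j
  G-value r j = trans (cong (λ x → if does (d ∣? N) then x * 1ℚ * ℕ→ℚ d else 0ℚ) (χ₁-periodic (suc r) j)) (trans (lemma (does (d ∣? N))) (cong (- χ-table (suc r % 5) *_) (sym (lam-suc (r ℕ.+ j ℕ.* 5) n))))
    where
    d = suc (r ℕ.+ j ℕ.* 5)
    lemma : ∀ b → (if b then χ-table (suc r % 5) * 1ℚ * ℕ→ℚ d else 0ℚ) ≡ - χ-table (suc r % 5) * (if b then - ℕ→ℚ d else 0ℚ)
    lemma true  = solve 2 (λ x y → x :* con 1ℚ :* y := :- x :* :- y) refl (χ-table (suc r % 5)) (ℕ→ℚ d)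
    lemma false = sym (ℚₚ.*-zeroʳ (- χ-table (suc r % 5)))
  inner : ∀ j → S 5 (λ r → G (r ℕ.+ j ℕ.* 5)) ≡ H j
  inner j = trans (cong₂ _+_ (G-value 0 j) (cong₂ _+_ (G-value 1 j) (cong₂ _+_ (G-value 2 j) (cong₂ _+_ (G-value 3 j) (cong (_+ 0ℚ) (G-value 4 j))))))
    (solve 5 (λ x y z w v → (:- con 1ℚ) :* x :+ ((:- (:- con 1ℚ)) :* y :+ ((:- (:- con 1ℚ)) :* z :+ ((:- con 1ℚ) :* w :+ ((:- con 0ℚ) :* v :+ con 0ℚ))))
       := ((:- x :+ :- w) :+ y) :+ z) refl (L 0 j) (L 1 j) (L 2 j) (L 3 j) (L 4 j))
  S-neg : ∀ F → S N (λ j → - F j) ≡ - S N F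
  S-neg F = trans (S-cong N _ _ (λ j _ → solve 1 (λ x → :- x := (:- con 1ℚ) :* x) refl (F j)))
    (trans (S-*ˡ N (- 1ℚ) F) (solve 1 (λ x → (:- con 1ℚ) :* x := :- x) refl (S N F)))
  linear : S N H ≡ ((- a 0 + - a 3) + a 1) + a 2
  linear = trans (S-+ N (λ j → (- L 0 j + - L 3 j) + L 1 j) (L 2)) (cong (_+ a 2)
    (trans (S-+ N (λ j → - L 0 j + - L 3 j) (L 1)) (cong (_+ a 1)
      (trans (S-+ N (λ j → - L 0 j) (λ j → - L 3 j)) (cong₂ _+_ (S-neg (L 0)) (S-neg (L 3)))))))

E₀₁-lam-fifth : κ 5 ⊛ K (- (pos 1 ℚ./ 5)) ≋ ⊝ one
E₀₁-lam-fifth zero    = refl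
E₀₁-lam-fifth (suc n) = trans (PSR.*-comm (κ 5) (K (- (pos 1 ℚ./ 5))) (suc n)) (K-⊛ (- (pos 1 ℚ./ 5)) (κ 5) (suc n))

f₁≋JT21 : f₁ ≋ JT 2 1
f₁≋JT21 = f₁-block 3 ⨾ PSI.solve 4 (λ a b c o → a :* (b :* (c :* o)) := a :* (c :* b) :* o) ≋-refl (Pr 2 3) (Pr 1 3) (Pr 0 3) one
  ⨾ PSR.*-identityʳ (Pr 2 3 ⊛ (Pr 0 3 ⊛ Pr 1 3)) ⨾ ≋-sym (jacobi-triple 1 0)
  where open PSI using (_:=_; _:*_)

f₁≋JT12 : f₁ ≋ JT 1 2
f₁≋JT12 = f₁-block 3 ⨾ PSI.solve 4 (λ a b c o → a :* (b :* (c :* o)) := a :* (b :* c) :* o) ≋-refl (Pr 2 3) (Pr 1 3) (Pr 0 3) one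
  ⨾ PSR.*-identityʳ (Pr 2 3 ⊛ (Pr 1 3 ⊛ Pr 0 3)) ⨾ ≋-sym (jacobi-triple 0 1)
  where open PSI using (_:=_; _:*_)

JT32⊛JT41 : JT 3 2 ⊛ JT 4 1 ≋ f₁ ⊛ sub 5 f₁
JT32⊛JT41 = ⊛-cong (jacobi-triple 2 1) (jacobi-triple 3 0)
  ⨾ PSI.solve 5 (λ a b c d e → (e :* (b :* c)) :* (e :* (a :* d)) := (e :* (d :* (c :* (b :* (a :* # 1))))) :* e) ≋-refl (Pr 0 5) (Pr 1 5) (Pr 2 5) (Pr 3 5) (Pr 4 5)
  ⨾ ⊛-cong
      (⊛-congˡ (Pr 4 5) (⊛-congˡ (Pr 3 5) (⊛-congˡ (Pr 2 5) (⊛-congˡ (Pr 1 5) (⊛-congˡ (Pr 0 5) (PSR.+-identityʳ one))))) ⨾ ≋-sym (f₁-block 5)) (≋-sym (sub-f₁ 4))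
  where open PSI using (_:=_; _:*_; #_)

-- h / g is the Rogers–Ramanujan continued fraction without its factor q^(1/5), which accounts
-- for the first summand.
wronskian : let g = JT 3 2 ; h = JT 4 1 in
  κ 8 ⊛ (g ⊛ h) ⊕ κ 40 ⊛ (g ⊛ Θ h) ⊕ ⊝ (κ 40 ⊛ (Θ g ⊛ h)) ≋ κ 8 ⊛ ((f₁ ⊛ (f₁ ⊛ f₁)) ⊛ (f₁ ⊛ (f₁ ⊛ f₁)))
wronskian = ≋-sym expand ⨾ ⊛-cancelˡ (κ 4) _ _ (λ ())
    (≋-sym W.four-pieces ⨾ W.total ⨾ PSI.solve 1 (λ a → # 32 :* a := # 4 :* (# 8 :* a)) ≋-refl (F ⊛ F))
  where
  module W = Wronskian
  open PSI using (_:=_; _:*_; #_)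
  F = f₁ ⊛ (f₁ ⊛ f₁)
  g = JT 3 2
  h = JT 4 1
  pg = E-proper 3 2
  ph = E-proper 4 1
  c₀ c₁ c₂ : ℤ × ℤ → ℚ
  c₀ mn = sgn (proj₁ mn) * sgn (proj₂ mn)
  c₁ mn = sgn (proj₁ mn) * (ℕ→ℚ (E 4 1 (proj₂ mn)) * sgn (proj₂ mn))
  c₂ mn = (ℕ→ℚ (E 3 2 (proj₁ mn)) * sgn (proj₁ mn)) * sgn (proj₂ mn)
  poly-value : ∀ m n → ι (Plane.⟪_⟫ W.W′ (m , n)) ≡ (ι (pos 8) + ι (pos 40) * ℕ→ℚ (E 4 1 n)) + - (ι (pos 40) * ℕ→ℚ (E 3 2 m))
  poly-value m n = trans (cong ι (trans (cong₂ (λ x y → pos 8 ℤ.+ pos 20 ℤ.* x ℤ.- pos 20 ℤ.* y) (sym (_IsHalf_.double (E-half 4 1 n))) (sym (_IsHalf_.double (E-half 3 2 m))))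
      (ring (pos (E 4 1 n)) (pos (E 3 2 m)))))
    (trans (ℚI.fromℤ-+ (pos 8 ℤ.+ pos 40 ℤ.* pos (E 4 1 n)) (ℤ.- (pos 40 ℤ.* pos (E 3 2 m))))
      (cong₂ _+_ (trans (ℚI.fromℤ-+ (pos 8) (pos 40 ℤ.* pos (E 4 1 n))) (cong (ι (pos 8) +_) (scale (E 4 1 n))))
                 (trans (ℚI.fromℤ-neg (pos 40 ℤ.* pos (E 3 2 m))) (cong -_ (scale (E 3 2 m))))))
    where
    ring : ∀ x y → pos 8 ℤ.+ pos 20 ℤ.* (pos 2 ℤ.* x) ℤ.- pos 20 ℤ.* (pos 2 ℤ.* y) ≡ (pos 8 ℤ.+ pos 40 ℤ.* x) ℤ.- pos 40 ℤ.* y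
    ring = ℤ-Solver.solve-∀
    scale : ∀ e → ι (pos 40 ℤ.* pos e) ≡ ι (pos 40) * ℕ→ℚ e
    scale e = trans (ℚI.fromℤ-* (pos 40) (pos e)) (cong (ι (pos 40) *_) (sym (ℕ→ℚ≡ι e)))
  weights : ∀ mn → (Plane.signed W.W′) mn ≡ (ι (pos 8) * c₀ mn + ι (pos 40) * c₁ mn) + (- ι (pos 40)) * c₂ mn
  weights (m , n) = trans (cong ((sgn m * sgn n) *_) (poly-value m n))
    (solveℚ 6 (λ s t a b x y → (s :×: t) :×: ((a :⊞: b :×: x) :⊞: :∸ (b :×: y)) :≡: (a :×: (s :×: t) :⊞: b :×: (s :×: (x :×: t))) :⊞: (:∸ b) :×: ((y :×: s) :×: t)) refl
      (sgn m) (sgn n) (ι (pos 8)) (ι (pos 40)) (ℕ→ℚ (E 4 1 n)) (ℕ→ℚ (E 3 2 m)))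
  expand : th (Plane.signed W.W′) W.e′ W.p′ ≋ κ 8 ⊛ (g ⊛ h) ⊕ κ 40 ⊛ (g ⊛ Θ h) ⊕ ⊝ (κ 40 ⊛ (Θ g ⊛ h))
  expand = th-cong W.p′ W.p′ weights (λ _ → refl)
    ⨾ th-⊕ (λ mn → ι (pos 8) * c₀ mn + ι (pos 40) * c₁ mn) (λ mn → (- ι (pos 40)) * c₂ mn) W.e′ W.p′
    ⨾ ⊕-cong (th-⊕ (λ mn → ι (pos 8) * c₀ mn) (λ mn → ι (pos 40) * c₁ mn) W.e′ W.p′
              ⨾ ⊕-cong (th-· (ι (pos 8)) c₀ W.e′ W.p′ ⨾ ι-· 8 (th c₀ W.e′ W.p′) ⨾ ⊛-congˡ (κ 8) (≋-sym (th-⊛ sgn (E 3 2) pg sgn (E 4 1) ph)))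
                       (th-· (ι (pos 40)) c₁ W.e′ W.p′ ⨾ ι-· 40 (th c₁ W.e′ W.p′) ⨾ ⊛-congˡ (κ 40) (≋-sym
                          (⊛-congˡ g (th-twist ℕ→ℚ sgn (E 4 1) ph) ⨾ th-⊛ sgn (E 3 2) pg (λ i → ℕ→ℚ (E 4 1 i) * sgn i) (E 4 1) ph))))
             (th-· (- ι (pos 40)) c₂ W.e′ W.p′ ⨾ (λ n → sym (ℚₚ.neg-distribˡ-* (ι (pos 40)) (th c₂ W.e′ W.p′ n)))
               ⨾ (λ n → cong -_ ((ι-· 40 (th c₂ W.e′ W.p′) ⨾ ⊛-congˡ (κ 40) (≋-sym
                          (⊛-congʳ h (th-twist ℕ→ℚ sgn (E 3 2) pg) ⨾ th-⊛ (λ i → ℕ→ℚ (E 3 2 i) * sgn i) (E 3 2) pg sgn (E 4 1) ph))) n)))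

-- The Wronskian is 8gh(1 + 5(ℓ' - ℓ)), with ℓ' and ℓ the logarithmic derivatives of h and g. Here
-- gh = f₁f₅ and 5(ℓ' - ℓ) = -5E₀₁ - 1, so the constants cancel and -40 f₁ f₅ E₀₁ = 8f₁⁶ remains.
E₀₁-eta : κ 5 ⊛ (sub 5 f₁ ⊛ E₀₁) ≋ ⊝ (f₁ ^ 5)
E₀₁-eta = ⊛-cancelˡ f₁ _ _ (λ ())
  (⊛-cancelˡ (κ 8) _ _ (λ ())
  (PSI.solve 3 (λ a b e → # 8 :* (a :* (# 5 :* (b :* e))) := :- (# 8 :* (a :* b) :+ # 8 :* ((a :* b) :* (# 5 :* (:- e) :+ :- # 1)))) ≋-refl f₁ f₅ E₀₁
  ⨾ (λ n → cong -_ (main n))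
  ⨾ PSI.solve 1 (λ a → :- (# 8 :* ((a :* (a :* a)) :* (a :* (a :* a)))) := # 8 :* (a :* (:- (a :^ 5)))) ≋-refl f₁))
  where
  open PSI using (_:=_; _:*_; _:+_; :-_; _:^_; #_)
  f₅ = sub 5 f₁
  g = JT 3 2
  h = JT 4 1
  l = lam5
  n8 = κ 8
  dg : LogDeriv g (l 4 ⊕ (l 1 ⊕ l 2))
  dg = LogDeriv-cong (l 4 ⊕ (l 1 ⊕ l 2)) (≋-sym (jacobi-triple 2 1)) (LogDeriv-⊛ (Pr 4 5) (Pr 1 5 ⊛ Pr 2 5) (l 4) (l 1 ⊕ l 2) (LogDeriv-Pr 4) (LogDeriv-⊛ (Pr 1 5) (Pr 2 5) (l 1) (l 2) (LogDeriv-Pr 1) (LogDeriv-Pr 2)))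
  dh : LogDeriv h (l 4 ⊕ (l 0 ⊕ l 3))
  dh = LogDeriv-cong (l 4 ⊕ (l 0 ⊕ l 3)) (≋-sym (jacobi-triple 3 0)) (LogDeriv-⊛ (Pr 4 5) (Pr 0 5 ⊛ Pr 3 5) (l 4) (l 0 ⊕ l 3) (LogDeriv-Pr 4) (LogDeriv-⊛ (Pr 0 5) (Pr 3 5) (l 0) (l 3) (LogDeriv-Pr 0) (LogDeriv-Pr 3)))
  lams : κ 5 ⊛ (l 0 ⊕ l 3 ⊕ ⊝ l 1 ⊕ ⊝ l 2) ≋ κ 5 ⊛ (⊝ E₀₁) ⊕ ⊝ κ 1
  lams = ⊛-congˡ (κ 5) E₀₁-lam ⨾ PSR.distribˡ (κ 5) (⊝ E₀₁) (K (- (pos 1 ℚ./ 5)))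
    ⨾ ⊕-cong (≋-refl {κ 5 ⊛ (⊝ E₀₁)}) (E₀₁-lam-fifth ⨾ λ n → cong -_ (sym (PSR.+-identityʳ one n)))
  main : n8 ⊛ (f₁ ⊛ f₅) ⊕ n8 ⊛ ((f₁ ⊛ f₅) ⊛ (κ 5 ⊛ (⊝ E₀₁) ⊕ ⊝ κ 1)) ≋ n8 ⊛ ((f₁ ⊛ (f₁ ⊛ f₁)) ⊛ (f₁ ⊛ (f₁ ⊛ f₁)))
  main = ⊕-cong (⊛-congˡ n8 (≋-sym JT32⊛JT41)) (⊛-congˡ n8 (⊛-cong (≋-sym JT32⊛JT41) (≋-sym lams)))
    ⨾ PSI.solve 7 (λ g h l₀ l₁ l₂ l₃ l₄ → # 8 :* (g :* h) :+ # 8 :* ((g :* h) :* (# 5 :* (l₀ :+ l₃ :+ :- l₁ :+ :- l₂)))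
        := # 8 :* (g :* h) :+ # 40 :* (g :* (h :* (l₄ :+ (l₀ :+ l₃)))) :+ :- (# 40 :* ((g :* (l₄ :+ (l₁ :+ l₂))) :* h))) ≋-refl g h (l 0) (l 1) (l 2) (l 3) (l 4)
    ⨾ ⊕-cong (⊕-cong (≋-refl {n8 ⊛ (g ⊛ h)}) (⊛-congˡ (κ 40) (⊛-congˡ g (≋-sym dh)))) (λ n → cong -_ (⊛-congˡ (κ 40) (⊛-congʳ h (≋-sym dg)) n))
    ⨾ wronskian

-- Hecke relations

divides-cancel : ∀ {p d n} → Prime p → ¬ p ∣ d → d ∣ n ℕ.* p → d ∣ n
divides-cancel {p} {d} {n} pp p∤d (divides c np≡cd) with euclidsLemma c d pp (divides n (sym np≡cd))
... | inj₂ p∣d = ⊥-elim (p∤d p∣d)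
... | inj₁ (divides c′ refl) = divides c′ (ℕₚ.*-cancelʳ-≡ n (c′ ℕ.* d) p {{prime⇒nonZero pp}}
  (trans np≡cd (trans (ℕₚ.*-assoc c′ p d) (trans (cong (c′ ℕ.*_) (ℕₚ.*-comm p d)) (sym (ℕₚ.*-assoc c′ d p))))))

prime-2 : Prime 2
prime-2 = from-yes (prime? 2)

prime-5 : Prime 5
prime-5 = from-yes (prime? 5)

χ₁-* : ∀ m n → χ₁ (m ℕ.* n) ≡ χ₁ m * χ₁ n
χ₁-* m n = trans (χ₁-table (m ℕ.* n)) (trans (cong χ-table (%-distribˡ-* m n 5)) (trans (mult (m%n<n m 5) (m%n<n n 5)) (sym (cong₂ _*_ (χ₁-table m) (χ₁-table n)))))
  where
  table : ∀ (a b : Fin 5) → χ-table ((toℕ a ℕ.* toℕ b) % 5) ≡ χ-table (toℕ a) * χ-table (toℕ b)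
  table = from-yes (Finₚ.all? {n = 5} (λ a → Finₚ.all? {n = 5} (λ b → χ-table ((toℕ a ℕ.* toℕ b) % 5) ℚ.≟ χ-table (toℕ a) * χ-table (toℕ b))))
  mult : ∀ {a b} → a ℕ.< 5 → b ℕ.< 5 → χ-table ((a ℕ.* b) % 5) ≡ χ-table a * χ-table b
  mult {a} {b} a<5 b<5 = subst (λ x → χ-table ((x ℕ.* b) % 5) ≡ χ-table x * χ-table b) (Finₚ.toℕ-fromℕ< a<5)
    (subst (λ y → χ-table ((toℕ (fromℕ< a<5) ℕ.* y) % 5) ≡ χ-table (toℕ (fromℕ< a<5)) * χ-table y) (Finₚ.toℕ-fromℕ< b<5) (table (fromℕ< a<5) (fromℕ< b<5)))

χ₁-5∣ : ∀ n → 5 ∣ n → χ₁ n ≡ 0ℚ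
χ₁-5∣ .(m ℕ.* 5) (divides m refl) = trans (χ₁-* m 5) (ℚₚ.*-zeroʳ (χ₁ m))

χ₁-sq : ∀ n → ¬ 5 ∣ n → χ₁ n * χ₁ n ≡ 1ℚ
χ₁-sq n 5∤n = trans (cong₂ _*_ (χ₁-table n) (χ₁-table n)) (cases (n % 5) refl (m%n<n n 5))
  where
  cases : ∀ r → n % 5 ≡ r → r ℕ.< 5 → χ-table r * χ-table r ≡ 1ℚ
  cases 0 eq _ = ⊥-elim (5∤n (∣.m%n≡0⇒n∣m n 5 eq))
  cases 1 _ _ = refl
  cases 2 _ _ = refl
  cases 3 _ _ = refl
  cases 4 _ _ = refl
  cases (suc (suc (suc (suc (suc _))))) _ (s≤s (s≤s (s≤s (s≤s (s≤s ())))))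

term₀₁ term₁₀ : ℕ → ℕ → ℚ
term₀₁ = divisorTerm χ₀ χ₁
term₁₀ = divisorTerm χ₁ χ₀

E₀₁-sum : ∀ n M .{{_ : NonZero n}} → n ℕ.< M → E₀₁ n ≡ S M (term₀₁ n)
E₀₁-sum (suc n) M n<M = σ-sum χ₀ χ₁ (suc n) M n<M

E₁₀-sum : ∀ n M .{{_ : NonZero n}} → n ℕ.< M → E₁₀ n ≡ S M (term₁₀ n)
E₁₀-sum (suc n) M n<M = σ-sum χ₁ χ₀ (suc n) M n<M

divisorTerm-zero : ∀ χ ψ n d → (∀ m → n ≡ m ℕ.* d → ψ d * χ m * ℕ→ℚ d ≡ 0ℚ) → divisorTerm χ ψ n d ≡ 0ℚ
divisorTerm-zero χ ψ n zero      p = refl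
divisorTerm-zero χ ψ n d@(suc _) p = cases (d ∣? n)
  where
  cases : Dec (d ∣ n) → divisorTerm χ ψ n d ≡ 0ℚ
  cases (yes (divides m eq)) = trans (cong (λ z → divisorTerm χ ψ z d) eq) (trans (divisorTerm-∣ χ ψ m d) (p m eq))
  cases (no d∤n) = divisorTerm-∤ χ ψ n d d∤n

-- The divisors of 5n that do not divide n are multiples of 5, where χ₁ vanishes.
E₀₁-5 : ∀ n → E₀₁ (n ℕ.* 5) ≡ E₀₁ n
E₀₁-5 zero      = refl
E₀₁-5 n@(suc _) = trans (E₀₁-sum (n ℕ.* 5) M ℕₚ.≤-refl) (trans (S-cong M _ _ (λ d _ → termwise d)) (sym (E₀₁-sum n M (s≤s (ℕₚ.m≤m*n n 5)))))
  where
  M = suc (n ℕ.* 5)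
  vanish : ∀ k d → 5 ∣ d → term₀₁ k d ≡ 0ℚ
  vanish k d 5∣d = divisorTerm-zero χ₀ χ₁ k d (λ m _ → trans (cong (λ z → z * 1ℚ * ℕ→ℚ d) (χ₁-5∣ d 5∣d)) (ℚₚ.*-zeroˡ (ℕ→ℚ d)))
  termwise : ∀ d → term₀₁ (n ℕ.* 5) d ≡ term₀₁ n d
  termwise zero      = refl
  termwise d@(suc _) with 5 ∣? d
  ... | yes 5∣d = trans (vanish (n ℕ.* 5) d 5∣d) (sym (vanish n d 5∣d))
  ... | no 5∤d  = cases (d ∣? n)
    where
    swap : ∀ m → m ℕ.* d ℕ.* 5 ≡ m ℕ.* 5 ℕ.* d
    swap m = trans (ℕₚ.*-assoc m d 5) (trans (cong (m ℕ.*_) (ℕₚ.*-comm d 5)) (sym (ℕₚ.*-assoc m 5 d)))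
    cases : Dec (d ∣ n) → term₀₁ (n ℕ.* 5) d ≡ term₀₁ n d
    cases (yes (divides m eq)) = trans (cong (λ z → term₀₁ z d) (trans (cong (ℕ._* 5) eq) (swap m)))
      (trans (divisorTerm-∣ χ₀ χ₁ (m ℕ.* 5) d) (trans (sym (divisorTerm-∣ χ₀ χ₁ m d)) (cong (λ z → term₀₁ z d) (sym eq))))
    cases (no d∤n) = trans (divisorTerm-∤ χ₀ χ₁ (n ℕ.* 5) d (d∤n ∘ divides-cancel prime-5 5∤d)) (sym (divisorTerm-∤ χ₀ χ₁ n d d∤n))

-- If 5 does not divide d, it divides the cofactor, where χ₁ vanishes. What survives are the
-- divisors 5j with j dividing n.
E₁₀-5 : ∀ n → E₁₀ (n ℕ.* 5) ≡ ι (pos 5) * E₁₀ n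
E₁₀-5 zero      = refl
E₁₀-5 n@(suc _) = begin
  E₁₀ (n ℕ.* 5)                             ≡⟨ E₁₀-sum (n ℕ.* 5) (suc n ℕ.* 5) (ℕₚ.*-monoˡ-< 5 (ℕₚ.n<1+n n)) ⟩
  S (suc n ℕ.* 5) (term₁₀ (n ℕ.* 5))        ≡⟨ S-multiples 5 (suc n) (term₁₀ (n ℕ.* 5)) vanish ⟩
  S (suc n) (λ j → term₁₀ (n ℕ.* 5) (j ℕ.* 5)) ≡⟨ S-cong (suc n) _ _ (λ j _ → termwise j) ⟩
  S (suc n) (λ j → ι (pos 5) * term₁₀ n j)  ≡⟨ S-*ˡ (suc n) (ι (pos 5)) (term₁₀ n) ⟩
  ι (pos 5) * S (suc n) (term₁₀ n)          ≡⟨ cong (ι (pos 5) *_) (E₁₀-sum n (suc n) ℕₚ.≤-refl) ⟨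
  ι (pos 5) * E₁₀ n                         ∎
  where
  open ≡-Reasoning
  open +-*-Solver
  vanish : ∀ d → ¬ 5 ∣ d → term₁₀ (n ℕ.* 5) d ≡ 0ℚ
  vanish d 5∤d = divisorTerm-zero χ₁ χ₀ (n ℕ.* 5) d (λ m eq → trans (cong (λ z → 1ℚ * z * ℕ→ℚ d) (χ₁-5∣ m (5∣m m eq))) (ℚₚ.*-zeroˡ (ℕ→ℚ d)))
    where
    5∣m : ∀ m → n ℕ.* 5 ≡ m ℕ.* d → 5 ∣ m
    5∣m m eq with euclidsLemma m d prime-5 (divides n (sym eq))
    ... | inj₁ p = p
    ... | inj₂ q = ⊥-elim (5∤d q)
  termwise : ∀ j → term₁₀ (n ℕ.* 5) (j ℕ.* 5) ≡ ι (pos 5) * term₁₀ n j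
  termwise zero      = sym (ℚₚ.*-zeroʳ (ι (pos 5)))
  termwise j@(suc _) = cases (j ∣? n)
    where
    cases : Dec (j ∣ n) → term₁₀ (n ℕ.* 5) (j ℕ.* 5) ≡ ι (pos 5) * term₁₀ n j
    cases (yes (divides m eq)) = trans (cong (λ z → term₁₀ z (j ℕ.* 5)) (trans (cong (ℕ._* 5) eq) (ℕₚ.*-assoc m j 5)))
      (trans (divisorTerm-∣ χ₁ χ₀ m (j ℕ.* 5)) (trans (trans (cong (1ℚ * χ₁ m *_) (ℕ→ℚ-* j 5))
        (solve 3 (λ x y z → con 1ℚ :* x :* (y :* z) := z :* (con 1ℚ :* x :* y)) refl (χ₁ m) (ℕ→ℚ j) (ι (pos 5))))
      (cong (ι (pos 5) *_) (trans (sym (divisorTerm-∣ χ₁ χ₀ m j)) (cong (λ z → term₁₀ z j) (sym eq))))))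
    cases (no j∤n) = trans (divisorTerm-∤ χ₁ χ₀ (n ℕ.* 5) (j ℕ.* 5) (j∤n ∘ ∣.*-cancelʳ-∣ 5))
      (sym (trans (cong (ι (pos 5) *_) (divisorTerm-∤ χ₁ χ₀ n j j∤n)) (ℚₚ.*-zeroʳ (ι (pos 5)))))

-- χ₁(n/d) = χ₁(n)χ₁(d), because χ₁(d) is ±1 for every divisor d of such an n.
E₁₀-twist : ∀ n → ¬ 5 ∣ n → E₁₀ n ≡ χ₁ n * E₀₁ n
E₁₀-twist zero      5∤n = ⊥-elim (5∤n (5 ∣.∣0))
E₁₀-twist n@(suc _) 5∤n = trans (E₁₀-sum n (suc n) ℕₚ.≤-refl) (trans (S-cong (suc n) _ _ (λ d _ → termwise d))
  (trans (S-*ˡ (suc n) (χ₁ n) (term₀₁ n)) (cong (χ₁ n *_) (sym (E₀₁-sum n (suc n) ℕₚ.≤-refl)))))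
  where
  open +-*-Solver
  termwise : ∀ d → term₁₀ n d ≡ χ₁ n * term₀₁ n d
  termwise zero      = sym (ℚₚ.*-zeroʳ (χ₁ n))
  termwise d@(suc _) = cases (d ∣? n)
    where
    cases : Dec (d ∣ n) → term₁₀ n d ≡ χ₁ n * term₀₁ n d
    cases (no d∤n) = trans (divisorTerm-∤ χ₁ χ₀ n d d∤n) (sym (trans (cong (χ₁ n *_) (divisorTerm-∤ χ₀ χ₁ n d d∤n)) (ℚₚ.*-zeroʳ (χ₁ n))))
    cases (yes d∣n@(divides m eq)) = trans (cong (λ z → term₁₀ z d) eq) (trans (divisorTerm-∣ χ₁ χ₀ m d) (trans value
      (cong₂ _*_ (trans (sym (χ₁-* m d)) (cong χ₁ (sym eq))) (trans (sym (divisorTerm-∣ χ₀ χ₁ m d)) (cong (λ z → term₀₁ z d) (sym eq))))))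
      where
      value : 1ℚ * χ₁ m * ℕ→ℚ d ≡ (χ₁ m * χ₁ d) * (χ₁ d * 1ℚ * ℕ→ℚ d)
      value = sym (trans (solve 3 (λ x y z → (x :* y) :* (y :* con 1ℚ :* z) := con 1ℚ :* x :* z :* (y :* y)) refl (χ₁ m) (χ₁ d) (ℕ→ℚ d))
        (trans (cong (1ℚ * χ₁ m * ℕ→ℚ d *_) (χ₁-sq d (λ 5∣d → 5∤n (∣.∣-trans 5∣d d∣n)))) (ℚₚ.*-identityʳ (1ℚ * χ₁ m * ℕ→ℚ d))))

E₁₀-rec : E₁₀ ≋ twist χ₁ E₀₁ ⊕ κ 5 ⊛ sub 5 E₁₀
E₁₀-rec = pointwise ⨾ ⊕-cong (≋-refl {twist χ₁ E₀₁}) (ι-· 5 (sub 5 E₁₀))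
  where
  pointwise : E₁₀ ≋ twist χ₁ E₀₁ ⊕ ι (pos 5) · sub 5 E₁₀
  pointwise n = cases (5 ∣? n)
    where
    cases : Dec (5 ∣ n) → E₁₀ n ≡ χ₁ n * E₀₁ n + ι (pos 5) * sub 5 E₁₀ n
    cases (yes 5∣n@(divides m eq)) = trans (cong E₁₀ eq) (trans (E₁₀-5 m) (trans (sym (ℚₚ.+-identityˡ (ι (pos 5) * E₁₀ m)))
      (cong₂ _+_ (sym (trans (cong (_* E₀₁ n) (χ₁-5∣ n 5∣n)) (ℚₚ.*-zeroˡ (E₀₁ n)))) (cong (ι (pos 5) *_) (sym (trans (cong (sub 5 E₁₀) eq) (sub-mult 5 E₁₀ m)))))))
    cases (no 5∤n) = trans (E₁₀-twist n 5∤n) (trans (sym (ℚₚ.+-identityʳ (χ₁ n * E₀₁ n)))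
      (cong (χ₁ n * E₀₁ n +_) (sym (trans (cong (ι (pos 5) *_) (sub-∤ 5 E₁₀ n 5∤n)) (ℚₚ.*-zeroʳ (ι (pos 5)))))))

-- The Hecke relation at 2, for divisor sums whose terms at even (odd) divisors
-- of 2n are s (t) times the corresponding terms for n.
module Hecke₂ (a : PS) (term : ℕ → ℕ → ℚ) (s t : ℚ)
  (a-sum : ∀ n M .{{_ : NonZero n}} → n ℕ.< M → a n ≡ S M (term n))
  (a-zero : a 0 ≡ (s + t) * a 0 + - (t * s) * a 0)
  (term-∤ : ∀ n d → ¬ d ∣ n → term n d ≡ 0ℚ)
  (term-even : ∀ n j .{{_ : NonZero n}} → term (n ℕ.* 2) (j ℕ.* 2) ≡ s * term n j)
  (term-odd : ∀ n d .{{_ : NonZero n}} → ¬ 2 ∣ d → term (n ℕ.* 2) d ≡ t * term n d) where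
  open +-*-Solver

  evens : ∀ n .{{_ : NonZero n}} → S (suc n) (λ j → term n (j ℕ.* 2)) ≡ s * sub 2 a n
  evens n = cases (2 ∣? n)
    where
    cases : Dec (2 ∣ n) → S (suc n) (λ j → term n (j ℕ.* 2)) ≡ s * sub 2 a n
    cases (yes (divides zero eq)) = ⊥-elim (ℕ.≢-nonZero⁻¹ n eq)
    cases (yes (divides m@(suc _) eq)) = trans (S-cong (suc n) _ _ (λ j _ → trans (cong (λ z → term z (j ℕ.* 2)) eq) (term-even m j)))
      (trans (S-*ˡ (suc n) s (term m)) (cong (s *_) (trans (sym (a-sum m (suc n) (s≤s (ℕₚ.≤-trans (ℕₚ.m≤m*n m 2) (ℕₚ.≤-reflexive (sym eq))))))
        (sym (trans (cong (sub 2 a) eq) (sub-mult 2 a m))))))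
    cases (no 2∤n) = trans (S-zero (suc n) _ (λ j _ → term-∤ n (j ℕ.* 2) (λ d → 2∤n (∣.∣-trans (∣.n∣m*n j) d))))
      (sym (trans (cong (s *_) (sub-∤ 2 a n 2∤n)) (ℚₚ.*-zeroʳ s)))

  private
    2∤odd : ∀ j → ¬ 2 ∣ 1 ℕ.+ j ℕ.* 2
    2∤odd j = ∤-between 2 1 j (s≤s z≤n) (s≤s (s≤s z≤n))

    halves : ∀ n M .{{_ : NonZero n}} → n ℕ.< M ℕ.* 2 → a n ≡ S M (λ j → term n (j ℕ.* 2)) + S M (λ j → term n (1 ℕ.+ j ℕ.* 2))
    halves n M n<2M = trans (a-sum n (M ℕ.* 2) n<2M) (trans (S-block 2 M (term n))
      (trans (S-cong M _ _ (λ j _ → cong (term n (j ℕ.* 2) +_) (ℚₚ.+-identityʳ (term n (1 ℕ.+ j ℕ.* 2)))))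
             (S-+ M (λ j → term n (j ℕ.* 2)) (λ j → term n (1 ℕ.+ j ℕ.* 2)))))

  hecke : ∀ n → a (n ℕ.* 2) ≡ (s + t) * a n + - (t * s) * sub 2 a n
  hecke zero      = a-zero
  hecke n@(suc _) = begin
    a (n ℕ.* 2)                                            ≡⟨ halves (n ℕ.* 2) M (ℕₚ.*-monoˡ-< 2 (ℕₚ.n<1+n n)) ⟩
    S M (λ j → term (n ℕ.* 2) (j ℕ.* 2)) + S M (λ j → term (n ℕ.* 2) (1 ℕ.+ j ℕ.* 2))
      ≡⟨ cong₂ _+_ (trans (S-cong M _ _ (λ j _ → term-even n j)) (S-*ˡ M s (term n)))
                   (trans (S-cong M _ _ (λ j _ → term-odd n (1 ℕ.+ j ℕ.* 2) (2∤odd j))) (S-*ˡ M t (λ j → term n (1 ℕ.+ j ℕ.* 2)))) ⟩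
    s * S M (term n) + t * O                               ≡⟨ cong₂ (λ x y → s * x + t * y) (sym (a-sum n M ℕₚ.≤-refl)) O-value ⟩
    s * a n + t * (a n + - (s * sub 2 a n))                ≡⟨ solve 4 (λ s t x y → s :* x :+ t :* (x :+ :- (s :* y)) := (s :+ t) :* x :+ :- (t :* s) :* y) refl s t (a n) (sub 2 a n) ⟩
    (s + t) * a n + - (t * s) * sub 2 a n                  ∎
    where
    open ≡-Reasoning
    M = suc n
    O = S M (λ j → term n (1 ℕ.+ j ℕ.* 2))
    O-value : O ≡ a n + - (s * sub 2 a n)
    O-value = trans (solve 2 (λ e o → o := (e :+ o) :+ :- e) refl (S M (λ j → term n (j ℕ.* 2))) O)
      (cong₂ (λ x y → x + - y) (sym (halves n M (ℕₚ.<-≤-trans (ℕₚ.n<1+n n) (ℕₚ.m≤m*n M 2)))) (evens n))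

  -- a(-q) is -a plus twice the even part of a, and by `hecke` the even part is a combination of
  -- a(q²) and a(q⁴).
  neg-a : neg a ≋ ⊝ a ⊕ ((1ℚ + 1ℚ) * (s + t)) · sub 2 a ⊕ (- ((1ℚ + 1ℚ) * (t * s))) · sub 4 a
  neg-a N = cases (2 ∣? N)
    where
    cases : Dec (2 ∣ N) → neg a N ≡ - a N + (1ℚ + 1ℚ) * (s + t) * sub 2 a N + (- ((1ℚ + 1ℚ) * (t * s))) * sub 4 a N
    cases (yes (divides n eq)) = trans (trans (cong (λ z → alt z * a z) eq) (trans (cong (_* a (n ℕ.* 2)) (alt-double n)) (ℚₚ.*-identityˡ (a (n ℕ.* 2)))))
      (trans (trans (solve 1 (λ x → x := :- x :+ (con 1ℚ :+ con 1ℚ) :* x) refl (a (n ℕ.* 2))) (cong (λ z → - a (n ℕ.* 2) + (1ℚ + 1ℚ) * z) (hecke n)))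
      (trans (solve 5 (λ b s t x y → :- b :+ (con 1ℚ :+ con 1ℚ) :* ((s :+ t) :* x :+ :- (t :* s) :* y) := :- b :+ (con 1ℚ :+ con 1ℚ) :* (s :+ t) :* x :+ (:- ((con 1ℚ :+ con 1ℚ) :* (t :* s))) :* y) refl (a (n ℕ.* 2)) s t (a n) (sub 2 a n))
      (trans (cong₂ (λ x y → - a (n ℕ.* 2) + (1ℚ + 1ℚ) * (s + t) * x + (- ((1ℚ + 1ℚ) * (t * s))) * y)
          (sym (sub-mult 2 a n)) (trans (sym (sub-mult 2 (sub 2 a) n)) (sub-sub 2 2 a (n ℕ.* 2))))
        (cong (λ z → - a z + (1ℚ + 1ℚ) * (s + t) * sub 2 a z + (- ((1ℚ + 1ℚ) * (t * s))) * sub 4 a z) (sym eq)))))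
    cases (no 2∤N) = trans (trans (cong (_* a N) (odd-alt N 2∤N)) (solve 1 (λ x → (:- con 1ℚ) :* x := :- x) refl (a N)))
      (sym (trans (cong₂ (λ x y → - a N + (1ℚ + 1ℚ) * (s + t) * x + (- ((1ℚ + 1ℚ) * (t * s))) * y) (sub-∤ 2 a N 2∤N)
             (sub-∤ 4 a N (λ 4∣N → 2∤N (∣.∣-trans (divides 2 refl) 4∣N))))
        (solve 3 (λ x c d → x :+ c :* con 0ℚ :+ d :* con 0ℚ := x) refl (- a N) ((1ℚ + 1ℚ) * (s + t)) (- ((1ℚ + 1ℚ) * (t * s))))))
      where
      odd-alt : ∀ N → ¬ 2 ∣ N → alt N ≡ - 1ℚ
      odd-alt zero          p = ⊥-elim (p (2 ∣.∣0))
      odd-alt (suc zero)    p = refl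
      odd-alt (suc (suc N)) p = trans (solve 1 (λ x → :- (:- x) := x) refl (alt N)) (odd-alt N (λ 2∣N → p (∣.∣m∣n⇒∣m+n (∣.∣-refl {2}) 2∣N)))

private
  even-cases : ∀ χ ψ s n j → (∀ m j .{{_ : NonZero j}} → ψ (j ℕ.* 2) * χ m * ℕ→ℚ (j ℕ.* 2) ≡ s * (ψ j * χ m * ℕ→ℚ j)) →
    divisorTerm χ ψ (n ℕ.* 2) (j ℕ.* 2) ≡ s * divisorTerm χ ψ n j
  even-cases χ ψ s n zero      v = sym (ℚₚ.*-zeroʳ s)
  even-cases χ ψ s n j@(suc _) v = cases (j ∣? n)
    where
    cases : Dec (j ∣ n) → divisorTerm χ ψ (n ℕ.* 2) (j ℕ.* 2) ≡ s * divisorTerm χ ψ n j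
    cases (yes (divides m eq)) = trans (cong (λ z → divisorTerm χ ψ z (j ℕ.* 2)) (trans (cong (ℕ._* 2) eq) (ℕₚ.*-assoc m j 2)))
      (trans (divisorTerm-∣ χ ψ m (j ℕ.* 2)) (trans (v m j) (cong (s *_) (trans (sym (divisorTerm-∣ χ ψ m j)) (cong (λ z → divisorTerm χ ψ z j) (sym eq))))))
    cases (no j∤n) = trans (divisorTerm-∤ χ ψ (n ℕ.* 2) (j ℕ.* 2) (j∤n ∘ ∣.*-cancelʳ-∣ 2)) (sym (trans (cong (s *_) (divisorTerm-∤ χ ψ n j j∤n)) (ℚₚ.*-zeroʳ s)))

  odd-cases : ∀ χ ψ t n d → ¬ 2 ∣ d → (∀ m d → ψ d * χ (m ℕ.* 2) * ℕ→ℚ d ≡ t * (ψ d * χ m * ℕ→ℚ d)) →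
    divisorTerm χ ψ (n ℕ.* 2) d ≡ t * divisorTerm χ ψ n d
  odd-cases χ ψ t n zero      2∤d v = ⊥-elim (2∤d (2 ∣.∣0))
  odd-cases χ ψ t n d@(suc _) 2∤d v = cases (d ∣? n)
    where
    cases : Dec (d ∣ n) → divisorTerm χ ψ (n ℕ.* 2) d ≡ t * divisorTerm χ ψ n d
    cases (yes (divides m eq)) = trans (cong (λ z → divisorTerm χ ψ z d) (trans (cong (ℕ._* 2) eq) (trans (ℕₚ.*-assoc m d 2) (trans (cong (m ℕ.*_) (ℕₚ.*-comm d 2)) (sym (ℕₚ.*-assoc m 2 d))))))
      (trans (divisorTerm-∣ χ ψ (m ℕ.* 2) d) (trans (v m d) (cong (t *_) (trans (sym (divisorTerm-∣ χ ψ m d)) (cong (λ z → divisorTerm χ ψ z d) (sym eq))))))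
    cases (no d∤n) = trans (divisorTerm-∤ χ ψ (n ℕ.* 2) d (d∤n ∘ divides-cancel prime-2 2∤d)) (sym (trans (cong (t *_) (divisorTerm-∤ χ ψ n d d∤n)) (ℚₚ.*-zeroʳ t)))

-- s = 2ψ(2) and t = χ(2): these are -2 and 1 here, and 2 and -1 for E₁₀.
module Hecke₀₁ = Hecke₂ E₀₁ term₀₁ (- (1ℚ + 1ℚ)) 1ℚ E₀₁-sum refl (divisorTerm-∤ χ₀ χ₁)
  (λ n j → even-cases χ₀ χ₁ (- (1ℚ + 1ℚ)) n j (λ m j → trans (cong₂ (λ x y → x * 1ℚ * y) (χ₁-* j 2) (ℕ→ℚ-* j 2))
    (solveℚ 2 (λ x y → x :×: (:∸ conℚ 1ℚ) :×: conℚ 1ℚ :×: (y :×: conℚ (1ℚ + 1ℚ)) :≡: (:∸ conℚ (1ℚ + 1ℚ)) :×: (x :×: conℚ 1ℚ :×: y)) refl (χ₁ j) (ℕ→ℚ j))))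
  (λ n d 2∤d → odd-cases χ₀ χ₁ 1ℚ n d 2∤d (λ m d → sym (ℚₚ.*-identityˡ (χ₁ d * 1ℚ * ℕ→ℚ d))))

module Hecke₁₀ = Hecke₂ E₁₀ term₁₀ (1ℚ + 1ℚ) (- 1ℚ) E₁₀-sum refl (divisorTerm-∤ χ₁ χ₀)
  (λ n j → even-cases χ₁ χ₀ (1ℚ + 1ℚ) n j (λ m j → trans (cong (λ y → 1ℚ * χ₁ m * y) (ℕ→ℚ-* j 2))
    (solveℚ 2 (λ x y → conℚ 1ℚ :×: x :×: (y :×: conℚ (1ℚ + 1ℚ)) :≡: conℚ (1ℚ + 1ℚ) :×: (conℚ 1ℚ :×: x :×: y)) refl (χ₁ m) (ℕ→ℚ j))))
  (λ n d 2∤d → odd-cases χ₁ χ₀ (- 1ℚ) n d 2∤d (λ m d → trans (cong (λ x → 1ℚ * x * ℕ→ℚ d) (χ₁-* m 2))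
    (solveℚ 2 (λ x y → conℚ 1ℚ :×: (x :×: (:∸ conℚ 1ℚ)) :×: y :≡: (:∸ conℚ 1ℚ) :×: (conℚ 1ℚ :×: x :×: y)) refl (χ₁ m) (ℕ→ℚ d))))

-- Five-dissection and E₁₀

-- `r` stands for its class and is not reduced, so residues simply add under products.
Residue : ℕ → PS → Set
Residue r f = ∀ n → n % 5 ≢ r % 5 → f n ≡ 0ℚ

Residue-⊕ : ∀ {f g} r → Residue r f → Residue r g → Residue r (f ⊕ g)
Residue-⊕ r R R′ n n≢ = trans (cong₂ _+_ (R n n≢) (R′ n n≢)) (ℚₚ.+-identityˡ 0ℚ)

Residue-⊝ : ∀ {f} r → Residue r f → Residue r (⊝ f)
Residue-⊝ r R n n≢ = cong -_ (R n n≢)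

Residue-⊛ : ∀ {f g} r s → Residue r f → Residue s g → Residue (r ℕ.+ s) (f ⊛ g)
Residue-⊛ {f} {g} r s R R′ n n≢ = trans (conv f g n) (S-zero (suc n) (λ k → f k * g (n ℕ.∸ k)) (λ k k<1+n → cases k (ℕₚ.≤-pred k<1+n) (k % 5 ℕ.≟ r % 5) ((n ℕ.∸ k) % 5 ℕ.≟ s % 5)))
  where
  cases : ∀ k → k ℕ.≤ n → Dec (k % 5 ≡ r % 5) → Dec ((n ℕ.∸ k) % 5 ≡ s % 5) → f k * g (n ℕ.∸ k) ≡ 0ℚ
  cases k k≤n (no p) _       = trans (cong (_* g (n ℕ.∸ k)) (R k p)) (ℚₚ.*-zeroˡ (g (n ℕ.∸ k)))
  cases k k≤n (yes _) (no q) = trans (cong (f k *_) (R′ (n ℕ.∸ k) q)) (ℚₚ.*-zeroʳ (f k))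
  cases k k≤n (yes p) (yes q) = ⊥-elim (n≢ (begin
    n % 5                                  ≡⟨ cong (_% 5) (ℕₚ.m+[n∸m]≡n k≤n) ⟨
    (k ℕ.+ (n ℕ.∸ k)) % 5                  ≡⟨ %-distribˡ-+ k (n ℕ.∸ k) 5 ⟩
    (k % 5 ℕ.+ (n ℕ.∸ k) % 5) % 5          ≡⟨ cong₂ (λ x y → (x ℕ.+ y) % 5) p q ⟩
    (r % 5 ℕ.+ s % 5) % 5                  ≡⟨ %-distribˡ-+ r s 5 ⟨
    (r ℕ.+ s) % 5                          ∎))
    where open ≡-Reasoning

Residue-one : Residue 0 one
Residue-one zero    n≢ = ⊥-elim (n≢ refl)
Residue-one (suc n) n≢ = refl

Residue-const : ∀ m → Residue 0 (κ m)
Residue-const zero    n n≢ = refl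
Residue-const (suc m) = Residue-⊕ 0 Residue-one (Residue-const m)

Residue-^ : ∀ {f} r n → Residue r f → Residue (n ℕ.* r) (f ^ n)
Residue-^ r zero    R = Residue-one
Residue-^ {f} r (suc n) R = Residue-⊛ r (n ℕ.* r) R (Residue-^ r n R)

Residue-th : {I : Set} → ∀ r (c : I → ℚ) e (p : Proper e) → (∀ i → e i % 5 ≡ r % 5) → Residue r (th c e p)
Residue-th r c e p eq n n≢ = sumOver-zero (proj₁ (p n)) (λ i → term-≢ c e n i (λ ei≡n → n≢ (trans (cong (_% 5) (sym ei≡n)) (eq i))))

tw : (ℕ → ℚ) → PS → PS
tw C = twist (λ n → C (n % 5))

tw-cong : ∀ C {f g} → f ≋ g → tw C f ≋ tw C g
tw-cong C p n = cong (C (n % 5) *_) (p n)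

tw-⊕ : ∀ C f g → tw C (f ⊕ g) ≋ tw C f ⊕ tw C g
tw-⊕ C f g n = ℚₚ.*-distribˡ-+ (C (n % 5)) (f n) (g n)

tw-Residue : ∀ C r f → Residue r f → tw C f ≋ C (r % 5) · f
tw-Residue C r f R n with n % 5 ℕ.≟ r % 5
... | yes p = cong (λ z → C z * f n) p
... | no p  = trans (cong (C (n % 5) *_) (R n p)) (trans (ℚₚ.*-zeroʳ (C (n % 5))) (sym (trans (cong (C (r % 5) *_) (R n p)) (ℚₚ.*-zeroʳ (C (r % 5))))))

tw-sub5 : ∀ C g f → tw C (sub 5 g ⊛ f) ≋ sub 5 g ⊛ tw C f
tw-sub5 C g f n = trans (cong (C (n % 5) *_) (conv (sub 5 g) f n)) (trans (sym (S-*ˡ (suc n) (C (n % 5)) (λ k → sub 5 g k * f (n ℕ.∸ k))))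
  (trans (S-cong (suc n) _ _ (λ k k<1+n → termwise k (ℕₚ.≤-pred k<1+n) (5 ∣? k)))
         (sym (conv (sub 5 g) (tw C f) n))))
  where
  open +-*-Solver
  termwise : ∀ k → k ℕ.≤ n → Dec (5 ∣ k) → C (n % 5) * (sub 5 g k * f (n ℕ.∸ k)) ≡ sub 5 g k * (C ((n ℕ.∸ k) % 5) * f (n ℕ.∸ k))
  termwise k k≤n (no 5∤k) = trans (cong (λ z → C (n % 5) * (z * f (n ℕ.∸ k))) (sub-∤ 5 g k 5∤k)) (trans (solve 2 (λ c x → c :* (con 0ℚ :* x) := con 0ℚ) refl (C (n % 5)) (f (n ℕ.∸ k)))
    (sym (trans (cong (_* (C ((n ℕ.∸ k) % 5) * f (n ℕ.∸ k))) (sub-∤ 5 g k 5∤k)) (ℚₚ.*-zeroˡ (C ((n ℕ.∸ k) % 5) * f (n ℕ.∸ k))))))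
  termwise k k≤n (yes (divides m eq)) = trans (cong (λ z → C z * (sub 5 g k * f (n ℕ.∸ k))) same)
    (solve 3 (λ c s x → c :* (s :* x) := s :* (c :* x)) refl (C ((n ℕ.∸ k) % 5)) (sub 5 g k) (f (n ℕ.∸ k)))
    where
    same : n % 5 ≡ (n ℕ.∸ k) % 5
    same = trans (cong (_% 5) (trans (sym (ℕₚ.m∸n+n≡m k≤n)) (cong ((n ℕ.∸ k) ℕ.+_) eq))) ([m+kn]%n≡m%n (n ℕ.∸ k) m 5)

^-cong : ∀ k {f g} → f ≋ g → f ^ k ≋ g ^ k
^-cong zero    p = ≋-refl
^-cong (suc k) {f} {g} p = ⊛-cong p (^-cong k p)

module Dissection where
  part : Fin 5 → PS
  part r = th (λ j → sgn (residue 5 2 r j)) (λ j → E 2 1 (residue 5 2 r j)) (proper-residue 5 2 (E-proper 2 1) r)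

  module _ where
    open Plane

    residue-mod-5 : ∀ a b r s a′ b′ → E² a b (# 5 :* x :+ (# (toℕ r) :- # 2)) ≐ # 2 :* # s :+ E² a′ b′ x :* # 5 →
      ∀ j → E a b (residue 5 2 r j) % 5 ≡ s % 5
    residue-mod-5 a b r s a′ b′ eq j = trans (cong (_% 5) (half-≡ (E-half a b (residue 5 2 r j)) (half-+ (half-const s) (half-* 5 (E-half a′ b′ j)))
      (≐-eval (E² a b (# 5 :* x :+ (# (toℕ r) :- # 2))) (# 2 :* # s :+ E² a′ b′ x :* # 5) eq (j , j)))) ([m+kn]%n≡m%n s (E a′ b′ j) 5)

  part₀ : Residue 5 (part 0F)
  part₀ = Residue-th 5 _ _ (proper-residue 5 2 (E-proper 2 1) 0F) (residue-mod-5 2 1 0F 5 2 13 refl)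

  part₁ : Residue 1 (part 1F)
  part₁ = Residue-th 1 _ _ (proper-residue 5 2 (E-proper 2 1) 1F) (residue-mod-5 2 1 1F 1 5 10 refl)

  part₂ : Residue 0 (part 2F)
  part₂ = Residue-th 0 _ _ (proper-residue 5 2 (E-proper 2 1) 2F) (residue-mod-5 2 1 2F 0 8 7 refl)

  part₃ : Residue 2 (part 3F)
  part₃ = Residue-th 2 _ _ (proper-residue 5 2 (E-proper 2 1) 3F) (residue-mod-5 2 1 3F 2 11 4 refl)

  part₄ : Residue 7 (part 4F)
  part₄ = Residue-th 7 _ _ (proper-residue 5 2 (E-proper 2 1) 4F) (residue-mod-5 2 1 4F 7 14 1 refl)

  -- The exponent k(3k + 1)/2 is 0 modulo 5 for k ≡ -2, 0, it is 1 for k ≡ -1, and it is 2 for k ≡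
  -- 1, 2.
  α β γ : PS
  α = part 0F ⊕ part 2F
  β = part 1F
  γ = part 3F ⊕ part 4F

  Rα : Residue 0 α
  Rα = Residue-⊕ 0 part₀ part₂

  Rβ : Residue 1 β
  Rβ = part₁

  Rγ : Residue 2 γ
  Rγ = Residue-⊕ 2 part₃ part₄

  f₁≋αβγ : f₁ ≋ α ⊕ β ⊕ γ
  f₁≋αβγ = f₁≋JT21 ⨾ th-residues 5 2 sgn (E 2 1) (E-proper 2 1) (proper-residue 5 2 (E-proper 2 1))
    ⨾ PSI.solve 5 (λ a b c d e → a :+ (b :+ (c :+ (d :+ (e :+ # 0)))) := (a :+ c) :+ b :+ (d :+ e)) ≋-refl (part 0F) (part 1F) (part 2F) (part 3F) (part 4F)
    where open PSI using (_:=_; _:+_; #_)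

  -- For k = 5j - 1 the exponent is 1 + 25 j(3j - 1)/2: the pentagonal series reappears at q²⁵, with
  -- the sign of (-1)^k reversed.
  β-eta : β ≋ ⊝ (mono 1 ⊛ sub 25 f₁)
  β-eta = th-cong (proper-residue 5 2 (E-proper 2 1) 1F) p (λ j → trans (sgn-odd (residue 5 2 1F j) j (pos 2 ℤ.* j ℤ.- pos 1) (parity j)) (solveℚ 1 (λ x → :∸ x :≡: (:∸ conℚ 1ℚ) :×: x) refl (sgn j)))
        (λ j → half-≡ (E-half 2 1 (pos 5 ℤ.* j ℤ.+ (pos 1 ℤ.- pos 2))) (half-+ (half-const 1) (half-* 25 (E-half 1 2 j))) (ring j))
    ⨾ th-· (- 1ℚ) sgn (λ j → 1 ℕ.+ E 1 2 j ℕ.* 25) p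
    ⨾ (λ n → solveℚ 1 (λ x → (:∸ conℚ 1ℚ) :×: x :≡: :∸ x) refl (th sgn (λ j → 1 ℕ.+ E 1 2 j ℕ.* 25) p n))
    ⨾ (λ n → cong -_ (sym ((⊛-congˡ (mono 1) (sub-cong 25 f₁≋JT12 ⨾ th-sub 25 sgn (E 1 2) (E-proper 1 2) (proper-* 25 (E-proper 1 2)))
         ⨾ th-mono 1 sgn (λ j → E 1 2 j ℕ.* 25) (proper-* 25 (E-proper 1 2)) p) n)))
    where
    p : Proper (λ j → 1 ℕ.+ E 1 2 j ℕ.* 25)
    p = proper-shift 1 (proper-* 25 (E-proper 1 2))
    ring : ∀ j → (pos 3 ℤ.* (pos 5 ℤ.* j ℤ.+ (pos 1 ℤ.- pos 2)) ℤ.* (pos 5 ℤ.* j ℤ.+ (pos 1 ℤ.- pos 2)) ℤ.+ pos 1 ℤ.* (pos 5 ℤ.* j ℤ.+ (pos 1 ℤ.- pos 2))) ≡ pos 2 ℤ.* pos 1 ℤ.+ (pos 3 ℤ.* j ℤ.* j ℤ.+ (ℤ.- pos 1) ℤ.* j) ℤ.* pos 25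
    ring = ℤ-Solver.solve-∀
    parity : ∀ j → (pos 5 ℤ.* j ℤ.+ (pos 1 ℤ.- pos 2)) ≡ pos 1 ℤ.+ j ℤ.+ ((pos 2 ℤ.* j ℤ.- pos 1) ℤ.+ (pos 2 ℤ.* j ℤ.- pos 1))
    parity = ℤ-Solver.solve-∀

  only-2 : ℕ → ℚ
  only-2 2 = 1ℚ
  only-2 _ = 0ℚ

  -- Modulo 5, k(k-1)/2 takes only the values 0, 1 and 3.
  tri-residue : ∀ k → only-2 (E 0 1 k % 5) ≡ 0ℚ
  tri-residue k = subst (λ z → only-2 (E 0 1 z % 5) ≡ 0ℚ) (proj₂ (residue-surj 5 2 k)) (at (proj₁ (residue-surj 5 2 k)) (quot 5 2 k))
    where
    at : ∀ r j → only-2 (E 0 1 (residue 5 2 r j) % 5) ≡ 0ℚ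
    at 0F j = cong only-2 (residue-mod-5 0 1 0F 3 0 5 refl j)
    at 1F j = cong only-2 (residue-mod-5 0 1 1F 1 1 4 refl j)
    at 2F j = cong only-2 (residue-mod-5 0 1 2F 0 2 3 refl j)
    at 3F j = cong only-2 (residue-mod-5 0 1 3F 0 3 2 refl j)
    at 4F j = cong only-2 (residue-mod-5 0 1 4F 1 4 1 refl j)

  open PSI using (_:=_; _:+_; _:*_; _:-_; :-_; _:^_; #_)

  cancel-zero : ∀ k f → k 0 ≢ 0ℚ → k ⊛ f ≋ 𝟘 → f ≋ 𝟘
  cancel-zero k f k₀≢0 p = ⊛-cancelˡ k f 𝟘 k₀≢0 (p ⨾ ≋-sym (PSR.zeroʳ k))

  -- The terms of (α + β + γ)³ with exponents 2 modulo 5 are 3α²γ + 3αβ². They vanish by Jacobi's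
  -- formula, and 3α has a nonzero constant term.
  αγ+β² : α ⊛ γ ⊕ β ⊛ β ≋ 𝟘
  αγ+β² = cancel-zero (κ 3 ⊛ α) (α ⊛ γ ⊕ β ⊛ β) (λ ()) (≋-sym component ⨾ vanish)
    where
    G₀ G₁ G₂ G₃ G₄ : PS
    G₀ = α ^ 3 ⊕ κ 3 ⊛ (β ⊛ γ ^ 2)
    G₁ = κ 3 ⊛ (α ^ 2 ⊛ β) ⊕ γ ^ 3
    G₂ = κ 3 ⊛ α ⊛ (α ⊛ γ ⊕ β ⊛ β)
    G₃ = κ 6 ⊛ (α ⊛ (β ⊛ γ)) ⊕ β ^ 3
    G₄ = κ 3 ⊛ (α ⊛ γ ^ 2) ⊕ κ 3 ⊛ (β ^ 2 ⊛ γ)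
    R₀ : Residue 0 G₀
    R₀ = Residue-⊕ 0 (Residue-^ 0 3 Rα) (Residue-⊛ 0 5 (Residue-const 3) (Residue-⊛ 1 4 Rβ (Residue-^ 2 2 Rγ)))
    R₁ : Residue 1 G₁
    R₁ = Residue-⊕ 1 (Residue-⊛ 0 1 (Residue-const 3) (Residue-⊛ 0 1 (Residue-^ 0 2 Rα) Rβ)) (Residue-^ 2 3 Rγ)
    R₂ : Residue 2 G₂
    R₂ = Residue-⊛ 0 2 (Residue-⊛ 0 0 (Residue-const 3) Rα) (Residue-⊕ 2 (Residue-⊛ 0 2 Rα Rγ) (Residue-⊛ 1 1 Rβ Rβ))
    R₃ : Residue 3 G₃
    R₃ = Residue-⊕ 3 (Residue-⊛ 0 3 (Residue-const 6) (Residue-⊛ 0 3 Rα (Residue-⊛ 1 2 Rβ Rγ))) (Residue-^ 1 3 Rβ)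
    R₄ : Residue 4 G₄
    R₄ = Residue-⊕ 4 (Residue-⊛ 0 4 (Residue-const 3) (Residue-⊛ 0 4 Rα (Residue-^ 2 2 Rγ))) (Residue-⊛ 0 4 (Residue-const 3) (Residue-⊛ 2 2 (Residue-^ 1 2 Rβ) Rγ))
    cube-parts : f₁ ⊛ (f₁ ⊛ f₁) ≋ G₀ ⊕ (G₁ ⊕ (G₂ ⊕ (G₃ ⊕ G₄)))
    cube-parts = ⊛-cong f₁≋αβγ (⊛-cong f₁≋αβγ f₁≋αβγ)
      ⨾ PSI.solve 3 (λ a b g → (a :+ b :+ g) :* ((a :+ b :+ g) :* (a :+ b :+ g)) := (a :^ 3 :+ # 3 :* (b :* g :^ 2)) :+ ((# 3 :* (a :^ 2 :* b) :+ g :^ 3)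
          :+ (# 3 :* a :* (a :* g :+ b :* b) :+ ((# 6 :* (a :* (b :* g)) :+ b :^ 3) :+ (# 3 :* (a :* g :^ 2) :+ # 3 :* (b :^ 2 :* g)))))) ≋-refl α β γ
      where s = α ⊕ β ⊕ γ
    component : tw only-2 (f₁ ⊛ (f₁ ⊛ f₁)) ≋ κ 3 ⊛ α ⊛ (α ⊛ γ ⊕ β ⊛ β)
    component = tw-cong only-2 cube-parts
      ⨾ tw-⊕ only-2 G₀ (G₁ ⊕ (G₂ ⊕ (G₃ ⊕ G₄))) ⨾ ⊕-cong (tw-Residue only-2 0 G₀ R₀)
        (tw-⊕ only-2 G₁ (G₂ ⊕ (G₃ ⊕ G₄)) ⨾ ⊕-cong (tw-Residue only-2 1 G₁ R₁)
        (tw-⊕ only-2 G₂ (G₃ ⊕ G₄) ⨾ ⊕-cong (tw-Residue only-2 2 G₂ R₂)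
        (tw-⊕ only-2 G₃ G₄ ⨾ ⊕-cong (tw-Residue only-2 3 G₃ R₃) (tw-Residue only-2 4 G₄ R₄))))
      ⨾ λ k → solveℚ 5 (λ a b c d e → conℚ 0ℚ :×: a :⊞: (conℚ 0ℚ :×: b :⊞: (conℚ 1ℚ :×: c :⊞: (conℚ 0ℚ :×: d :⊞: conℚ 0ℚ :×: e))) :≡: c) refl (G₀ k) (G₁ k) (G₂ k) (G₃ k) (G₄ k)
    vanish : tw only-2 (f₁ ⊛ (f₁ ⊛ f₁)) ≋ 𝟘
    vanish k = trans (cong (only-2 (k % 5) *_) (trans (solveℚ 1 (λ x → x :≡: :∸ (:∸ x)) refl ((f₁ ⊛ (f₁ ⊛ f₁)) k)) (cong -_ (sym (Cube.cube k)))))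
      (trans (sym (ℚₚ.neg-distribʳ-* (only-2 (k % 5)) (th Cube.weight (E 0 1) (E-proper 0 1) k)))
      (cong -_ (trans (th-twist (λ m → only-2 (m % 5)) Cube.weight (E 0 1) (E-proper 0 1) k)
        (th-zero (λ i → only-2 (E 0 1 i % 5) * Cube.weight i) (E 0 1) (E-proper 0 1) (λ i → trans (cong (_* Cube.weight i) (tri-residue i)) (ℚₚ.*-zeroˡ (Cube.weight i))) k))))

  drop : ∀ f c → f ⊕ (α ⊛ γ ⊕ β ⊛ β) ⊛ c ≋ f
  drop f c = ⊕-cong (≋-refl {f}) (⊛-congʳ c αγ+β² ⨾ PSR.zeroˡ c) ⨾ PSR.+-identityʳ f

  -- The components of f₁⁵ by exponent modulo 5, reduced by αγ = -β² until no product αγ is left.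
  F₀ F₁ F₂ F₃ F₄ : PS
  F₀ = α ^ 5 ⊕ κ 11 ⊛ β ^ 5 ⊕ γ ^ 5
  F₁ = κ 5 ⊛ (α ^ 4 ⊛ β) ⊕ ⊝ (κ 15 ⊛ (β ^ 4 ⊛ γ))
  F₂ = κ 5 ⊛ (α ^ 3 ⊛ β ^ 2) ⊕ ⊝ (κ 10 ⊛ (β ^ 3 ⊛ γ ^ 2))
  F₃ = κ 5 ⊛ (β ^ 2 ⊛ γ ^ 3) ⊕ ⊝ (κ 10 ⊛ (α ^ 2 ⊛ β ^ 3))
  F₄ = κ 5 ⊛ (β ⊛ γ ^ 4) ⊕ ⊝ (κ 15 ⊛ (α ⊛ β ^ 4))

  fifth-power : f₁ ^ 5 ≋ F₀ ⊕ (F₁ ⊕ (F₂ ⊕ (F₃ ⊕ F₄)))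
  fifth-power = ^-cong 5 f₁≋αβγ
    -- The part multiplied by αγ + β² records this reduction; its cofactor is the cubic that `drop`
    -- discards.
    ⨾ PSI.solve 3 (λ a b g → (a :+ b :+ g) :^ 5 := ((a :^ 5 :+ # 11 :* b :^ 5 :+ g :^ 5) :+ ((# 5 :* (a :^ 4 :* b) :+ :- (# 15 :* (b :^ 4 :* g))) :+ ((# 5 :* (a :^ 3 :* b :^ 2) :+ :- (# 10 :* (b :^ 3 :* g :^ 2))) :+ ((# 5 :* (b :^ 2 :* g :^ 3) :+ :- (# 10 :* (a :^ 2 :* b :^ 3))) :+ (# 5 :* (b :* g :^ 4) :+ :- (# 15 :* (a :* b :^ 4))))))) :+ (a :* g :+ b :* b) :* (# 5 :* a :* a :* a :+ # 20 :* a :* a :* b :+ # 10 :* a :* a :* g :+ # 20 :* a :* b :* b :+ # 30 :* a :* b :* g :+ # 10 :* a :* g :* g :- (# 10 :* b :* b :* b) :+ # 20 :* b :* b :* g :+ # 20 :* b :* g :* g :+ # 5 :* g :* g :* g)) ≋-refl α β γ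
    ⨾ drop (F₀ ⊕ (F₁ ⊕ (F₂ ⊕ (F₃ ⊕ F₄)))) (κ 5 ⊛ α ⊛ α ⊛ α ⊕ κ 20 ⊛ α ⊛ α ⊛ β ⊕ κ 10 ⊛ α ⊛ α ⊛ γ ⊕ κ 20 ⊛ α ⊛ β ⊛ β ⊕ κ 30 ⊛ α ⊛ β ⊛ γ ⊕ κ 10 ⊛ α ⊛ γ ⊛ γ ⊕ ⊝ (κ 10 ⊛ β ⊛ β ⊛ β) ⊕ κ 20 ⊛ β ⊛ β ⊛ γ ⊕ κ 20 ⊛ β ⊛ γ ⊛ γ ⊕ κ 5 ⊛ γ ⊛ γ ⊛ γ)

  private
    scaled : ∀ {f} k r → Residue r f → Residue r (κ k ⊛ f)
    scaled k r R = Residue-⊛ 0 r (Residue-const k) R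

  RF₀ : Residue 0 F₀
  RF₀ = Residue-⊕ 0 (Residue-⊕ 0 (Residue-^ 0 5 Rα) (scaled 11 5 (Residue-^ 1 5 Rβ))) (Residue-^ 2 5 Rγ)
  RF₁ : Residue 1 F₁
  RF₁ = Residue-⊕ 1 (scaled 5 1 (Residue-⊛ 0 1 (Residue-^ 0 4 Rα) Rβ)) (Residue-⊝ 1 (scaled 15 6 (Residue-⊛ 4 2 (Residue-^ 1 4 Rβ) Rγ)))
  RF₂ : Residue 2 F₂
  RF₂ = Residue-⊕ 2 (scaled 5 2 (Residue-⊛ 0 2 (Residue-^ 0 3 Rα) (Residue-^ 1 2 Rβ))) (Residue-⊝ 2 (scaled 10 7 (Residue-⊛ 3 4 (Residue-^ 1 3 Rβ) (Residue-^ 2 2 Rγ))))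
  RF₃ : Residue 3 F₃
  RF₃ = Residue-⊕ 3 (scaled 5 8 (Residue-⊛ 2 6 (Residue-^ 1 2 Rβ) (Residue-^ 2 3 Rγ))) (Residue-⊝ 3 (scaled 10 3 (Residue-⊛ 0 3 (Residue-^ 0 2 Rα) (Residue-^ 1 3 Rβ))))
  RF₄ : Residue 4 F₄
  RF₄ = Residue-⊕ 4 (scaled 5 9 (Residue-⊛ 1 8 Rβ (Residue-^ 2 4 Rγ))) (Residue-⊝ 4 (scaled 15 4 (Residue-⊛ 0 4 Rα (Residue-^ 1 4 Rβ))))

  tw-fifth : ∀ C → tw C (f₁ ^ 5) ≋ C 0 · F₀ ⊕ (C 1 · F₁ ⊕ (C 2 · F₂ ⊕ (C 3 · F₃ ⊕ C 4 · F₄)))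
  tw-fifth C = tw-cong C fifth-power
    ⨾ tw-⊕ C F₀ (F₁ ⊕ (F₂ ⊕ (F₃ ⊕ F₄))) ⨾ ⊕-cong (tw-Residue C 0 F₀ RF₀)
      (tw-⊕ C F₁ (F₂ ⊕ (F₃ ⊕ F₄)) ⨾ ⊕-cong (tw-Residue C 1 F₁ RF₁)
      (tw-⊕ C F₂ (F₃ ⊕ F₄) ⨾ ⊕-cong (tw-Residue C 2 F₂ RF₂)
      (tw-⊕ C F₃ F₄ ⨾ ⊕-cong (tw-Residue C 3 F₃ RF₃) (tw-Residue C 4 F₄ RF₄))))

  tw-E₀₁ : ∀ C → κ 5 ⊛ (sub 5 f₁ ⊛ tw C E₀₁) ≋ ⊝ tw C (f₁ ^ 5)
  tw-E₀₁ C = ⊛-congˡ (κ 5) (≋-sym (tw-sub5 C f₁ E₀₁)) ⨾ ≋-sym (ι-· 5 (tw C (sub 5 f₁ ⊛ E₀₁)))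
    ⨾ (λ k → trans (solveℚ 3 (λ a c x → a :×: (c :×: x) :≡: c :×: (a :×: x)) refl (ι (pos 5)) (C (k % 5)) ((sub 5 f₁ ⊛ E₀₁) k))
         (trans (cong (C (k % 5) *_) (trans (ι-· 5 (sub 5 f₁ ⊛ E₀₁) k) (E₀₁-eta k))) (sym (ℚₚ.neg-distribʳ-* (C (k % 5)) ((f₁ ^ 5) k)))))

  only-0 : ℕ → ℚ
  only-0 0 = 1ℚ
  only-0 _ = 0ℚ

  tw-only-0 : tw only-0 E₀₁ ≋ sub 5 E₀₁
  tw-only-0 = ≋-sub 5 E₀₁ (tw only-0 E₀₁)
    (λ m → trans (cong₂ (λ a b → only-0 a * b) ([m+kn]%n≡m%n 0 m 5) (E₀₁-5 m)) (ℚₚ.*-identityˡ (E₀₁ m)))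
    (λ k 5∤k → trans (cong (_* E₀₁ k) (nonzero (k % 5) (λ eq → 5∤k (∣.m%n≡0⇒n∣m k 5 eq)))) (ℚₚ.*-zeroˡ (E₀₁ k)))
    where
    nonzero : ∀ r → r ≢ 0 → only-0 r ≡ 0ℚ
    nonzero zero    p = ⊥-elim (p refl)
    nonzero (suc r) p = refl

  f₅ f₂₅ : PS
  f₅ = sub 5 f₁
  f₂₅ = sub 25 f₁

  -- Since E₀₁ is unchanged by n → 5n, the component 0 of 5f₅E₀₁ = -f₁⁵ is 5f₅E₀₁(q⁵) = -F₀. The
  -- same identity at q⁵ eliminates E₀₁(q⁵).
  f₅⁶ : f₂₅ ⊛ F₀ ≋ f₅ ^ 6
  f₅⁶ = ⊛-congˡ f₂₅ F₀-value
    ⨾ PSI.solve 3 (λ a b e → b :* (:- (# 5 :* (a :* e))) := :- (a :* (# 5 :* (b :* e)))) ≋-refl f₅ f₂₅ (sub 5 E₀₁)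
    ⨾ (λ k → cong -_ (⊛-congˡ f₅ sub5-eta k))
    ⨾ PSI.solve 1 (λ a → :- (a :* (:- (a :^ 5))) := a :^ 6) ≋-refl f₅
    where
    F₀-value : F₀ ≋ ⊝ (κ 5 ⊛ (f₅ ⊛ sub 5 E₀₁))
    F₀-value = (λ k → solveℚ 5 (λ a b c d e → a :≡: conℚ 1ℚ :×: a :⊞: (conℚ 0ℚ :×: b :⊞: (conℚ 0ℚ :×: c :⊞: (conℚ 0ℚ :×: d :⊞: conℚ 0ℚ :×: e)))) refl (F₀ k) (F₁ k) (F₂ k) (F₃ k) (F₄ k))
      ⨾ ≋-sym (tw-fifth only-0) ⨾ (λ k → solveℚ 1 (λ x → x :≡: :∸ (:∸ x)) refl (tw only-0 (f₁ ^ 5) k))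
      ⨾ (λ k → cong -_ (sym ((⊛-congˡ (κ 5) (⊛-congˡ f₅ (≋-sym tw-only-0)) ⨾ tw-E₀₁ only-0) k)))
    sub5-eta : κ 5 ⊛ (f₂₅ ⊛ sub 5 E₀₁) ≋ ⊝ (f₅ ^ 5)
    sub5-eta = sub-transport 5 3 (λ a b e → (# 5 :* (b :* e)) := :- (a :^ 5)) {f₁ ∷ f₅ ∷ E₀₁ ∷ []} {f₅ ∷ f₂₅ ∷ sub 5 E₀₁ ∷ []} (≋-refl ∷ sub-sub 5 5 f₁ ∷ ≋-refl ∷ []) E₀₁-eta

  inv-f₁ : PS
  inv-f₁ = Π∞ (λ i → geom (suc i))

  f₁⊛inv : f₁ ⊛ inv-f₁ ≋ one
  f₁⊛inv = ≋-sym (Π∞-⊛ (λ i → om (suc i)) (λ i → geom (suc i)) (λ i → om-Agree i (suc i) ℕₚ.≤-refl) geom-unital)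
    ⨾ Π∞-cong (λ i → om-geom (suc i)) ⨾ (λ k → ΠS-one k k)
    where
    geom-unital : Unital (λ i → geom (suc i))
    geom-unital i zero    _   = refl
    geom-unital i (suc k) k<i = cong (λ b → if b then 1ℚ else 0ℚ) (dec-false (suc i ∣? suc k) (∣.>⇒∤ (s≤s k<i)))

  -- The candidate q f₅⁵/f₁ for E₁₀.
  C : PS
  C = mono 1 ⊛ (f₅ ^ 5 ⊛ inv-f₁)

  f₁C : f₁ ⊛ C ≋ mono 1 ⊛ f₅ ^ 5
  f₁C = PSI.solve 4 (λ f q g i → f :* (q :* (g :* i)) := q :* g :* (f :* i)) ≋-refl f₁ (mono 1) (f₅ ^ 5) inv-f₁
    ⨾ ⊛-congˡ (mono 1 ⊛ f₅ ^ 5) f₁⊛inv ⨾ PSR.*-identityʳ (mono 1 ⊛ f₅ ^ 5)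

  f₅C : f₅ ⊛ sub 5 C ≋ mono 1 ^ 5 ⊛ f₂₅ ^ 5
  f₅C = sub-transport 5 4 (λ f c q g → f :* c := q :* g :^ 5) {f₁ ∷ C ∷ mono 1 ∷ f₅ ∷ []} {f₅ ∷ sub 5 C ∷ mono 1 ^ 5 ∷ f₂₅ ∷ []}
      (≋-refl ∷ ≋-refl ∷ (sub-mono 5 1 ⨾ ≋-sym (mono-pow 5)) ∷ sub-sub 5 5 f₁ ∷ []) f₁C
    where
    mono-pow : ∀ k → mono 1 ^ k ≋ mono k
    mono-pow zero    = ≋-refl
    mono-pow (suc k) = ⊛-congˡ (mono 1) (mono-pow k) ⨾ mono-+ 1 k

  V : PS
  V = C ⊕ ⊝ (κ 5 ⊛ sub 5 C)

  -- Multiplied by 5f₁f₅, both sides become polynomials in the dissection, through f₁ = α + β + γ, q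
  -- f₂₅ = -β and f₅⁶ = f₂₅F₀. These agree modulo αγ + β².
  V≋twist : V ≋ twist χ₁ E₀₁
  V≋twist = ⊛-cancelˡ (κ 5 ⊛ (f₁ ⊛ f₅)) V _ (λ ()) (left ⨾ middle ⨾ ≋-sym right)
    where
    F′ : PS
    F′ = F₁ ⊕ (⊝ F₂ ⊕ (⊝ F₃ ⊕ F₄))
    right : κ 5 ⊛ (f₁ ⊛ f₅) ⊛ twist χ₁ E₀₁ ≋ ⊝ ((α ⊕ β ⊕ γ) ⊛ F′)
    right = PSI.solve 3 (λ f g e → # 5 :* (f :* g) :* e := f :* (# 5 :* (g :* e))) ≋-refl f₁ f₅ (twist χ₁ E₀₁)
      ⨾ ⊛-congˡ f₁ (⊛-congˡ (κ 5) (⊛-congˡ f₅ (λ k → cong (_* E₀₁ k) (χ₁-table k))) ⨾ tw-E₀₁ χ-table)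
      ⨾ ⊛-cong f₁≋αβγ (λ k → cong -_ (trans (tw-fifth χ-table k)
          (solveℚ 5 (λ a b c d e → conℚ 0ℚ :×: a :⊞: (conℚ 1ℚ :×: b :⊞: ((:∸ conℚ 1ℚ) :×: c :⊞: ((:∸ conℚ 1ℚ) :×: d :⊞: conℚ 1ℚ :×: e))) :≡: b :⊞: (:∸ c :⊞: (:∸ d :⊞: e))) refl (F₀ k) (F₁ k) (F₂ k) (F₃ k) (F₄ k))))
      ⨾ PSI.solve 2 (λ s f → s :* (:- f) := :- (s :* f)) ≋-refl (α ⊕ β ⊕ γ) F′
    left : κ 5 ⊛ (f₁ ⊛ f₅) ⊛ V ≋ κ 5 ⊛ (κ 5 ⊛ ((α ⊕ β ⊕ γ) ⊛ β ^ 5) ⊕ ⊝ (β ⊛ F₀))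
    left = PSI.solve 4 (λ f g c d → # 5 :* (f :* g) :* (c :+ :- (# 5 :* d)) := # 5 :* (g :* (f :* c) :+ :- (# 5 :* (f :* (g :* d))))) ≋-refl f₁ f₅ C (sub 5 C)
      ⨾ ⊛-congˡ (κ 5) (⊕-cong (⊛-congˡ f₅ f₁C ⨾ PSI.solve 2 (λ g q → g :* (q :* g :^ 5) := q :* g :^ 6) ≋-refl f₅ (mono 1) ⨾ ⊛-congˡ (mono 1) (≋-sym f₅⁶)
              ⨾ PSI.solve 3 (λ q h x → q :* (h :* x) := :- (:- (q :* h) :* x)) ≋-refl (mono 1) f₂₅ F₀ ⨾ (λ k → cong -_ (⊛-congʳ F₀ (≋-sym β-eta) k)))
            (λ k → cong -_ (⊛-congˡ (κ 5) (⊛-cong f₁≋αβγ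
               (f₅C ⨾ PSI.solve 2 (λ q h → q :^ 5 :* h :^ 5 := :- ((:- (q :* h)) :^ 5)) ≋-refl (mono 1) f₂₅ ⨾ (λ k → cong -_ (^-cong 5 (≋-sym β-eta) k)))) k)))
      ⨾ PSI.solve 3 (λ s b x → # 5 :* (:- (b :* x) :+ :- (# 5 :* (s :* (:- (b :^ 5))))) := # 5 :* (# 5 :* (s :* b :^ 5) :+ :- (b :* x))) ≋-refl (α ⊕ β ⊕ γ) β F₀
    middle : κ 5 ⊛ (κ 5 ⊛ ((α ⊕ β ⊕ γ) ⊛ β ^ 5) ⊕ ⊝ (β ⊛ F₀)) ≋ ⊝ ((α ⊕ β ⊕ γ) ⊛ F′)
    -- Both sides have degree 6, and the cofactor of αγ + β² is a quartic.
    middle = PSI.solve 3 (λ a b g → # 5 :* (# 5 :* ((a :+ b :+ g) :* b :^ 5) :+ :- (b :* (a :^ 5 :+ # 11 :* b :^ 5 :+ g :^ 5)))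
         := :- ((a :+ b :+ g) :* ((# 5 :* (a :^ 4 :* b) :+ :- (# 15 :* (b :^ 4 :* g))) :+ (:- (# 5 :* (a :^ 3 :* b :^ 2) :+ :- (# 10 :* (b :^ 3 :* g :^ 2))) :+ (:- (# 5 :* (b :^ 2 :* g :^ 3) :+ :- (# 10 :* (a :^ 2 :* b :^ 3))) :+ (# 5 :* (b :* g :^ 4) :+ :- (# 15 :* (a :* b :^ 4))))))) :+ (a :* g :+ b :* b) :* (# 5 :* a :* a :* a :* b :- (# 5 :* a :* a :* b :* b) :+ # 10 :* a :* b :* b :* b :- (# 30 :* b :* b :* b :* b) :+ # 10 :* b :* b :* b :* g :- (# 5 :* b :* b :* g :* g) :+ # 5 :* b :* g :* g :* g)) ≋-refl α β γ
      ⨾ drop (⊝ ((α ⊕ β ⊕ γ) ⊛ F′)) (κ 5 ⊛ α ⊛ α ⊛ α ⊛ β ⊕ ⊝ (κ 5 ⊛ α ⊛ α ⊛ β ⊛ β) ⊕ κ 10 ⊛ α ⊛ β ⊛ β ⊛ β ⊕ ⊝ (κ 30 ⊛ β ⊛ β ⊛ β ⊛ β) ⊕ κ 10 ⊛ β ⊛ β ⊛ β ⊛ γ ⊕ ⊝ (κ 5 ⊛ β ⊛ β ⊛ γ ⊛ γ) ⊕ κ 5 ⊛ β ⊛ γ ⊛ γ ⊛ γ)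

  -- Off the multiples of 5 the coefficients are 0, X(5m) = 5X(m) is a descent, and at 0 there
  -- remains X(0) = 5X(0).
  fixpoint-zero : ∀ X → X ≋ κ 5 ⊛ sub 5 X → X ≋ 𝟘
  fixpoint-zero X p = <-rec (λ k → X k ≡ 0ℚ) step
    where
    eq : ∀ k → X k ≡ ι (pos 5) * sub 5 X k
    eq k = trans (p k) (sym (ι-· 5 (sub 5 X) k))
    step : ∀ k → (∀ {m} → m ℕ.< k → X m ≡ 0ℚ) → X k ≡ 0ℚ
    step k IH = cases (5 ∣? k)
      where
      cases : Dec (5 ∣ k) → X k ≡ 0ℚ
      cases (no 5∤k) = trans (eq k) (trans (cong (ι (pos 5) *_) (sub-∤ 5 X k 5∤k)) (ℚₚ.*-zeroʳ (ι (pos 5))))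
      cases (yes (divides zero refl)) = ℚ-cancelˡ (ι (pos 4)) (X 0) (λ ()) (trans (solveℚ 1 (λ x → conℚ (ι (pos 4)) :×: x :≡: conℚ (ι (pos 5)) :×: x :⊞: :∸ x) refl (X 0))
        (x≡y⇒x-y≡0 (ι (pos 5) * X 0) (X 0) (sym (eq 0))))
      cases (yes (divides m@(suc _) refl)) = trans (eq (m ℕ.* 5)) (trans (cong (ι (pos 5) *_) (trans (sub-mult 5 X m) (IH (ℕₚ.m<m*n m 5 (s≤s (s≤s z≤n)))))) (ℚₚ.*-zeroʳ (ι (pos 5))))

  -- `C` and E₁₀ obey the same recursion a = χ₁E₀₁ + 5a(q⁵), so their difference is a fixed point.
  E₁₀-eta : f₁ ⊛ E₁₀ ≋ mono 1 ⊛ f₅ ^ 5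
  E₁₀-eta = ⊛-congˡ f₁ (λ k → sym (x-y≡0⇒x≡y (C k) (E₁₀ k) (fixpoint-zero (C ⊕ ⊝ E₁₀) fixed k))) ⨾ f₁C
    where
    fixed : C ⊕ ⊝ E₁₀ ≋ κ 5 ⊛ sub 5 (C ⊕ ⊝ E₁₀)
    fixed = ⊕-cong (PSI.solve 2 (λ c d → c := (c :+ :- (# 5 :* d)) :+ # 5 :* d) ≋-refl C (sub 5 C) ⨾ ⊕-cong V≋twist (≋-refl {κ 5 ⊛ sub 5 C})) (λ k → cong -_ (E₁₀-rec k))
      ⨾ PSI.solve 3 (λ v c e → (v :+ # 5 :* c) :+ :- (v :+ # 5 :* e) := # 5 :* (c :+ :- e)) ≋-refl (twist χ₁ E₀₁) (sub 5 C) (sub 5 E₁₀)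
      ⨾ ⊛-congˡ (κ 5) (≋-sym (sub-⊕ 5 C (⊝ E₁₀) ⨾ ⊕-cong (≋-refl {sub 5 C}) (sub-⊝ 5 E₁₀)))

-- Algebra of theta series and eta quotients

neg-sub5 : ∀ f → neg (sub 5 f) ≋ sub 5 (neg f)
neg-sub5 f = ≋-sub 5 (neg f) (neg (sub 5 f))
  (λ m → cong₂ _*_ (trans (cong alt (ℕₚ.*-comm m 5)) (alt-odd 2 m)) (sub-mult 5 f m))
  (λ n p → trans (cong (alt n *_) (sub-∤ 5 f n p)) (ℚₚ.*-zeroʳ (alt n)))

neg-neg : ∀ f → neg (neg f) ≋ f
neg-neg f n = trans (sym (ℚₚ.*-assoc (alt n) (alt n) (f n))) (trans (cong (_* f n) (alt-sq n)) (ℚₚ.*-identityˡ (f n)))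

Unital-⊛ : ∀ F G → Unital F → Unital G → Unital (λ i → F i ⊛ G i)
Unital-⊛ F G u v i = Agree-trans (Agree-⊛ i (F i) one (G i) one (u i) (v i)) (≋⇒Agree i (PSR.*-identityˡ one))

Unital-^ : ∀ F k → Unital F → Unital (λ i → F i ^ k)
Unital-^ F zero    u i = ≋⇒Agree i ≋-refl
Unital-^ F (suc k) u   = Unital-⊛ F (λ i → F i ^ k) u (Unital-^ F k u)

Π∞-^ : ∀ F k → Unital F → Π∞ (λ i → F i ^ k) ≋ Π∞ F ^ k
Π∞-^ F zero    u n = ΠS-one n n
Π∞-^ F (suc k) u   = Π∞-⊛ F (λ i → F i ^ k) u (Unital-^ F k u) ⨾ ⊛-congˡ (Π∞ F) (Π∞-^ F k u)

-- The factors of the eta product at q^(k+1) and of its reciprocal, in the form in which `B₁` and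
-- `B₂` are given.
module Factors (k : ℕ) where
  minus : ℕ → PS
  minus i = oneMinus (suc k ℕ.* suc i)

  inverse : ℕ → PS
  inverse i = geom (suc k ℕ.* suc i)

  index-≤ : ∀ i → i ℕ.< suc k ℕ.* suc i
  index-≤ i = ℕₚ.m≤m+n (suc i) (k ℕ.* suc i)

  minus≋om : ∀ i → minus i ≋ om (suc k ℕ.* suc i)
  minus≋om i = oneMinus≋om (suc k ℕ.* suc i)

  minus-unital : Unital minus
  minus-unital i = Agree-trans (≋⇒Agree i (minus≋om i)) (om-Agree i (suc k ℕ.* suc i) (index-≤ i))

  inverse-unital : Unital inverse
  inverse-unital i zero    _   = cong (λ b → if b then 1ℚ else 0ℚ) (dec-true ((suc k ℕ.* suc i) ∣? 0) (_ ∣.∣0))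
  inverse-unital i (suc n) n<i = cong (λ b → if b then 1ℚ else 0ℚ) (dec-false ((suc k ℕ.* suc i) ∣? suc n) (∣.>⇒∤ (ℕₚ.≤-<-trans n<i (index-≤ i))))

  sub-f₁-Π : sub (suc k) f₁ ≋ Π∞ minus
  sub-f₁-Π = Π∞-sub (suc k) (λ i → om (suc i)) (λ i → om-Agree i (suc i) ℕₚ.≤-refl)
    ⨾ Π∞-cong (λ i → sub-om (suc k) (suc i) ⨾ (λ n → cong (λ e → om e n) (ℕₚ.*-comm (suc i) (suc k))) ⨾ ≋-sym (minus≋om i))

  cancels : sub (suc k) f₁ ⊛ Π∞ inverse ≋ one
  cancels = ⊛-congʳ (Π∞ inverse) sub-f₁-Π ⨾ ≋-sym (Π∞-⊛ minus inverse minus-unital inverse-unital)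
    ⨾ Π∞-cong (λ i → ⊛-congʳ (inverse i) (minus≋om i) ⨾ om-geom (suc k ℕ.* suc i)) ⨾ λ n → ΠS-one n n

module Eta where
  module A = EtaAlgebra PS-ring
  open PSI using (_:=_; _:+_; _:*_; _:-_; :-_; _:^_; #_) renaming (solve to solveP)

  q x y X Y c s d t C D : PS
  q = mono 1
  x = φ
  y = neg φ
  X = sub 5 φ
  Y = sub 5 (neg φ)
  c = sub 2 φ
  s = sub 2 (neg φ)
  d = sub 10 φ
  t = sub 10 (neg φ)
  C = sub 4 (neg φ)
  D = sub 20 (neg φ)

  f2 f4 f5 f8 f10 f20 f40 n1 n5 : PS
  f2 = sub 2 f₁
  f4 = sub 4 f₁
  f5 = sub 5 f₁
  f8 = sub 8 f₁
  f10 = sub 10 f₁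
  f20 = sub 20 f₁
  f40 = sub 40 f₁
  n1 = neg f₁
  n5 = neg f5

  y≋JT : y ≋ JT 1 1
  y≋JT = neg-cong φ≋Th ⨾ neg-Th 0 0

  q-double : sub 2 q ≋ q ^ 2
  q-double = sub-mono 2 1 ⨾ ≋-sym (⊛-congˡ q (PSR.*-identityʳ q) ⨾ mono-+ 1 1)

  neg-q : neg q ≋ ⊝ q
  neg-q = neg-mono 1 ⨾ λ n → solveℚ 1 (λ z → (:∸ conℚ 1ℚ) :×: z :≡: :∸ z) refl (mono 1 n)

  neg-even : ∀ j f .{{_ : NonZero j}} .{{_ : NonZero (2 ℕ.* j)}} → neg (sub (2 ℕ.* j) f) ≋ sub (2 ℕ.* j) f
  neg-even j f = neg-cong (≋-sym (sub-sub 2 j f)) ⨾ neg-sub2 (sub j f) ⨾ sub-sub 2 j f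

  φ-eta : y ⊛ f2 ≋ f₁ ^ 2
  φ-eta = ⊛-cong (y≋JT ⨾ jacobi-triple 0 0) (sub-f₁ 1)
    ⨾ solveP 3 (λ a b o → (a :* (b :* b)) :* a := (a :* b) :* (a :* b)) ≋-refl (Pr 1 2) (Pr 0 2) one
    ⨾ ⊛-cong f₁-two (f₁-two ⨾ ≋-sym (PSR.*-identityʳ f₁))
    where
    f₁-two : Pr 1 2 ⊛ Pr 0 2 ≋ f₁
    f₁-two = ⊛-congˡ (Pr 1 2) (≋-sym (PSR.*-identityʳ (Pr 0 2))) ⨾ ≋-sym (f₁-block 2)

  φ₅-eta : Y ⊛ f10 ≋ f5 ^ 2
  φ₅-eta = sub-transport 5 3 (λ y f2 f1 → y :* f2 := f1 :^ 2) {y ∷ f2 ∷ f₁ ∷ []} {Y ∷ f10 ∷ f5 ∷ []} (≋-refl ∷ sub-sub 5 2 f₁ ∷ ≋-refl ∷ []) φ-eta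

  φ₂-eta : s ⊛ f4 ≋ f2 ^ 2
  φ₂-eta = sub-transport 2 3 (λ y f2 f1 → y :* f2 := f1 :^ 2) {y ∷ f2 ∷ f₁ ∷ []} {s ∷ f4 ∷ f2 ∷ []} (≋-refl ∷ sub-sub 2 2 f₁ ∷ ≋-refl ∷ []) φ-eta

  φ₄-eta : C ⊛ f8 ≋ f4 ^ 2
  φ₄-eta = sub-transport 4 3 (λ y f2 f1 → y :* f2 := f1 :^ 2) {y ∷ f2 ∷ f₁ ∷ []} {C ∷ f8 ∷ f4 ∷ []} (≋-refl ∷ sub-sub 4 2 f₁ ∷ ≋-refl ∷ []) φ-eta

  φ₂₀-eta : D ⊛ f40 ≋ f20 ^ 2
  φ₂₀-eta = sub-transport 20 3 (λ y f2 f1 → y :* f2 := f1 :^ 2) {y ∷ f2 ∷ f₁ ∷ []} {D ∷ f40 ∷ f20 ∷ []} (≋-refl ∷ sub-sub 20 2 f₁ ∷ ≋-refl ∷ []) φ-eta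

  φ-conj-eta : x ⊛ f2 ≋ n1 ^ 2
  φ-conj-eta = neg-transport 3 (λ y f2 f1 → y :* f2 := f1 :^ 2) {y ∷ f2 ∷ f₁ ∷ []} {x ∷ f2 ∷ n1 ∷ []} (neg-neg φ ∷ neg-sub2 f₁ ∷ ≋-refl ∷ []) φ-eta

  -- Split into residue classes modulo 10, each side contains every class once, except that the
  -- multiples of 10 occur four times.
  products-mod-10 : (JT 9 1 ⊛ JT 3 7) ⊛ (f2 ⊛ f5) ≋ f₁ ⊛ f10 ^ 3
  products-mod-10 = ⊛-cong
      (⊛-cong (jacobi-triple 8 0) (jacobi-triple 2 6))
      (⊛-cong two five)
    ⨾ solveP 10 (λ a b c d e f g h i j → ((j :* (a :* i)) :* (j :* (g :* c))) :* ((j :* (h :* (f :* (d :* (b :* # 1))))) :* (j :* (e :* # 1)))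
         := (j :* (i :* (h :* (g :* (f :* (e :* (d :* (c :* (b :* (a :* # 1)))))))))) :* j :^ 3) ≋-refl (P 0) (P 1) (P 2) (P 3) (P 4) (P 5) (P 6) (P 7) (P 8) (P 9)
    ⨾ ⊛-cong (drop-one ⨾ ≋-sym (f₁-block 10)) (^-cong 3 (≋-sym (sub-f₁ 9)))
    where
    P : ℕ → PS
    P r = Pr r 10
    F₂ F₅ F₁₀ : PS
    F₂ = P 9 ⊛ (P 7 ⊛ (P 5 ⊛ (P 3 ⊛ (P 1 ⊛ κ 1))))
    F₅ = P 9 ⊛ (P 4 ⊛ κ 1)
    F₁₀ = P 9 ⊛ (P 8 ⊛ (P 7 ⊛ (P 6 ⊛ (P 5 ⊛ (P 4 ⊛ (P 3 ⊛ (P 2 ⊛ (P 1 ⊛ (P 0 ⊛ κ 1)))))))))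
    k1 : one ≋ κ 1
    k1 = ≋-sym (PSR.+-identityʳ one)
    two : f2 ≋ F₂
    two = sub-cong 2 (f₁-block 5) ⨾ ΠS-sub 2 5 (λ r → Pr r 5) ⨾ ΠS-cong 5 (λ r → sub-Pr 1 r 5)
      ⨾ ⊛-congˡ (P 9) (⊛-congˡ (P 7) (⊛-congˡ (P 5) (⊛-congˡ (P 3) (⊛-congˡ (P 1) k1))))
    five : f5 ≋ F₅
    five = sub-cong 5 (f₁-block 2) ⨾ ΠS-sub 5 2 (λ r → Pr r 2) ⨾ ΠS-cong 2 (λ r → sub-Pr 4 r 2) ⨾ ⊛-congˡ (P 9) (⊛-congˡ (P 4) k1)
    drop-one : F₁₀ ≋ ΠS 10 P
    drop-one = ⊛-congˡ (P 9) (⊛-congˡ (P 8) (⊛-congˡ (P 7) (⊛-congˡ (P 6) (⊛-congˡ (P 5) (⊛-congˡ (P 4) (⊛-congˡ (P 3) (⊛-congˡ (P 2) (⊛-congˡ (P 1) (⊛-congˡ (P 0) (≋-sym k1))))))))))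

  -- The index-5 relation is taken at -q, where its theta series acquire signs and become triple
  -- products.
  R2 : (Y ⊛ Y ⊕ ⊝ (y ⊛ y)) ⊛ (f2 ⊛ f5) ≋ κ 4 ⊛ (q ⊛ (f₁ ⊛ f10 ^ 3))
  R2 = ⊛-congʳ (f2 ⊛ f5) (⊕-cong (≋-refl {Y ⊛ Y}) (λ n → cong -_ (conj n)))
    ⨾ solveP 5 (λ Y q J f g → (Y :* Y :+ :- (Y :* Y :+ # 4 :* (:- q :* J))) :* (f :* g) := # 4 :* (q :* (J :* (f :* g)))) ≋-refl Y q (JT 9 1 ⊛ JT 3 7) f2 f5
    ⨾ ⊛-congˡ (κ 4) (⊛-congˡ q products-mod-10)
    where
    conj : y ⊛ y ≋ Y ⊛ Y ⊕ κ 4 ⊛ (⊝ q ⊛ (JT 9 1 ⊛ JT 3 7))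
    conj = neg-transport 5 (λ T S q U V → T :* T := S :* S :+ # 4 :* (q :* (U :* V)))
      {Th 1 1 ∷ sub 5 (Th 1 1) ∷ q ∷ Th 9 1 ∷ Th 3 7 ∷ []} {y ∷ Y ∷ ⊝ q ∷ JT 9 1 ∷ JT 3 7 ∷ []}
      ((neg-Th 0 0 ⨾ ≋-sym y≋JT) ∷ (neg-sub5 (Th 1 1) ⨾ sub-cong 5 (neg-Th 0 0 ⨾ ≋-sym y≋JT)) ∷ neg-q ∷ neg-Th 4 0 ∷ neg-Th 1 3 ∷ []) φ²-φ[5]²

  R2-double : (t ⊛ t ⊕ ⊝ (s ⊛ s)) ⊛ (f4 ⊛ f10) ≋ κ 4 ⊛ (q ^ 2 ⊛ (f2 ⊛ f20 ^ 3))
  R2-double = sub-transport 2 7 (λ Y y f2 f5 q f1 f10 → (Y :* Y :- y :* y) :* (f2 :* f5) := # 4 :* (q :* (f1 :* f10 :^ 3)))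
    {Y ∷ y ∷ f2 ∷ f5 ∷ q ∷ f₁ ∷ f10 ∷ []} {t ∷ s ∷ f4 ∷ f10 ∷ q ^ 2 ∷ f2 ∷ f20 ∷ []}
    (sub-sub 2 5 y ∷ ≋-refl ∷ sub-sub 2 2 f₁ ∷ sub-sub 2 5 f₁ ∷ q-double ∷ ≋-refl ∷ sub-sub 2 10 f₁ ∷ []) R2

  R2-conj : (x ⊛ x ⊕ ⊝ (X ⊛ X)) ⊛ (f2 ⊛ n5) ≋ κ 4 ⊛ (q ⊛ (n1 ⊛ f10 ^ 3))
  R2-conj = solveP 4 (λ x X f g → (x :* x :+ :- (X :* X)) :* (f :* g) := :- ((X :* X :+ :- (x :* x)) :* (f :* g))) ≋-refl x X f2 n5
    ⨾ (λ n → cong -_ (raw n)) ⨾ solveP 3 (λ q f g → :- (# 4 :* (:- q :* (f :* g :^ 3))) := # 4 :* (q :* (f :* g :^ 3))) ≋-refl q n1 f10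
    where
    raw : (X ⊛ X ⊕ ⊝ (x ⊛ x)) ⊛ (f2 ⊛ n5) ≋ κ 4 ⊛ (⊝ q ⊛ (n1 ⊛ f10 ^ 3))
    raw = neg-transport 7 (λ Y y f2 f5 q f1 f10 → (Y :* Y :- y :* y) :* (f2 :* f5) := # 4 :* (q :* (f1 :* f10 :^ 3)))
      {Y ∷ y ∷ f2 ∷ f5 ∷ q ∷ f₁ ∷ f10 ∷ []} {X ∷ x ∷ f2 ∷ n5 ∷ ⊝ q ∷ n1 ∷ f10 ∷ []}
      ((neg-sub5 y ⨾ sub-cong 5 (neg-neg φ)) ∷ neg-neg φ ∷ neg-sub2 f₁ ∷ ≋-refl ∷ neg-q ∷ ≋-refl ∷ neg-even 5 f₁ ∷ []) R2

  xy≋ss : x ⊛ y ≋ s ⊛ s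
  xy≋ss = ⊛-cong φ≋Th y≋JT ⨾ φφ[-] ⨾ ⊛-cong (sub-cong 2 (≋-sym y≋JT)) (sub-cong 2 (≋-sym y≋JT))

  XY≋tt : X ⊛ Y ≋ t ⊛ t
  XY≋tt = sub-transport 5 3 (λ x y s → x :* y := s :* s) {x ∷ y ∷ s ∷ []} {X ∷ Y ∷ t ∷ []} (≋-refl ∷ ≋-refl ∷ sub-sub 5 2 y ∷ []) xy≋ss

  CC≋cs : C ⊛ C ≋ c ⊛ s
  CC≋cs = ≋-sym (sub-transport 2 3 (λ x y s → x :* y := s :* s) {x ∷ y ∷ s ∷ []} {c ∷ s ∷ C ∷ []} (≋-refl ∷ ≋-refl ∷ sub-sub 2 2 y ∷ []) xy≋ss)

  DD≋dt : D ⊛ D ≋ d ⊛ t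
  DD≋dt = ≋-sym (sub-transport 10 3 (λ x y s → x :* y := s :* s) {x ∷ y ∷ s ∷ []} {d ∷ t ∷ D ∷ []} (≋-refl ∷ ≋-refl ∷ sub-sub 10 2 y ∷ []) xy≋ss)

  xx+yy : x ⊛ x ⊕ y ⊛ y ≋ κ 2 ⊛ (c ⊛ c)
  xx+yy = ⊕-cong (⊛-cong φ≋Th φ≋Th) (⊛-cong y≋JT y≋JT) ⨾ φ²+φ[-]²
    ⨾ ι-· 2 (sub 2 (Th 1 1) ⊛ sub 2 (Th 1 1)) ⨾ ⊛-congˡ (κ 2) (⊛-cong (sub-cong 2 (≋-sym φ≋Th)) (sub-cong 2 (≋-sym φ≋Th)))

  XX+YY : X ⊛ X ⊕ Y ⊛ Y ≋ κ 2 ⊛ (d ⊛ d)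
  XX+YY = sub-transport 5 3 (λ x y c → x :* x :+ y :* y := # 2 :* (c :* c)) {x ∷ y ∷ c ∷ []} {X ∷ Y ∷ d ∷ []} (≋-refl ∷ ≋-refl ∷ sub-sub 5 2 x ∷ []) xx+yy

  Z-eta : x ⊛ Y ⊕ ⊝ (y ⊛ X) ≋ κ 4 ⊛ (q ⊛ (f4 ⊛ f20))
  Z-eta = ⊕-cong (⊛-cong φ≋Th (sub-cong 5 y≋JT)) (λ n → cong -_ (⊛-cong y≋JT (sub-cong 5 φ≋Th) n))
    ⨾ φφ[-5]-φ[-]φ[5] ⨾ ⊛-congˡ (κ 4) (⊛-congˡ q (⊛-cong (sub-cong 4 (≋-sym f₁≋JT21)) (sub-cong 20 (≋-sym f₁≋JT21))))

  Z-double : c ⊛ t ⊕ ⊝ (s ⊛ d) ≋ κ 4 ⊛ (q ^ 2 ⊛ (f8 ⊛ f40))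
  Z-double = sub-transport 2 7 (λ x Y y X q f4 f20 → x :* Y :- y :* X := # 4 :* (q :* (f4 :* f20)))
    {x ∷ Y ∷ y ∷ X ∷ q ∷ f4 ∷ f20 ∷ []} {c ∷ t ∷ s ∷ d ∷ q ^ 2 ∷ f8 ∷ f40 ∷ []}
    (≋-refl ∷ sub-sub 2 5 y ∷ ≋-refl ∷ sub-sub 2 5 x ∷ q-double ∷ sub-sub 2 4 f₁ ∷ sub-sub 2 20 f₁ ∷ []) Z-eta

  -- Both sides have constant term 1, so equality of squares is enough.
  conjugate : f₁ ⊛ n1 ⊛ f4 ≋ f2 ^ 3
  conjugate = sqrt-unique _ _ (λ ()) (A.conjugate-square f₁ n1 f2 f4 x y s φ-eta φ-conj-eta xy≋ss φ₂-eta)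

  conjugate₅ : f5 ⊛ n5 ⊛ f20 ≋ f10 ^ 3
  conjugate₅ = sub-transport 5 4 (λ f1 n1 f4 f2 → f1 :* n1 :* f4 := f2 :^ 3) {f₁ ∷ n1 ∷ f4 ∷ f2 ∷ []} {f5 ∷ n5 ∷ f20 ∷ f10 ∷ []} (≋-refl ∷ ≋-sym (neg-sub5 f₁) ∷ sub-sub 5 4 f₁ ∷ sub-sub 5 2 f₁ ∷ []) conjugate

  difference-product : (x ⊛ x ⊕ ⊝ (X ⊛ X)) ⊛ (Y ⊛ Y ⊕ ⊝ (y ⊛ y)) ⊛ f4 ≋ κ 16 ⊛ q ^ 2 ⊛ f2 ⊛ f10 ^ 3 ⊛ f20
  difference-product = ⊛-cancelˡ (f2 ^ 2 ⊛ f10 ^ 3) _ _ (λ ())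
    (A.difference-product q f₁ n1 f2 f4 f5 n5 f10 f20 x y X Y R2 R2-conj conjugate conjugate₅)

  -- `R1-eta` contains no theta functions any more, and after removal of its factor q² it is an
  -- identity in q², which descends to q.
  R1 : f2 ^ 4 ⊛ f5 ^ 2 ⊛ f10 ≋ f₁ ⊛ f2 ⊛ f5 ^ 5 ⊕ q ⊛ f₁ ^ 2 ⊛ f10 ^ 5
  R1 = sub-reflect 2 (λ {f} {g} → sub-inj 2 {f} {g}) 5 (λ q f1 f2 f5 f10 → f2 :^ 4 :* f5 :^ 2 :* f10 := f1 :* f2 :* f5 :^ 5 :+ q :* f1 :^ 2 :* f10 :^ 5)
    {q ∷ f₁ ∷ f2 ∷ f5 ∷ f10 ∷ []} {q ^ 2 ∷ f2 ∷ f4 ∷ f10 ∷ f20 ∷ []}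
    (q-double ∷ ≋-refl ∷ sub-sub 2 2 f₁ ∷ sub-sub 2 5 f₁ ∷ sub-sub 2 10 f₁ ∷ [])
    -- The two powers of q are removed one at a time, the rest by its constant term.
    (⊛-cancelˡ (κ 16 ⊛ f20) l r (λ ()) (mono-cancelˡ 1 _ _ (mono-cancelˡ 1 _ _
      (≋-sym (pull l) ⨾ A.R1-eta q f2 f4 f10 f20 x y X Y s t Z-eta difference-product R2-double xy≋ss XY≋tt ⨾ pull r))))
    where
    l r : PS
    l = f4 ^ 4 ⊛ f10 ^ 2 ⊛ f20
    r = f2 ⊛ f4 ⊛ f10 ^ 5 ⊕ q ^ 2 ⊛ f2 ^ 2 ⊛ f20 ^ 5
    pull : ∀ g → (κ 16 ⊛ q ^ 2 ⊛ f20) ⊛ g ≋ q ⊛ (q ⊛ (κ 16 ⊛ f20 ⊛ g))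
    pull g = solveP 3 (λ q f g → (# 16 :* q :^ 2 :* f) :* g := q :* (q :* (# 16 :* f :* g))) ≋-refl q f20 g

  R2′ : f5 ^ 5 ⊛ f2 ^ 2 ≋ f₁ ^ 4 ⊛ f10 ^ 2 ⊛ f5 ⊕ κ 4 ⊛ q ⊛ f₁ ⊛ f2 ⊛ f10 ^ 5
  R2′ = A.R2-eta q f₁ f2 f5 f10 y Y φ-eta φ₅-eta R2

  R4 : κ 5 ⊛ f₁ ⊛ f2 ^ 2 ⊛ f5 ^ 4 ≋ f₁ ^ 5 ⊛ f10 ^ 2 ⊕ κ 4 ⊛ f2 ^ 5 ⊛ f5 ⊛ f10
  R4 = ⊛-cancelˡ f5 _ _ (λ ()) (A.R4-eta q f₁ f2 f5 f10 R1 R2′)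

  private
    SY : PS
    SY = κ 5 ⊛ (Y ⊛ Y) ⊕ ⊝ (y ⊛ y)

  S-eta : SY ⊛ (f₁ ⊛ f10) ≋ κ 4 ⊛ (f2 ^ 3 ⊛ f5)
  S-eta = ⊛-cancelˡ (f2 ^ 2 ⊛ f10) _ _ (λ ()) (A.S-eta f₁ f2 f5 f10 y Y φ-eta φ₅-eta R4)

  S-double : (κ 5 ⊛ (t ⊛ t) ⊕ ⊝ (s ⊛ s)) ⊛ (f2 ⊛ f20) ≋ κ 4 ⊛ (f4 ^ 3 ⊛ f10)
  S-double = sub-transport 2 6 (λ Y y f1 f10 f2 f5 → (# 5 :* (Y :* Y) :- y :* y) :* (f1 :* f10) := # 4 :* (f2 :^ 3 :* f5))
    {Y ∷ y ∷ f₁ ∷ f10 ∷ f2 ∷ f5 ∷ []} {t ∷ s ∷ f2 ∷ f20 ∷ f4 ∷ f10 ∷ []}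
    (sub-sub 2 5 y ∷ ≋-refl ∷ ≋-refl ∷ sub-sub 2 10 f₁ ∷ sub-sub 2 2 f₁ ∷ sub-sub 2 5 f₁ ∷ []) S-eta

  M : (Y ⊛ Y ⊕ ⊝ (y ⊛ y)) ⊛ SY ≋ κ 16 ⊛ q ⊛ f2 ^ 2 ⊛ f10 ^ 2
  M = ⊛-cancelˡ (f₁ ⊛ f2 ⊛ f5 ⊛ f10) _ _ (λ ()) (A.M-eta q f₁ f2 f5 f10 y Y R2 S-eta)

  M-double : (t ⊛ t ⊕ ⊝ (s ⊛ s)) ⊛ (κ 5 ⊛ (t ⊛ t) ⊕ ⊝ (s ⊛ s)) ≋ κ 16 ⊛ q ^ 2 ⊛ f4 ^ 2 ⊛ f20 ^ 2
  M-double = sub-transport 2 5 (λ Y y q f2 f10 → (Y :* Y :- y :* y) :* (# 5 :* (Y :* Y) :- y :* y) := # 16 :* q :* f2 :^ 2 :* f10 :^ 2)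
    {Y ∷ y ∷ q ∷ f2 ∷ f10 ∷ []} {t ∷ s ∷ q ^ 2 ∷ f4 ∷ f20 ∷ []} (sub-sub 2 5 y ∷ ≋-refl ∷ q-double ∷ sub-sub 2 2 f₁ ∷ sub-sub 2 10 f₁ ∷ []) M

  M-conj : (X ⊛ X ⊕ ⊝ (x ⊛ x)) ⊛ (κ 5 ⊛ (X ⊛ X) ⊕ ⊝ (x ⊛ x)) ≋ ⊝ (κ 16 ⊛ q ⊛ f2 ^ 2 ⊛ f10 ^ 2)
  M-conj = neg-transport 5 (λ Y y q f2 f10 → (Y :* Y :- y :* y) :* (# 5 :* (Y :* Y) :- y :* y) := # 16 :* q :* f2 :^ 2 :* f10 :^ 2)
      {Y ∷ y ∷ q ∷ f2 ∷ f10 ∷ []} {X ∷ x ∷ ⊝ q ∷ f2 ∷ f10 ∷ []}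
      ((neg-sub5 y ⨾ sub-cong 5 (neg-neg φ)) ∷ neg-neg φ ∷ neg-q ∷ neg-sub2 f₁ ∷ neg-even 5 f₁ ∷ []) M
    ⨾ solveP 3 (λ q f g → # 16 :* (:- q) :* f :^ 2 :* g :^ 2 := :- (# 16 :* q :* f :^ 2 :* g :^ 2)) ≋-refl q f2 f10

  M-conj-double : (d ⊛ d ⊕ ⊝ (c ⊛ c)) ⊛ (κ 5 ⊛ (d ⊛ d) ⊕ ⊝ (c ⊛ c)) ≋ ⊝ (κ 16 ⊛ q ^ 2 ⊛ f4 ^ 2 ⊛ f20 ^ 2)
  M-conj-double = sub-transport 2 5 (λ X x q f2 f10 → (X :* X :- x :* x) :* (# 5 :* (X :* X) :- x :* x) := :- (# 16 :* q :* f2 :^ 2 :* f10 :^ 2))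
    {X ∷ x ∷ q ∷ f2 ∷ f10 ∷ []} {d ∷ c ∷ q ^ 2 ∷ f4 ∷ f20 ∷ []} (sub-sub 2 5 x ∷ ≋-refl ∷ q-double ∷ sub-sub 2 2 f₁ ∷ sub-sub 2 10 f₁ ∷ []) M-conj

  N : x ⊛ x ⊛ (Y ⊛ Y) ⊕ y ⊛ y ⊛ (X ⊛ X) ⊕ ⊝ (κ 2 ⊛ (x ⊛ y ⊛ (X ⊛ Y))) ≋ (X ⊛ Y ⊕ ⊝ (x ⊛ y)) ⊛ (κ 5 ⊛ (X ⊛ Y) ⊕ ⊝ (x ⊛ y))
  N = A.N-eta q f4 f20 x y X Y s t Z-eta M-double xy≋ss XY≋tt

  N-double : c ⊛ c ⊛ (t ⊛ t) ⊕ s ⊛ s ⊛ (d ⊛ d) ⊕ ⊝ (κ 2 ⊛ (c ⊛ s ⊛ (d ⊛ t))) ≋ (d ⊛ t ⊕ ⊝ (c ⊛ s)) ⊛ (κ 5 ⊛ (d ⊛ t) ⊕ ⊝ (c ⊛ s))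
  N-double = sub-transport 2 4 (λ x y X Y → x :* x :* (Y :* Y) :+ y :* y :* (X :* X) :- # 2 :* (x :* y :* (X :* Y)) := (X :* Y :- x :* y) :* (# 5 :* (X :* Y) :- x :* y))
    {x ∷ y ∷ X ∷ Y ∷ []} {c ∷ s ∷ d ∷ t ∷ []} (≋-refl ∷ ≋-refl ∷ sub-sub 2 5 x ∷ sub-sub 2 5 y ∷ []) N

  N₃ = A.N₃-eta q f2 f10 x y X Y M M-conj

-- Eisenstein series, cusp forms and the six products

module EisensteinIdentities where
  open Eta
  open PSI using (_:=_; _:+_; _:*_; _:-_; :-_; _:^_; #_) renaming (solve to solveP)

  e1 e2 e4 e8 g1 g2 g4 g8 : PS
  e1 = E₀₁
  e2 = sub 2 E₀₁
  e4 = sub 4 E₀₁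
  e8 = sub 8 E₀₁
  g1 = E₁₀
  g2 = sub 2 E₁₀
  g4 = sub 4 E₁₀
  g8 = sub 8 E₁₀

  e2-eta : κ 5 ⊛ (f10 ⊛ e2) ≋ ⊝ (f2 ^ 5)
  e2-eta = sub-transport 2 3 (λ f5 e f1 → # 5 :* (f5 :* e) := :- (f1 :^ 5)) {f5 ∷ e1 ∷ f₁ ∷ []} {f10 ∷ e2 ∷ f2 ∷ []} (sub-sub 2 5 f₁ ∷ ≋-refl ∷ ≋-refl ∷ []) E₀₁-eta

  g2-eta : f2 ⊛ g2 ≋ q ^ 2 ⊛ f10 ^ 5
  g2-eta = sub-transport 2 4 (λ f1 g q f5 → f1 :* g := q :* f5 :^ 5) {f₁ ∷ g1 ∷ q ∷ f5 ∷ []} {f2 ∷ g2 ∷ q ^ 2 ∷ f10 ∷ []} (≋-refl ∷ ≋-refl ∷ q-double ∷ sub-sub 2 5 f₁ ∷ []) Dissection.E₁₀-eta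

  private
    SY DY l₁ r₁ l₂ r₂ : PS
    SY = κ 5 ⊛ (Y ⊛ Y) ⊕ ⊝ (y ⊛ y)
    DY = Y ⊛ Y ⊕ ⊝ (y ⊛ y)
    l₁ = y ⊛ Y ⊛ SY
    r₁ = ⊝ (κ 4 ⊛ e1) ⊕ ⊝ (κ 16 ⊛ e2)
    l₂ = y ⊛ Y ⊛ DY
    r₂ = κ 4 ⊛ g1 ⊕ ⊝ (κ 16 ⊛ g2)

    E₀₁-part : l₁ ≋ r₁
    E₀₁-part = ⊛-cancelˡ (κ 5 ⊛ f₁ ⊛ f2 ⊛ f10 ^ 2 ⊛ f5) _ _ (λ ()) (EtaAlgebra.E₀₁-product PS-ring f₁ f2 f5 f10 y Y e1 e2 φ-eta φ₅-eta S-eta E₀₁-eta e2-eta R4)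

    E₁₀-part : l₂ ≋ r₂
    E₁₀-part = ⊛-cancelˡ (f₁ ⊛ f2 ^ 2 ⊛ f10 ⊛ f5) _ _ (λ ()) (EtaAlgebra.E₁₀-product PS-ring q f₁ f2 f5 f10 y Y g1 g2 φ-eta φ₅-eta R2 Dissection.E₁₀-eta g2-eta R2′)

  y³Y : y ^ 3 ⊛ Y ≋ ⊝ e1 ⊕ ⊝ (κ 4 ⊛ e2) ⊕ ⊝ (κ 5 ⊛ g1) ⊕ κ 20 ⊛ g2
  y³Y = ⊛-cancelˡ (κ 4) _ _ (λ ()) (EtaAlgebra.cubes₁ PS-ring y Y e1 e2 g1 g2 E₀₁-part E₁₀-part)

  yY³ : y ⊛ Y ^ 3 ≋ ⊝ e1 ⊕ ⊝ (κ 4 ⊛ e2) ⊕ ⊝ g1 ⊕ κ 4 ⊛ g2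
  yY³ = ⊛-cancelˡ (κ 4) _ _ (λ ()) (EtaAlgebra.cubes₂ PS-ring y Y e1 e2 g1 g2 E₀₁-part E₁₀-part)

  neg-e : neg E₀₁ ≋ ⊝ e1 ⊕ ⊝ (κ 2 ⊛ e2) ⊕ κ 4 ⊛ e4
  neg-e = Hecke₀₁.neg-a ⨾ ⊕-cong (⊕-cong (≋-refl {⊝ e1}) ((λ n → sym (ℚₚ.neg-distribˡ-* (ι (pos 2)) (e2 n))) ⨾ (λ n → cong -_ (ι-· 2 e2 n)))) (ι-· 4 e4)

  neg-g : neg E₁₀ ≋ ⊝ g1 ⊕ κ 2 ⊛ g2 ⊕ κ 4 ⊛ g4
  neg-g = Hecke₁₀.neg-a ⨾ ⊕-cong (⊕-cong (≋-refl {⊝ g1}) (ι-· 2 g2)) (ι-· 4 g4)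

  x³X : x ^ 3 ⊛ X ≋ e1 ⊕ ⊝ (κ 2 ⊛ e2) ⊕ ⊝ (κ 4 ⊛ e4) ⊕ κ 5 ⊛ g1 ⊕ κ 10 ⊛ g2 ⊕ ⊝ (κ 20 ⊛ g4)
  x³X = EtaAlgebra.conjugate₁ PS-ring x X e1 e2 e4 g1 g2 g4 (neg e1) (neg g1)
    (neg-transport 6 (λ y Y e e2 g g2 → y :^ 3 :* Y := :- e :- # 4 :* e2 :- # 5 :* g :+ # 20 :* g2) {y ∷ Y ∷ e1 ∷ e2 ∷ g1 ∷ g2 ∷ []} {x ∷ X ∷ neg e1 ∷ e2 ∷ neg g1 ∷ g2 ∷ []}
      (neg-neg φ ∷ (neg-sub5 y ⨾ sub-cong 5 (neg-neg φ)) ∷ ≋-refl ∷ neg-sub2 E₀₁ ∷ ≋-refl ∷ neg-sub2 E₁₀ ∷ []) y³Y) neg-e neg-g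

  xX³ : x ⊛ X ^ 3 ≋ e1 ⊕ ⊝ (κ 2 ⊛ e2) ⊕ ⊝ (κ 4 ⊛ e4) ⊕ g1 ⊕ κ 2 ⊛ g2 ⊕ ⊝ (κ 4 ⊛ g4)
  xX³ = EtaAlgebra.conjugate₂ PS-ring x X e1 e2 e4 g1 g2 g4 (neg e1) (neg g1)
    (neg-transport 6 (λ y Y e e2 g g2 → y :* Y :^ 3 := :- e :- # 4 :* e2 :- g :+ # 4 :* g2) {y ∷ Y ∷ e1 ∷ e2 ∷ g1 ∷ g2 ∷ []} {x ∷ X ∷ neg e1 ∷ e2 ∷ neg g1 ∷ g2 ∷ []}
      (neg-neg φ ∷ (neg-sub5 y ⨾ sub-cong 5 (neg-neg φ)) ∷ ≋-refl ∷ neg-sub2 E₀₁ ∷ ≋-refl ∷ neg-sub2 E₁₀ ∷ []) yY³) neg-e neg-g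

  c³d : c ^ 3 ⊛ d ≋ e2 ⊕ ⊝ (κ 2 ⊛ e4) ⊕ ⊝ (κ 4 ⊛ e8) ⊕ κ 5 ⊛ g2 ⊕ κ 10 ⊛ g4 ⊕ ⊝ (κ 20 ⊛ g8)
  c³d = sub-transport 2 8 (λ x X e1 e2 e4 g1 g2 g4 → x :^ 3 :* X := e1 :- # 2 :* e2 :- # 4 :* e4 :+ # 5 :* g1 :+ # 10 :* g2 :- # 20 :* g4)
    {x ∷ X ∷ e1 ∷ e2 ∷ e4 ∷ g1 ∷ g2 ∷ g4 ∷ []} {c ∷ d ∷ e2 ∷ e4 ∷ e8 ∷ g2 ∷ g4 ∷ g8 ∷ []}
    (≋-refl ∷ sub-sub 2 5 φ ∷ ≋-refl ∷ sub-sub 2 2 E₀₁ ∷ sub-sub 2 4 E₀₁ ∷ ≋-refl ∷ sub-sub 2 2 E₁₀ ∷ sub-sub 2 4 E₁₀ ∷ []) x³X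

  cd³ : c ⊛ d ^ 3 ≋ e2 ⊕ ⊝ (κ 2 ⊛ e4) ⊕ ⊝ (κ 4 ⊛ e8) ⊕ g2 ⊕ κ 2 ⊛ g4 ⊕ ⊝ (κ 4 ⊛ g8)
  cd³ = sub-transport 2 8 (λ x X e1 e2 e4 g1 g2 g4 → x :* X :^ 3 := e1 :- # 2 :* e2 :- # 4 :* e4 :+ g1 :+ # 2 :* g2 :- # 4 :* g4)
    {x ∷ X ∷ e1 ∷ e2 ∷ e4 ∷ g1 ∷ g2 ∷ g4 ∷ []} {c ∷ d ∷ e2 ∷ e4 ∷ e8 ∷ g2 ∷ g4 ∷ g8 ∷ []}
    (≋-refl ∷ sub-sub 2 5 φ ∷ ≋-refl ∷ sub-sub 2 2 E₀₁ ∷ sub-sub 2 4 E₀₁ ∷ ≋-refl ∷ sub-sub 2 2 E₁₀ ∷ sub-sub 2 4 E₁₀ ∷ []) xX³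

  C³D : C ^ 3 ⊛ D ≋ ⊝ e4 ⊕ ⊝ (κ 4 ⊛ e8) ⊕ ⊝ (κ 5 ⊛ g4) ⊕ κ 20 ⊛ g8
  C³D = sub-transport 4 6 (λ y Y e e2 g g2 → y :^ 3 :* Y := :- e :- # 4 :* e2 :- # 5 :* g :+ # 20 :* g2)
    {y ∷ Y ∷ e1 ∷ e2 ∷ g1 ∷ g2 ∷ []} {C ∷ D ∷ e4 ∷ e8 ∷ g4 ∷ g8 ∷ []} (≋-refl ∷ sub-sub 4 5 y ∷ ≋-refl ∷ sub-sub 4 2 E₀₁ ∷ ≋-refl ∷ sub-sub 4 2 E₁₀ ∷ []) y³Y

  CD³ : C ⊛ D ^ 3 ≋ ⊝ e4 ⊕ ⊝ (κ 4 ⊛ e8) ⊕ ⊝ g4 ⊕ κ 4 ⊛ g8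
  CD³ = sub-transport 4 6 (λ y Y e e2 g g2 → y :* Y :^ 3 := :- e :- # 4 :* e2 :- g :+ # 4 :* g2)
    {y ∷ Y ∷ e1 ∷ e2 ∷ g1 ∷ g2 ∷ []} {C ∷ D ∷ e4 ∷ e8 ∷ g4 ∷ g8 ∷ []} (≋-refl ∷ sub-sub 4 5 y ∷ ≋-refl ∷ sub-sub 4 2 E₀₁ ∷ ≋-refl ∷ sub-sub 4 2 E₁₀ ∷ []) yY³

  private
    module F2 = Factors 1
    module F4 = Factors 3
    module F10 = Factors 9
    module F20 = Factors 19

  mono-3 : mono 3 ≋ q ^ 3
  mono-3 = ≋-sym (⊛-congˡ q (⊛-congˡ q (PSR.*-identityʳ q) ⨾ mono-+ 1 1) ⨾ mono-+ 1 2)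

  f10B₁ : f10 ⊛ B₁ ≋ q ^ 3 ⊛ f2 ⊛ f20 ^ 4
  f10B₁ = ⊛-congˡ f10 (shift≋mono 3 P ⨾ ⊛-cong mono-3 expand)
    ⨾ solveP 5 (λ f q g h i → f :* (q :* (g :* h :* i)) := q :* g :* h :* (f :* i)) ≋-refl f10 (q ^ 3) f2 (f20 ^ 4) (Π∞ F10.inverse)
    ⨾ ⊛-congˡ (q ^ 3 ⊛ f2 ⊛ f20 ^ 4) F10.cancels ⨾ PSR.*-identityʳ (q ^ 3 ⊛ f2 ⊛ f20 ^ 4)
    where
    P : PS
    P = Π∞ (λ i → F2.minus i ⊛ (F20.minus i ^ 4) ⊛ F10.inverse i)
    u₁ : Unital (λ i → F20.minus i ^ 4)
    u₁ = Unital-^ F20.minus 4 F20.minus-unital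
    expand : P ≋ f2 ⊛ f20 ^ 4 ⊛ Π∞ F10.inverse
    expand = Π∞-⊛ (λ i → F2.minus i ⊛ (F20.minus i ^ 4)) F10.inverse (Unital-⊛ F2.minus (λ i → F20.minus i ^ 4) F2.minus-unital u₁) F10.inverse-unital
      ⨾ ⊛-congʳ (Π∞ F10.inverse) (Π∞-⊛ F2.minus (λ i → F20.minus i ^ 4) F2.minus-unital u₁
        ⨾ ⊛-cong (≋-sym F2.sub-f₁-Π) (Π∞-^ F20.minus 4 F20.minus-unital ⨾ ^-cong 4 (≋-sym F20.sub-f₁-Π)))

  f2B₂ : f2 ⊛ B₂ ≋ q ⊛ f4 ^ 4 ⊛ f10
  f2B₂ = ⊛-congˡ f2 (shift≋mono 1 P ⨾ ⊛-congˡ q expand)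
    ⨾ solveP 5 (λ f q g h i → f :* (q :* (g :* h :* i)) := q :* g :* h :* (f :* i)) ≋-refl f2 q (f4 ^ 4) f10 (Π∞ F2.inverse)
    ⨾ ⊛-congˡ (q ⊛ f4 ^ 4 ⊛ f10) F2.cancels ⨾ PSR.*-identityʳ (q ⊛ f4 ^ 4 ⊛ f10)
    where
    P : PS
    P = Π∞ (λ i → (F4.minus i ^ 4) ⊛ F10.minus i ⊛ F2.inverse i)
    u₁ : Unital (λ i → F4.minus i ^ 4)
    u₁ = Unital-^ F4.minus 4 F4.minus-unital
    expand : P ≋ f4 ^ 4 ⊛ f10 ⊛ Π∞ F2.inverse
    expand = Π∞-⊛ (λ i → (F4.minus i ^ 4) ⊛ F10.minus i) F2.inverse (Unital-⊛ (λ i → F4.minus i ^ 4) F10.minus u₁ F10.minus-unital) F2.inverse-unital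
      ⨾ ⊛-congʳ (Π∞ F2.inverse) (Π∞-⊛ (λ i → F4.minus i ^ 4) F10.minus u₁ F10.minus-unital
        ⨾ ⊛-cong (Π∞-^ F4.minus 4 F4.minus-unital ⨾ ^-cong 4 (≋-sym F4.sub-f₁-Π)) (≋-sym F10.sub-f₁-Π))

  B₁-theta : κ 16 ⊛ B₁ ≋ (X ⊛ Y ⊕ ⊝ (x ⊛ y)) ⊛ (x ⊛ Y ⊕ ⊝ (y ⊛ X))
  B₁-theta = ⊛-cancelˡ (f4 ⊛ f10) _ _ (λ ())
    (EtaAlgebra.B₁-eta PS-ring q f2 f4 f10 f20 x y X Y s t B₁ f10B₁ R2-double Z-eta xy≋ss XY≋tt)

  B₂-theta : κ 16 ⊛ B₂ ≋ (κ 5 ⊛ (X ⊛ Y) ⊕ ⊝ (x ⊛ y)) ⊛ (x ⊛ Y ⊕ ⊝ (y ⊛ X))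
  B₂-theta = ⊛-cancelˡ (f2 ⊛ f20) _ _ (λ ())
    (EtaAlgebra.B₂-eta PS-ring q f2 f4 f10 f20 x y X Y s t B₂ f2B₂ S-double Z-eta xy≋ss XY≋tt)

  -- By `B₂-theta` and `B₁-theta` these are 16B₂ + 3x³X - 5xX³ - 3y³Y + 5yY³ and x³X - 3xX³ - y³Y +
  -- 3yY³ - 16B₁.
  U₂ U₆ : PS
  U₂ = (κ 5 ⊛ (X ⊛ Y) ⊕ ⊝ (x ⊛ y)) ⊛ (x ⊛ Y ⊕ ⊝ (y ⊛ X)) ⊕ x ⊛ X ⊛ (κ 3 ⊛ (x ⊛ x) ⊕ ⊝ (κ 5 ⊛ (X ⊛ X))) ⊕ ⊝ (y ⊛ Y ⊛ (κ 3 ⊛ (y ⊛ y) ⊕ ⊝ (κ 5 ⊛ (Y ⊛ Y))))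
  U₆ = x ⊛ X ⊛ (x ⊛ x ⊕ ⊝ (κ 3 ⊛ (X ⊛ X))) ⊕ ⊝ (y ⊛ Y ⊛ (y ⊛ y ⊕ ⊝ (κ 3 ⊛ (Y ⊛ Y)))) ⊕ ⊝ ((X ⊛ Y ⊕ ⊝ (x ⊛ y)) ⊛ (x ⊛ Y ⊕ ⊝ (y ⊛ X)))

  -- Both sides are odd in q and start at q¹, which calls for the uniqueness of roots in order one.
  U₂-theta : κ 4 ⊛ ((x ⊛ x ⊕ ⊝ (y ⊛ y)) ⊛ (c ⊛ d)) ≋ U₂
  U₂-theta = sqrt-unique₁ _ _ refl (λ ()) (EtaAlgebra.U₂-square PS-ring x y X Y c d N N₃ xx+yy XX+YY)

  U₆-theta : κ 4 ⊛ ((X ⊛ X ⊕ ⊝ (Y ⊛ Y)) ⊛ (c ⊛ d)) ≋ U₆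
  U₆-theta = ⊛-cancel₁ (x ⊛ x ⊕ ⊝ (y ⊛ y)) _ _ refl (λ ()) (EtaAlgebra.U₆ PS-ring x y X Y c d U₂-theta N N₃)

  -- Twice the even part of xX.
  Ev : PS
  Ev = x ⊛ X ⊕ y ⊛ Y

  CDz : κ 4 ⊛ (C ⊛ D ⊛ (c ⊛ t ⊕ ⊝ (s ⊛ d))) ≋ (c ⊛ c ⊕ ⊝ (d ⊛ d)) ⊛ (κ 5 ⊛ (d ⊛ d) ⊕ ⊝ (c ⊛ c))
  CDz = ⊛-cancelˡ (f8 ⊛ f40) _ _ (λ ())
    (EtaAlgebra.CD-eta PS-ring q f4 f8 f20 f40 c s d t C D Z-double φ₄-eta φ₂₀-eta M-conj-double)

  -- The auxiliary factor z² = (ct - sd)² is q⁴ times a series with nonzero constant term, and the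
  -- two are cancelled separately. The constant terms then select the root.
  Ev-d : Ev ⊛ (d ⊛ d) ≋ c ⊛ d ⊛ (c ⊛ c ⊕ ⊝ (κ 3 ⊛ (d ⊛ d))) ⊕ κ 4 ⊛ (C ⊛ D ⊛ (D ⊛ D))
  Ev-d = sqrt-unique a b (λ ()) (⊛-cancelˡ (κ 16 ⊛ (f8 ⊛ f40 ⊛ (f8 ⊛ f40))) _ _ (λ ())
      (mono-cancelˡ 1 _ _ (mono-cancelˡ 1 _ _ (mono-cancelˡ 1 _ _
        (mono-cancelˡ 1 _ _ (≋-sym (pull (a ⊛ a)) ⨾ EtaAlgebra.even-d-square PS-ring Ev c s d t C D even-square N-double CDz DD≋dt ⨾ pull (b ⊛ b)))))))
    where
    a b z : PS
    a = Ev ⊛ (d ⊛ d)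
    b = c ⊛ d ⊛ (c ⊛ c ⊕ ⊝ (κ 3 ⊛ (d ⊛ d))) ⊕ κ 4 ⊛ (C ⊛ D ⊛ (D ⊛ D))
    z = c ⊛ t ⊕ ⊝ (s ⊛ d)
    w : PS → PS
    w g = κ 16 ⊛ (f8 ⊛ f40 ⊛ (f8 ⊛ f40)) ⊛ g
    even-square : Ev ⊛ Ev ≋ κ 4 ⊛ (c ⊛ c ⊛ (d ⊛ d)) ⊕ ⊝ ((c ⊛ c ⊕ ⊝ (d ⊛ d)) ⊛ (κ 5 ⊛ (d ⊛ d) ⊕ ⊝ (c ⊛ c)))
    even-square = EtaAlgebra.even-square PS-ring q f4 f20 x y X Y c d Z-eta M-conj-double xx+yy XX+YY
    pull : ∀ g → z ⊛ z ⊛ g ≋ q ⊛ (q ⊛ (q ⊛ (q ⊛ w g)))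
    pull g = ⊛-congʳ g (⊛-cong Z-double Z-double)
      ⨾ solveP 3 (λ q f g → (# 4 :* (q :^ 2 :* f)) :* (# 4 :* (q :^ 2 :* f)) :* g := q :* (q :* (q :* (q :* (# 16 :* (f :* f) :* g))))) ≋-refl q (f8 ⊛ f40) g

  Ev-c : Ev ⊛ (c ⊛ c) ≋ c ⊛ d ⊛ (κ 3 ⊛ (c ⊛ c) ⊕ ⊝ (κ 5 ⊛ (d ⊛ d))) ⊕ κ 4 ⊛ (C ⊛ D ⊛ (C ⊛ C))
  Ev-c = ⊛-cancelˡ (d ⊛ d) _ _ (λ ())
    (EtaAlgebra.even-c PS-ring Ev c s d t C D Ev-d CDz DD≋dt CC≋cs)

  identity₁ = EtaAlgebra.identity₁ PS-ring x X e1 e2 e4 g1 g2 g4 x³X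

  identity₄ = EtaAlgebra.identity₄ PS-ring x X e1 e2 e4 g1 g2 g4 xX³

  identity₂ = EtaAlgebra.identity₂ PS-ring x y X Y c d B₂ e1 e2 e4 e8 g1 g2 g4 g8 xx+yy U₂-theta B₂-theta x³X xX³ y³Y yY³ c³d

  identity₆ = EtaAlgebra.identity₆ PS-ring x y X Y c d B₁ e1 e2 e4 e8 g1 g2 g4 g8 XX+YY U₆-theta B₁-theta x³X xX³ y³Y yY³ cd³

  identity₃ = EtaAlgebra.identity₃ PS-ring x y X Y c d C D B₁ B₂ e1 e2 e4 e8 g1 g2 g4 g8 xx+yy Ev-c x³X y³Y B₁-theta B₂-theta c³d cd³ C³D

  identity₅ = EtaAlgebra.identity₅ PS-ring x y X Y c d C D B₁ B₂ e1 e2 e4 e8 g1 g2 g4 g8 XX+YY Ev-d xX³ yY³ B₁-theta B₂-theta c³d cd³ CD³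

-- From integer to rational coefficients

module LinearCombination where
  -- A summand with its coefficient in two forms: the integer that occurs in the multiplied
  -- identity, and the rational number of the statement.
  Term : Set
  Term = ℤ × ℚ × PS

  integral rational : Term → PS
  integral (i , _ , f) = PSI.fromℤ i ⊛ f
  rational (_ , c , f) = c · f

  sum : (Term → PS) → Term → List Term → PS
  sum g t = foldl (λ s t → s ⊕ g t) (g t)

  fromℤ-⊛ : ∀ i f → PSI.fromℤ i ⊛ f ≋ ι i · f
  fromℤ-⊛ (pos n)  f   = ≋-sym (ι-· n f)
  fromℤ-⊛ -[1+ n ] f k = trans (PSI.solve 2 (λ a f → :- a :* f := :- (a :* f)) ≋-refl (PSI.fromℤ (pos (suc n))) f k)
    (trans (cong -_ (sym (ι-· (suc n) f k))) (ℚₚ.neg-distribˡ-* (ι (pos (suc n))) (f k)))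
    where open PSI using (_:=_; _:*_; :-_)

  module _ (m : ℕ) where
    Scaled : List Term → Set
    Scaled ts = map (λ (i , _ , _) → ι i) ts ≡ map (λ (_ , c , _) → ι (pos m) * c) ts

    scaled-term : ∀ t → ι (proj₁ t) ≡ ι (pos m) * proj₁ (proj₂ t) → integral t ≋ κ m ⊛ rational t
    scaled-term (i , c , f) eq = fromℤ-⊛ i f ⨾ (λ k → trans (cong (_* f k) eq) (ℚₚ.*-assoc (ι (pos m)) c (f k))) ⨾ ι-· m (c · f)

    scaled-sum : ∀ s s′ ts → s ≋ κ m ⊛ s′ → Scaled ts →
      foldl (λ s t → s ⊕ integral t) s ts ≋ κ m ⊛ foldl (λ s t → s ⊕ rational t) s′ ts
    scaled-sum s s′ []       p eqs = p
    scaled-sum s s′ (t ∷ ts) p eqs = scaled-sum (s ⊕ integral t) (s′ ⊕ rational t) ts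
      (⊕-cong p (scaled-term t (proj₁ (∷-injective eqs))) ⨾ ≋-sym (PSR.distribˡ (κ m) s′ (rational t))) (proj₂ (∷-injective eqs))

    -- Certificates admit only integer coefficients, so the identities were obtained for 1, 8 or 16
    -- times the product; this factor is cancelled here.
    divide : ∀ {L} t ts → κ m 0 ≢ 0ℚ → Scaled (t ∷ ts) → κ m ⊛ L ≋ sum integral t ts → L ≋ sum rational t ts
    divide {L} t ts m≢0 eqs p = ⊛-cancelˡ (κ m) L _ m≢0
      (p ⨾ scaled-sum (integral t) (rational t) ts (scaled-term t (proj₁ (∷-injective eqs))) (proj₂ (∷-injective eqs)))


open import Data.Integer using (+_)

theorem2p6 :
  (∀ (n : ℕ) → (φ ^ 3 ⊛ sub 5 φ) n
     ≡ ((+ 1 ⁄ 1) · E₀₁ ⊕ (-[1+ 1 ] ⁄ 1) · sub 2 E₀₁ ⊕ (-[1+ 3 ] ⁄ 1) · sub 4 E₀₁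
        ⊕ (+ 5 ⁄ 1) · E₁₀ ⊕ (+ 10 ⁄ 1) · sub 2 E₁₀ ⊕ (-[1+ 19 ] ⁄ 1) · sub 4 E₁₀) n)
  × (∀ (n : ℕ) → (φ ^ 2 ⊛ sub 2 φ ⊛ sub 10 φ) n
     ≡ ((-[1+ 0 ] ⁄ 2) · E₀₁ ⊕ (+ 1 ⁄ 2) · sub 2 E₀₁ ⊕ (-[1+ 0 ] ⁄ 1) · sub 4 E₀₁
        ⊕ (-[1+ 3 ] ⁄ 1) · sub 8 E₀₁
        ⊕ (+ 5 ⁄ 2) · E₁₀ ⊕ (+ 5 ⁄ 2) · sub 2 E₁₀ ⊕ (+ 5 ⁄ 1) · sub 4 E₁₀
        ⊕ (-[1+ 19 ] ⁄ 1) · sub 8 E₁₀ ⊕ (+ 2 ⁄ 1) · B₂) n)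
  × (∀ (n : ℕ) → (φ ⊛ sub 2 φ ^ 2 ⊛ sub 5 φ) n
     ≡ ((+ 1 ⁄ 2) · E₀₁ ⊕ (-[1+ 0 ] ⁄ 2) · sub 2 E₀₁ ⊕ (-[1+ 0 ] ⁄ 1) · sub 4 E₀₁
        ⊕ (-[1+ 3 ] ⁄ 1) · sub 8 E₀₁
        ⊕ (+ 5 ⁄ 2) · E₁₀ ⊕ (+ 5 ⁄ 2) · sub 2 E₁₀ ⊕ (-[1+ 4 ] ⁄ 1) · sub 4 E₁₀
        ⊕ (+ 20 ⁄ 1) · sub 8 E₁₀ ⊕ (+ 5 ⁄ 1) · B₁ ⊕ (-[1+ 0 ] ⁄ 1) · B₂) n)
  × (∀ (n : ℕ) → (φ ⊛ sub 5 φ ^ 3) n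
     ≡ ((+ 1 ⁄ 1) · E₀₁ ⊕ (-[1+ 1 ] ⁄ 1) · sub 2 E₀₁ ⊕ (-[1+ 3 ] ⁄ 1) · sub 4 E₀₁
        ⊕ (+ 1 ⁄ 1) · E₁₀ ⊕ (+ 2 ⁄ 1) · sub 2 E₁₀ ⊕ (-[1+ 3 ] ⁄ 1) · sub 4 E₁₀) n)
  × (∀ (n : ℕ) → (φ ⊛ sub 5 φ ⊛ sub 10 φ ^ 2) n
     ≡ ((+ 1 ⁄ 2) · E₀₁ ⊕ (-[1+ 0 ] ⁄ 2) · sub 2 E₀₁ ⊕ (-[1+ 0 ] ⁄ 1) · sub 4 E₀₁
        ⊕ (-[1+ 3 ] ⁄ 1) · sub 8 E₀₁
        ⊕ (+ 1 ⁄ 2) · E₁₀ ⊕ (+ 1 ⁄ 2) · sub 2 E₁₀ ⊕ (-[1+ 0 ] ⁄ 1) · sub 4 E₁₀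
        ⊕ (+ 4 ⁄ 1) · sub 8 E₁₀ ⊕ (-[1+ 0 ] ⁄ 1) · B₁ ⊕ (+ 1 ⁄ 1) · B₂) n)
  × (∀ (n : ℕ) → (sub 2 φ ⊛ sub 5 φ ^ 2 ⊛ sub 10 φ) n
     ≡ ((-[1+ 0 ] ⁄ 2) · E₀₁ ⊕ (+ 1 ⁄ 2) · sub 2 E₀₁ ⊕ (-[1+ 0 ] ⁄ 1) · sub 4 E₀₁
        ⊕ (-[1+ 3 ] ⁄ 1) · sub 8 E₀₁
        ⊕ (+ 1 ⁄ 2) · E₁₀ ⊕ (+ 1 ⁄ 2) · sub 2 E₁₀ ⊕ (+ 1 ⁄ 1) · sub 4 E₁₀
        ⊕ (-[1+ 3 ] ⁄ 1) · sub 8 E₁₀ ⊕ (-[1+ 1 ] ⁄ 1) · B₁) n)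
theorem2p6 =
    divide 1 {φ ^ 3 ⊛ sub 5 φ} (pos 1 , (pos 1 ⁄ 1) , e1)
      ((-[1+ 1 ] , (-[1+ 1 ] ⁄ 1) , e2) ∷ (-[1+ 3 ] , (-[1+ 3 ] ⁄ 1) , e4) ∷ (pos 5 , (pos 5 ⁄ 1) , g1) ∷ (pos 10 , (pos 10 ⁄ 1) , g2) ∷ (-[1+ 19 ] , (-[1+ 19 ] ⁄ 1) , g4) ∷ []) (λ ()) refl identity₁
  , divide 8 {φ ^ 2 ⊛ sub 2 φ ⊛ sub 10 φ} (-[1+ 3 ] , (-[1+ 0 ] ⁄ 2) , e1)
      ((pos 4 , (pos 1 ⁄ 2) , e2) ∷ (-[1+ 7 ] , (-[1+ 0 ] ⁄ 1) , e4) ∷ (-[1+ 31 ] , (-[1+ 3 ] ⁄ 1) , e8) ∷ (pos 20 , (pos 5 ⁄ 2) , g1) ∷ (pos 20 , (pos 5 ⁄ 2) , g2) ∷ (pos 40 , (pos 5 ⁄ 1) , g4) ∷ (-[1+ 159 ] , (-[1+ 19 ] ⁄ 1) , g8) ∷ (pos 16 , (pos 2 ⁄ 1) , B₂) ∷ []) (λ ()) refl identity₂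
  , divide 16 {φ ⊛ sub 2 φ ^ 2 ⊛ sub 5 φ} (pos 8 , (pos 1 ⁄ 2) , e1)
      ((-[1+ 7 ] , (-[1+ 0 ] ⁄ 2) , e2) ∷ (-[1+ 15 ] , (-[1+ 0 ] ⁄ 1) , e4) ∷ (-[1+ 63 ] , (-[1+ 3 ] ⁄ 1) , e8) ∷ (pos 40 , (pos 5 ⁄ 2) , g1) ∷ (pos 40 , (pos 5 ⁄ 2) , g2) ∷ (-[1+ 79 ] , (-[1+ 4 ] ⁄ 1) , g4) ∷ (pos 320 , (pos 20 ⁄ 1) , g8) ∷ (pos 80 , (pos 5 ⁄ 1) , B₁) ∷ (-[1+ 15 ] , (-[1+ 0 ] ⁄ 1) , B₂) ∷ []) (λ ()) refl identity₃
  , divide 1 {φ ⊛ sub 5 φ ^ 3} (pos 1 , (pos 1 ⁄ 1) , e1)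
      ((-[1+ 1 ] , (-[1+ 1 ] ⁄ 1) , e2) ∷ (-[1+ 3 ] , (-[1+ 3 ] ⁄ 1) , e4) ∷ (pos 1 , (pos 1 ⁄ 1) , g1) ∷ (pos 2 , (pos 2 ⁄ 1) , g2) ∷ (-[1+ 3 ] , (-[1+ 3 ] ⁄ 1) , g4) ∷ []) (λ ()) refl identity₄
  , divide 16 {φ ⊛ sub 5 φ ⊛ sub 10 φ ^ 2} (pos 8 , (pos 1 ⁄ 2) , e1)
      ((-[1+ 7 ] , (-[1+ 0 ] ⁄ 2) , e2) ∷ (-[1+ 15 ] , (-[1+ 0 ] ⁄ 1) , e4) ∷ (-[1+ 63 ] , (-[1+ 3 ] ⁄ 1) , e8) ∷ (pos 8 , (pos 1 ⁄ 2) , g1) ∷ (pos 8 , (pos 1 ⁄ 2) , g2) ∷ (-[1+ 15 ] , (-[1+ 0 ] ⁄ 1) , g4) ∷ (pos 64 , (pos 4 ⁄ 1) , g8) ∷ (-[1+ 15 ] , (-[1+ 0 ] ⁄ 1) , B₁) ∷ (pos 16 , (pos 1 ⁄ 1) , B₂) ∷ []) (λ ()) refl identity₅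
  , divide 8 {sub 2 φ ⊛ sub 5 φ ^ 2 ⊛ sub 10 φ} (-[1+ 3 ] , (-[1+ 0 ] ⁄ 2) , e1)
      ((pos 4 , (pos 1 ⁄ 2) , e2) ∷ (-[1+ 7 ] , (-[1+ 0 ] ⁄ 1) , e4) ∷ (-[1+ 31 ] , (-[1+ 3 ] ⁄ 1) , e8) ∷ (pos 4 , (pos 1 ⁄ 2) , g1) ∷ (pos 4 , (pos 1 ⁄ 2) , g2) ∷ (pos 8 , (pos 1 ⁄ 1) , g4) ∷ (-[1+ 31 ] , (-[1+ 3 ] ⁄ 1) , g8) ∷ (-[1+ 15 ] , (-[1+ 1 ] ⁄ 1) , B₁) ∷ []) (λ ()) refl identity₆
  where
  open EisensteinIdentities
  open LinearCombination
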